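{- There is a parallel algorithm (the level-by-level algorithm levelWT) which, given a sequence $S$ of length $n$ over the alphabet $\Sigma=\{0,\ldots,\sigma-1\}$ with $\sigma\le n$, constructs the wavelet tree of $S$ using $O(n\log\sigma)$ work and $O(\log n\log\sigma)$ depth.
   Context: Model: work-depth model with concurrent reads and writes permitted, with unit-cost operations on machine words of $\Theta(\log n)$ bits. The work is the total number of operations and the depth is the number of parallel time steps. $\log$ is base 2, and, as usual in asymptotic bounds, logarithmic factors are read as being at least $1$. Sequences are indexed from $0$. The (standard, binary) wavelet tree of $S$ is defined recursively. The root represents the symbols $[0,\ldots,2^{\lceil\log\sigma\rceil}-1]$. A node $v$ representing the symbols $[a,\ldots,b]$ stores a bitmap: let $S_v$ be the subsequence of $S$ (in the original order) of all symbols lying in $[a,\ldots,b]$; the bitmap has length $|S_v|$ and has a $0$ in position $i$ if $S_v[i]\in[a,\ldots,\frac{a+b+1}{2}-1]$ and a $1$ otherwise. The left child of $v$ represents $[a,\ldots,\frac{a+b+1}{2}-1]$ and the right child represents $[\frac{a+b+1}{2},\ldots,b]$. The recursion stops when the size of the range is 2 or less, or if a node has no symbols to represent (its subsequence is empty). Along with its bitmap, each node stores a succinct rank/select structure (of size sub-linear in the bitmap length) supporting rank and select queries on the bitmap in $O(1)$ work. The bitmaps of all nodes on one level may be stored consecutively in one bitmap of length $n$, with each node storing its starting point and its length. -}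

module Defs where

open import Data.Bool using (Bool; true; false; if_then_else_)
open import Data.Fin using (Fin; toℕ)
open import Data.List using (List; []; _∷_; _++_; length; lookup; map; filter; take)
open import Data.Nat
open import Data.Nat.Logarithm using (⌈log₂_⌉)
open import Data.Nat.Properties using (m^n≢0; anyUpTo?)
open import Data.Product using (_×_; _,_; ∃; ∃-syntax)
open import Data.Sum using (_⊎_; inj₁; inj₂)
open import Data.Vec using (Vec; toList)
open import Relation.Binary.PropositionalEquality using (_≡_; _≢_; refl)
open import Relation.Nullary using (¬_; Dec; yes; no)
open import Relation.Nullary.Decidable using (_×-dec_; ¬?)

-- A logarithmic factor in an asymptotic bound, read as at least 1.  Rounding up
-- changes max(1, log x) by a factor of at most 2.
lg : ℕ → ℕ
lg x = 1 ⊔ ⌈log₂ x ⌉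

-- A synchronous shared-memory machine whose words are the numbers below 2 ^ w.
-- Memory is split into arrays; a program is a finite text, so it mentions
-- finitely many arrays, each indexed by a word.

infixl 7 _div_ _mod_

_div_ : ℕ → ℕ → ℕ
x div zero  = 0
x div suc y = x / suc y

_mod_ : ℕ → ℕ → ℕ
x mod zero  = x
x mod suc y = x % suc y

wrap : ℕ → ℕ → ℕ
wrap w x = _%_ x (2 ^ w) {{m^n≢0 2 w}}

bitwise : (ℕ → ℕ → ℕ) → ℕ → ℕ → ℕ → ℕ
bitwise f zero    x y = 0
bitwise f (suc w) x y = f (x % 2) (y % 2) + 2 * bitwise f w (x / 2) (y / 2)

𝟙 : Bool → ℕ
𝟙 true  = 1
𝟙 false = 0

data Op : Set where
  add sub mul quo rem shl shr and or xor lt eq : Op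

-- Subtraction saturates at 0.
apply : ℕ → Op → ℕ → ℕ → ℕ
apply w add x y = wrap w (x + y)
apply w sub x y = wrap w (x ∸ y)
apply w mul x y = wrap w (x * y)
apply w quo x y = wrap w (x div y)
apply w rem x y = wrap w (x mod y)
apply w shl x y = wrap w (x * 2 ^ y)
apply w shr x y = wrap w (x div 2 ^ y)
apply w and x y = wrap w (bitwise _*_ w x y)
apply w or  x y = wrap w (bitwise _⊔_ w x y)
apply w xor x y = wrap w (bitwise ∣_-_∣ w x y)
apply w lt  x y = wrap w (𝟙 (x <ᵇ y))
apply w eq  x y = wrap w (𝟙 (x ≡ᵇ y))

Array : Set
Array = ℕ

Mem : Set
Mem = Array → ℕ → ℕ

Words : ℕ → Mem → Set
Words w M = ∀ A j → M A j < 2 ^ w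

-- `pid` is the index of the processor evaluating the expression.
data Exp : Set where
  lit  : ℕ → Exp
  pid  : Exp
  load : Array → Exp → Exp
  bin  : Op → Exp → Exp → Exp

eval : ℕ → Mem → ℕ → Exp → ℕ
eval w M i (lit x)     = wrap w x
eval w M i pid         = wrap w i
eval w M i (load A e)  = M A (eval w M i e)
eval w M i (bin o e r) = apply w o (eval w M i e) (eval w M i r)

ops : Exp → ℕ
ops (lit x)     = 1
ops pid         = 1
ops (load A e)  = 1 + ops e
ops (bin o e r) = 1 + ops e + ops r

-- `pardo k g A a v`: processors 0, …, k - 1 simultaneously evaluate g, a and v
-- (all reads precede all writes); each one whose g is nonzero then writes v to
-- cell a of array A.
data Stmt : Set where
  pardo  : (k g : Exp) (A : Array) (a v : Exp) → Stmt
  branch : Exp → List Stmt → List Stmt → Stmt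
  while  : Exp → List Stmt → Stmt

Program : Set
Program = List Stmt

Writes : ℕ → Mem → Exp → Array → Exp → ℕ → Array → ℕ → Set
Writes w M g A a i B j = B ≡ A × eval w M i g ≢ 0 × eval w M i a ≡ j

-- Concurrent writes to a cell: an arbitrary one of them succeeds.
Outcome : ℕ → (k : ℕ) → Exp → Array → Exp → Exp → Mem → Mem → Set
Outcome w k g A a v M M′ = ∀ B j →
    (∃[ i ] i < k × Writes w M g A a i B j × M′ B j ≡ eval w M i v)
  ⊎ (¬ (∃[ i ] i < k × Writes w M g A a i B j) × M′ B j ≡ M B j)

-- `Halts w Q K M t d`: started with the statements K still to be executed, in
-- memory M, with work t and depth d already spent, every execution (whichever
-- concurrent writes succeed) terminates, and its final memory, total work and
-- total depth satisfy Q.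
data Halts (w : ℕ) (Q : Mem → ℕ → ℕ → Set) : Program → Mem → ℕ → ℕ → Set where
  done : ∀ {M t d} → Q M t d → Halts w Q [] M t d

  pardo : ∀ {k g A a v K M t d} →
    let procs = eval w M 0 k
        each  = ops g + ops a + ops v + 1
    in (∀ M′ → Outcome w procs g A a v M M′ →
          Halts w Q K M′ (t + (ops k + procs * each)) (d + (ops k + each))) →
       Halts w Q (pardo k g A a v ∷ K) M t d

  branch-true : ∀ {e P R K M t d} → eval w M 0 e ≢ 0 →
    Halts w Q (P ++ K) M (t + ops e) (d + ops e) →
    Halts w Q (branch e P R ∷ K) M t d

  branch-false : ∀ {e P R K M t d} → eval w M 0 e ≡ 0 →
    Halts w Q (R ++ K) M (t + ops e) (d + ops e) →
    Halts w Q (branch e P R ∷ K) M t d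

  while-true : ∀ {e P K M t d} → eval w M 0 e ≢ 0 →
    Halts w Q (P ++ while e P ∷ K) M (t + ops e) (d + ops e) →
    Halts w Q (while e P ∷ K) M t d

  while-false : ∀ {e P K M t d} → eval w M 0 e ≡ 0 →
    Halts w Q K M (t + ops e) (d + ops e) →
    Halts w Q (while e P ∷ K) M t d

-- The quantification over outcomes in `Halts.pardo` is never vacuous.
outcome-exists : ∀ w k g A a v M → ∃[ M′ ] Outcome w k g A a v M M′
outcome-exists w k g A a v M = M′ , correct
  where
  writes? : ∀ B j → Dec (∃[ i ] i < k × Writes w M g A a i B j)
  writes? B j = anyUpTo?
    (λ i → B ≟ A ×-dec (¬? (eval w M i g ≟ 0) ×-dec eval w M i a ≟ j)) k

  M′ : Mem
  M′ B j with writes? B j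
  ... | yes (i , _) = eval w M i v
  ... | no _        = M B j

  correct : Outcome w k g A a v M M′
  correct B j with writes? B j
  ... | yes (i , i<k , p) = inj₁ (i , i<k , p , refl)
  ... | no ¬p             = inj₂ (¬p , refl)

params input root bits start len left right aux auxStart auxLen arg result : Array
params   = 0
input    = 1
root     = 2
bits     = 3
start    = 4
len      = 5
left     = 6
right    = 7
aux      = 8
auxStart = 9
auxLen   = 10
arg      = 11
result   = 12

Params : ℕ → ℕ → ℕ → Mem → Set
Params w n σ M = M params 0 ≡ n × M params 1 ≡ σ × M params 2 ≡ w

symbols : ∀ {n σ} → Vec (Fin σ) n → List ℕ
symbols S = map toℕ (toList S)

-- All cells outside `params` and `input` hold arbitrary words initially.
Input : ∀ {n σ} → ℕ → Vec (Fin σ) n → Mem → Set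
Input {n} {σ} w S M =
    Words w M
  × Params w n σ M
  × (∀ (i : Fin (length (symbols S))) → M input (toℕ i) ≡ lookup (symbols S) i)

-- Bit q of an array whose words are fully packed, w bits to the word.
bitAt : ℕ → Mem → Array → ℕ → ℕ
bitAt w M A q = (M A (q div w) div 2 ^ (q mod w)) % 2

subsequence : List ℕ → ℕ → ℕ → List ℕ
subsequence L a b = filter (λ s → a ≤? s ×-dec s ≤? b) L

mid : ℕ → ℕ → ℕ
mid a b = (a + b + 1) / 2

-- For s in [a,…,b], lying in [a,…,mid a b - 1] amounts to s < mid a b.  The
-- division is exact on ranges of even size; on the range [0,…,0] of a
-- one-letter alphabet the left part is empty, so every bit is 1.
bitmap : List ℕ → ℕ → ℕ → List ℕ
bitmap L a b = map (λ s → if s <ᵇ mid a b then 0 else 1) (subsequence L a b)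

occurrences : ℕ → List ℕ → ℕ
occurrences β B = length (filter (_≟ β) B)

-- Occurrences of β among positions 0, …, i - 1.
rank : ℕ → ℕ → List ℕ → ℕ
rank β i B = occurrences β (take i B)

-- r is the position of the j-th occurrence of β, counting from j = 1.
IsSelect : ℕ → ℕ → List ℕ → ℕ → Set
IsSelect β j B r =
  ∃[ q ] toℕ {length B} q ≡ r × lookup B q ≡ β × rank β (suc (toℕ q)) B ≡ j

Sublinear : (ℕ → ℕ) → Set
Sublinear f = ∀ k → ∃[ N ] (∀ m → N ≤ m → k * f m ≤ m)

-- A structure for a bitmap of length m takes `size m` bits, up to `slack` words
-- (it starts and ends at word boundaries).
record RankSelect : Set where
  field
    rankQuery selectQuery : Program
    queryWork             : ℕ
    size                  : ℕ → ℕ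
    sublinear             : Sublinear size
    slack                 : ℕ

module _ (w : ℕ) (D : RankSelect) {n σ : ℕ} (S : Vec (Fin σ) n) (M : Mem) where

  open RankSelect D

  -- M′ is any memory in which the query (β, i) at node p can be posed.  It
  -- shares with M only the record of p, the words holding the m bits of its
  -- bitmap, and its rank/select structure; so a query can use nothing else.
  record Query (m p β i : ℕ) (M′ : Mem) : Set where
    field
      words      : Words w M′
      parameters : Params w n σ M′
      arg-node   : M′ arg 0 ≡ p
      arg-bit    : M′ arg 1 ≡ β
      arg-index  : M′ arg 2 ≡ i
      ≡-start    : M′ start p ≡ M start p
      ≡-len      : M′ len p ≡ M len p
      ≡-auxStart : M′ auxStart p ≡ M auxStart p
      ≡-auxLen   : M′ auxLen p ≡ M auxLen p
      ≡-bits     : ∀ q → q < m →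
                   M′ bits ((M start p + q) div w) ≡ M bits ((M start p + q) div w)
      ≡-aux      : ∀ q → q < M auxLen p →
                   M′ aux (M auxStart p + q) ≡ M aux (M auxStart p + q)

  record NodeAt (B : List ℕ) (p : ℕ) : Set where
    field
      length-stored : M len p ≡ length B
      bitmap-stored : ∀ (i : Fin (length B)) →
        bitAt w M bits (M start p + toℕ i) ≡ lookup B i
      succinct : M auxLen p * w ≤ size (length B) + slack * w
      rank-ok : ∀ β i M′ → β ≤ 1 → i ≤ length B →
        Query (length B) p β i M′ →
        Halts w (λ M″ t _ → M″ result 0 ≡ rank β i B × t ≤ queryWork)
          rankQuery M′ 0 0
      select-ok : ∀ β j M′ → β ≤ 1 → 1 ≤ j → j ≤ occurrences β B →
        Query (length B) p β j M′ →
        Halts w (λ M″ t _ → IsSelect β j B (M″ result 0) × t ≤ queryWork)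
          selectQuery M′ 0 0

  data TreeAt (a b p : ℕ) : Set where
    leaf : suc b ∸ a ≤ 2 ⊎ subsequence (symbols S) a b ≡ [] →
           NodeAt (bitmap (symbols S) a b) p →
           TreeAt a b p
    node : 2 < suc b ∸ a → subsequence (symbols S) a b ≢ [] →
           NodeAt (bitmap (symbols S) a b) p →
           TreeAt a (mid a b ∸ 1) (M left p) →
           TreeAt (mid a b) b (M right p) →
           TreeAt a b p

  WaveletTree : Set
  WaveletTree = TreeAt 0 (2 ^ ⌈log₂ σ ⌉ ∸ 1) (M root 0)

{-# OPTIONS --safe #-}
module Submission where

-- Give the symbol s the code 2 ^ Λ + s, Λ = lg σ.  In heap order (root 1, children
-- 2 p and 2 p + 1) the ancestors of a code are its quotients by powers of 2, so the
-- symbols below p in level order are the codes v with v div 2 ^ (Λ ∸ depth p) ≡ p.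
-- From one level to the next, a symbol moves to the child given by its bit, at its
-- rank among the equal bits of its node; these ranks come from one prefix sum over
-- the level, which takes O(n) work and O(log n) depth.  After the last level, a
-- constant number of passes over all (Λ + 1) n slots packs the bitmaps and builds
-- the rank and select directories of all nodes.  Sums over segments, in particular
-- the assembly of words from fields, are differences of prefix sums modulo 2 ^ w.
--
-- With e = ⌊log₂ w⌋, directory counters take ℓ = 8 e bits, blocks b = 8 e² bits and
-- superblocks B bits, where B is of order w e, so that one word holds the counts of
-- the B / b blocks of a superblock and word arithmetic adds, compares and counts
-- these fields at once.  Select stores every B-th occurrence, and either all positions of
-- its group or the superblocks of every b-th one.

-- A query sees only the record, the bitmap words and the structure of its own node. So there is no
-- shared lookup table for counting bits in a word, and a small node cannot afford one within its
-- constant number of slack words. Hence all counting inside a word is arithmetic: a multiplication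
-- copies a block, a mask isolates its bits, and a remainder modulo 2 ^ f - 1 adds up fields of f
-- bits. This needs (b + 1)² < w, which follows from (8 e² + 1)² < 2 ^ e. That inequality fails at e
-- = 24 and holds from e = 25 on; the threshold 2 ^ 25 for κ forces e ≥ 25 for every n, so short
-- inputs need no separate treatment. Each superblock owns one row of 16 words, that is O(w) bits
-- for about w e / 2 bits of bitmap: a fraction O(1 / e), and e grows with log log n. The select
-- entries are charged to the same rows. A group is stored position by position only if it extends
-- over more than B superblocks, whose rows then have room for its B positions; a subgroup is stored
-- only if it extends so far that no other stored subgroup starts in the same superblock.

open import Defs
open import Data.Bool using (Bool; true; false; T; if_then_else_)
open import Data.Empty using (⊥-elim)
open import Data.Fin using (Fin; toℕ; fromℕ<) renaming (zero to fzero; suc to fsuc)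
open import Data.Fin.Properties using (toℕ<n; toℕ-fromℕ<)
open import Data.List using (List; []; _∷_; _++_; length; lookup; map; filter; take)
open import Data.List.Properties using (++-assoc; ++-identityʳ; length-map; length-filter; filter-accept; filter-reject)
open import Data.List.Relation.Unary.All using (All; []; _∷_)
import Data.List.Relation.Unary.All as All
open import Data.List.Relation.Unary.All.Properties using (map⁺)
open import Data.Nat
open import Data.Nat.DivMod using (m≡m%n+[m/n]*n; m%n<n; [m+kn]%n≡m%n; m<n⇒m%n≡m; +-distrib-/-∣ʳ; m<n⇒m/n≡0; m*n/n≡m; %-distribˡ-+; m%n%n≡m%n; m%n≤m; m/n≤m)
open import Data.Nat.Divisibility using (n∣m*n)
open import Data.Nat.Induction using (<-rec)
open import Data.Nat.Logarithm using (⌊log₂_⌋; ⌈log₂_⌉; ⌊log₂⌊n/2⌋⌋≡⌊log₂n⌋∸1; ⌊log₂[2*b]⌋≡1+⌊log₂b⌋; ⌊log₂[2^n]⌋≡n; ⌊log₂⌋-mono-≤; ⌈log₂⌉-mono-≤; ⌈log₂2^n⌉≡n; ⌈log₂⌈n/2⌉⌉≡⌈log₂n⌉∸1)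
open import Data.Nat.Properties
open import Data.Nat.Tactic.RingSolver using (solve-∀)
open import Data.Product using (_×_; _,_; proj₁; proj₂; ∃-syntax)
open import Data.Sum using (_⊎_; inj₁; inj₂)
open import Data.Unit using (⊤; tt)
open import Data.Vec using (Vec; []; _∷_)
open import Function using (_∘_; case_of_)
open import Relation.Binary.Definitions using (tri<; tri≈; tri>)
open import Relation.Binary.PropositionalEquality
open import Relation.Nullary using (¬_; Dec; yes; no)
open import Relation.Nullary.Decidable using (_×-dec_)
open import Relation.Unary using (Decidable)

-- Division and remainder with the machine's conventions for the divisor 0

divmod : ∀ x y → x ≡ x mod y + x div y * y
divmod x zero    = sym (+-identityʳ x)
divmod x (suc y) = m≡m%n+[m/n]*n x (suc y)

mod< : ∀ x {y} → 0 < y → x mod y < y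
mod< x {suc y} _ = m%n<n x (suc y)

div-unique : ∀ {x y r} q → r < y → x ≡ r + q * y → x div y ≡ q
div-unique {y = suc y} {r} q r<y refl = begin
  (r + q * suc y) / suc y           ≡⟨ +-distrib-/-∣ʳ r (n∣m*n q) ⟩
  r / suc y + (q * suc y) / suc y   ≡⟨ cong₂ _+_ (m<n⇒m/n≡0 r<y) (m*n/n≡m q (suc y)) ⟩
  q                                 ∎
  where open ≡-Reasoning

mod-unique : ∀ {x y r} q → r < y → x ≡ r + q * y → x mod y ≡ r
mod-unique {y = suc y} {r} q r<y refl = trans ([m+kn]%n≡m%n r q (suc y)) (m<n⇒m%n≡m r<y)

mod-small : ∀ {x y} → x < y → x mod y ≡ x
mod-small {x} x<y = mod-unique 0 x<y (sym (+-identityʳ x))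

div-small : ∀ {x y} → x < y → x div y ≡ 0
div-small {x} x<y = div-unique 0 x<y (sym (+-identityʳ x))

mod≤ : ∀ x y → x mod y ≤ x
mod≤ x zero    = ≤-refl
mod≤ x (suc y) = m%n≤m x (suc y)

div≤ : ∀ x y → x div y ≤ x
div≤ x zero    = z≤n
div≤ x (suc y) = m/n≤m x (suc y)

div*≤ : ∀ x y → x div y * y ≤ x
div*≤ x y = subst (x div y * y ≤_) (sym (divmod x y)) (m≤n+m _ (x mod y))

div-upper : ∀ x {y} → 0 < y → x < suc (x div y) * y
div-upper x {y} 0<y = subst (_< suc (x div y) * y) (sym (divmod x y))
  (+-monoˡ-< (x div y * y) (mod< x 0<y))

div< : ∀ {x y q} → x < q * y → x div y < q
div< {x} {y} {q} x<qy = *-cancelʳ-< y (x div y) q (≤-<-trans (div*≤ x y) x<qy)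

≤div : ∀ {x y q} → 0 < y → q * y ≤ x → q ≤ x div y
≤div {x} {y} {q} 0<y qy≤x = s≤s⁻¹ (*-cancelʳ-< y q (suc (x div y)) (≤-<-trans qy≤x (div-upper x 0<y)))

div-mono : ∀ {x x′} y → x ≤ x′ → x div y ≤ x′ div y
div-mono zero    _ = z≤n
div-mono {x} (suc y) x≤x′ = ≤div z<s (≤-trans (div*≤ x (suc y)) x≤x′)

mod-+ˡ : ∀ x z y → (x mod y + z) mod y ≡ (x + z) mod y
mod-+ˡ x z zero    = refl
mod-+ˡ x z (suc y) = begin
  (x % n + z) % n               ≡⟨ %-distribˡ-+ (x % n) z n ⟩
  (x % n % n + z % n) % n       ≡⟨ cong (λ t → (t + z % n) % n) (m%n%n≡m%n x n) ⟩
  (x % n + z % n) % n           ≡⟨ %-distribˡ-+ x z n ⟨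
  (x + z) % n                   ∎
  where open ≡-Reasoning ; n = suc y

mod-+ʳ : ∀ x z y → (x + z mod y) mod y ≡ (x + z) mod y
mod-+ʳ x z y = trans (cong (_mod y) (+-comm x (z mod y)))
  (trans (mod-+ˡ z x y) (cong (_mod y) (+-comm z x)))

mod-+* : ∀ x k y → (x + k * y) mod y ≡ x mod y
mod-+* x k zero    = trans (cong (x +_) (*-zeroʳ k)) (+-identityʳ x)
mod-+* x k (suc y) = [m+kn]%n≡m%n x k (suc y)

div-+* : ∀ x k {y} → 0 < y → (x + k * y) div y ≡ x div y + k
div-+* x k {y} 0<y = div-unique (x div y + k) (mod< x 0<y) (begin
  x + k * y                             ≡⟨ cong (_+ k * y) (divmod x y) ⟩
  x mod y + x div y * y + k * y         ≡⟨ lemma (x mod y) (x div y) k y ⟩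
  x mod y + (x div y + k) * y           ∎)
  where
  open ≡-Reasoning
  lemma : ∀ a b c d → a + b * d + c * d ≡ a + (b + c) * d
  lemma = solve-∀

module _ (x : ℕ) {y z : ℕ} (0<y : 0 < y) (0<z : 0 < z) where

  private
    q = x div y
    r< : x mod y + q mod z * y < z * y
    r< = <-≤-trans (+-monoˡ-< (q mod z * y) (mod< x 0<y)) (*-monoˡ-≤ y (mod< q 0<z))
    lemma : ∀ a b c d e → a + (b + c * d) * e ≡ a + b * e + c * (d * e)
    lemma = solve-∀
    -- The expansion of `x` in mixed radix, first `y` and then `z`; each of the two lemmas reads one
    -- digit off it.
    x≡ : x ≡ x mod y + q mod z * y + q div z * (z * y)
    x≡ = trans (divmod x y) (trans (cong (λ t → x mod y + t * y) (divmod q z))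
           (lemma (x mod y) (q mod z) (q div z) z y))

  div-div : x div y div z ≡ x div (z * y)
  div-div = sym (div-unique (x div y div z) r< x≡)

  mod-*-div : (x mod (z * y)) div y ≡ x div y mod z
  mod-*-div = trans
    (cong (_div y) (mod-unique {r = x mod y + q mod z * y} (q div z) r< x≡))
    (trans (div-+* (x mod y) (q mod z) 0<y) (cong (_+ q mod z) (div-small (mod< x 0<y))))

mod-*-mod : ∀ x y z → (x mod (z * y)) mod y ≡ x mod y
mod-*-mod x y z = sym (trans (cong (_mod y) (trans (divmod x (z * y))
  (cong (x mod (z * y) +_) (sym (*-assoc (x div (z * y)) z y)))))
  (mod-+* (x mod (z * y)) (x div (z * y) * z) y))

div-1 : ∀ x → x div 1 ≡ x
div-1 x = div-unique x (s≤s z≤n) (sym (*-identityʳ x))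

*-cancel-div : ∀ x {y} → 0 < y → (x * y) div y ≡ x
*-cancel-div x 0<y = div-unique x 0<y refl

0<2^ : ∀ k → 0 < 2 ^ k
0<2^ k = m^n>0 2 k

2^-mono : ∀ {j k} → j ≤ k → 2 ^ j ≤ 2 ^ k
2^-mono = ^-monoʳ-≤ 2

2^-+ : ∀ j k → 2 ^ (j + k) ≡ 2 ^ j * 2 ^ k
2^-+ = ^-distribˡ-+-* 2

n<2^n : ∀ n → n < 2 ^ n
n<2^n zero    = s≤s z≤n
n<2^n (suc n) = ≤-trans (+-mono-≤ (0<2^ n) (n<2^n n)) (≤-reflexive (cong (2 ^ n +_) (sym (+-identityʳ (2 ^ n)))))

2^-cancel-< : ∀ {j k} → 2 ^ j < 2 ^ k → j < k
2^-cancel-< {j} {k} p = ≰⇒> (λ k≤j → <⇒≱ p (2^-mono k≤j))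

wrap-mod : ∀ w x → wrap w x ≡ x mod 2 ^ w
wrap-mod w x = %≡mod (2 ^ w) {{m^n≢0 2 w}}
  where
  -- `2 ^ w` does not reduce to a successor, so the modulus is generalised before it is matched on.
  %≡mod : ∀ y .{{_ : NonZero y}} → x % y ≡ x mod y
  %≡mod (suc y) = refl

wrap-small : ∀ w {x} → x < 2 ^ w → wrap w x ≡ x
wrap-small w {x} x< = trans (wrap-mod w x) (mod-small x<)

wrap< : ∀ w x → wrap w x < 2 ^ w
wrap< w x = subst (_< 2 ^ w) (sym (wrap-mod w x)) (mod< x (0<2^ w))

∸-swap : ∀ {x y z} → x ≡ y + z → x ∸ y ≡ z
∸-swap {y = y} {z} refl = m+n∸m≡n y z

-- Finite sums

Σ< : ℕ → (ℕ → ℕ) → ℕ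
Σ< zero    f = 0
Σ< (suc n) f = Σ< n f + f n

Σ-cong : ∀ n {f g} → (∀ i → i < n → f i ≡ g i) → Σ< n f ≡ Σ< n g
Σ-cong zero    f≡g = refl
Σ-cong (suc n) f≡g = cong₂ _+_ (Σ-cong n (λ i i<n → f≡g i (m<n⇒m<1+n i<n))) (f≡g n ≤-refl)

Σ-split : ∀ m n f → Σ< (m + n) f ≡ Σ< m f + Σ< n (λ i → f (m + i))
Σ-split m zero    f = trans (cong (λ k → Σ< k f) (+-identityʳ m)) (sym (+-identityʳ _))
Σ-split m (suc n) f = trans (cong (λ k → Σ< k f) (+-suc m n))
  (trans (cong (_+ f (m + n)) (Σ-split m n f)) (+-assoc (Σ< m f) _ _))

Σ-≤ : ∀ n {f g} → (∀ i → i < n → f i ≤ g i) → Σ< n f ≤ Σ< n g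
Σ-≤ zero    f≤g = z≤n
Σ-≤ (suc n) f≤g = +-mono-≤ (Σ-≤ n (λ i i<n → f≤g i (m<n⇒m<1+n i<n))) (f≤g n ≤-refl)

Σ-const : ∀ n c → Σ< n (λ _ → c) ≡ n * c
Σ-const zero    c = refl
Σ-const (suc n) c = trans (cong (_+ c) (Σ-const n c)) (+-comm (n * c) c)

Σ-*ʳ : ∀ n f c → Σ< n (λ i → f i * c) ≡ Σ< n f * c
Σ-*ʳ zero    f c = refl
Σ-*ʳ (suc n) f c = trans (cong (_+ f n * c) (Σ-*ʳ n f c)) (sym (*-distribʳ-+ c (Σ< n f) (f n)))

Σ-*ˡ : ∀ n c f → Σ< n (λ i → c * f i) ≡ c * Σ< n f
Σ-*ˡ n c f = trans (Σ-cong n (λ i _ → *-comm c (f i))) (trans (Σ-*ʳ n f c) (*-comm (Σ< n f) c))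

Σ-+ : ∀ n f g → Σ< n (λ i → f i + g i) ≡ Σ< n f + Σ< n g
Σ-+ zero    f g = refl
Σ-+ (suc n) f g = trans (cong (_+ (f n + g n)) (Σ-+ n f g)) (lemma (Σ< n f) (Σ< n g) (f n) (g n))
  where
  lemma : ∀ a b c d → a + b + (c + d) ≡ a + c + (b + d)
  lemma = solve-∀

Σ-mono : ∀ {m n} f → m ≤ n → Σ< m f ≤ Σ< n f
Σ-mono {m} {n} f m≤n = subst (λ k → Σ< m f ≤ Σ< k f) (m+[n∸m]≡n m≤n)
  (subst (Σ< m f ≤_) (sym (Σ-split m (n ∸ m) f)) (m≤m+n _ _))

Σ-suc : ∀ n f → Σ< (suc n) f ≡ f 0 + Σ< n (f ∘ suc)
Σ-suc n f = Σ-split 1 n f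

Σ-extend : ∀ {m n} f → m ≤ n → (∀ i → m ≤ i → i < n → f i ≡ 0) → Σ< n f ≡ Σ< m f
Σ-extend {m} {n} f m≤n zeros = begin
  Σ< n f                                     ≡⟨ cong (λ k → Σ< k f) (m+[n∸m]≡n m≤n) ⟨
  Σ< (m + (n ∸ m)) f                         ≡⟨ Σ-split m (n ∸ m) f ⟩
  Σ< m f + Σ< (n ∸ m) (λ i → f (m + i))      ≡⟨ cong (Σ< m f +_) (Σ-cong (n ∸ m) λ i i< →
      zeros (m + i) (m≤m+n m i) (subst (m + i <_) (m+[n∸m]≡n m≤n) (+-monoʳ-< m i<))) ⟩
  Σ< m f + Σ< (n ∸ m) (λ _ → 0)              ≡⟨ cong (Σ< m f +_) (trans (Σ-const (n ∸ m) 0) (*-zeroʳ (n ∸ m))) ⟩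
  Σ< m f + 0                                 ≡⟨ +-identityʳ _ ⟩
  Σ< m f                                     ∎
  where open ≡-Reasoning

Σ-blocks : ∀ N b f → Σ< (N * b) f ≡ Σ< N (λ r → Σ< b (λ i → f (r * b + i)))
Σ-blocks zero    b f = refl
Σ-blocks (suc N) b f = trans (cong (λ k → Σ< k f) (+-comm b (N * b)))
  (trans (Σ-split (N * b) b f) (cong (_+ Σ< b (λ i → f (N * b + i))) (Σ-blocks N b f)))

-- Numbers with N digits in base 2 ^ f

pack : ℕ → ℕ → (ℕ → ℕ) → ℕ
pack f N v = Σ< N (λ r → v r * 2 ^ (f * r))

pack-cong : ∀ f N {u v} → (∀ r → r < N → u r ≡ v r) → pack f N u ≡ pack f N v
pack-cong f N u≡v = Σ-cong N (λ r r<N → cong (_* 2 ^ (f * r)) (u≡v r r<N))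

pack-split : ∀ f m n v → pack f (m + n) v ≡ pack f m v + pack f n (λ r → v (m + r)) * 2 ^ (f * m)
pack-split f m n v = trans (Σ-split m n _) (cong (pack f m v +_)
  (trans (Σ-cong n (λ r _ → begin
     v (m + r) * 2 ^ (f * (m + r))             ≡⟨ cong (λ k → v (m + r) * 2 ^ k) (*-distribˡ-+ f m r) ⟩
     v (m + r) * 2 ^ (f * m + f * r)           ≡⟨ cong (v (m + r) *_) (2^-+ (f * m) (f * r)) ⟩
     v (m + r) * (2 ^ (f * m) * 2 ^ (f * r))   ≡⟨ lemma (v (m + r)) (2 ^ (f * m)) (2 ^ (f * r)) ⟩
     v (m + r) * 2 ^ (f * r) * 2 ^ (f * m)     ∎))
   (Σ-*ʳ n _ (2 ^ (f * m)))))
  where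
  open ≡-Reasoning
  lemma : ∀ a b c → a * (b * c) ≡ a * c * b
  lemma = solve-∀

pack-suc : ∀ f N v → pack f (suc N) v ≡ v 0 + pack f N (v ∘ suc) * 2 ^ f
pack-suc f N v = trans (pack-split f 1 N v)
  (cong₂ _+_ (trans (cong (λ k → v 0 * 2 ^ k) (*-zeroʳ f)) (*-identityʳ (v 0)))
             (cong (λ k → pack f N (v ∘ suc) * 2 ^ k) (*-identityʳ f)))

pack< : ∀ f N {v} → (∀ r → r < N → v r < 2 ^ f) → pack f N v < 2 ^ (f * N)
pack< f zero    _  = subst (λ k → 0 < 2 ^ k) (sym (*-zeroʳ f)) (s≤s z≤n)
pack< f (suc N) {v} v< = begin-strict
  pack f N v + v N * 2 ^ (f * N)       <⟨ +-monoˡ-< _ (pack< f N (λ r r<N → v< r (m<n⇒m<1+n r<N))) ⟩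
  2 ^ (f * N) + v N * 2 ^ (f * N)      ≤⟨ *-monoˡ-≤ (2 ^ (f * N)) (v< N ≤-refl) ⟩
  2 ^ f * 2 ^ (f * N)                  ≡⟨ 2^-+ f (f * N) ⟨
  2 ^ (f + f * N)                      ≡⟨ cong (2 ^_) (*-suc f N) ⟨
  2 ^ (f * suc N)                      ∎
  where open ≤-Reasoning

n∸r≡suc : ∀ {r N} → r < N → N ∸ r ≡ suc (N ∸ suc r)
n∸r≡suc {zero}  {suc N} _ = refl
n∸r≡suc {suc r} {suc N} (s≤s r<N) = n∸r≡suc r<N

module _ (f N : ℕ) {v : ℕ → ℕ} (v< : ∀ r → r < N → v r < 2 ^ f) where

  private
    split-at : ∀ {r} → r ≤ N → pack f N v ≡ pack f r v + pack f (N ∸ r) (λ i → v (r + i)) * 2 ^ (f * r)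
    split-at {r} r≤N = trans (cong (λ k → pack f k v) (sym (m+[n∸m]≡n r≤N))) (pack-split f r (N ∸ r) v)

    low< : ∀ {r} → r ≤ N → pack f r v < 2 ^ (f * r)
    low< {r} r≤N = pack< f r (λ i i<r → v< i (<-≤-trans i<r r≤N))

  pack-mod : ∀ {r} → r ≤ N → pack f N v mod 2 ^ (f * r) ≡ pack f r v
  pack-mod {r} r≤N = mod-unique (pack f (N ∸ r) (λ i → v (r + i))) (low< r≤N) (split-at r≤N)

  pack-digit : ∀ {r} → r < N → pack f N v div 2 ^ (f * r) mod 2 ^ f ≡ v r
  pack-digit {r} r<N = trans (cong (_mod 2 ^ f) (div-unique (pack f (N ∸ r) (λ i → v (r + i))) (low< (<⇒≤ r<N)) (split-at (<⇒≤ r<N))))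
    (mod-unique (pack f (N ∸ suc r) (λ i → v (r + suc i))) (v< r r<N)
      (trans (cong (λ k → pack f k (λ i → v (r + i))) (n∸r≡suc r<N))
        (trans (pack-suc f (N ∸ suc r) (λ i → v (r + i)))
          (cong (λ k → v k + pack f (N ∸ suc r) (λ i → v (r + suc i)) * 2 ^ f) (+-identityʳ r)))))

-- Multiplying a digit string by 2 ^ f - 1 telescopes its prefix sums.
pack-prefix : ∀ f N v → pack f N (λ r → Σ< (suc r) v) * (2 ^ f ∸ 1) + pack f N v ≡ Σ< N v * 2 ^ (f * N)
pack-prefix f zero    v = refl
pack-prefix f (suc N) v = begin
  (P + (S + x) * Y) * (X ∸ 1) + (D + x * Y)        ≡⟨ lemma₁ P S x Y (X ∸ 1) D ⟩
  (P * (X ∸ 1) + D) + (S + x) * Y * (X ∸ 1) + x * Y  ≡⟨ cong (λ t → t + (S + x) * Y * (X ∸ 1) + x * Y) (pack-prefix f N v) ⟩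
  S * Y + (S + x) * Y * (X ∸ 1) + x * Y            ≡⟨ lemma₂ S x Y (X ∸ 1) ⟩
  (S + x) * ((1 + (X ∸ 1)) * Y)                    ≡⟨ cong (λ t → (S + x) * (t * Y)) (m+[n∸m]≡n (0<2^ f)) ⟩
  (S + x) * (X * Y)                                ≡⟨ cong ((S + x) *_) (sym (2^-+ f (f * N))) ⟩
  (S + x) * 2 ^ (f + f * N)                        ≡⟨ cong (λ t → (S + x) * 2 ^ t) (*-suc f N) ⟨
  (S + x) * 2 ^ (f * suc N)                        ∎
  where
  open ≡-Reasoning
  X = 2 ^ f ; Y = 2 ^ (f * N) ; S = Σ< N v ; x = v N
  P = pack f N (λ r → Σ< (suc r) v)
  D = pack f N v
  lemma₁ : ∀ P S x Y Z D → (P + (S + x) * Y) * Z + (D + x * Y) ≡ (P * Z + D) + (S + x) * Y * Z + x * Y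
  lemma₁ = solve-∀
  lemma₂ : ∀ S x Y Z → S * Y + (S + x) * Y * Z + x * Y ≡ (S + x) * ((1 + Z) * Y)
  lemma₂ = solve-∀

ones : ℕ → ℕ → ℕ
ones f N = pack f N (λ _ → 1)

ones-geometric : ∀ f N → 2 ^ (f * N) ∸ 1 ≡ ones f N * (2 ^ f ∸ 1)
ones-geometric f zero    = cong (λ k → 2 ^ k ∸ 1) (*-zeroʳ f)
ones-geometric f (suc N) = ∸-swap (begin
  2 ^ (f * suc N)                        ≡⟨ cong (2 ^_) (*-suc f N) ⟩
  2 ^ (f + f * N)                        ≡⟨ 2^-+ f (f * N) ⟩
  2 ^ f * Y                              ≡⟨ cong (_* Y) (sym (m+[n∸m]≡n (0<2^ f))) ⟩
  (1 + Z) * Y                            ≡⟨ lemma₁ Y Z ⟩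
  Y + Y * Z                              ≡⟨ cong (_+ Y * Z) (sym (m+[n∸m]≡n (0<2^ (f * N)))) ⟩
  1 + (Y ∸ 1) + Y * Z                    ≡⟨ cong (λ t → 1 + t + Y * Z) (ones-geometric f N) ⟩
  1 + ones f N * Z + Y * Z               ≡⟨ lemma₂ (ones f N) Y Z ⟩
  1 + (ones f N + 1 * Y) * Z             ∎)
  where
  open ≡-Reasoning
  Y = 2 ^ (f * N) ; Z = 2 ^ f ∸ 1
  lemma₁ : ∀ Y Z → (1 + Z) * Y ≡ Y + Y * Z
  lemma₁ = solve-∀
  lemma₂ : ∀ a Y Z → 1 + a * Z + Y * Z ≡ 1 + (a + 1 * Y) * Z
  lemma₂ = solve-∀

-- The mask with a one in every field is a geometric series, so a query obtains it by one division
-- instead of reading it from a table.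
ones-quo : ∀ {f} N → 0 < f → (2 ^ (f * N) ∸ 1) div (2 ^ f ∸ 1) ≡ ones f N
ones-quo {f} N 0<f = trans (cong (_div (2 ^ f ∸ 1)) (ones-geometric f N))
  (*-cancel-div (ones f N) (m<n⇒0<n∸m (≤-<-trans 0<f (n<2^n f))))

-- Casting out: `2 ^ f` is 1 modulo `2 ^ f ∸ 1`, so every digit counts with weight 1. A single
-- remainder thus adds up all fields of a word; with fields that are 0 or 1 it is a population
-- count.
pack-mod-pred : ∀ f N v → Σ< N v < 2 ^ f ∸ 1 → pack f N v mod (2 ^ f ∸ 1) ≡ Σ< N v
pack-mod-pred f N v small = trans (reduce N) (mod-small small)
  where
  y = 2 ^ f ∸ 1
  power : ∀ N → 2 ^ (f * N) ≡ 1 + ones f N * y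
  power N = trans (sym (m+[n∸m]≡n (0<2^ (f * N)))) (cong suc (ones-geometric f N))
  lemma : ∀ D x o y → D + x * (1 + o * y) ≡ D + x + x * o * y
  lemma = solve-∀
  reduce : ∀ N → pack f N v mod y ≡ Σ< N v mod y
  reduce zero    = refl
  reduce (suc N) = begin
    (pack f N v + v N * 2 ^ (f * N)) mod y          ≡⟨ cong (λ t → (pack f N v + v N * t) mod y) (power N) ⟩
    (pack f N v + v N * (1 + ones f N * y)) mod y   ≡⟨ cong (_mod y) (lemma (pack f N v) (v N) (ones f N) y) ⟩
    (pack f N v + v N + v N * ones f N * y) mod y   ≡⟨ mod-+* (pack f N v + v N) (v N * ones f N) y ⟩
    (pack f N v + v N) mod y                        ≡⟨ mod-+ˡ (pack f N v) (v N) y ⟨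
    (pack f N v mod y + v N) mod y                  ≡⟨ cong (λ t → (t + v N) mod y) (reduce N) ⟩
    (Σ< N v mod y + v N) mod y                      ≡⟨ mod-+ˡ (Σ< N v) (v N) y ⟩
    (Σ< N v + v N) mod y                            ∎
    where open ≡-Reasoning

-- Single bits of a number

bit : ℕ → ℕ → ℕ
bit k x = x div 2 ^ k mod 2

bit<2 : ∀ k x → bit k x < 2
bit<2 k x = mod< (x div 2 ^ k) z<s

bit-div : ∀ j k x → bit j (x div 2 ^ k) ≡ bit (j + k) x
bit-div j k x = cong (_mod 2) (trans (div-div x (0<2^ k) (0<2^ j)) (cong (x div_) (sym (2^-+ j k))))

bit-mod : ∀ {j k} x → j < k → bit j (x mod 2 ^ k) ≡ bit j x
bit-mod {j} {k} x j<k = begin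
  (x mod 2 ^ k) div 2 ^ j mod 2                    ≡⟨ cong (λ t → (x mod t) div 2 ^ j mod 2) pow ⟩
  (x mod (2 ^ (k ∸ j) * 2 ^ j)) div 2 ^ j mod 2    ≡⟨ cong (_mod 2) (mod-*-div x (0<2^ j) (0<2^ (k ∸ j))) ⟩
  (x div 2 ^ j) mod 2 ^ (k ∸ j) mod 2              ≡⟨ cong (λ t → (x div 2 ^ j) mod t mod 2) pow′ ⟩
  (x div 2 ^ j) mod (2 ^ (k ∸ suc j) * 2) mod 2    ≡⟨ mod-*-mod (x div 2 ^ j) 2 (2 ^ (k ∸ suc j)) ⟩
  x div 2 ^ j mod 2                                ∎
  where
  open ≡-Reasoning
  pow : 2 ^ k ≡ 2 ^ (k ∸ j) * 2 ^ j
  pow = trans (cong (2 ^_) (sym (m∸n+n≡m (<⇒≤ j<k)))) (2^-+ (k ∸ j) j)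
  pow′ : 2 ^ (k ∸ j) ≡ 2 ^ (k ∸ suc j) * 2
  pow′ = trans (cong (2 ^_) (n∸r≡suc j<k)) (*-comm 2 (2 ^ (k ∸ suc j)))

pack-bits : ∀ N {x} → x < 2 ^ N → pack 1 N (λ k → bit k x) ≡ x
pack-bits zero    {zero} _ = refl
pack-bits zero    {suc x} (s≤s ())
pack-bits (suc N) {x} x< = begin
  pack 1 (suc N) (λ k → bit k x)                           ≡⟨ pack-suc 1 N (λ k → bit k x) ⟩
  x div 1 mod 2 + pack 1 N (λ k → bit (suc k) x) * 2       ≡⟨ cong₂ (λ a b → a mod 2 + b * 2) (div-1 x) rest ⟩
  x mod 2 + x div 2 * 2                                    ≡⟨ divmod x 2 ⟨
  x                                                        ∎
  where
  open ≡-Reasoning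
  rest : pack 1 N (λ k → bit (suc k) x) ≡ x div 2
  rest = trans (pack-cong 1 N {λ k → bit (suc k) x} (λ k _ → trans (cong (λ j → bit j x) (+-comm 1 k)) (sym (bit-div k 1 x))))
    (pack-bits N (div< (subst (x <_) (*-comm 2 (2 ^ N)) x<)))

-- Bitwise conjunction with a mask of isolated ones

private
  and-0 : ∀ w x → bitwise _*_ w x 0 ≡ 0
  and-0 zero    x = refl
  and-0 (suc w) x = cong₂ (λ a b → a + 2 * b) (*-zeroʳ (x % 2)) (and-0 w (x / 2))

  and-split : ∀ k w x {lo} hi → lo < 2 ^ k →
    bitwise _*_ (k + w) x (lo + hi * 2 ^ k) ≡ bitwise _*_ k x lo + bitwise _*_ w (x div 2 ^ k) hi * 2 ^ k
  and-split zero w x {zero} hi _ = trans (cong₂ (bitwise _*_ w) (sym (div-1 x)) (*-identityʳ hi))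
    (sym (*-identityʳ _))
  and-split zero w x {suc lo} hi (s≤s ())
  and-split (suc k) w x {lo} hi lo< = begin
    (x % 2) * (y % 2) + 2 * bitwise _*_ (k + w) (x / 2) (y / 2)
      ≡⟨ cong₂ (λ a b → (x % 2) * a + 2 * bitwise _*_ (k + w) (x / 2) b) y%2 y/2 ⟩
    (x % 2) * (lo % 2) + 2 * bitwise _*_ (k + w) (x / 2) (lo / 2 + hi * 2 ^ k)
      ≡⟨ cong (λ a → (x % 2) * (lo % 2) + 2 * a) (and-split k w (x / 2) hi (div< (subst (lo <_) (*-comm 2 (2 ^ k)) lo<))) ⟩
    (x % 2) * (lo % 2) + 2 * (bitwise _*_ k (x / 2) (lo / 2) + bitwise _*_ w (x / 2 div 2 ^ k) hi * 2 ^ k)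
      ≡⟨ cong (λ a → (x % 2) * (lo % 2) + 2 * (bitwise _*_ k (x / 2) (lo / 2) + bitwise _*_ w a hi * 2 ^ k))
           (trans (div-div x z<s (0<2^ k)) (cong (x div_) (*-comm (2 ^ k) 2))) ⟩
    (x % 2) * (lo % 2) + 2 * (bitwise _*_ k (x / 2) (lo / 2) + bitwise _*_ w (x div 2 ^ suc k) hi * 2 ^ k)
      ≡⟨ lemma ((x % 2) * (lo % 2)) (bitwise _*_ k (x / 2) (lo / 2)) (bitwise _*_ w (x div 2 ^ suc k) hi) (2 ^ k) ⟩
    bitwise _*_ (suc k) x lo + bitwise _*_ w (x div 2 ^ suc k) hi * 2 ^ suc k ∎
    where
    open ≡-Reasoning
    y = lo + hi * 2 ^ suc k
    lemma : ∀ a b c d → a + 2 * (b + c * d) ≡ a + 2 * b + c * (2 * d)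
    lemma = solve-∀
    shape : ∀ a b c → a + b * (2 * c) ≡ a + b * c * 2
    shape = solve-∀
    y%2 : y % 2 ≡ lo % 2
    y%2 = trans (cong (_mod 2) (shape lo hi (2 ^ k))) (mod-+* lo (hi * 2 ^ k) 2)
    y/2 : y / 2 ≡ lo / 2 + hi * 2 ^ k
    y/2 = trans (cong (_div 2) (shape lo hi (2 ^ k))) (div-+* lo (hi * 2 ^ k) z<s)

  and-1 : ∀ w x → bitwise _*_ (suc w) x 1 ≡ x mod 2
  and-1 w x = trans (cong₂ (λ a b → a + 2 * b) (*-identityʳ (x % 2)) (and-0 w (x / 2)))
    (+-identityʳ (x % 2))

and-ones : ∀ f N w x → 0 < f → f * N ≤ w →
  bitwise _*_ w x (ones f N) ≡ pack f N (λ r → bit (f * r) x)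
and-ones f zero w x 0<f _ = and-0 w x
and-ones f@(suc f′) (suc N) w x 0<f fN≤w = begin
  bitwise _*_ w x (ones f (suc N))
    ≡⟨ cong₂ (λ k o → bitwise _*_ k x o) (sym (m+[n∸m]≡n f≤w)) (pack-suc f N (λ _ → 1)) ⟩
  bitwise _*_ (f + (w ∸ f)) x (1 + ones f N * 2 ^ f)
    ≡⟨ and-split f (w ∸ f) x (ones f N) (≤-<-trans 0<f (n<2^n f)) ⟩
  bitwise _*_ f x 1 + bitwise _*_ (w ∸ f) (x div 2 ^ f) (ones f N) * 2 ^ f
    ≡⟨ cong₂ (λ a b → a + b * 2 ^ f) (and-1 f′ x) (and-ones f N (w ∸ f) (x div 2 ^ f) 0<f rest≤) ⟩
  x mod 2 + pack f N (λ r → bit (f * r) (x div 2 ^ f)) * 2 ^ f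
    ≡⟨ cong₂ (λ a b → a + b * 2 ^ f) (sym first) (pack-cong f N (λ r _ → trans (bit-div (f * r) f x)
         (cong (λ k → bit k x) (trans (+-comm (f * r) f) (sym (*-suc f r)))))) ⟩
  bit (f * 0) x + pack f N (λ r → bit (f * suc r) x) * 2 ^ f
    ≡⟨ pack-suc f N (λ r → bit (f * r) x) ⟨
  pack f (suc N) (λ r → bit (f * r) x) ∎
  where
  open ≡-Reasoning
  f+fN≤w : f + f * N ≤ w
  f+fN≤w = subst (_≤ w) (*-suc f N) fN≤w
  f≤w = m+n≤o⇒m≤o f f+fN≤w
  rest≤ : f * N ≤ w ∸ f
  rest≤ = m+n≤o⇒m≤o∸n (f * N) (subst (_≤ w) (+-comm f (f * N)) f+fN≤w)
  first : bit (f * 0) x ≡ x mod 2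
  first = trans (cong (λ k → bit k x) (*-zeroʳ f)) (cong (_mod 2) (div-1 x))

-- Copy r of x starts at bit b r, so bit r of that copy is bit (b + 1) r of the
-- product: masking there isolates each bit of x in a digit of its own.
spread : ∀ b w {x} → 0 < b → suc b * b ≤ w → x < 2 ^ b →
  bitwise _*_ w (x * ones b b) (ones (suc b) b) ≡ pack (suc b) b (λ r → bit r x)
spread b w {x} 0<b fits x< = trans (and-ones (suc b) b w (x * ones b b) z<s fits)
  (pack-cong (suc b) b isolated)
  where
  copies : x * ones b b ≡ pack b b (λ _ → x)
  copies = trans (*-comm x (ones b b)) (trans (sym (Σ-*ʳ b _ x))
    (Σ-cong b (λ r _ → trans (cong (_* x) (*-identityˡ (2 ^ (b * r)))) (*-comm (2 ^ (b * r)) x))))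
  isolated : ∀ r → r < b → bit (suc b * r) (x * ones b b) ≡ bit r x
  isolated r r<b = begin
    bit (r + b * r) (x * ones b b)                             ≡⟨ cong (bit (r + b * r)) copies ⟩
    bit (r + b * r) (pack b b (λ _ → x))                       ≡⟨ bit-div r (b * r) _ ⟨
    bit r (pack b b (λ _ → x) div 2 ^ (b * r))                 ≡⟨ bit-mod (pack b b (λ _ → x) div 2 ^ (b * r)) r<b ⟨
    bit r (pack b b (λ _ → x) div 2 ^ (b * r) mod 2 ^ b)       ≡⟨ cong (bit r) (pack-digit b b (λ _ _ → x<) r<b) ⟩
    bit r x                                                    ∎
    where open ≡-Reasoning

-- Indicators, and the search for an occurrence among packed counts

𝟙< : ℕ → ℕ → ℕ
𝟙< x y = 𝟙 (x <ᵇ y)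

𝟙≡ : ℕ → ℕ → ℕ
𝟙≡ x y = 𝟙 (x ≡ᵇ y)

𝟙<-true : ∀ {x y} → x < y → 𝟙< x y ≡ 1
𝟙<-true {x} {y} x<y with x <ᵇ y | <⇒<ᵇ x<y
... | true | _ = refl

𝟙<-false : ∀ {x y} → y ≤ x → 𝟙< x y ≡ 0
𝟙<-false {x} {y} y≤x with x <ᵇ y | <ᵇ⇒< x y
... | true  | f = ⊥-elim (<⇒≱ (f _) y≤x)
... | false | _ = refl

𝟙≡-true : ∀ x → 𝟙≡ x x ≡ 1
𝟙≡-true zero    = refl
𝟙≡-true (suc x) = 𝟙≡-true x

𝟙≡-false : ∀ {x y} → x ≢ y → 𝟙≡ x y ≡ 0
𝟙≡-false {x} {y} x≢y with x ≡ᵇ y | ≡ᵇ⇒≡ x y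
... | true  | f = ⊥-elim (x≢y (f _))
... | false | _ = refl

𝟙≤1 : ∀ b → 𝟙 b ≤ 1
𝟙≤1 true  = ≤-refl
𝟙≤1 false = z≤n

count≤ : (ℕ → ℕ) → ℕ → ℕ → ℕ
count≤ v j N = Σ< N (λ r → 𝟙< (Σ< (suc r) v) (suc j))

-- Prefix sums do not decrease, so the indices counted form an initial segment, and their number is
-- the first index whose prefix sum exceeds `j`: the digit to which occurrence `j` belongs.
count≤-spec : ∀ v j N → j < Σ< N v →
  count≤ v j N < N × Σ< (count≤ v j N) v ≤ j × j < Σ< (suc (count≤ v j N)) v
count≤-spec v j N j<tot with go N
  where
  go : ∀ N → (count≤ v j N ≡ N × Σ< N v ≤ j) ⊎
             (count≤ v j N < N × Σ< (count≤ v j N) v ≤ j × j < Σ< (suc (count≤ v j N)) v)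
  go zero = inj₁ (refl , z≤n)
  go (suc N) with go N
  ... | inj₂ (k<N , lo , hi) = inj₂ (subst (λ k → k < suc N × Σ< k v ≤ j × j < Σ< (suc k) v)
          (sym (trans (cong (count≤ v j N +_) (𝟙<-false (≤-trans hi (Σ-mono v (s≤s (<⇒≤ k<N)))))) (+-identityʳ _)))
          (m<n⇒m<1+n k<N , lo , hi))
  ... | inj₁ (k≡N , lo) with Σ< (suc N) v ≤? j
  ...   | yes le = inj₁ (trans (cong₂ _+_ k≡N (𝟙<-true (s≤s le))) (+-comm N 1) , le)
  ...   | no ¬le = inj₂ (subst (λ k → k < suc N × Σ< k v ≤ j × j < Σ< (suc k) v)
          (sym (trans (cong₂ _+_ k≡N (𝟙<-false (≰⇒> ¬le))) (+-identityʳ N)))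
          (≤-refl , lo , ≰⇒> ¬le))
... | inj₁ (_ , le) = ⊥-elim (<⇒≱ j<tot le)
... | inj₂ p = p

module _ (g N : ℕ) (v : ℕ → ℕ) (j : ℕ) (total≤ : Σ< N v ≤ 2 ^ g) (j<h : j < 2 ^ g) where

  private
    f = suc g
    h = 2 ^ g
    S : ℕ → ℕ
    S r = Σ< (suc r) v
    S≤h : ∀ {r} → r < N → S r ≤ h
    S≤h r<N = ≤-trans (Σ-mono v r<N) total≤
    U = (j + h) * ones f N ∸ pack f N S

    f∸1>0 : 0 < 2 ^ f ∸ 1
    f∸1>0 = m<n⇒0<n∸m (≤-<-trans (s≤s z≤n) (n<2^n f))

  prefix-sums : (Σ< N v * 2 ^ (f * N) ∸ pack f N v) div (2 ^ f ∸ 1) ≡ pack f N S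
  prefix-sums = trans (cong (_div (2 ^ f ∸ 1))
      (∸-swap (trans (sym (pack-prefix f N v)) (+-comm (pack f N S * _) (pack f N v)))))
    (*-cancel-div (pack f N S) f∸1>0)

  private
    digit : ℕ → ℕ
    digit r = (j + h) ∸ S r

    -- Every `S r` is at most `h`, hence at most `j + h`: no field borrows from the next, and the
    -- subtraction acts on the fields separately.
    U-digits : U ≡ pack f N digit
    U-digits = ∸-swap (begin
      (j + h) * ones f N                     ≡⟨ Σ-*ˡ N (j + h) _ ⟨
      Σ< N (λ r → (j + h) * (1 * 2 ^ (f * r)))  ≡⟨ Σ-cong N (λ r r<N → trans (cong ((j + h) *_) (*-identityˡ _))
         (trans (cong (_* 2 ^ (f * r)) (sym (m+[n∸m]≡n (≤-trans (S≤h r<N) (m≤n+m h j)))))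
           (*-distribʳ-+ (2 ^ (f * r)) (S r) (digit r)))) ⟩
      Σ< N (λ r → S r * 2 ^ (f * r) + digit r * 2 ^ (f * r))  ≡⟨ Σ-+ N _ _ ⟩
      pack f N S + pack f N digit            ∎)
      where open ≡-Reasoning

    2h : 2 ^ f ≡ h + h
    2h = cong (h +_) (+-identityʳ h)

    digit< : ∀ r → r < N → digit r < 2 ^ f
    digit< r _ = ≤-<-trans (m∸n≤m (j + h) (S r)) (subst (j + h <_) (sym 2h) (+-monoˡ-< h j<h))

    top-bit : ∀ r → r < N → bit g (digit r) ≡ 𝟙< (S r) (suc j)
    top-bit r r<N with S r ≤? j
    ... | yes S≤j = trans (cong (_mod 2) (div-unique {r = j ∸ S r} 1 (≤-<-trans (m∸n≤m j (S r)) j<h)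
            (trans (+-∸-comm h S≤j) (cong (j ∸ S r +_) (sym (*-identityˡ h))))))
          (sym (𝟙<-true (s≤s S≤j)))
    ... | no S≰j = trans (cong (_mod 2) (div-small small)) (sym (𝟙<-false (≰⇒> S≰j)))
      where
      small : digit r < h
      small = +-cancelˡ-< (S r) (digit r) h (subst (_< S r + h)
        (sym (m+[n∸m]≡n (≤-trans (S≤h r<N) (m≤n+m h j)))) (+-monoˡ-< h (≰⇒> S≰j)))

  -- The shift by `g` brings the comparison bit of each field to its lowest position, where the mask
  -- keeps it. At most `N` ones remain, so the remainder is their exact number.
  count-by-masking : ∀ w → f * N ≤ w → N < 2 ^ f ∸ 1 →
    bitwise _*_ w (U div h) (ones f N) mod (2 ^ f ∸ 1) ≡ count≤ v j N
  count-by-masking w fN≤w N< = begin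
    bitwise _*_ w (U div h) (ones f N) mod (2 ^ f ∸ 1)
      ≡⟨ cong (_mod (2 ^ f ∸ 1)) (and-ones f N w (U div h) z<s fN≤w) ⟩
    pack f N (λ r → bit (f * r) (U div h)) mod (2 ^ f ∸ 1)
      ≡⟨ cong (_mod (2 ^ f ∸ 1)) (pack-cong f N λ r r<N → begin
           bit (f * r) (U div h)                ≡⟨ bit-div (f * r) g U ⟩
           bit (f * r + g) U                    ≡⟨ cong (λ k → bit k U) (+-comm (f * r) g) ⟩
           bit (g + f * r) U                    ≡⟨ bit-div g (f * r) U ⟨
           bit g (U div 2 ^ (f * r))            ≡⟨ bit-mod {g} {f} (U div 2 ^ (f * r)) ≤-refl ⟨
           bit g (U div 2 ^ (f * r) mod 2 ^ f)  ≡⟨ cong (λ x → bit g (x div 2 ^ (f * r) mod 2 ^ f)) U-digits ⟩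
           bit g (pack f N digit div 2 ^ (f * r) mod 2 ^ f) ≡⟨ cong (bit g) (pack-digit f N digit< r<N) ⟩
           bit g (digit r)                      ≡⟨ top-bit r r<N ⟩
           𝟙< (S r) (suc j)                     ∎) ⟩
    pack f N (λ r → 𝟙< (S r) (suc j)) mod (2 ^ f ∸ 1)
      ≡⟨ pack-mod-pred f N _ (≤-<-trans count≤N N<) ⟩
    count≤ v j N ∎
    where
    open ≡-Reasoning
    count≤N : count≤ v j N ≤ N
    count≤N = ≤-trans (Σ-≤ N (λ r _ → 𝟙≤1 (S r <ᵇ suc j))) (≤-reflexive (trans (Σ-const N 1) (*-identityʳ N)))

-- Expressions

infixl 6 _⊕_ _⊖_
infixl 7 _⊗_ _⊘_ _⊛_

_⊕_ _⊖_ _⊗_ _⊘_ _⊛_ : Exp → Exp → Exp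
_⊕_ = bin add
_⊖_ = bin sub
_⊗_ = bin mul
_⊘_ = bin quo
_⊛_ = bin rem

ltE eqE powE : Exp → Exp → Exp
ltE = bin lt
eqE = bin eq
powE x e = bin shl x e

2^E : Exp → Exp
2^E e = bin shl (lit 1) e

ifE : Exp → Exp → Exp → Exp
ifE c x y = c ⊗ x ⊕ (lit 1 ⊖ c) ⊗ y

onesE : Exp → Exp → Exp
onesE f N = (2^E (f ⊗ N) ⊖ lit 1) ⊘ (2^E f ⊖ lit 1)

prefixE : Exp → Exp → Exp → Exp
prefixE f D r = D ⊛ 2^E (f ⊗ r) ⊛ (2^E f ⊖ lit 1)

fieldE : Exp → Exp → Exp → Exp
fieldE f D r = bin shr D (f ⊗ r) ⊛ 2^E f

-- Field r of sums is the sum of the first r + 1 fields of D.  Subtracting it from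
-- j + 2 ^ (f - 1) leaves the top bit of the field set iff that sum is at most j;
-- the final remainder adds up these bits.
countE : Exp → Exp → Exp → Exp → Exp
countE f N D j = bin and (bin shr ((j ⊕ 2^E (f ⊖ lit 1)) ⊗ onesE f N ⊖ sums) (f ⊖ lit 1)) (onesE f N) ⊛ (2^E f ⊖ lit 1)
  where
  sums = (D ⊛ (2^E f ⊖ lit 1) ⊗ 2^E (f ⊗ N) ⊖ D) ⊘ (2^E f ⊖ lit 1)

eval< : ∀ {w M} → Words w M → ∀ i e → eval w M i e < 2 ^ w
eval< {w} Wd i (lit x)     = wrap< w x
eval< {w} Wd i pid         = wrap< w i
eval< Wd i (load A e)      = Wd A _
eval< {w} Wd i (bin add e r) = wrap< w _
eval< {w} Wd i (bin sub e r) = wrap< w _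
eval< {w} Wd i (bin mul e r) = wrap< w _
eval< {w} Wd i (bin quo e r) = wrap< w _
eval< {w} Wd i (bin rem e r) = wrap< w _
eval< {w} Wd i (bin shl e r) = wrap< w _
eval< {w} Wd i (bin shr e r) = wrap< w _
eval< {w} Wd i (bin and e r) = wrap< w _
eval< {w} Wd i (bin or e r)  = wrap< w _
eval< {w} Wd i (bin xor e r) = wrap< w _
eval< {w} Wd i (bin lt e r)  = wrap< w _
eval< {w} Wd i (bin eq e r)  = wrap< w _

module Eval (w θ : ℕ) (64θ≤w : 64 * θ ≤ w) (10≤θ : 10 ≤ θ) (M : Mem) (Wd : Words w M) (i : ℕ) where

  infix 4 _⇓_ _⇓⟨_⟩_

  -- A record and not the bare equation: `eval` would compute on a given expression and leave
  -- nothing from which `e` could be inferred when the rules below are applied.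
  record _⇓_ (e : Exp) (x : ℕ) : Set where
    constructor by
    field value : eval w M i e ≡ x
  open _⇓_ public

  -- The index `s` measures size in units of `θ` bits. The rules compute it on closed numerals, so
  -- the condition that no operation overflows is a Boolean test that reduces to `⊤` and is filled
  -- in silently.
  record _⇓⟨_⟩_ (e : Exp) (s x : ℕ) : Set where
    constructor _within_
    field
      value⁺ : e ⇓ x
      bound  : x < 2 ^ (s * θ)
  open _⇓⟨_⟩_ public renaming (value⁺ to ↓_)

  word : ∀ {e x} → e ⇓ x → x < 2 ^ w
  word {e} (by refl) = eval< Wd i e

  cast : ∀ {e x y} → x ≡ y → e ⇓ x → e ⇓ y
  cast refl p = p

  castˢ : ∀ {e s x y} → x ≡ y → e ⇓⟨ s ⟩ x → e ⇓⟨ s ⟩ y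
  castˢ refl p = p

  0<w : 0 < w
  0<w = ≤-trans (≤-trans (s≤s z≤n) 10≤θ) (≤-trans (m≤n*m θ 64) 64θ≤w)

  1<2^w : 1 < 2 ^ w
  1<2^w = ≤-<-trans 0<w (n<2^n w)

  private
    apply2 : ∀ o {e r x y z} → (apply w o x y ≡ z) → e ⇓ x → r ⇓ y → bin o e r ⇓ z
    apply2 o p (by refl) (by refl) = by p

  self : ∀ e → e ⇓ eval w M i e
  self e = by refl

  lit⇓ : ∀ {x} → x < 2 ^ w → lit x ⇓ x
  lit⇓ x< = by (wrap-small w x<)

  one⇓ : lit 1 ⇓ 1
  one⇓ = lit⇓ 1<2^w

  zero⇓ : lit 0 ⇓ 0
  zero⇓ = lit⇓ (0<2^ w)

  pid⇓ : i < 2 ^ w → pid ⇓ i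
  pid⇓ i< = by (wrap-small w i<)

  load⇓ : ∀ {A e x y} → e ⇓ x → M A x ≡ y → load A e ⇓ y
  load⇓ (by refl) p = by p

  add⇓ : ∀ {e r x y} → e ⇓ x → r ⇓ y → x + y < 2 ^ w → e ⊕ r ⇓ x + y
  add⇓ p q lts = apply2 add (wrap-small w lts) p q

  addʷ : ∀ {e r x y} → e ⇓ x → r ⇓ y → e ⊕ r ⇓ (x + y) mod 2 ^ w
  addʷ {x = x} {y} p q = apply2 add (wrap-mod w (x + y)) p q

  mul⇓ : ∀ {e r x y} → e ⇓ x → r ⇓ y → x * y < 2 ^ w → e ⊗ r ⇓ x * y
  mul⇓ p q lts = apply2 mul (wrap-small w lts) p q

  sub⇓ : ∀ {e r x y} → e ⇓ x → r ⇓ y → e ⊖ r ⇓ x ∸ y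
  sub⇓ {x = x} {y} p q = apply2 sub (wrap-small w (≤-<-trans (m∸n≤m x y) (word p))) p q

  quo⇓ : ∀ {e r x y} → e ⇓ x → r ⇓ y → e ⊘ r ⇓ x div y
  quo⇓ {x = x} {y} p q = apply2 quo (wrap-small w (≤-<-trans (div≤ x y) (word p))) p q

  rem⇓ : ∀ {e r x y} → e ⇓ x → r ⇓ y → e ⊛ r ⇓ x mod y
  rem⇓ {x = x} {y} p q = apply2 rem (wrap-small w (≤-<-trans (mod≤ x y) (word p))) p q

  shl⇓ : ∀ {e r x y} → e ⇓ x → r ⇓ y → x * 2 ^ y < 2 ^ w → powE e r ⇓ x * 2 ^ y
  shl⇓ p q lts = apply2 shl (wrap-small w lts) p q

  shlʷ : ∀ {e r x y} → e ⇓ x → r ⇓ y → powE e r ⇓ (x * 2 ^ y) mod 2 ^ w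
  shlʷ {x = x} {y} p q = apply2 shl (wrap-mod w (x * 2 ^ y)) p q

  shr⇓ : ∀ {e r x y} → e ⇓ x → r ⇓ y → bin shr e r ⇓ x div 2 ^ y
  shr⇓ {x = x} {y} p q = apply2 shr (wrap-small w (≤-<-trans (div≤ x (2 ^ y)) (word p))) p q

  and⇓ : ∀ {e r x y} → e ⇓ x → r ⇓ y → bitwise _*_ w x y < 2 ^ w → bin and e r ⇓ bitwise _*_ w x y
  and⇓ p q lts = apply2 and (wrap-small w lts) p q

  private
    bool< : ∀ b → 𝟙 b < 2 ^ w
    bool< b = ≤-<-trans (𝟙≤1 b) 1<2^w

  lt⇓ : ∀ {e r x y} → e ⇓ x → r ⇓ y → ltE e r ⇓ 𝟙< x y
  lt⇓ {x = x} {y} p q = apply2 lt (wrap-small w (bool< (x <ᵇ y))) p q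

  eq⇓ : ∀ {e r x y} → e ⇓ x → r ⇓ y → eqE e r ⇓ 𝟙≡ x y
  eq⇓ {x = x} {y} p q = apply2 eq (wrap-small w (bool< (x ≡ᵇ y))) p q

  2^⇓ : ∀ {e x} → e ⇓ x → x < w → 2^E e ⇓ 2 ^ x
  2^⇓ {x = x} p x<w = cast (*-identityˡ (2 ^ x))
    (shl⇓ one⇓ p (subst (_< 2 ^ w) (sym (*-identityˡ (2 ^ x))) (^-monoʳ-< 2 (s≤s (s≤s z≤n)) x<w)))

  2^-1⇓ : ∀ {e x} → e ⇓ x → x < w → 2^E e ⊖ lit 1 ⇓ 2 ^ x ∸ 1
  2^-1⇓ p x<w = sub⇓ (2^⇓ p x<w) one⇓

  -- `ifE` evaluates both branches. The one not taken is multiplied by 0, so nothing need be known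
  -- about it; in a query it may be computed from table cells that were never filled.
  if-true : ∀ {c x y v} → c ⇓ 1 → x ⇓ v → ifE c x y ⇓ v
  if-true {x = x} {y} {v} pc px = cast (trans (+-identityʳ _) (*-identityˡ v))
    (add⇓ (mul⇓ pc px (subst (_< 2 ^ w) (sym (*-identityˡ v)) (word px)))
          (mul⇓ (sub⇓ one⇓ pc) (self y) (0<2^ w))
          (subst (_< 2 ^ w) (sym (trans (+-identityʳ _) (*-identityˡ v))) (word px)))

  if-false : ∀ {c x y v} → c ⇓ 0 → y ⇓ v → ifE c x y ⇓ v
  if-false {x = x} {y} {v} pc py = cast (*-identityˡ v)
    (add⇓ (mul⇓ pc (self x) (0<2^ w))
          (mul⇓ (sub⇓ one⇓ pc) py (subst (_< 2 ^ w) (sym (*-identityˡ v)) (word py)))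
          (subst (_< 2 ^ w) (sym (*-identityˡ v)) (word py)))

  mul<ʷ : ∀ {x} → x ≤ w → x < 2 ^ w
  mul<ʷ x≤w = ≤-<-trans x≤w (n<2^n w)

  ones⇓ : ∀ {fE NE f N} → fE ⇓ f → NE ⇓ N → 0 < f → f * N < w → f < w → onesE fE NE ⇓ ones f N
  ones⇓ {N = N} pf pN 0<f fN<w f<w = cast (ones-quo N 0<f)
    (quo⇓ (2^-1⇓ (mul⇓ pf pN (mul<ʷ (<⇒≤ fN<w))) fN<w) (2^-1⇓ pf f<w))

  prefix⇓ : ∀ {fE DE rE f N r v} → fE ⇓ f → DE ⇓ pack f N v → rE ⇓ r →
    (∀ k → k < N → v k < 2 ^ f) → r ≤ N → f * N < w → f < w → Σ< r v < 2 ^ f ∸ 1 →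
    prefixE fE DE rE ⇓ Σ< r v
  prefix⇓ {f = f} {N} {r} {v} pf pD pr v< r≤N fN<w f<w small =
    cast (trans (cong (_mod (2 ^ f ∸ 1)) (pack-mod f N v< r≤N)) (pack-mod-pred f r v small))
      (rem⇓ (rem⇓ pD (2^⇓ (mul⇓ pf pr (mul<ʷ (<⇒≤ fr<w))) fr<w)) (2^-1⇓ pf f<w))
    where fr<w = ≤-<-trans (*-monoʳ-≤ f r≤N) fN<w

  field⇓ : ∀ {fE DE rE f N r v} → fE ⇓ f → DE ⇓ pack f N v → rE ⇓ r →
    (∀ k → k < N → v k < 2 ^ f) → r < N → f * N < w → f < w → fieldE fE DE rE ⇓ v r
  field⇓ {f = f} {N} {r} pf pD pr v< r<N fN<w f<w = cast (pack-digit f N v< r<N)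
    (rem⇓ (shr⇓ pD (mul⇓ pf pr (mul<ʷ (≤-trans (*-monoʳ-≤ f (<⇒≤ r<N)) (<⇒≤ fN<w))))) (2^⇓ pf f<w))

  count⇓ : ∀ {fE NE DE jE g N v j} → fE ⇓ suc g → NE ⇓ N → DE ⇓ pack (suc g) N v → jE ⇓ j →
    suc g + suc g * N < w → N < 2 ^ suc g ∸ 1 → Σ< N v < 2 ^ g → j < 2 ^ g →
    countE fE NE DE jE ⇓ count≤ v j N
  count⇓ {g = g} {N} {v} {j} pf pN pD pj size N< total< j<h =
    cast (trans (cong (λ P → bitwise _*_ w (((j + h) * ones f N ∸ P) div h) (ones f N) mod (2 ^ f ∸ 1))
                   (prefix-sums g N v j (<⇒≤ total<) j<h))
           (count-by-masking g N v j (<⇒≤ total<) j<h w (<⇒≤ fN<w) N<))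
      (rem⇓ (and⇓ (shr⇓ (sub⇓ (mul⇓ (add⇓ pj (2^⇓ p-g g<w) j+h<) p-ones top<) sums) p-g) p-ones and<) p-max)
    where
    f = suc g
    h = 2 ^ g
    h+h : h + h ≡ 2 ^ f
    h+h = cong (h +_) (sym (+-identityʳ h))
    f<w = ≤-<-trans (m≤m+n f (f * N)) size
    fN<w = ≤-<-trans (m≤n+m (f * N) f) size
    g<w = <-trans (n<1+n g) f<w
    j+h<2^f : j + h < 2 ^ f
    j+h<2^f = subst (j + h <_) h+h (+-monoˡ-< h j<h)
    j+h< : j + h < 2 ^ w
    j+h< = <-≤-trans j+h<2^f (2^-mono (<⇒≤ f<w))
    p-g = sub⇓ pf one⇓
    p-max = 2^-1⇓ pf f<w
    p-ones = ones⇓ pf pN z<s fN<w f<w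
    -- A one-field factor times an `N`-field factor needs one spare field; this is why `size` asks
    -- for `suc g + suc g * N` bits.
    product< : ∀ {x y} → x < 2 ^ f → y ≤ 2 ^ (f * N) → x * y < 2 ^ w
    product< {x} {y} x< y≤ = ≤-<-trans (*-monoʳ-≤ x y≤) (<-≤-trans (*-monoˡ-< (2 ^ (f * N)) {{m^n≢0 2 (f * N)}} x<)
      (≤-trans (≤-reflexive (sym (2^-+ f (f * N)))) (2^-mono (<⇒≤ size))))
    top< : (j + h) * ones f N < 2 ^ w
    top< = product< j+h<2^f (<⇒≤ (pack< f N (λ _ _ → ≤-<-trans z<s (n<2^n f))))
    tot≡ : pack f N v mod (2 ^ f ∸ 1) ≡ Σ< N v
    tot≡ = pack-mod-pred f N v (<-≤-trans total< (≤-trans (≤-reflexive (sym (m+n∸n≡m h 1)))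
      (≤-trans (∸-monoˡ-≤ 1 (+-monoʳ-≤ h (0<2^ g))) (≤-reflexive (cong (_∸ 1) h+h)))))
    sums = quo⇓ (sub⇓ (mul⇓ (cast tot≡ (rem⇓ pD p-max)) (2^⇓ (mul⇓ pf pN (mul<ʷ (<⇒≤ fN<w))) fN<w)
              (product< (<-≤-trans total< (subst (h ≤_) h+h (m≤m+n h h))) ≤-refl)) pD) p-max
    and< : ∀ {x} → bitwise _*_ w x (ones f N) < 2 ^ w
    and< {x} = subst (_< 2 ^ w) (sym (and-ones f N w x z<s (<⇒≤ fN<w)))
      (<-≤-trans (pack< f N (λ r _ → <-≤-trans (bit<2 (f * r) x) (2^-mono {1} {f} (s≤s z≤n))))
        (2^-mono (<⇒≤ fN<w)))

  -- Values below 2 ^ (s θ); as long as s ≤ 64 no operation on them overflows.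

  small-word : ∀ {s x} → s ≤ 64 → x < 2 ^ (s * θ) → x < 2 ^ w
  small-word s≤64 x< = <-≤-trans x< (2^-mono (≤-trans (*-monoˡ-≤ θ s≤64) 64θ≤w))

  weaken : ∀ {e s x} t → s ≤ t → e ⇓⟨ s ⟩ x → e ⇓⟨ t ⟩ x
  weaken t s≤t (p within lts) = p within (<-≤-trans lts (2^-mono (*-monoˡ-≤ θ s≤t)))

  private
    2*≤ : ∀ s → 2 * 2 ^ (s * θ) ≤ 2 ^ (suc s * θ)
    2*≤ s = ≤-trans (*-monoˡ-≤ (2 ^ (s * θ)) (≤-trans (≤-reflexive (sym (*-identityʳ 2))) (2^-mono {1} (≤-trans (s≤s z≤n) 10≤θ))))
      (≤-reflexive (sym (2^-+ θ (s * θ))))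

  -- 1024 is `2 ^ 10`, which `10≤θ` puts within one unit.
  litˢ : ∀ x {_ : T (x <ᵇ 1024)} → lit x ⇓⟨ 1 ⟩ x
  litˢ x {p} = lit⇓ (small-word (s≤s z≤n) x<) within x<
    where
    x< : x < 2 ^ (1 * θ)
    x< = <-≤-trans (<ᵇ⇒< x 1024 p) (2^-mono {10} (≤-trans 10≤θ (≤-reflexive (sym (*-identityˡ θ)))))

  pidˢ : ∀ s {_ : T (s ≤ᵇ 64)} → i < 2 ^ (s * θ) → pid ⇓⟨ s ⟩ i
  pidˢ s {ok} i< = pid⇓ (small-word {s} (≤ᵇ⇒≤ s 64 ok) i<) within i<

  loadˢ : ∀ s {t A e x y} → e ⇓⟨ t ⟩ x → M A x ≡ y → y < 2 ^ (s * θ) → load A e ⇓⟨ s ⟩ y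
  loadˢ s p m≡ y< = load⇓ (↓ p) m≡ within y<

  infixl 6 _+ˢ_ _-ˢ_
  infixl 7 _*ˢ_ _/ˢ_ _%ˢ_

  _+ˢ_ : ∀ {e r s t x y} → e ⇓⟨ s ⟩ x → r ⇓⟨ t ⟩ y → {_ : T (suc (s ⊔ t) ≤ᵇ 64)} → e ⊕ r ⇓⟨ suc (s ⊔ t) ⟩ x + y
  _+ˢ_ {s = s} {t} {x} {y} (p within x<) (q within y<) {ok} =
    add⇓ p q (small-word (≤ᵇ⇒≤ (suc (s ⊔ t)) 64 ok) sum<) within sum<
    where
    u = s ⊔ t
    sum< : x + y < 2 ^ (suc u * θ)
    sum< = <-≤-trans (+-mono-< (<-≤-trans x< (2^-mono (*-monoˡ-≤ θ (m≤m⊔n s t))))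
                               (<-≤-trans y< (2^-mono (*-monoˡ-≤ θ (m≤n⊔m s t)))))
      (subst (_≤ 2 ^ (suc u * θ)) (cong (2 ^ (u * θ) +_) (+-identityʳ _)) (2*≤ u))

  _*ˢ_ : ∀ {e r s t x y} → e ⇓⟨ s ⟩ x → r ⇓⟨ t ⟩ y → {_ : T (s + t ≤ᵇ 64)} → e ⊗ r ⇓⟨ s + t ⟩ x * y
  _*ˢ_ {s = s} {t} {x} {y} (p within x<) (q within y<) {ok} =
    mul⇓ p q (small-word (≤ᵇ⇒≤ (s + t) 64 ok) prod<) within prod<
    where
    prod< : x * y < 2 ^ ((s + t) * θ)
    prod< = subst (x * y <_) (trans (sym (2^-+ (s * θ) (t * θ))) (cong (2 ^_) (sym (*-distribʳ-+ θ s t)))) (*-mono-< x< y<)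

  _-ˢ_ : ∀ {e r s t x y} → e ⇓⟨ s ⟩ x → r ⇓⟨ t ⟩ y → e ⊖ r ⇓⟨ s ⟩ x ∸ y
  _-ˢ_ {x = x} {y} (p within x<) (q within y<) = sub⇓ p q within ≤-<-trans (m∸n≤m x y) x<

  _/ˢ_ : ∀ {e r s t x y} → e ⇓⟨ s ⟩ x → r ⇓⟨ t ⟩ y → e ⊘ r ⇓⟨ s ⟩ x div y
  _/ˢ_ {x = x} {y} (p within x<) (q within y<) = quo⇓ p q within ≤-<-trans (div≤ x y) x<

  _%ˢ_ : ∀ {e r s t x y} → e ⇓⟨ s ⟩ x → r ⇓⟨ t ⟩ y → e ⊛ r ⇓⟨ s ⟩ x mod y
  _%ˢ_ {x = x} {y} (p within x<) (q within y<) = rem⇓ p q within ≤-<-trans (mod≤ x y) x<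

  private
    bool<ˢ : ∀ b → 𝟙 b < 2 ^ (1 * θ)
    bool<ˢ b = ≤-<-trans (𝟙≤1 b) (<-≤-trans {j = 2 ^ 1} (s≤s (s≤s z≤n)) (2^-mono (≤-trans (≤-trans (s≤s z≤n) 10≤θ) (≤-reflexive (sym (*-identityˡ θ))))))

  ltˢ : ∀ {e r s t x y} → e ⇓⟨ s ⟩ x → r ⇓⟨ t ⟩ y → ltE e r ⇓⟨ 1 ⟩ 𝟙< x y
  ltˢ {x = x} {y} (p within _) (q within _) = lt⇓ p q within bool<ˢ (x <ᵇ y)

  eqˢ : ∀ {e r s t x y} → e ⇓⟨ s ⟩ x → r ⇓⟨ t ⟩ y → eqE e r ⇓⟨ 1 ⟩ 𝟙≡ x y
  eqˢ {x = x} {y} (p within _) (q within _) = eq⇓ p q within bool<ˢ (x ≡ᵇ y)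

  if-trueˢ : ∀ {c x y s v} → c ⇓ 1 → x ⇓⟨ s ⟩ v → ifE c x y ⇓⟨ s ⟩ v
  if-trueˢ pc (px within v<) = if-true pc px within v<

  if-falseˢ : ∀ {c x y s v} → c ⇓ 0 → y ⇓⟨ s ⟩ v → ifE c x y ⇓⟨ s ⟩ v
  if-falseˢ pc (py within v<) = if-false pc py within v<

-- Programs

assign : Array → Exp → Stmt
assign A v = pardo (lit 1) (lit 1) A (lit 0) v

cell : Array → Exp
cell A = load A (lit 0)

for : Array → Exp → Program → Program
for A limit body = assign A (lit 0) ∷ while (ltE (cell A) limit) (body ++ assign A (cell A ⊕ lit 1) ∷ []) ∷ []

module Hoare (w θ : ℕ) (64θ≤w : 64 * θ ≤ w) (10≤θ : 10 ≤ θ) where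

  module At = Eval w θ 64θ≤w 10≤θ

  val : ∀ {M Wd i e x} → At._⇓_ M Wd i e x → eval w M i e ≡ x
  val = At.value

  valˢ : ∀ {M Wd i e s x} → At._⇓⟨_⟩_ M Wd i e s x → eval w M i e ≡ x
  valˢ p = At.value (At.↓ p)

  -- Every run of P from M ends in a memory satisfying Q, after at most a X
  -- further work and b Y further depth.
  record Triple (X Y : ℕ) (P : Program) (M : Mem) (a b : ℕ) (Q : Mem → Set) : Set₁ where
    constructor triple
    field
      run : ∀ (R : Mem → ℕ → ℕ → Set) K t d →
        (∀ M′ t′ d′ → Words w M′ → Q M′ → t′ ≤ t + a * X → d′ ≤ d + b * Y → Halts w R K M′ t′ d′) →
        Halts w R (P ++ K) M t d
  open Triple public

  private
    step-≤ : ∀ {t t′ t″} a a′ X → t′ ≤ t + a * X → t″ ≤ t′ + a′ * X → t″ ≤ t + (a + a′) * X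
    step-≤ {t} a a′ X p q = ≤-trans q (≤-trans (+-monoˡ-≤ (a′ * X) p)
      (≤-reflexive (trans (+-assoc t (a * X) (a′ * X)) (cong (t +_) (sym (*-distribʳ-+ X a a′))))))

  infixr 5 _⨾_

  -- Since `run` accepts an arbitrary continuation, sequencing is composition: the second program
  -- knows of the first only its postcondition, whichever writes succeeded, and the costs add up.
  _⨾_ : ∀ {X Y P P′ M a a′ b b′ Q Q′} → Triple X Y P M a b Q →
    (∀ M′ → Words w M′ → Q M′ → Triple X Y P′ M′ a′ b′ Q′) → Triple X Y (P ++ P′) M (a + a′) (b + b′) Q′
  _⨾_ {X} {Y} {P} {P′} {M} {a} {a′} {b} {b′} f g = triple λ R K t d k →
    subst (λ L → Halts w R L M t d) (sym (++-assoc P P′ K))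
      (run f R (P′ ++ K) t d λ M′ t′ d′ Wd q t≤ d≤ →
        run (g M′ Wd q) R K t′ d′ λ M″ t″ d″ Wd′ q′ t≤′ d≤′ →
          k M″ t″ d″ Wd′ q′ (step-≤ a a′ X t≤ t≤′) (step-≤ b b′ Y d≤ d≤′))

  skip : ∀ {X Y M} {Q : Mem → Set} → Words w M → Q M → Triple X Y [] M 0 0 Q
  skip Wd q = triple λ R K t d k → k _ t d Wd q (≤-reflexive (sym (+-identityʳ t))) (≤-reflexive (sym (+-identityʳ d)))

  consequence : ∀ {X Y P M a b Q Q′} → (∀ M′ → Words w M′ → Q M′ → Q′ M′) → Triple X Y P M a b Q → Triple X Y P M a b Q′
  consequence i f = triple λ R K t d k → run f R K t d λ M′ t′ d′ Wd q → k M′ t′ d′ Wd (i M′ Wd q)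

  -- Changes the units of cost. A prefix sum is measured by its own size, while the passes around it
  -- are measured by the budget of the whole construction.
  rescale : ∀ {X Y X′ Y′ P M a b Q} α β → X ≤ α * X′ → Y ≤ β * Y′ →
    Triple X Y P M a b Q → Triple X′ Y′ P M (a * α) (b * β) Q
  rescale {X} {Y} {X′} {Y′} {a = a} {b} α β X≤ Y≤ f = triple λ R K t d k → run f R K t d λ M′ t′ d′ Wd q t≤ d≤ →
    k M′ t′ d′ Wd q
      (≤-trans t≤ (+-monoʳ-≤ t (≤-trans (*-monoʳ-≤ a X≤) (≤-reflexive (sym (*-assoc a α X′))))))
      (≤-trans d≤ (+-monoʳ-≤ d (≤-trans (*-monoʳ-≤ b Y≤) (≤-reflexive (sym (*-assoc b β Y′))))))

  record Wrote (x : ℕ) (g : Exp) (A : Array) (a v : Exp) (M M′ : Mem) : Set where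
    constructor wrote
    field outcome : Outcome w x g A a v M M′

  module _ {x g A a v M M′} (out : Wrote x g A a v M M′) where

    open Wrote out

    untouched : ∀ {B} → B ≢ A → ∀ j → M′ B j ≡ M B j
    untouched {B} B≢A j with outcome B j
    ... | inj₁ (_ , _ , (B≡A , _) , _) = ⊥-elim (B≢A B≡A)
    ... | inj₂ (_ , p) = p

    -- Which of several concurrent writes succeeds is arbitrary, so the content of the cell is
    -- determined only because all its writers agree; the last hypothesis says so.
    written : ∀ {j y} z → z < x → eval w M z g ≢ 0 → eval w M z a ≡ j →
      (∀ z′ → z′ < x → eval w M z′ g ≢ 0 → eval w M z′ a ≡ j → eval w M z′ v ≡ y) → M′ A j ≡ y
    written {j} z z<x g≢0 a≡j same with outcome A j
    ... | inj₁ (z′ , z′< , (_ , g′ , a′) , p) = trans p (same z′ z′< g′ a′)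
    ... | inj₂ (none , _) = ⊥-elim (none (z , z<x , refl , g≢0 , a≡j))

    unwritten : ∀ {j} → (∀ z → z < x → eval w M z g ≢ 0 → eval w M z a ≢ j) → M′ A j ≡ M A j
    unwritten {j} never with outcome A j
    ... | inj₁ (z , z<x , (_ , g≢0 , a≡j) , _) = ⊥-elim (never z z<x g≢0 a≡j)
    ... | inj₂ (_ , p) = p

    words-after : Words w M → Words w M′
    words-after Wd B j with outcome B j
    ... | inj₁ (z , _ , _ , p) = subst (_< 2 ^ w) (sym p) (eval< Wd z v)
    ... | inj₂ (_ , p) = subst (_< 2 ^ w) (sym p) (Wd B j)

  pardo-rule : ∀ {X Y k g A a v M x Q} α → Words w M → eval w M 0 k ≡ x → x ≤ α * X → 1 ≤ X → 1 ≤ Y →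
    (∀ M′ → Words w M′ → Wrote x g A a v M M′ → Q M′) →
    Triple X Y (pardo k g A a v ∷ []) M (ops k + α * (ops g + ops a + ops v + 1)) (ops k + (ops g + ops a + ops v + 1)) Q
  pardo-rule {X} {Y} {k} {g} {A} {a} {v} {M} α Wd refl x≤ 1≤X 1≤Y post = triple λ R K t d cont →
    pardo λ M′ out → cont M′ _ _ (words-after (wrote {eval w M 0 k} {g} {A} {a} {v} out) Wd) (post M′ (words-after (wrote {eval w M 0 k} {g} {A} {a} {v} out) Wd) (wrote {eval w M 0 k} {g} {A} {a} {v} out))
      (+-monoʳ-≤ t work≤) (+-monoʳ-≤ d (m≤m*n _ Y {{>-nonZero 1≤Y}}))
    where
    each = ops g + ops a + ops v + 1
    lemma : ∀ o α e X → o * X + α * X * e ≡ (o + α * e) * X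
    lemma = solve-∀
    work≤ : ops k + eval w M 0 k * each ≤ (ops k + α * each) * X
    work≤ = ≤-trans (+-mono-≤ (m≤m*n (ops k) X {{>-nonZero 1≤X}}) (*-monoˡ-≤ each x≤))
      (≤-reflexive (lemma (ops k) α each X))

  only : Array → Mem → Mem → Set
  only A M M′ = ∀ B j → B ≢ A → M′ B j ≡ M B j

  one≢0 : ∀ {M} (Wd : Words w M) i → eval w M i (lit 1) ≢ 0
  one≢0 {M} Wd i p = case trans (sym (value (one⇓))) p of λ ()
    where open At M Wd i

  assign-rule : ∀ {X Y A v M y Q} → Words w M → 1 ≤ X → 1 ≤ Y → eval w M 0 v ≡ y →
    (∀ M′ → Words w M′ → only A M M′ → M′ A 0 ≡ y → Q M′) →
    Triple X Y (assign A v ∷ []) M (ops v + 4) (ops v + 4) Q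
  assign-rule {X} {Y} {A} {v} {M} {y} {Q} Wd 1≤X 1≤Y v≡y post = subst (λ c → Triple X Y (assign A v ∷ []) M c c Q) shape
    (subst (λ c → Triple X Y (assign A v ∷ []) M c (1 + (1 + 1 + ops v + 1)) Q) (cong suc (*-identityˡ _))
    (pardo-rule {X} {Y} {a = lit 0} 1 Wd (value one⇓) (≤-trans 1≤X (≤-reflexive (sym (*-identityˡ X)))) 1≤X 1≤Y λ M′ Wd′ out →
      post M′ Wd′ (λ B j B≢A → untouched out B≢A j)
        (written out 0 (s≤s z≤n) (one≢0 Wd 0) (value zero⇓) λ { zero _ _ _ → v≡y ; (suc _) (s≤s ()) })))
    where
    open At M Wd 0
    shape : 1 + (1 + 1 + ops v + 1) ≡ ops v + 4
    shape = trans (cong (λ o → 3 + o) (+-comm (ops v) 1)) (+-comm 4 (ops v))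

  -- The loop itself advances the counter `A`. Therefore the invariant must survive any change to
  -- that array, and the body must leave the counter as it found it.
  module _ {X Y A limit body a b} (1≤X : 1 ≤ X) (1≤Y : 1 ≤ Y) (m : ℕ) (1≤m : 1 ≤ m) (m<2^w : m < 2 ^ w)
    (Inv : ℕ → Mem → Set)
    (stable : ∀ {k M M′} → only A M M′ → Inv k M → Inv k M′)
    (limit-value : ∀ {k M} → Words w M → Inv k M → eval w M 0 limit ≡ m)
    (body-rule : ∀ {k M} → k < m → Words w M → Inv k M → M A 0 ≡ k →
       Triple X Y body M a b (λ M′ → Inv (suc k) M′ × M′ A 0 ≡ k)) where

    private
      guard = ltE (cell A) limit
      o = ops guard
      next : Program
      next = assign A (cell A ⊕ lit 1) ∷ []
      loop = while guard (body ++ next)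

      reassoc : ∀ x y a r X → (x + a * X) + (y * X + r * ((a + y) * X)) ≡ x + (1 + r) * ((a + y) * X)
      reassoc = solve-∀

      iterate : ∀ r k {M} → k + r ≡ m → Words w M → Inv k M → M A 0 ≡ k →
        ∀ (R : Mem → ℕ → ℕ → Set) K t d →
        (∀ M′ t′ d′ → Words w M′ → Inv m M′ → t′ ≤ t + r * ((a + (o + 8)) * X) + o → d′ ≤ d + r * ((b + (o + 8)) * Y) + o →
          Halts w R K M′ t′ d′) →
        Halts w R (loop ∷ K) M t d
      iterate zero k {M} k+r≡m Wd inv c≡k R K t d cont = while-false
        (trans (value (lt⇓ (load⇓ zero⇓ c≡k) (by {limit} (limit-value Wd inv))))
          (𝟙<-false (≤-reflexive (trans (sym k+r≡m) (+-identityʳ k)))))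
        (cont M _ _ Wd (subst (λ j → Inv j M) (trans (sym (+-identityʳ k)) k+r≡m) inv)
          (≤-reflexive (cong (_+ o) (sym (+-identityʳ t)))) (≤-reflexive (cong (_+ o) (sym (+-identityʳ d)))))
        where open At M Wd 0
      iterate (suc r) k {M} k+r≡m Wd inv c≡k R K t d cont = while-true
        (λ p → case trans (sym (trans (value (lt⇓ (load⇓ zero⇓ c≡k) (by {limit} (limit-value Wd inv)))) (𝟙<-true k<m))) p of λ ())
        (run (body-rule k<m Wd inv c≡k ⨾ λ M₁ Wd₁ (inv₁ , c₁) → assign-rule {X} {Y} {Q = λ M₂ → Inv (suc k) M₂ × M₂ A 0 ≡ suc k} Wd₁ 1≤X 1≤Y (At.value (At.add⇓ M₁ Wd₁ 0 (At.load⇓ M₁ Wd₁ 0 (At.zero⇓ M₁ Wd₁ 0) c₁) (At.one⇓ M₁ Wd₁ 0) k+1<))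
            λ M₂ Wd₂ fr c₂ → stable fr inv₁ , trans c₂ (+-comm k 1))
          R (loop ∷ K) (t + o) (d + o) λ M₂ t₂ d₂ Wd₂ (inv₂ , c₂) t≤ d≤ →
            iterate r (suc k) (trans (sym (+-suc k r)) k+r≡m) Wd₂ inv₂ c₂ R K t₂ d₂ λ M₃ t₃ d₃ Wd₃ inv₃ t≤′ d≤′ →
              cont M₃ t₃ d₃ Wd₃ inv₃ (combine {a = a} 1≤X t≤ t≤′) (combine {a = b} 1≤Y d≤ d≤′))
        where
        open At M Wd 0
        k<m : k < m
        k<m = subst (k <_) k+r≡m (subst (k <_) (sym (+-suc k r)) (s≤s (m≤m+n k r)))
        k+1< : k + 1 < 2 ^ w
        k+1< = ≤-<-trans (≤-trans (≤-reflexive (+-comm k 1)) k<m) m<2^w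
        shape : ∀ t o a X → t + o + (a + 8) * X ≡ t + a * X + (o + 8 * X)
        shape = solve-∀
        shape′ : ∀ t a o X → t + a * X + (o * X + 8 * X) ≡ t + (a + (o + 8)) * X
        shape′ = solve-∀
        combine : ∀ {a X t t₂ t₃} → 1 ≤ X → t₂ ≤ t + o + (a + 8) * X → t₃ ≤ t₂ + r * ((a + (o + 8)) * X) + o →
          t₃ ≤ t + suc r * ((a + (o + 8)) * X) + o
        combine {a} {X} {t} {t₂} {t₃} 1≤X p q = ≤-trans q (+-monoˡ-≤ o (≤-trans (+-monoˡ-≤ (r * c) p′)
          (≤-reflexive (+-assoc t c (r * c)))))
          where
          c = (a + (o + 8)) * X
          p′ : t₂ ≤ t + c
          p′ = ≤-trans p (≤-trans (≤-reflexive (shape t o a X))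
            (≤-trans (+-monoʳ-≤ (t + a * X) (+-monoˡ-≤ (8 * X) (m≤m*n o X {{>-nonZero 1≤X}}))) (≤-reflexive (shape′ t a o X))))

    -- Each round pays `o` for the guard and 8 for the increment; the final `o + 5` is the failing
    -- guard and the initial assignment.
    for-rule : ∀ {M} → Words w M → (∀ M′ → only A M M′ → Inv 0 M′) →
      Triple (m * X) (m * Y) (for A limit body) M (a + (o + 8) + (o + 5)) (b + (o + 8) + (o + 5)) (Inv m)
    for-rule {M} Wd init = triple λ R K t d cont →
      run (assign-rule {1} {1} {Q = λ M′ → Inv 0 M′ × M′ A 0 ≡ 0} Wd ≤-refl ≤-refl (At.value (At.zero⇓ M Wd 0))
        (λ M′ Wd′ fr c → init M′ fr , c)) R (loop ∷ K) t d λ M₁ t₁ d₁ Wd₁ (inv , c) t≤ d≤ →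
          iterate m 0 refl Wd₁ inv c R K t₁ d₁ λ M₂ t₂ d₂ Wd₂ inv₂ t≤′ d≤′ →
            cont M₂ t₂ d₂ Wd₂ inv₂ (total {a} 1≤X t≤ t≤′) (total {b} 1≤Y d≤ d≤′)
      where
      shape : ∀ t m a o X → t + 5 + m * ((a + (o + 8)) * X) + o ≡ t + ((a + (o + 8)) * (m * X) + (o + 5))
      shape = solve-∀
      total : ∀ {a X t t₁ t₂} → 1 ≤ X → t₁ ≤ t + 5 → t₂ ≤ t₁ + m * ((a + (o + 8)) * X) + o → t₂ ≤ t + (a + (o + 8) + (o + 5)) * (m * X)
      total {a} {X} {t} 1≤X p q = ≤-trans q (≤-trans (+-monoˡ-≤ o (+-monoˡ-≤ _ p)) (≤-trans (≤-reflexive (shape t m a o X))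
        (+-monoʳ-≤ t (≤-trans (+-monoʳ-≤ ((a + (o + 8)) * (m * X)) (m≤m*n (o + 5) (m * X) {{>-nonZero (*-mono-≤ 1≤m 1≤X)}}))
          (≤-reflexive (sym (*-distribʳ-+ (m * X) (a + (o + 8)) (o + 5))))))))

-- Frame conditions list what may change. Membership is Boolean so that, for concrete arrays, the
-- side conditions hold by computation.
fresh : List ℕ → ℕ → Bool
fresh []      B = true
fresh (A ∷ L) B = if B ≡ᵇ A then false else fresh L B

fresh-≢ : ∀ {L A B} → T (fresh L B) → ¬ T (fresh L A) → B ≢ A
fresh-≢ fB ¬fA refl = ¬fA fB

Keeps : List ℕ → Mem → Mem → Set
Keeps L M M′ = ∀ B → T (fresh L B) → ∀ j → M′ B j ≡ M B j

keeps-trans : ∀ L {M M′ M″} → Keeps L M M′ → Keeps L M′ M″ → Keeps L M M″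
keeps-trans L k k′ B f j = trans (k′ B f j) (k B f j)

-- Prefix sums modulo 2 ^ w

ctr slen tot src dst : Array
ctr  = 15
slen = 16
tot  = 17
src  = 18
dst  = 19

wE lenE chunksE chunkAddr : Exp
wE        = load params (lit 2)
lenE      = cell slen
chunksE   = lenE ⊘ wE ⊕ lit 1
chunkAddr = pid ⊗ wE ⊕ cell ctr

-- Each chunk of w cells is summed sequentially; the chunk totals are then
-- combined by doubling and added back.
scan : Program
scan = (pardo chunksE (lit 1) tot pid (lit 0) ∷ [])
  ++ for ctr wE ((pardo chunksE (lit 1) dst chunkAddr (load tot pid) ∷ [])
              ++ (pardo chunksE (lit 1) tot pid (load tot pid ⊕ load src chunkAddr) ∷ []))
  ++ for ctr wE (pardo chunksE (ltE (2^E (cell ctr)) (pid ⊕ lit 1)) tot pid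
                   (load tot pid ⊕ load tot (pid ⊖ 2^E (cell ctr))) ∷ [])
  ++ (pardo (chunksE ⊗ wE) (ltE wE (pid ⊕ lit 1)) dst pid (load dst pid ⊕ load tot (pid ⊘ wE ⊖ lit 1)) ∷ [])

scanTemps : List ℕ
scanTemps = ctr ∷ tot ∷ dst ∷ []

module Scan (w θ : ℕ) (64θ≤w : 64 * θ ≤ w) (10≤θ : 10 ≤ θ) (w<2^θ : w < 2 ^ θ) where

  open Hoare w θ 64θ≤w 10≤θ public

  1≤w : 1 ≤ w
  1≤w = ≤-trans (≤-trans (s≤s z≤n) 10≤θ) (≤-trans (m≤n*m θ 64) 64θ≤w)

  W : ℕ
  W = 2 ^ w

  only-keeps : ∀ L {A M M′} → ¬ T (fresh L A) → only A M M′ → Keeps L M M′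
  only-keeps L ¬fA o B fB j = o B j (fresh-≢ {L} fB ¬fA)

  w<2^1θ : w < 2 ^ (1 * θ)
  w<2^1θ = subst (λ t → w < 2 ^ t) (sym (*-identityˡ θ)) w<2^θ

  module _ {M₀ : Mem} (w-stored : M₀ params 2 ≡ w) {N : ℕ} (N-stored : M₀ slen 0 ≡ N) (N< : N < 2 ^ (2 * θ)) where

    -- One more than `N div w`, so that the chunks cover all of the positions 0, ..., `N` at which a
    -- prefix sum is wanted.
    chunks : ℕ
    chunks = N div w + 1

    private
      σ : ℕ → ℕ → ℕ
      σ c k = Σ< k (λ z → M₀ src (c * w + z))

      S : ℕ → ℕ
      S z = Σ< z (M₀ src)

      S-chunk : ∀ c k → S (c * w) + σ c k ≡ S (c * w + k)
      S-chunk c k = sym (Σ-split (c * w) k (M₀ src))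

      keeps : Mem → Set
      keeps = Keeps scanTemps M₀

      N<2^θ² : chunks * w < 2 ^ (3 * θ)
      N<2^θ² = <-≤-trans (≤-<-trans (≤-trans (≤-reflexive (*-distribʳ-+ w (N div w) 1))
                 (≤-trans (+-mono-≤ (div*≤ N w) (≤-reflexive (*-identityˡ w))) (+-monoʳ-≤ N (<⇒≤ w<2^1θ)))) (+-monoˡ-< _ N<))
        (≤-trans (+-monoʳ-≤ (2 ^ (2 * θ)) (2^-mono (*-monoˡ-≤ θ (s≤s (z≤n {1})))))
          (≤-trans (≤-reflexive (cong (2 ^ (2 * θ) +_) (sym (+-identityʳ _))))
            (≤-trans (*-monoˡ-≤ (2 ^ (2 * θ)) {2 ^ 1} {2 ^ θ} (2^-mono {1} (≤-trans (s≤s z≤n) 10≤θ)))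
              (≤-reflexive (sym (2^-+ θ (2 * θ)))))))

      chunk< : ∀ {c} → c < chunks → c < 2 ^ (3 * θ)
      chunk< c< = <-trans c< (≤-<-trans (m≤m*n chunks w {{>-nonZero 1≤w}}) N<2^θ²)

      module Run {M} (Wd : Words w M) (kept : keeps M) (i : ℕ) where
        open At M Wd i public
        wV : wE ⇓⟨ 1 ⟩ w
        wV = loadˢ 1 (litˢ 2) (trans (kept params _ 2) w-stored) w<2^1θ
        chunksV : chunksE ⇓⟨ 3 ⟩ chunks
        chunksV = loadˢ 2 (litˢ 0) (trans (kept slen _ 0) N-stored) N< /ˢ wV +ˢ litˢ 1
        ctrV : ∀ {k} → k < w → M ctr 0 ≡ k → cell ctr ⇓⟨ 1 ⟩ k
        ctrV k<w c = loadˢ 1 (litˢ 0) c (<-trans k<w w<2^1θ)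
        addrV : ∀ {k} → k < w → M ctr 0 ≡ k → i < chunks → chunkAddr ⇓⟨ 5 ⟩ i * w + k
        addrV k<w c i< = pidˢ 3 (chunk< i<) *ˢ wV +ˢ ctrV k<w c

      addr-inj : ∀ {c c′ z z′} → z < w → z′ < w → c * w + z ≡ c′ * w + z′ → c ≡ c′ × z ≡ z′
      addr-inj {c} {c′} {z} {z′} z< z′< p =
          trans (sym (div-unique c z< (+-comm (c * w) z))) (trans (cong (_div w) p) (div-unique c′ z′< (+-comm (c′ * w) z′)))
        , trans (sym (mod-unique c z< (+-comm (c * w) z))) (trans (cong (_mod w) p) (mod-unique c′ z′< (+-comm (c′ * w) z′)))

      Local : ℕ → Mem → Set
      Local k M = ∀ c → c < chunks → ∀ z → z < k → M dst (c * w + z) ≡ σ c z mod W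

      Sums : ℕ → Mem → Set
      Sums k M = ∀ c → c < chunks → M tot c ≡ σ c k mod W

      -- `Inv₂ k` says that `tot c` is the sum of the last `2 ^ k` chunks up to `c`. The prefix
      -- before them is added on the left instead of being subtracted on the right, because
      -- everything is known only modulo `W`; truncated subtraction covers the chunks near the
      -- beginning.
      Inv₁ Inv₂ : ℕ → Mem → Set
      Inv₁ k M = keeps M × Local k M × Sums k M
      Inv₂ k M = keeps M × Local w M ×
        (∀ c → c < chunks → (M tot c + S ((suc c ∸ 2 ^ k) * w)) mod W ≡ S (suc c * w) mod W)

      only-ctr : ∀ {M M′} → only ctr M M′ → Keeps scanTemps M M′
      only-ctr = only-keeps scanTemps (λ x → x)

      stable₁ : ∀ {k M M′} → only ctr M M′ → Inv₁ k M → Inv₁ k M′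
      stable₁ o (kp , l , s) = keeps-trans scanTemps kp (only-ctr o) ,
        (λ c c< z z< → trans (o dst _ λ ()) (l c c< z z<)) , (λ c c< → trans (o tot _ λ ()) (s c c<))

      stable₂ : ∀ {k M M′} → only ctr M M′ → Inv₂ k M → Inv₂ k M′
      stable₂ o (kp , l , s) = keeps-trans scanTemps kp (only-ctr o) ,
        (λ c c< z z< → trans (o dst _ λ ()) (l c c< z z<)) ,
        (λ c c< → trans (cong (λ t → (t + _) mod W) (o tot _ λ ())) (s c c<))

      1≤chunks : 1 ≤ chunks
      1≤chunks = m≤n+m 1 (N div w)

      ≤1* : ∀ x → x ≤ 1 * x
      ≤1* x = ≤-reflexive (sym (*-identityˡ x))

      body₁ : ∀ {k M} → k < w → Words w M → Inv₁ k M → M ctr 0 ≡ k →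
        Triple chunks 1 ((pardo chunksE (lit 1) dst chunkAddr (load tot pid) ∷ [])
              ++ (pardo chunksE (lit 1) tot pid (load tot pid ⊕ load src chunkAddr) ∷ [])) M 39 39
          (λ M′ → Inv₁ (suc k) M′ × M′ ctr 0 ≡ k)
      body₁ {k} {M} k<w Wd (kp , l , s) c≡k =
        pardo-rule 1 Wd (valˢ (chunksV)) (≤1* _) 1≤chunks ≤-refl (λ M₁ Wd₁ out → first M₁ out)
        ⨾ λ M₁ Wd₁ (kp₁ , l₁ , s₁ , c₁) →
          pardo-rule 1 Wd₁ (valˢ (Run.chunksV Wd₁ kp₁ 0)) (≤1* _) 1≤chunks ≤-refl (λ M₂ Wd₂ out → second M₁ Wd₁ kp₁ l₁ s₁ c₁ M₂ out)
        where
        open Run Wd kp 0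
        first : ∀ M₁ → Wrote chunks (lit 1) dst chunkAddr (load tot pid) M M₁ → keeps M₁ × Local (suc k) M₁ × Sums k M₁ × M₁ ctr 0 ≡ k
        first M₁ out = keeps-trans scanTemps kp (only-keeps scanTemps (λ x → x) (λ B j B≢ → untouched out B≢ j)) , local ,
          (λ c c< → trans (untouched out (λ ()) c) (s c c<)) , trans (untouched out (λ ()) 0) c≡k
          where
          at : ∀ c → c < chunks → eval w M c chunkAddr ≡ c * w + k
          at c c< = valˢ (Run.addrV Wd kp c k<w c≡k c<)
          local : Local (suc k) M₁
          local c c< z z≤k with z ≟ k
          ... | yes refl = written out c c< (one≢0 Wd c) (at c c<) λ c′ c′< _ p →
                  trans (val (Run.load⇓ Wd kp c′ (Run.pid⇓ Wd kp c′ (Run.small-word Wd kp c′ {3} (s≤s (s≤s (s≤s z≤n))) (chunk< c′<))) refl))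
                    (trans (s c′ c′<) (cong (λ t → σ t k mod W) (proj₁ (addr-inj {c′} {c} k<w k<w (trans (sym (at c′ c′<)) p)))))
          ... | no z≢k = trans (unwritten out λ c′ c′< _ p → z≢k (sym (proj₂ (addr-inj {c′} {c} k<w (<-trans z<k k<w) (trans (sym (at c′ c′<)) p))))) (l c c< z z<k)
            where z<k = ≤∧≢⇒< (s≤s⁻¹ z≤k) z≢k
        second : ∀ M₁ (Wd₁ : Words w M₁) → keeps M₁ → Local (suc k) M₁ → Sums k M₁ → M₁ ctr 0 ≡ k → ∀ M₂ →
          Wrote chunks (lit 1) tot pid (load tot pid ⊕ load src chunkAddr) M₁ M₂ → Inv₁ (suc k) M₂ × M₂ ctr 0 ≡ k
        second M₁ Wd₁ kp₁ l₁ s₁ c₁ M₂ out = (keeps-trans scanTemps kp₁ (only-keeps scanTemps (λ x → x) (λ B j B≢ → untouched out B≢ j)) ,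
            (λ c c< z z< → trans (untouched out (λ ()) _) (l₁ c c< z z<)) , sums) , trans (untouched out (λ ()) 0) c₁
          where
          pidV : ∀ c → c < chunks → eval w M₁ c pid ≡ c
          pidV c c< = valˢ (Run.pidˢ Wd₁ kp₁ c 3 (chunk< c<))
          sums : Sums (suc k) M₂
          sums c c< = written out c c< (one≢0 Wd₁ c) (pidV c c<) λ c′ c′< _ p → go c′ c′< (trans (sym (pidV c′ c′<)) p)
            where
            go : ∀ c′ → c′ < chunks → c′ ≡ c → eval w M₁ c′ (load tot pid ⊕ load src chunkAddr) ≡ σ c (suc k) mod W
            go c′ c′< refl = trans (val (Run.addʷ Wd₁ kp₁ c (Run.load⇓ Wd₁ kp₁ c (At.↓ Run.pidˢ Wd₁ kp₁ c 3 (chunk< c<)) (s₁ c c<))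
                (Run.load⇓ Wd₁ kp₁ c (At.↓ Run.addrV Wd₁ kp₁ c k<w c₁ c<) (kp₁ src _ _))))
              (mod-+ˡ (σ c k) (M₀ src (c * w + k)) W)

      -- All reads precede all writes, so doubling works in place: both totals that are added belong
      -- to the previous round.
      body₂ : ∀ {k M} → k < w → Words w M → Inv₂ k M → M ctr 0 ≡ k →
        Triple chunks 1 (pardo chunksE (ltE (2^E (cell ctr)) (pid ⊕ lit 1)) tot pid
                   (load tot pid ⊕ load tot (pid ⊖ 2^E (cell ctr))) ∷ []) M 27 27
          (λ M′ → Inv₂ (suc k) M′ × M′ ctr 0 ≡ k)
      body₂ {k} {M} k<w Wd (kp , l , s) c≡k =
        pardo-rule 1 Wd (valˢ (Run.chunksV Wd kp 0)) (≤1* _) 1≤chunks ≤-refl λ M₁ Wd₁ out →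
          (keeps-trans scanTemps kp (only-keeps scanTemps (λ x → x) (λ B j B≢ → untouched out B≢ j)) ,
            (λ c c< z z< → trans (untouched out (λ ()) _) (l c c< z z<)) , sums M₁ out) , trans (untouched out (λ ()) 0) c≡k
        where
        guard = ltE (2^E (cell ctr)) (pid ⊕ lit 1)
        new   = load tot pid ⊕ load tot (pid ⊖ 2^E (cell ctr))
        module _ (c : ℕ) (c< : c < chunks) where
          open Run Wd kp c
          pidV : pid ⇓⟨ 3 ⟩ c
          pidV = pidˢ 3 (chunk< c<)
          stepV : 2^E (cell ctr) ⇓ 2 ^ k
          stepV = 2^⇓ (↓ ctrV k<w c≡k) k<w
          guardV : eval w M c guard ≡ 𝟙< (2 ^ k) (c + 1)
          guardV = val (lt⇓ stepV (↓ (pidV +ˢ litˢ 1)))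
          addrV′ : eval w M c pid ≡ c
          addrV′ = valˢ (pidV)
          newV : eval w M c new ≡ (M tot c + M tot (c ∸ 2 ^ k)) mod W
          newV = val (addʷ (load⇓ (↓ pidV) refl) (load⇓ (sub⇓ (↓ pidV) stepV) refl))
        double : ∀ c → suc c ∸ 2 ^ suc k ≡ suc c ∸ 2 ^ k ∸ 2 ^ k
        double c = trans (cong (suc c ∸_) (cong (2 ^ k +_) (+-identityʳ (2 ^ k)))) (sym (∸-+-assoc (suc c) (2 ^ k) (2 ^ k)))
        sums : ∀ M₁ → Wrote chunks guard tot pid new M M₁ → ∀ c → c < chunks →
          (M₁ tot c + S ((suc c ∸ 2 ^ suc k) * w)) mod W ≡ S (suc c * w) mod W
        sums M₁ out c c< with 2 ^ k ≤? c
        ... | yes 2^k≤c = trans (cong (λ t → (t + S ((suc c ∸ 2 ^ suc k) * w)) mod W)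
                (written out c c< (λ p → case trans (sym (trans (guardV c c<) (𝟙<-true (≤-<-trans 2^k≤c (m<m+n c z<s))))) p of λ ())
                  (addrV′ c c<) λ c′ c′< _ p → same c′ c′< (trans (sym (addrV′ c′ c′<)) p)))
              combine
          where
          same : ∀ c′ → c′ < chunks → c′ ≡ c → eval w M c′ new ≡ (M tot c + M tot (c ∸ 2 ^ k)) mod W
          same c′ c′< refl = newV c c<
          c₀ = c ∸ 2 ^ k
          a = M tot c
          a₀ = M tot c₀
          A₀ = S ((suc c ∸ 2 ^ suc k) * w)
          suc-∸ : suc c ∸ 2 ^ k ≡ suc c₀
          suc-∸ = +-∸-assoc 1 2^k≤c
          earlier : (a₀ + A₀) mod W ≡ S ((suc c ∸ 2 ^ k) * w) mod W
          earlier = trans (cong (λ t → (a₀ + S (t * w)) mod W) (trans (double c) (cong (_∸ 2 ^ k) suc-∸)))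
            (trans (s c₀ (≤-<-trans (m∸n≤m c (2 ^ k)) c<)) (cong (λ t → S (t * w) mod W) (sym suc-∸)))
          combine : ((a + a₀) mod W + A₀) mod W ≡ S (suc c * w) mod W
          combine = begin
            ((a + a₀) mod W + A₀) mod W                      ≡⟨ mod-+ˡ (a + a₀) A₀ W ⟩
            (a + a₀ + A₀) mod W                              ≡⟨ cong (_mod W) (+-assoc a a₀ A₀) ⟩
            (a + (a₀ + A₀)) mod W                            ≡⟨ mod-+ʳ a (a₀ + A₀) W ⟨
            (a + (a₀ + A₀) mod W) mod W                      ≡⟨ cong (λ t → (a + t) mod W) earlier ⟩
            (a + S ((suc c ∸ 2 ^ k) * w) mod W) mod W        ≡⟨ mod-+ʳ a _ W ⟩
            (a + S ((suc c ∸ 2 ^ k) * w)) mod W              ≡⟨ s c c< ⟩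
            S (suc c * w) mod W                              ∎
            where open ≡-Reasoning
        ... | no 2^k≰c = trans (cong (λ t → (t + S ((suc c ∸ 2 ^ suc k) * w)) mod W) (unwritten out never))
              (trans (cong (λ t → (M tot c + S (t * w)) mod W) (trans (double c) (trans (cong (_∸ 2 ^ k) empty) (trans (0∸n≡0 (2 ^ k)) (sym empty))))) (s c c<))
          where
          c<2^k = ≰⇒> 2^k≰c
          empty : suc c ∸ 2 ^ k ≡ 0
          empty = m≤n⇒m∸n≡0 c<2^k
          never : ∀ z → z < chunks → eval w M z guard ≢ 0 → eval w M z pid ≢ c
          never z z< g≢0 p with trans (sym (addrV′ z z<)) p
          ... | refl = g≢0 (trans (guardV c c<) (𝟙<-false (subst (_≤ 2 ^ k) (+-comm 1 c) c<2^k)))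

    -- Both loops run for `w` rounds. For the second this is more than the logarithm of the number
    -- of chunks, but the extra rounds have a false guard everywhere, and `w * chunks` is at most
    -- `N + w` in any case. The depth is of order `w`, hence logarithmic.
    scan-rule : Words w M₀ → Triple (w * chunks) (w * 1) scan M₀ 151 151
      (λ M → Keeps scanTemps M₀ M × (∀ z → z ≤ N → M dst z ≡ Σ< z (M₀ src) mod W))
    scan-rule Wd₀ =
      pardo-rule 1 Wd₀ (valˢ (Run.chunksV Wd₀ (λ _ _ _ → refl) 0)) (≤-trans (m≤n*m chunks w {{>-nonZero 1≤w}}) (≤1* _)) 1≤X 1≤Y
        (λ M₁ Wd₁ out → zeroed M₁ out)
      ⨾ λ M₁ Wd₁ inv₁ → for-rule 1≤chunks ≤-refl w 1≤w (n<2^n w) Inv₁ (λ {k} → stable₁ {k})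
          (λ Wd (kp , _) → valˢ (Run.wV Wd kp 0)) body₁ Wd₁ (λ M′ o → stable₁ {0} o inv₁)
      ⨾ λ M₂ Wd₂ (kp , l , s) → for-rule 1≤chunks ≤-refl w 1≤w (n<2^n w) Inv₂ (λ {k} → stable₂ {k})
          (λ Wd (kp , _) → valˢ (Run.wV Wd kp 0)) body₂ Wd₂ (λ M′ o → stable₂ {0} o (kp , l , start₂ M₂ s))
      ⨾ λ M₃ Wd₃ inv → pardo-rule 1 Wd₃ (valˢ ((Run.chunksV Wd₃ (proj₁ inv) 0 *ˢ′ Run.wV Wd₃ (proj₁ inv) 0))) (≤-trans (≤-reflexive (*-comm chunks w)) (≤1* _)) 1≤X 1≤Y
          (λ M₄ Wd₄ out → finish M₃ Wd₃ inv M₄ out)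
      where
      1≤X = *-mono-≤ 1≤w 1≤chunks
      1≤Y = *-mono-≤ 1≤w (≤-refl {1})
      _*ˢ′_ = λ {M} {Wd} {i} {e} {r} {s} {t} {x} {y} → At._*ˢ_ M Wd i {e} {r} {s} {t} {x} {y}
      zeroed : ∀ M₁ → Wrote chunks (lit 1) tot pid (lit 0) M₀ M₁ → Inv₁ 0 M₁
      zeroed M₁ out = only-keeps scanTemps (λ x → x) (λ B j B≢ → untouched out B≢ j) , (λ _ _ _ ()) ,
        λ c c< → trans (written out c c< (one≢0 Wd₀ c) (valˢ (Run.pidˢ Wd₀ (λ _ _ _ → refl) c 3 (chunk< c<)))
          (λ z _ _ _ → val (Run.zero⇓ Wd₀ (λ _ _ _ → refl) z))) (sym (mod-small (0<2^ w)))
      start₂ : ∀ M → Sums w M → ∀ c → c < chunks → (M tot c + S ((suc c ∸ 1) * w)) mod W ≡ S (suc c * w) mod W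
      start₂ M s c c< = begin
        (M tot c + S (c * w)) mod W            ≡⟨ cong (λ t → (t + S (c * w)) mod W) (s c c<) ⟩
        (σ c w mod W + S (c * w)) mod W        ≡⟨ mod-+ˡ (σ c w) (S (c * w)) W ⟩
        (σ c w + S (c * w)) mod W              ≡⟨ cong (_mod W) (trans (+-comm (σ c w) (S (c * w))) (S-chunk c w)) ⟩
        S (c * w + w) mod W                    ≡⟨ cong (λ t → S t mod W) (+-comm (c * w) w) ⟩
        S (suc c * w) mod W                    ∎
        where open ≡-Reasoning
      finish : ∀ M (Wd : Words w M) → Inv₂ w M → ∀ M′ →
        Wrote (chunks * w) (ltE wE (pid ⊕ lit 1)) dst pid (load dst pid ⊕ load tot (pid ⊘ wE ⊖ lit 1)) M M′ →
        Keeps scanTemps M₀ M′ × (∀ z → z ≤ N → M′ dst z ≡ S z mod W)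
      finish M Wd (kp , l , s) M′ out = keeps-trans scanTemps kp (only-keeps scanTemps (λ x → x) (λ B j B≢ → untouched out B≢ j)) ,
          λ z z≤N → all z (≤-<-trans z≤N (subst (λ t → N < t * w) (+-comm 1 (N div w)) (div-upper N 1≤w)))
        where
        guard = ltE wE (pid ⊕ lit 1)
        new = load dst pid ⊕ load tot (pid ⊘ wE ⊖ lit 1)
        module _ (z : ℕ) (z< : z < chunks * w) where
          open Run Wd kp z
          pidV : pid ⇓⟨ 3 ⟩ z
          pidV = pidˢ 3 (<-trans z< N<2^θ²)
          guardV : eval w M z guard ≡ 𝟙< w (z + 1)
          guardV = valˢ (ltˢ wV (pidV +ˢ litˢ 1))
          newV : eval w M z new ≡ (M dst z + M tot (z div w ∸ 1)) mod W
          newV = val (addʷ (load⇓ (↓ pidV) refl) (load⇓ (↓ (pidV /ˢ wV -ˢ litˢ 1)) refl))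
        total : ∀ c → c < chunks → M tot c ≡ S (suc c * w) mod W
        total c c< = trans (sym (mod-small (Wd tot c))) (trans (cong (_mod W) (sym (trans (cong (λ t → M tot c + S (t * w)) none) (+-identityʳ _)))) (s c c<))
          where
          -- There are fewer than `2 ^ w` chunks, so after `w` rounds the missing prefix in `Inv₂`
          -- is empty and `tot c` is the full sum.
          none : suc c ∸ 2 ^ w ≡ 0
          none = m≤n⇒m∸n≡0 (≤-trans c< (<⇒≤ (<-≤-trans (≤-<-trans (m≤m*n chunks w {{>-nonZero 1≤w}}) N<2^θ²)
                   (2^-mono (≤-trans (*-monoˡ-≤ θ (s≤s (s≤s (s≤s (z≤n {61}))))) 64θ≤w)))))
        all : ∀ z → z < chunks * w → M′ dst z ≡ S z mod W
        all z z< with z div w in q≡ | w ≤? z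
        ... | c | no w≰z = trans (unwritten out never) (trans (cong (M dst) (sym (z≡ 0))) (trans (l 0 1≤chunks z z<w)
                (cong (_mod W) (sym (S-chunk 0 z)))))
          where
          z<w = ≰⇒> w≰z
          z≡ : ∀ t → 0 * t + z ≡ z
          z≡ t = refl
          never : ∀ z′ → z′ < chunks * w → eval w M z′ guard ≢ 0 → eval w M z′ pid ≢ z
          never z′ z′< g≢0 p with trans (sym (valˢ (pidV z′ z′<))) p
          ... | refl = g≢0 (trans (guardV z z<) (𝟙<-false (subst (_≤ w) (+-comm 1 z) z<w)))
        ... | zero | yes w≤z = ⊥-elim (<⇒≱ (≤div {q = 1} 1≤w (subst (_≤ z) (sym (*-identityˡ w)) w≤z)) (≤-reflexive q≡))
        ... | suc c | yes w≤z = trans (written out z z< (λ p → case trans (sym (trans (guardV z z<) (𝟙<-true (≤-<-trans w≤z (m<m+n z z<s))))) p of λ ())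
                (valˢ (pidV z z<)) λ z′ z′< _ p → same z′ z′< (trans (sym (valˢ (pidV z′ z′<))) p))
              combine
          where
          same : ∀ z′ → z′ < chunks * w → z′ ≡ z → eval w M z′ new ≡ (M dst z + M tot (z div w ∸ 1)) mod W
          same z′ z′< refl = newV z z<
          y = z mod w
          y<w = mod< z 1≤w
          z≡ : z ≡ suc c * w + y
          z≡ = trans (divmod z w) (trans (+-comm y _) (cong (λ t → t * w + y) q≡))
          c+1< : suc c < chunks
          c+1< = subst (_< chunks) q≡ (div< z<)
          combine : (M dst z + M tot (z div w ∸ 1)) mod W ≡ S z mod W
          combine = begin
            (M dst z + M tot (z div w ∸ 1)) mod W          ≡⟨ cong₂ (λ a b → (M dst a + M tot (b ∸ 1)) mod W) z≡ q≡ ⟩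
            (M dst (suc c * w + y) + M tot c) mod W        ≡⟨ cong₂ (λ a b → (a + b) mod W) (l (suc c) c+1< y y<w) (total c (<-trans (n<1+n c) c+1<)) ⟩
            (σ (suc c) y mod W + S (suc c * w) mod W) mod W ≡⟨ trans (mod-+ˡ (σ (suc c) y) _ W) (mod-+ʳ (σ (suc c) y) _ W) ⟩
            (σ (suc c) y + S (suc c * w)) mod W            ≡⟨ cong (_mod W) (trans (+-comm (σ (suc c) y) _) (S-chunk (suc c) y)) ⟩
            S (suc c * w + y) mod W                        ≡⟨ cong (λ t → S t mod W) z≡ ⟨
            S z mod W                                      ∎
            where open ≡-Reasoning

-- A block of b bits read from two adjacent words

double-word : ∀ w {x} y k → x < 2 ^ w →
  (k < w → bit k (x + y * 2 ^ w) ≡ bit k x) × (w ≤ k → bit k (x + y * 2 ^ w) ≡ bit (k ∸ w) y)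
double-word w {x} y k x< =
    (λ k<w → trans (sym (bit-mod (x + y * 2 ^ w) k<w)) (cong (bit k) (mod-unique y x< refl)))
  , (λ w≤k → trans (cong (λ j → bit j (x + y * 2 ^ w)) (sym (m∸n+n≡m w≤k)))
      (trans (sym (bit-div (k ∸ w) w (x + y * 2 ^ w))) (cong (bit (k ∸ w)) (div-unique y x< refl))))

module _ {w : ℕ} (0<w : 0 < w) {M : Mem} (Wd : Words w M) (A : Array) (g : ℕ) where

  private
    j = g div w
    o = g mod w
    x = M A j
    y = M A (suc j)
    g≡ : ∀ r → g + r ≡ (o + r) + j * w
    g≡ r = trans (cong (_+ r) (divmod g w)) (lemma o (j * w) r)
      where
      lemma : ∀ a b c → a + b + c ≡ a + c + b
      lemma = solve-∀

    -- As `o < w` and `r ≤ w`, bit `o + r` lies below `2 w`, so the pair of words contains it.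
    in-pair : ∀ {r} → r ≤ w → bit (o + r) (x + y * 2 ^ w) ≡ bitAt w M A (g + r)
    in-pair {r} r≤w with o + r <? w
    ... | yes k<w = trans (proj₁ (double-word w y (o + r) (Wd A j)) k<w)
            (cong₂ (λ a k → bit k (M A a)) (sym (div-unique j k<w (g≡ r))) (sym (mod-unique j k<w (g≡ r))))
    ... | no k≮w = trans (proj₂ (double-word w y (o + r) (Wd A j)) w≤k)
            (cong₂ (λ a k → bit k (M A a)) (sym (div-unique (suc j) k-w< g≡′)) (sym (mod-unique (suc j) k-w< g≡′)))
      where
      w≤k = ≮⇒≥ k≮w
      k-w< : o + r ∸ w < w
      k-w< = +-cancelʳ-< w (o + r ∸ w) w (subst (_< w + w) (sym (m∸n+n≡m w≤k)) (+-mono-<-≤ (mod< g 0<w) r≤w))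
      g≡′ : g + r ≡ (o + r ∸ w) + suc j * w
      g≡′ = trans (g≡ r) (trans (cong (_+ j * w) (sym (m∸n+n≡m w≤k))) (+-assoc (o + r ∸ w) w (j * w)))

  block-bits : ∀ {b r} → r < b → b ≤ w →
    bit r ((x div 2 ^ o + y * 2 ^ (w ∸ o)) mod 2 ^ b) ≡ bitAt w M A (g + r)
  block-bits {b} {r} r<b b≤w = begin
    bit r ((x div 2 ^ o + y * 2 ^ (w ∸ o)) mod 2 ^ b)   ≡⟨ bit-mod (x div 2 ^ o + y * 2 ^ (w ∸ o)) r<b ⟩
    bit r (x div 2 ^ o + y * 2 ^ (w ∸ o))               ≡⟨ cong (bit r) joined ⟨
    bit r ((x + y * 2 ^ w) div 2 ^ o)                   ≡⟨ bit-div r o (x + y * 2 ^ w) ⟩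
    bit (r + o) (x + y * 2 ^ w)                         ≡⟨ cong (λ k → bit k (x + y * 2 ^ w)) (+-comm r o) ⟩
    bit (o + r) (x + y * 2 ^ w)                         ≡⟨ in-pair (≤-trans (<⇒≤ r<b) b≤w) ⟩
    bitAt w M A (g + r)                                 ∎
    where
    open ≡-Reasoning
    o≤w = <⇒≤ (mod< g 0<w)
    joined : (x + y * 2 ^ w) div 2 ^ o ≡ x div 2 ^ o + y * 2 ^ (w ∸ o)
    joined = trans (cong (λ t → (x + t) div 2 ^ o) (trans (cong (λ t → y * 2 ^ t) (sym (m∸n+n≡m o≤w)))
        (trans (cong (y *_) (2^-+ (w ∸ o) o)) (sym (*-assoc y (2 ^ (w ∸ o)) (2 ^ o))))))
      (div-+* x (y * 2 ^ (w ∸ o)) (0<2^ o))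

-- Subtracting from a block of ones flips every bit without borrowing, so a query about zeros
-- becomes one about ones.
complement-bit : ∀ {b x r} → x < 2 ^ b → r < b → bit r (2 ^ b ∸ 1 ∸ x) ≡ 1 ∸ bit r x
complement-bit {b} {x} {r} x< r<b = trans (cong (bit r) flipped)
  (trans (cong (λ k → pack 1 b (λ i → 1 ∸ bit i x) div 2 ^ k mod 2) (sym (*-identityˡ r)))
    (pack-digit 1 b (λ i _ → s≤s (m∸n≤m 1 (bit i x))) r<b))
  where
  flipped : 2 ^ b ∸ 1 ∸ x ≡ pack 1 b (λ i → 1 ∸ bit i x)
  flipped = ∸-swap (trans (trans (cong (λ k → 2 ^ k ∸ 1) (sym (*-identityˡ b))) (trans (ones-geometric 1 b) (*-identityʳ _)))
    (trans (Σ-cong b (λ i _ → trans (cong (_* 2 ^ (1 * i)) (sym (m+[n∸m]≡n (s≤s⁻¹ (bit<2 i x)))))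
        (*-distribʳ-+ (2 ^ (1 * i)) (bit i x) (1 ∸ bit i x))))
      (trans (Σ-+ b _ _) (cong (_+ pack 1 b (λ i → 1 ∸ bit i x)) (pack-bits b x<)))))

flip-indicator : ∀ {x} → x < 2 → 1 ∸ x ≡ 𝟙≡ x 0
flip-indicator {0} _ = refl
flip-indicator {1} _ = refl
flip-indicator {suc (suc x)} (s≤s (s≤s ()))

same-indicator : ∀ {x} → x < 2 → x ≡ 𝟙≡ x 1
same-indicator {0} _ = refl
same-indicator {1} _ = refl
same-indicator {suc (suc x)} (s≤s (s≤s ()))

-- The geometry of the rank/select structure: superblocks of B = b F bits, blocks
-- of b bits, and words of F counters of ℓ bits each.

module Geometry (w e : ℕ) where

  ℓ b F B : ℕ
  ℓ = 8 * e
  b = ℓ * e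
  F = w div (2 * ℓ)
  B = b * F

  -- What one word must accommodate. `block`: the bits of a block spread over `b` fields of `b + 1`
  -- bits, with one field to spare. `counters`: the `F` counters, again with a spare field. `b≤F`:
  -- the offsets of a whole subgroup. `B<`: counts within a superblock stay below the comparison bit
  -- of a counter. `BB<`: offsets within a short group. `F<`: a number of counters survives the
  -- casting out.
  record Sizes (θ : ℕ) : Set where
    field
      64θ≤w   : 64 * θ ≤ w
      10≤θ    : 10 ≤ θ
      w<2^θ   : w < 2 ^ θ
      e<2^θ   : e < 2 ^ θ
      0<e     : 0 < e
      0<F     : 0 < F
      block   : suc b * suc b < w
      counters : ℓ + ℓ * F < w
      b≤F     : b ≤ F
      B<      : B < 2 ^ (ℓ ∸ 1)
      BB<     : (B + 2) * B < 2 ^ ℓ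
      F<      : F < 2 ^ ℓ ∸ 1

  -- Positions from m on count for neither bit.
  ind : (m : ℕ) (bf : ℕ → ℕ) → ℕ → ℕ → ℕ
  ind m bf β q = 𝟙< q m * 𝟙≡ (bf q) β

  rk : (m : ℕ) (bf : ℕ → ℕ) → ℕ → ℕ → ℕ
  rk m bf β q = Σ< q (ind m bf β)

  counts : (m : ℕ) (bf : ℕ → ℕ) → ℕ → ℕ → ℕ → ℕ
  counts m bf β s r = Σ< b (λ i → ind m bf β (s * B + (r * b + i)))

  -- Group k of the occurrences of β holds occurrences k B, …, k B + B - 1.  If it
  -- is flagged, all its positions are stored, otherwise the superblocks of every
  -- b-th one, and the positions of the b after it if they leave the superblocks
  -- s and s + 1.
  GroupStored : (m : ℕ) (bf : ℕ → ℕ) (Q tab : ℕ → ℕ → ℕ) (β k : ℕ) → Set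
  GroupStored m bf Q tab β k =
      (tab (k + 1) 3 ≡ 1 × first + B ≤ m div B ×
        (∀ i → i < B → k * B + i < rk m bf β m → tab (first + i + 2) 5 ≡ Q β (k * B + i)))
    ⊎ (tab (k + 1) 3 ≡ 0 ×
        (∃[ v ] (∀ u → u < F → v u < 2 ^ ℓ) × tab (k + 1) 4 ≡ pack ℓ F v ×
          (∀ u → u < F → k * B + u * b < rk m bf β m → first + v u ≡ Q β (k * B + u * b) div B)) ×
        (∀ u i → u < F → i < b → k * B + u * b + i < rk m bf β m →
          let s = Q β (k * B + u * b) div B in (s + 2) * B ≤ Q β (k * B + u * b + i) →
          ∃[ N ] ∃[ v ] N ≤ b × i < N × (∀ i → i < N → v i < 2 ^ ℓ) × tab (s + 2) 6 ≡ pack ℓ N v ×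
            s * B + v i ≡ Q β (k * B + u * b + i)))
    where first = Q β (k * B) div B

  -- Q β r is the position of occurrence r of β.
  record Table (m : ℕ) (bf : ℕ → ℕ) (Q : ℕ → ℕ → ℕ) (M : Mem) (A₀ st : ℕ) : Set where
    tab : ℕ → ℕ → ℕ → ℕ
    tab β row f = M aux (A₀ + 16 * row + (f + 8 * β))
    field
      e-stored    : M aux (A₀ + 7) ≡ e
      bits-stored : ∀ q → q < m → bitAt w M bits (st + q) ≡ bf q
      R-stored    : ∀ β s → β ≤ 1 → s * B < m → tab β (s + 1) 0 ≡ rk m bf β (s * B)
      D-stored    : ∀ β s → β ≤ 1 → s * B < m → tab β (s + 1) 1 ≡ pack ℓ F (counts m bf β s)
      Q-spec      : ∀ β r → β ≤ 1 → r < rk m bf β m → Q β r < m × ind m bf β (Q β r) ≡ 1 × rk m bf β (Q β r) ≡ r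
      G-stored    : ∀ β k → β ≤ 1 → k * B < rk m bf β m → tab β (k + 1) 2 ≡ Q β (k * B) div B
      group       : ∀ β k → β ≤ 1 → k * B < rk m bf β m → GroupStored m bf Q (tab β) β k

  -- A query memory agrees with the original one only on the recorded length of the structure, so
  -- every cell that `Table` mentions must lie in the rows 0, ..., `m div B + 2`. For a flagged
  -- group this is its bound `first + B ≤ m div B`; all other rows belong to superblocks or groups,
  -- and there are no more groups than superblocks.
  table-transfer : ∀ {m bf Q M M′ A₀ st} → 0 < B → (∀ q → q < m → M′ bits ((st + q) div w) ≡ M bits ((st + q) div w)) →
    (∀ x → x < 16 * (m div B + 3) → M′ aux (A₀ + x) ≡ M aux (A₀ + x)) → Table m bf Q M A₀ st → Table m bf Q M′ A₀ st
  table-transfer {m} {bf} {Q} {M} {M′} {A₀} {st} 0<B same-bits same-aux t = record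
    { e-stored    = trans (same-aux 7 (≤-trans (≤ᵇ⇒≤ 8 48 _) (*-monoʳ-≤ 16 (m≤n+m 3 (m div B))))) e-stored
    ; bits-stored = λ q q< → trans (cong (λ x → x div 2 ^ ((st + q) mod w) % 2) (same-bits q q<)) (bits-stored q q<)
    ; R-stored    = λ β s β≤1 s< → trans (same-tab β (s + 1) 0 β≤1 (superblock-row s s<)) (R-stored β s β≤1 s<)
    ; D-stored    = λ β s β≤1 s< → trans (same-tab β (s + 1) 1 β≤1 (superblock-row s s<)) (D-stored β s β≤1 s<)
    ; Q-spec      = Q-spec
    ; G-stored    = λ β k β≤1 k< → trans (same-tab β (k + 1) 2 β≤1 (group-row β k k<)) (G-stored β k β≤1 k<)
    ; group       = λ β k β≤1 k< → same-group β k β≤1 k< (group β k β≤1 k<)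
    }
    where
    open Table t
    tab′ : ℕ → ℕ → ℕ → ℕ
    tab′ β row f = M′ aux (A₀ + 16 * row + (f + 8 * β))
    same-tab : ∀ β row f {_ : T (f <ᵇ 8)} → β ≤ 1 → row ≤ m div B + 2 → tab′ β row f ≡ tab β row f
    same-tab β row f {f<} β≤1 row≤ = trans (cong (M′ aux) (+-assoc A₀ (16 * row) _)) (trans (same-aux (16 * row + (f + 8 * β)) x<) (cong (M aux) (sym (+-assoc A₀ (16 * row) _))))
      where
      lemma : ∀ x → 16 * (x + 2) + 16 ≡ 16 * (x + 3)
      lemma = solve-∀
      x< : 16 * row + (f + 8 * β) < 16 * (m div B + 3)
      x< = <-≤-trans (+-mono-≤-< (*-monoʳ-≤ 16 row≤) (+-mono-<-≤ (<ᵇ⇒< f 8 f<) (*-monoʳ-≤ 8 β≤1))) (≤-reflexive (lemma (m div B)))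
    superblock-row : ∀ s → s * B < m → s + 1 ≤ m div B + 2
    superblock-row s s< = +-mono-≤ (≤div 0<B (<⇒≤ s<)) (s≤s z≤n)
    rank≤m : ∀ β → rk m bf β m ≤ m
    rank≤m β = ≤-trans (Σ-≤ m (λ i _ → *-mono-≤ (𝟙≤1 (i <ᵇ m)) (𝟙≤1 (bf i ≡ᵇ β)))) (≤-reflexive (trans (Σ-const m 1) (*-identityʳ m)))
    group-row : ∀ β k → k * B < rk m bf β m → k + 1 ≤ m div B + 2
    group-row β k k< = superblock-row k (<-≤-trans k< (rank≤m β))
    same-group : ∀ β k → β ≤ 1 → k * B < rk m bf β m → GroupStored m bf Q (tab β) β k → GroupStored m bf Q (tab′ β) β k
    same-group β k β≤1 k< (inj₁ (flag , bound , e1)) = inj₁ (trans (same-tab β (k + 1) 3 β≤1 (group-row β k k<)) flag , bound ,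
      λ i i<B i< → trans (same-tab β (Q β (k * B) div B + i + 2) 5 β≤1 (+-monoˡ-≤ 2 (≤-trans (+-monoʳ-≤ (Q β (k * B) div B) (<⇒≤ i<B)) bound))) (e1 i i<B i<))
    same-group β k β≤1 k< (inj₂ (flag , (v , v< , P≡ , v≡) , e2)) = inj₂ (trans (same-tab β (k + 1) 3 β≤1 (group-row β k k<)) flag ,
      (v , v< , trans (same-tab β (k + 1) 4 β≤1 (group-row β k k<)) P≡ , v≡) ,
      λ u i u< i< r< far → case e2 u i u< i< r< far of λ { (N , v′ , N≤ , i<N , v′< , E≡ , pos≡) →
        N , v′ , N≤ , i<N , v′< , trans (same-tab β (Q β (k * B + u * b) div B + 2) 6 β≤1 (+-monoˡ-≤ 2 (div-mono B (<⇒≤ (proj₁ (Q-spec β (k * B + u * b) β≤1 (≤-<-trans (m≤m+n _ i) r<))))))) E≡ , pos≡ })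

-- Queries

module SizeExp (eE : Exp) where

  ℓE bE FE BE : Exp
  ℓE = lit 8 ⊗ eE
  bE = ℓE ⊗ eE
  FE = wE ⊘ (lit 2 ⊗ ℓE)
  BE = bE ⊗ FE

module QueryExp (eE pE βE : Exp) where

  open SizeExp eE public

  tabE : Exp → ℕ → Exp
  tabE row f = load aux (load auxStart pE ⊕ lit 16 ⊗ row ⊕ (lit f ⊕ lit 8 ⊗ βE))

  blockE : Exp → Exp
  blockE q = (bin shr (load bits (g ⊘ wE)) (g ⊛ wE) ⊕ powE (load bits (g ⊘ wE ⊕ lit 1)) (wE ⊖ g ⊛ wE)) ⊛ 2^E bE
    where g = load start pE ⊕ q

  digitsE : Exp → Exp
  digitsE q = bin and (ifE βE (blockE q) (2^E bE ⊖ lit 1 ⊖ blockE q) ⊗ onesE bE bE) (onesE (bE ⊕ lit 1) bE)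

  -- Position `q` itself is counted. The rank at `i` is asked as the inclusive rank at `i - 1`,
  -- because position `m` may begin a superblock that has no entry.
  inclusiveE : Exp → Exp
  inclusiveE q = tabE (q ⊘ BE ⊕ lit 1) 0
    ⊕ prefixE ℓE (tabE (q ⊘ BE ⊕ lit 1) 1) (q ⊛ BE ⊘ bE)
    ⊕ prefixE (bE ⊕ lit 1) (digitsE (q ⊖ q ⊛ BE ⊛ bE)) (q ⊛ BE ⊛ bE ⊕ lit 1)

  searchE : Exp → Exp → Exp
  searchE j s = q₀ ⊕ countE (bE ⊕ lit 1) bE (digitsE q₀) (j₁ ⊖ prefixE ℓE D blk)
    where
    D   = tabE (s ⊕ lit 1) 1
    j₁  = j ⊖ tabE (s ⊕ lit 1) 0
    blk = countE ℓE FE D j₁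
    q₀  = s ⊗ BE ⊕ blk ⊗ bE

  rankEndE : Exp → Exp
  rankEndE s = tabE (s ⊕ lit 1) 0 ⊕ prefixE ℓE (tabE (s ⊕ lit 1) 1) FE

  -- Here `j` counts from 0. In a group without flag, the directory gives only the superblock `s`
  -- where the subgroup of `j` begins. So `s` and `s + 1` are tried in turn, by comparing `j` with
  -- the ranks at their ends; if `j` lies beyond both, its subgroup has stored offsets.
  selectionE : Exp → Exp
  selectionE j = ifE (tabE (k ⊕ lit 1) 3) (tabE (G ⊕ y ⊕ lit 2) 5)
      (ifE (ltE j (rankEndE s)) (searchE j s)
        (ifE (ltE j (rankEndE (s ⊕ lit 1))) (searchE j (s ⊕ lit 1))
          (s ⊗ BE ⊕ fieldE ℓE (tabE (s ⊕ lit 2) 6) (y ⊛ bE))))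
    where
    k = j ⊘ BE
    y = j ⊛ BE
    G = tabE (k ⊕ lit 1) 2
    s = G ⊕ fieldE ℓE (tabE (k ⊕ lit 1) 4) (y ⊘ bE)

nodeE betaE indexE headerE : Exp
nodeE   = load arg (lit 0)
betaE   = load arg (lit 1)
indexE  = load arg (lit 2)
headerE = load aux (load auxStart nodeE ⊕ lit 7)

rankE selectE : Exp
rankE   = ifE (ltE (lit 0) indexE) (QueryExp.inclusiveE headerE nodeE betaE (indexE ⊖ lit 1)) (lit 0)
selectE = QueryExp.selectionE headerE nodeE betaE (indexE ⊖ lit 1)

module QueryProof (w e θ : ℕ) (sz : Geometry.Sizes w e θ) where

  open Geometry w e
  open Sizes sz
  open QueryExp headerE nodeE betaE

  private
    module E = Eval w θ 64θ≤w 10≤θ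

  0<ℓ : 0 < ℓ
  0<ℓ = ≤-trans 0<e (m≤n*m e 8)

  0<b : 0 < b
  0<b = *-mono-≤ 0<ℓ 0<e

  0<B : 0 < B
  0<B = *-mono-≤ 0<b 0<F

  ℓ≡ : suc (ℓ ∸ 1) ≡ ℓ
  ℓ≡ = m+[n∸m]≡n 0<ℓ

  ℓ<w : ℓ < w
  ℓ<w = ≤-<-trans (m≤m+n ℓ (ℓ * F)) counters

  ℓF<w : ℓ * F < w
  ℓF<w = ≤-<-trans (m≤n+m (ℓ * F) ℓ) counters

  b<w : b < w
  b<w = <-trans (n<1+n b) (≤-<-trans (m≤m*n (suc b) (suc b)) block)

  sb<w : suc b < w
  sb<w = ≤-<-trans (m≤m*n (suc b) (suc b)) block

  sbb<w : suc b * b < w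
  sbb<w = ≤-<-trans (*-monoʳ-≤ (suc b) (n≤1+n b)) block

  bb<w : b * b < w
  bb<w = ≤-<-trans (*-monoˡ-≤ b (n≤1+n b)) sbb<w

  b<2^b-1 : b < 2 ^ suc b ∸ 1
  b<2^b-1 = ≤-trans (n<2^n b) (≤-trans (≤-reflexive (sym (m+n∸n≡m (2 ^ b) 1)))
    (∸-monoˡ-≤ 1 (+-monoʳ-≤ (2 ^ b) (≤-trans (0<2^ b) (≤-reflexive (sym (+-identityʳ _)))))))

  B<ℓ : B < 2 ^ ℓ ∸ 1
  B<ℓ = ≤-trans B< (≤-trans (≤-reflexive (sym (m+n∸n≡m (2 ^ (ℓ ∸ 1)) 1)))
    (≤-trans (∸-monoˡ-≤ 1 (+-monoʳ-≤ (2 ^ (ℓ ∸ 1)) (≤-trans (0<2^ (ℓ ∸ 1)) (≤-reflexive (sym (+-identityʳ _))))))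
      (≤-reflexive (cong (λ k → 2 ^ k ∸ 1) ℓ≡))))

  module _ {m : ℕ} {bf : ℕ → ℕ} {Q : ℕ → ℕ → ℕ} {M : Mem} {A₀ st : ℕ} (bf<2 : ∀ q → q < m → bf q < 2)
    (tbl : Table m bf Q M A₀ st) (Wd : Words w M) (w-stored : M params 2 ≡ w)
    {p β : ℕ} (p< : p < 2 ^ (2 * θ)) (p-stored : M arg 0 ≡ p) (β≤1 : β ≤ 1) (β-stored : M arg 1 ≡ β)
    (A₀< : A₀ < 2 ^ (8 * θ)) (A₀-stored : M auxStart p ≡ A₀) (st< : st < 2 ^ (2 * θ)) (st-stored : M start p ≡ st)
    (m< : m < 2 ^ (1 * θ)) where

    open Table tbl
    open E M Wd 0

    private
      I : ℕ → ℕ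
      I = ind m bf β

      rank′ : ℕ → ℕ
      rank′ = rk m bf β

      I≤1 : ∀ q → I q ≤ 1
      I≤1 q = *-mono-≤ (𝟙≤1 (q <ᵇ m)) (𝟙≤1 (bf q ≡ᵇ β))

      I-in : ∀ {q} → q < m → I q ≡ 𝟙≡ (bf q) β
      I-in {q} q<m = trans (cong (_* 𝟙≡ (bf q) β) (𝟙<-true q<m)) (*-identityˡ _)

      I-out : ∀ {q} → m ≤ q → I q ≡ 0
      I-out {q} m≤q = cong (_* 𝟙≡ (bf q) β) (𝟙<-false m≤q)

      rank≤m : ∀ q → rank′ q ≤ m
      rank≤m q with q ≤? m
      ... | yes q≤m = ≤-trans (Σ-≤ q (λ i _ → I≤1 i)) (≤-trans (≤-reflexive (trans (Σ-const q 1) (*-identityʳ q))) q≤m)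
      ... | no q≰m = ≤-trans (≤-reflexive (Σ-extend I (≰⇒≥ q≰m) (λ i m≤i _ → I-out m≤i)))
              (≤-trans (Σ-≤ m (λ i _ → I≤1 i)) (≤-reflexive (trans (Σ-const m 1) (*-identityʳ m))))

      β<2^ : β < 2 ^ (1 * θ)
      β<2^ = ≤-<-trans β≤1 (≤-<-trans (≤-trans (s≤s z≤n) 10≤θ) (subst (λ t → θ < 2 ^ t) (sym (*-identityˡ θ)) (n<2^n θ)))

    pV : nodeE ⇓⟨ 2 ⟩ p
    pV = loadˢ 2 (litˢ 0) p-stored p<

    βV : betaE ⇓⟨ 1 ⟩ β
    βV = loadˢ 1 (litˢ 1) β-stored β<2^

    wV : wE ⇓⟨ 1 ⟩ w
    wV = loadˢ 1 (litˢ 2) w-stored (subst (λ t → w < 2 ^ t) (sym (*-identityˡ θ)) w<2^θ)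

    baseV : load auxStart nodeE ⇓⟨ 8 ⟩ A₀
    baseV = loadˢ 8 pV A₀-stored A₀<

    eV : headerE ⇓⟨ 1 ⟩ e
    eV = loadˢ 1 (baseV +ˢ litˢ 7) e-stored (subst (λ t → e < 2 ^ t) (sym (*-identityˡ θ)) e<2^θ)

    ℓV : ℓE ⇓⟨ 2 ⟩ ℓ
    ℓV = litˢ 8 *ˢ eV

    bV : bE ⇓⟨ 3 ⟩ b
    bV = ℓV *ˢ eV

    FV : FE ⇓⟨ 1 ⟩ F
    FV = wV /ˢ (litˢ 2 *ˢ ℓV)

    BV : BE ⇓⟨ 4 ⟩ B
    BV = bV *ˢ FV

    sbV : bE ⊕ lit 1 ⇓ suc b
    sbV = cast (+-comm b 1) (↓ (bV +ˢ litˢ 1))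

    tabV : ∀ {rowE row} f {_ : T (f <ᵇ 1024)} {y} → rowE ⇓⟨ 10 ⟩ row → tab β row f ≡ y → tabE rowE f ⇓ y
    tabV f {ok} row y≡ = load⇓ (↓ (baseV +ˢ litˢ 16 *ˢ row +ˢ (litˢ f {ok} +ˢ litˢ 8 *ˢ βV))) y≡

    blockV : ∀ {qE q} → qE ⇓⟨ 10 ⟩ q → ∃[ x ] blockE qE ⇓ x × x < 2 ^ b × (∀ r → r < b → bit r x ≡ bitAt w M bits (st + q + r))
    blockV {qE} {q} qV = x , cast x≡ xV , mod< x₀ (0<2^ b) , λ r r<b → block-bits 0<w Wd bits (st + q) r<b (<⇒≤ b<w)
      where
      g = st + q
      x₀ = M bits (g div w) div 2 ^ (g mod w) + M bits (suc (g div w)) * 2 ^ (w ∸ g mod w)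
      x = x₀ mod 2 ^ b
      gV : load start nodeE ⊕ qE ⇓⟨ 11 ⟩ g
      gV = loadˢ 2 pV st-stored st< +ˢ qV
      xV = rem⇓ (addʷ (shr⇓ (load⇓ (↓ (gV /ˢ wV)) refl) (↓ (gV %ˢ wV)))
                      (shlʷ (load⇓ (↓ (gV /ˢ wV +ˢ litˢ 1)) (cong (M bits) (+-comm (g div w) 1))) (↓ (wV -ˢ gV %ˢ wV))))
                (2^⇓ (↓ bV) b<w)
      W≡ : 2 ^ w ≡ 2 ^ (w ∸ b) * 2 ^ b
      W≡ = trans (cong (2 ^_) (sym (m∸n+n≡m (<⇒≤ b<w)))) (2^-+ (w ∸ b) b)
      -- The machine reduces the shifted word and the sum modulo `2 ^ w`, which is a multiple of
      -- `2 ^ b`, so the low `b` bits come out right.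
      x≡ : (M bits (g div w) div 2 ^ (g mod w) + (M bits (suc (g div w)) * 2 ^ (w ∸ g mod w)) mod 2 ^ w) mod 2 ^ w mod 2 ^ b ≡ x
      x≡ = trans (cong (_mod 2 ^ b) (mod-+ʳ (M bits (g div w) div 2 ^ (g mod w)) _ (2 ^ w)))
        (trans (cong (λ t → (x₀ mod t) mod 2 ^ b) W≡) (mod-*-mod x₀ (2 ^ b) (2 ^ (w ∸ b))))

    -- The b digits z i of the block at q: those at positions below m are the indicators.
    digitsV : ∀ {qE q} → qE ⇓⟨ 10 ⟩ q → ∃[ z ] digitsE qE ⇓ pack (suc b) b z × (∀ i → z i ≤ 1) × (∀ i → i < b → q + i < m → z i ≡ I (q + i))
    digitsV {qE} {q} qV = go (blockV qV)
      where
      masked : ∀ {x} → ifE betaE (blockE qE) (2^E bE ⊖ lit 1 ⊖ blockE qE) ⇓ x → x < 2 ^ b → digitsE qE ⇓ pack (suc b) b (λ r → bit r x)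
      masked {x} xV x< = cast (spread b w 0<b (<⇒≤ sbb<w) x<)
        (and⇓ (mul⇓ xV (ones⇓ (↓ bV) (↓ bV) 0<b bb<w b<w) copies<) (ones⇓ sbV (↓ bV) z<s sbb<w sb<w)
          (subst (_< 2 ^ w) (sym (spread b w 0<b (<⇒≤ sbb<w) x<))
            (<-≤-trans (pack< (suc b) b (λ r _ → <-≤-trans (bit<2 r x) (2^-mono {1} {suc b} (s≤s z≤n)))) (2^-mono (<⇒≤ sbb<w)))))
        where
        copies< : x * ones b b < 2 ^ w
        copies< = <-≤-trans (*-mono-< x< (pack< b b (λ _ _ → ≤-<-trans 0<b (n<2^n b))))
          (≤-trans (≤-reflexive (sym (2^-+ b (b * b)))) (2^-mono (<⇒≤ sbb<w)))
      go : (∃[ x ] blockE qE ⇓ x × x < 2 ^ b × (∀ r → r < b → bit r x ≡ bitAt w M bits (st + q + r))) →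
        ∃[ z ] digitsE qE ⇓ pack (suc b) b z × (∀ i → z i ≤ 1) × (∀ i → i < b → q + i < m → z i ≡ I (q + i))
      go (x , xV , x< , x-bits) with n≤1⇒n≡0∨n≡1 β≤1
      ... | inj₁ β≡0 = (λ r → bit r (2 ^ b ∸ 1 ∸ x)) , masked (if-false (cast β≡0 (↓ βV)) (sub⇓ (2^-1⇓ (↓ bV) b<w) xV))
              (≤-<-trans (m∸n≤m (2 ^ b ∸ 1) x) (≤-reflexive (m+[n∸m]≡n (0<2^ b)))) , (λ i → s≤s⁻¹ (bit<2 i _)) , λ i i<b q+i< →
          trans (complement-bit x< i<b) (trans (cong (1 ∸_) (stored i<b q+i<)) (trans (flip-indicator (bf<2 (q + i) q+i<))
            (trans (cong (𝟙≡ (bf (q + i))) (sym β≡0)) (sym (I-in q+i<)))))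
        where
        stored : ∀ {i} → i < b → q + i < m → bit i x ≡ bf (q + i)
        stored {i} i<b q+i< = trans (x-bits i i<b) (trans (cong (bitAt w M bits) (+-assoc st q i)) (bits-stored (q + i) q+i<))
      ... | inj₂ β≡1 = (λ r → bit r x) , masked (if-true (cast β≡1 (↓ βV)) xV) x< , (λ i → s≤s⁻¹ (bit<2 i _)) , λ i i<b q+i< →
          trans (x-bits i i<b) (trans (cong (bitAt w M bits) (+-assoc st q i)) (trans (bits-stored (q + i) q+i<)
            (trans (same-indicator (bf<2 (q + i) q+i<)) (trans (cong (𝟙≡ (bf (q + i))) (sym β≡1)) (sym (I-in q+i<))))))

    private
      R-at : ∀ s → s * B < m → tab β (s + 1) 0 ≡ rank′ (s * B)
      R-at s = R-stored β s β≤1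

      N : ℕ → ℕ → ℕ
      N s r = counts m bf β s r

      N≤ : ∀ s r → N s r ≤ b
      N≤ s r = ≤-trans (Σ-≤ b (λ i _ → I≤1 (s * B + (r * b + i)))) (≤-reflexive (trans (Σ-const b 1) (*-identityʳ b)))

      b≤B : b ≤ B
      b≤B = m≤m*n b F {{>-nonZero 0<F}}

      N< : ∀ s r → r < F → N s r < 2 ^ ℓ
      N< s r _ = ≤-<-trans (≤-trans (N≤ s r) b≤B) (<-≤-trans B<ℓ (m∸n≤m (2 ^ ℓ) 1))

      ΣN : ∀ s r → rank′ (s * B) + Σ< r (N s) ≡ rank′ (s * B + r * b)
      ΣN s r = trans (cong (rank′ (s * B) +_) (sym (Σ-blocks r b (λ i → I (s * B + i))))) (sym (Σ-split (s * B) (r * b) I))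

      ΣN≤ : ∀ s r → r ≤ F → Σ< r (N s) ≤ B
      ΣN≤ s r r≤F = ≤-trans (Σ-≤ r (λ i _ → N≤ s i)) (≤-trans (≤-reflexive (Σ-const r b)) (≤-trans (*-monoˡ-≤ b r≤F) (≤-reflexive (*-comm F b))))

    inclusive⇓ : ∀ {qE q} → qE ⇓⟨ 2 ⟩ q → q < m → inclusiveE qE ⇓ rank′ (suc q)
    inclusive⇓ {qE} {q} qV q<m = go (digitsV (weaken 10 (≤ᵇ⇒≤ 2 10 _) (qV -ˢ qV %ˢ BV %ˢ bV)))
      where
      s = q div B
      y = q mod B
      r = y div b
      o = y mod b
      q₀ = q ∸ o
      o<b = mod< y 0<b
      r<F : r < F
      r<F = div< (subst (y <_) (*-comm b F) (mod< q 0<B))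
      sB≤q = div*≤ q B
      sB<m = ≤-<-trans sB≤q q<m
      q₀≡ : q₀ ≡ s * B + r * b
      q₀≡ = ∸-swap {y = o} (trans (divmod q B) (trans (cong (_+ s * B) (divmod y b)) (lemma o (r * b) (s * B))))
        where
        lemma : ∀ a b c → a + b + c ≡ a + (c + b)
        lemma = solve-∀
      q₀+o : q₀ + o ≡ q
      q₀+o = m∸n+n≡m (≤-trans (mod≤ y b) (mod≤ q B))
      suc-q : s * B + r * b + suc o ≡ suc q
      suc-q = trans (cong (_+ suc o) (sym q₀≡)) (trans (+-suc q₀ o) (cong suc q₀+o))
      rowV : qE ⊘ BE ⊕ lit 1 ⇓⟨ 10 ⟩ s + 1
      rowV = weaken 10 (≤ᵇ⇒≤ 3 10 _) (qV /ˢ BV +ˢ litˢ 1)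
      small : ∀ q → rank′ q < 2 ^ w
      small q = small-word {1} (s≤s z≤n) (≤-<-trans (rank≤m q) m<)
      go : (∃[ z ] digitsE (qE ⊖ qE ⊛ BE ⊛ bE) ⇓ pack (suc b) b z × (∀ i → z i ≤ 1) × (∀ i → i < b → q₀ + i < m → z i ≡ I (q₀ + i))) →
        inclusiveE qE ⇓ rank′ (suc q)
      go (z , zV , z≤1 , z≡) = cast total
        (add⇓ (add⇓ (tabV 0 rowV (R-at s sB<m)) inner (subst (_< 2 ^ w) (sym (ΣN s r)) (small (s * B + r * b))))
              outer (subst (_< 2 ^ w) (sym total) (small (suc q))))
        where
        inner : prefixE ℓE (tabE (qE ⊘ BE ⊕ lit 1) 1) (qE ⊛ BE ⊘ bE) ⇓ Σ< r (N s)
        inner = prefix⇓ (↓ ℓV) (tabV 1 rowV (D-stored β s β≤1 sB<m)) (↓ (qV %ˢ BV /ˢ bV)) (N< s) (<⇒≤ r<F) ℓF<w ℓ<w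
          (≤-<-trans (ΣN≤ s r (<⇒≤ r<F)) B<ℓ)
        outer : prefixE (bE ⊕ lit 1) (digitsE (qE ⊖ qE ⊛ BE ⊛ bE)) (qE ⊛ BE ⊛ bE ⊕ lit 1) ⇓ Σ< (suc o) z
        outer = prefix⇓ sbV zV (cast (+-comm o 1) (↓ (qV %ˢ BV %ˢ bV +ˢ litˢ 1)))
          (λ k _ → ≤-<-trans (z≤1 k) (n<2^n′ k)) o<b sbb<w sb<w
          (≤-<-trans (≤-trans (Σ-≤ (suc o) (λ i _ → z≤1 i)) (≤-trans (≤-reflexive (trans (Σ-const (suc o) 1) (*-identityʳ (suc o)))) o<b)) b<2^b-1)
          where
          n<2^n′ : ∀ k → 1 < 2 ^ suc b
          n<2^n′ _ = 2^-mono {1} {suc b} (s≤s z≤n)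
        total : rank′ (s * B) + Σ< r (N s) + Σ< (suc o) z ≡ rank′ (suc q)
        total = trans (cong₂ _+_ (ΣN s r) (trans (Σ-cong (suc o) λ i i≤o →
              trans (z≡ i (≤-<-trans (s≤s⁻¹ i≤o) o<b) (≤-<-trans (≤-trans (+-monoʳ-≤ q₀ (s≤s⁻¹ i≤o)) (≤-reflexive q₀+o)) q<m))
                (cong (λ t → I (t + i)) q₀≡)) refl))
          (trans (sym (Σ-split (s * B + r * b) (suc o) I)) (cong rank′ suc-q))

    search⇓ : ∀ {jE j sE s} → jE ⇓⟨ 2 ⟩ j → sE ⇓⟨ 4 ⟩ s → s * B < m → rank′ (s * B) ≤ j → j < rank′ (suc s * B) →
      ∃[ q ] searchE jE sE ⇓ q × q < m × rank′ q ≤ j × j < rank′ (suc q)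
    search⇓ {jE} {j} {sE} {s} jV sV sB<m lo hi = go (digitsV q₀V)
      where
      rowV : sE ⊕ lit 1 ⇓⟨ 10 ⟩ s + 1
      rowV = weaken 10 (≤ᵇ⇒≤ 5 10 _) (sV +ˢ litˢ 1)
      R = rank′ (s * B)
      j₁ = j ∸ R
      R+j₁ : R + j₁ ≡ j
      R+j₁ = m+[n∸m]≡n lo
      whole : rank′ (s * B + F * b) ≡ rank′ (suc s * B)
      whole = cong rank′ (trans (cong (s * B +_) (*-comm F b)) (+-comm (s * B) B))
      j₁< : j₁ < Σ< F (N s)
      j₁< = +-cancelˡ-< R j₁ _ (subst₂ _<_ (sym R+j₁) (trans (sym whole) (sym (ΣN s F))) hi)
      dV = tabV 1 rowV (D-stored β s β≤1 sB<m)
      j₁V = sub⇓ (↓ jV) (tabV 0 rowV (R-at s sB<m))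
      blk = count≤ (N s) j₁ F
      spec = count≤-spec (N s) j₁ F j₁<
      blk<F = proj₁ spec
      N<g : Σ< F (N s) < 2 ^ (ℓ ∸ 1)
      N<g = ≤-<-trans (ΣN≤ s F ≤-refl) B<
      j₁<g = <-trans j₁< N<g
      blkV = count⇓ {g = ℓ ∸ 1} {N = F} {v = N s} {j = j₁} (cast (sym ℓ≡) (↓ ℓV)) (↓ FV)
        (cast (cong (λ k → pack k F (N s)) (sym ℓ≡)) dV) j₁V
        (subst (λ k → k + k * F < w) (sym ℓ≡) counters) (subst (λ k → F < 2 ^ k ∸ 1) (sym ℓ≡) F<) N<g j₁<g
      before = Σ< blk (N s)
      beforeV = prefix⇓ (↓ ℓV) dV blkV (N< s) (<⇒≤ blk<F) ℓF<w ℓ<w (≤-<-trans (ΣN≤ s blk (<⇒≤ blk<F)) B<ℓ)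
      j₂ = j₁ ∸ before
      before+j₂ : before + j₂ ≡ j₁
      before+j₂ = m+[n∸m]≡n (proj₁ (proj₂ spec))
      q₀ = s * B + blk * b
      q₀V : sE ⊗ BE ⊕ countE ℓE FE (tabE (sE ⊕ lit 1) 1) (jE ⊖ tabE (sE ⊕ lit 1) 0) ⊗ bE ⇓⟨ 10 ⟩ q₀
      q₀V = weaken 10 (≤ᵇ⇒≤ 9 10 _) (sV *ˢ BV +ˢ _within_ {s = 1} blkV blk< *ˢ bV)
        where
        blk< : blk < 2 ^ (1 * θ)
        blk< = <-trans blk<F (bound FV)
      j₂< : j₂ < Σ< b (λ i → I (q₀ + i))
      j₂< = +-cancelˡ-< before j₂ _ (subst₂ _<_ (sym before+j₂)
        (cong (before +_) (Σ-cong b (λ i _ → cong I (sym (+-assoc (s * B) (blk * b) i))))) (proj₂ (proj₂ spec)))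
      rank-q₀ : rank′ q₀ + j₂ ≡ j
      rank-q₀ = trans (cong (_+ j₂) (sym (ΣN s blk))) (trans (+-assoc R before j₂) (trans (cong (R +_) before+j₂) R+j₁))
      go : (∃[ z ] digitsE (sE ⊗ BE ⊕ countE ℓE FE (tabE (sE ⊕ lit 1) 1) (jE ⊖ tabE (sE ⊕ lit 1) 0) ⊗ bE) ⇓ pack (suc b) b z × (∀ i → z i ≤ 1) × (∀ i → i < b → q₀ + i < m → z i ≡ I (q₀ + i))) →
        ∃[ q ] searchE jE sE ⇓ q × q < m × rank′ q ≤ j × j < rank′ (suc q)
      go (z , zV , z≤1 , z≡) = q₀ + o , posV , inside ,
          subst (_≤ j) (sym (Σ-split q₀ o I)) (subst (rank′ q₀ + Σ< o (λ i → I (q₀ + i)) ≤_) rank-q₀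
            (+-monoʳ-≤ (rank′ q₀) (subst (_≤ j₂) (Σ-cong o (λ i i<o → agree i (<-trans i<o o<b) (<⇒≤ i<o))) (proj₁ (proj₂ spec′))))) ,
          subst (j <_) (trans (sym (Σ-split q₀ (suc o) I)) (cong rank′ (+-suc q₀ o))) (subst (_< rank′ q₀ + Σ< (suc o) (λ i → I (q₀ + i))) rank-q₀
            (+-monoʳ-< (rank′ q₀) (subst (j₂ <_) (Σ-cong (suc o) (λ i i≤o → agree i (≤-<-trans (s≤s⁻¹ i≤o) o<b) (s≤s⁻¹ i≤o))) (proj₂ (proj₂ spec′)))))
        where
        -- Digits past the end of the bitmap are stray bits that follow it in memory and may exceed
        -- the indicators, which are 0 there; only an inequality holds at this point.
        I≤z : ∀ i → i < b → I (q₀ + i) ≤ z i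
        I≤z i i<b with q₀ + i <? m
        ... | yes lts = ≤-reflexive (sym (z≡ i i<b lts))
        ... | no ¬lt = subst (_≤ z i) (sym (I-out (≮⇒≥ ¬lt))) z≤n
        j₂<z : j₂ < Σ< b z
        j₂<z = <-≤-trans j₂< (Σ-≤ b I≤z)
        o = count≤ z j₂ b
        spec′ = count≤-spec z j₂ b j₂<z
        o<b = proj₁ spec′
        -- If q₀ + o were not inside, the o digits before it would contain every
        -- occurrence in the block, more than j₂ of them.
        inside : q₀ + o < m
        inside = ≰⇒> λ m≤ → <⇒≱ j₂< (≤-trans (≤-reflexive (Σ-extend (λ i → I (q₀ + i)) (<⇒≤ o<b) (λ i o≤i _ → I-out (≤-trans m≤ (+-monoʳ-≤ q₀ o≤i)))))
          (≤-trans (Σ-≤ o (λ i i<o → I≤z i (<-trans i<o o<b))) (proj₁ (proj₂ spec′))))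
        agree : ∀ i → i < b → i ≤ o → z i ≡ I (q₀ + i)
        agree i i<b i≤o = z≡ i i<b (≤-<-trans (+-monoʳ-≤ q₀ i≤o) inside)
        z≤b : Σ< b z ≤ b
        z≤b = ≤-trans (Σ-≤ b (λ i _ → z≤1 i)) (≤-reflexive (trans (Σ-const b 1) (*-identityʳ b)))
        oV = count⇓ {g = b} {N = b} {v = z} {j = j₂} sbV (↓ bV) zV (sub⇓ j₁V beforeV)
          (subst (_< w) (lemma b) block) b<2^b-1 (≤-<-trans z≤b (n<2^n b)) (<-≤-trans j₂<z (≤-trans z≤b (<⇒≤ (n<2^n b))))
          where
          lemma : ∀ b → suc b * suc b ≡ suc b + suc b * b
          lemma = solve-∀
        posV : searchE jE sE ⇓ q₀ + o
        posV = add⇓ (↓ q₀V) oV (small-word {1} (s≤s z≤n) (<-trans inside m<))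

    rank-correct : ∀ {i} → M arg 2 ≡ i → i ≤ m → eval w M 0 rankE ≡ rank′ i
    rank-correct {zero} i≡ _ = value (if-false {x = inclusiveE (indexE ⊖ lit 1)} (lt⇓ zero⇓ (load⇓ (↓ litˢ 2) i≡)) zero⇓)
    rank-correct {suc q} i≡ q<m = value (if-true {y = lit 0} (lt⇓ zero⇓ (load⇓ (↓ litˢ 2) i≡)) (inclusive⇓ (loadˢ 2 (litˢ 2) i≡ i< -ˢ litˢ 1) q<m))
      where
      i< : suc q < 2 ^ (2 * θ)
      i< = ≤-<-trans q<m (<-≤-trans m< (2^-mono (*-monoˡ-≤ θ (s≤s (z≤n {1})))))

    rankEnd⇓ : ∀ {sE s} → sE ⇓⟨ 4 ⟩ s → s * B < m → rankEndE sE ⇓ rank′ (suc s * B)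
    rankEnd⇓ {sE} {s} sV sB<m = cast end≡ (add⇓ (tabV 0 rowV (R-at s sB<m))
        (prefix⇓ (↓ ℓV) (tabV 1 rowV (D-stored β s β≤1 sB<m)) (↓ FV) (N< s) ≤-refl ℓF<w ℓ<w (≤-<-trans (ΣN≤ s F ≤-refl) B<ℓ))
        (subst (_< 2 ^ w) (sym end≡) (small-word {1} (s≤s z≤n) (≤-<-trans (rank≤m (suc s * B)) m<))))
      where
      rowV : sE ⊕ lit 1 ⇓⟨ 10 ⟩ s + 1
      rowV = weaken 10 (≤ᵇ⇒≤ 5 10 _) (sV +ˢ litˢ 1)
      end≡ : rank′ (s * B) + Σ< F (N s) ≡ rank′ (suc s * B)
      end≡ = trans (ΣN s F) (cong rank′ (trans (cong (s * B +_) (*-comm F b)) (+-comm (s * B) B)))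

    private
      Found : Exp → ℕ → Set
      Found qE j = ∃[ q ] qE ⇓ q × q < m × rank′ q ≤ j × j < rank′ (suc q)

      rank-beyond : ∀ {q} → m ≤ q → rank′ q ≡ rank′ m
      rank-beyond m≤q = Σ-extend I m≤q (λ i m≤i _ → I-out m≤i)

      at-Q : ∀ {qE j r} → r ≡ j → j < rank′ m → qE ⇓ Q β r → Found qE j
      at-Q {j = j} refl j< qV = Q β j , qV , proj₁ spec , ≤-reflexive (proj₂ (proj₂ spec)) ,
          ≤-reflexive (trans (+-comm 1 j) (sym (cong₂ _+_ (proj₂ (proj₂ spec)) (proj₁ (proj₂ spec)))))
        where spec = Q-spec β j β≤1 j<

      through : ∀ {e₁ e₂ j} → (∀ {q} → e₁ ⇓ q → e₂ ⇓ q) → Found e₁ j → Found e₂ j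
      through f (q , qV , rest) = q , f qV , rest

    by-group : ∀ {jE j} → jE ⇓⟨ 2 ⟩ j → j < rank′ m → GroupStored m bf Q (tab β) β (j div B) → Found (selectionE jE) j
    by-group {jE} {j} jV j< (inj₁ (flag , _ , e1)) = at-Q j≡ j< (if-true (tabV 3 kV flag) (tabV 5 (weaken 10 (≤ᵇ⇒≤ 4 10 _) (GV +ˢ jV %ˢ BV +ˢ litˢ 2)) (e1 (j mod B) (mod< j 0<B) (subst (_< rank′ m) (sym j≡) j<))))
      where
      k = j div B
      j≡ : k * B + j mod B ≡ j
      j≡ = trans (+-comm (k * B) (j mod B)) (sym (divmod j B))
      kV : jE ⊘ BE ⊕ lit 1 ⇓⟨ 10 ⟩ k + 1
      kV = weaken 10 (≤ᵇ⇒≤ 3 10 _) (jV /ˢ BV +ˢ litˢ 1)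
      kB< = ≤-<-trans (div*≤ j B) j<
      GV : tabE (jE ⊘ BE ⊕ lit 1) 2 ⇓⟨ 1 ⟩ Q β (k * B) div B
      GV = tabV 2 kV (G-stored β k β≤1 kB<) within ≤-<-trans (div≤ (Q β (k * B)) B) (<-trans (proj₁ (Q-spec β (k * B) β≤1 kB<)) m<)
    by-group {jE} {j} jV j< (inj₂ (flag , (v , v< , P≡ , v≡) , e2)) = through (if-false (tabV 3 kV flag)) inner
      where
      k = j div B
      y = j mod B
      u = y div b
      i = y mod b
      G = Q β (k * B) div B
      r = k * B + u * b
      r+i : r + i ≡ j
      r+i = trans (lemma (k * B) (u * b) i) (trans (cong (λ t → t + k * B) (sym (divmod y b))) (sym (divmod j B)))
        where
        lemma : ∀ a b c → a + b + c ≡ c + b + a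
        lemma = solve-∀
      r≤j : r ≤ j
      r≤j = subst (r ≤_) r+i (m≤m+n r i)
      r< = ≤-<-trans r≤j j<
      u<F : u < F
      u<F = div< (subst (y <_) (*-comm b F) (mod< j 0<B))
      s = Q β r div B
      spec = Q-spec β r β≤1 r<
      kV : jE ⊘ BE ⊕ lit 1 ⇓⟨ 10 ⟩ k + 1
      kV = weaken 10 (≤ᵇ⇒≤ 3 10 _) (jV /ˢ BV +ˢ litˢ 1)
      kB< = ≤-<-trans (div*≤ j B) j<
      GV : tabE (jE ⊘ BE ⊕ lit 1) 2 ⇓ G
      GV = tabV 2 kV (G-stored β k β≤1 kB<)
      sE = tabE (jE ⊘ BE ⊕ lit 1) 2 ⊕ fieldE ℓE (tabE (jE ⊘ BE ⊕ lit 1) 4) (jE ⊛ BE ⊘ bE)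
      s< : s < 2 ^ (1 * θ)
      s< = ≤-<-trans (div≤ (Q β r) B) (<-trans (proj₁ spec) m<)
      sum≡ : G + v u ≡ s
      sum≡ = v≡ u u<F r<
      sV : sE ⇓⟨ 4 ⟩ s
      sV = weaken 4 (≤ᵇ⇒≤ 1 4 _) (cast sum≡ (add⇓ GV (field⇓ (↓ ℓV) (tabV 4 kV P≡) (↓ (jV %ˢ BV /ˢ bV)) v< u<F ℓF<w ℓ<w)
        (small-word {1} (s≤s z≤n) (subst (_< 2 ^ (1 * θ)) (sym sum≡) s<))) within s<)
      rowV : ∀ c {_ : T (c <ᵇ 1024)} → sE ⊕ lit c ⇓⟨ 10 ⟩ s + c
      rowV c {ok} = weaken 10 (≤ᵇ⇒≤ 5 10 _) (sV +ˢ litˢ c {ok})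
      sB≤Q : s * B ≤ Q β r
      sB≤Q = div*≤ (Q β r) B
      sB<m = ≤-<-trans sB≤Q (proj₁ spec)
      lo : rank′ (s * B) ≤ j
      lo = ≤-trans (Σ-mono I sB≤Q) (≤-trans (≤-reflexive (proj₂ (proj₂ spec))) r≤j)
      R₁ = rank′ (suc s * B)
      R₁V : rankEndE sE ⇓ R₁
      R₁V = rankEnd⇓ sV sB<m
      e₃ = sE ⊗ BE ⊕ fieldE ℓE (tabE (sE ⊕ lit 2) 6) (jE ⊛ BE ⊛ bE)
      e₂ = ifE (ltE jE (rankEndE (sE ⊕ lit 1))) (searchE jE (sE ⊕ lit 1)) e₃
      inner : Found (ifE (ltE jE (rankEndE sE)) (searchE jE sE) e₂) j
      inner with j <? R₁
      ... | yes j<R₁ = through (if-true {y = e₂} (cast (𝟙<-true j<R₁) (lt⇓ (↓ jV) R₁V))) (search⇓ jV sV sB<m lo j<R₁)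
      ... | no j≮R₁ = through (if-false {x = searchE jE sE} (cast (𝟙<-false R₁≤j) (lt⇓ (↓ jV) R₁V))) inner₂
        where
        R₁≤j = ≮⇒≥ j≮R₁
        -- If superblock `s + 1` began at or after the end, `R₁` would count all occurrences and `j`
        -- could not be one of them.
        s′B<m : suc s * B < m
        s′B<m = ≰⇒> λ m≤ → <⇒≱ j< (subst (_≤ j) (rank-beyond m≤) R₁≤j)
        R₂ = rank′ (suc (suc s) * B)
        s′V : sE ⊕ lit 1 ⇓⟨ 4 ⟩ suc s
        s′V = cast (+-comm s 1) (↓ (sV +ˢ litˢ 1)) within
          ≤-<-trans (m≤m*n (suc s) B {{>-nonZero 0<B}}) (<-trans s′B<m (<-≤-trans m< (2^-mono (*-monoˡ-≤ θ (s≤s (z≤n {3}))))))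
        R₂V : rankEndE (sE ⊕ lit 1) ⇓ R₂
        R₂V = rankEnd⇓ s′V s′B<m
        inner₂ : Found e₂ j
        inner₂ with j <? R₂
        ... | yes j<R₂ = through (if-true {y = e₃} (cast (𝟙<-true j<R₂) (lt⇓ (↓ jV) R₂V)))
                (search⇓ jV s′V s′B<m R₁≤j j<R₂)
        ... | no j≮R₂ = through (if-false {x = searchE jE (sE ⊕ lit 1)} (cast (𝟙<-false (≮⇒≥ j≮R₂)) (lt⇓ (↓ jV) R₂V))) (spread-out (e2 u i u<F (mod< y 0<b) (subst (_< rank′ m) (sym r+i) j<) far))
          where
          specⱼ = Q-spec β (r + i) β≤1 (subst (_< rank′ m) (sym r+i) j<)
          -- A position in front of superblock `s + 2` would make the rank at its start exceed `j`.
          -- This is exactly the condition under which the offsets have been stored.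
          far : (s + 2) * B ≤ Q β (r + i)
          far = ≮⇒≥ λ near → <⇒≱ (≤-trans (≤-reflexive (trans (cong suc (sym r+i)) (trans (+-comm 1 (r + i)) (sym (cong₂ _+_ (proj₂ (proj₂ specⱼ)) (proj₁ (proj₂ specⱼ)))))))
                   (Σ-mono I (subst (λ t → Q β (r + i) < t * B) (+-comm s 2) near))) (≮⇒≥ j≮R₂)
          spread-out : (∃[ N ] ∃[ v ] N ≤ b × i < N × (∀ i → i < N → v i < 2 ^ ℓ) × tab β (s + 2) 6 ≡ pack ℓ N v × s * B + v i ≡ Q β (r + i)) → Found e₃ j
          spread-out (N , v′ , N≤b , i<N , v′< , E≡ , pos≡) = at-Q r+i j< (cast pos≡
            (add⇓ (↓ (sV *ˢ BV)) (field⇓ (↓ ℓV) (tabV 6 (rowV 2) E≡) (↓ (jV %ˢ BV %ˢ bV)) v′< i<N (≤-<-trans (*-monoʳ-≤ ℓ (≤-trans N≤b b≤F)) ℓF<w) ℓ<w)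
              (small-word {1} (s≤s z≤n) (subst (_< 2 ^ (1 * θ)) (sym pos≡) (<-trans (proj₁ specⱼ) m<)))))

    selection⇓ : ∀ {jE j} → jE ⇓⟨ 2 ⟩ j → j < rank′ m → Found (selectionE jE) j
    selection⇓ {j = j} jV j< = by-group jV j< (group β (j div B) β≤1 (≤-<-trans (div*≤ j B) j<))

    select-correct : ∀ {j} → M arg 2 ≡ suc j → j < rank′ m → ∃[ q ] eval w M 0 selectE ≡ q × q < m × rank′ q ≤ j × j < rank′ (suc q)
    select-correct {j} j≡ j< = finish (selection⇓ (loadˢ 2 (litˢ 2) j≡ small -ˢ litˢ 1) j<)
      where
      finish : Found selectE j → ∃[ q ] eval w M 0 selectE ≡ q × q < m × rank′ q ≤ j × j < rank′ (suc q)
      finish (q , qV , rest) = q , value qV , rest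
      small : suc j < 2 ^ (2 * θ)
      small = ≤-<-trans (≤-trans j< (rank≤m m)) (<-≤-trans m< (2^-mono (*-monoˡ-≤ θ (s≤s (z≤n {1})))))

-- Ranks and occurrences in a list

nth : List ℕ → ℕ → ℕ
nth []       _       = 0
nth (x ∷ xs) zero    = x
nth (x ∷ xs) (suc i) = nth xs i

module Occurrences (f : ℕ → ℕ) (β : ℕ) (has : ∀ x → Dec (f x ≡ β)) where

  indicator : List ℕ → ℕ → ℕ
  indicator xs i = 𝟙< i (length xs) * 𝟙≡ (f (nth xs i)) β

  rank< : List ℕ → ℕ → ℕ
  rank< xs q = Σ< q (indicator xs)

  position : List ℕ → ℕ → ℕ
  position []       r = 0
  position (x ∷ xs) r with has x
  position (x ∷ xs) zero    | yes _ = 0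
  position (x ∷ xs) (suc r) | yes _ = suc (position xs r)
  position (x ∷ xs) r       | no _  = suc (position xs r)

  head-yes : ∀ {x} xs → f x ≡ β → indicator (x ∷ xs) 0 ≡ 1
  head-yes xs refl = trans (*-identityˡ _) (𝟙≡-true β)

  head-no : ∀ {x} xs → f x ≢ β → indicator (x ∷ xs) 0 ≡ 0
  head-no xs fx≢ = trans (*-identityˡ _) (𝟙≡-false fx≢)

  rank-yes : ∀ {x} xs q → f x ≡ β → rank< (x ∷ xs) (suc q) ≡ suc (rank< xs q)
  rank-yes {x} xs q p = trans (Σ-suc q (indicator (x ∷ xs))) (cong (_+ rank< xs q) (head-yes xs p))

  rank-no : ∀ {x} xs q → f x ≢ β → rank< (x ∷ xs) (suc q) ≡ rank< xs q
  rank-no {x} xs q p = trans (Σ-suc q (indicator (x ∷ xs))) (cong (_+ rank< xs q) (head-no xs p))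

  rank-length : ∀ xs → rank< xs (length xs) ≡ length (filter has xs)
  rank-length [] = refl
  rank-length (x ∷ xs) with has x
  ... | yes p = trans (rank-yes xs (length xs) p) (cong suc (rank-length xs))
  ... | no p  = trans (rank-no xs (length xs) p) (rank-length xs)

  position-spec : ∀ xs r → r < length (filter has xs) →
    let q = position xs r in
    q < length xs × indicator xs q ≡ 1 × rank< xs q ≡ r × nth (filter has xs) r ≡ nth xs q
  position-spec (x ∷ xs) r r< with has x
  position-spec (x ∷ xs) zero    r< | yes p = z<s , head-yes xs p , refl , refl
  position-spec (x ∷ xs) (suc r) (s≤s r<) | yes p with position-spec xs r r<
  ... | q< , i≡ , r≡ , n≡ = s≤s q< , i≡ , trans (rank-yes xs (position xs r) p) (cong suc r≡) , n≡
  position-spec (x ∷ xs) r r< | no p with position-spec xs r r<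
  ... | q< , i≡ , r≡ , n≡ = s≤s q< , i≡ , trans (rank-no xs (position xs r) p) r≡ , n≡

  position-rank : ∀ xs q → q < length xs → f (nth xs q) ≡ β →
    rank< xs q < length (filter has xs) × position xs (rank< xs q) ≡ q
  position-rank (x ∷ xs) zero _ p with has x
  ... | yes _  = z<s , refl
  ... | no ¬p = ⊥-elim (¬p p)
  position-rank (x ∷ xs) (suc q) (s≤s q<) p with position-rank xs q q< p
  ... | r< , pos≡ = go (has x)
    where
    position-yes : f x ≡ β → ∀ r → position (x ∷ xs) (suc r) ≡ suc (position xs r)
    position-yes px r with has x
    ... | yes _  = refl
    ... | no ¬px = ⊥-elim (¬px px)
    position-no : f x ≢ β → ∀ r → position (x ∷ xs) r ≡ suc (position xs r)
    position-no ¬px r with has x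
    ... | yes px = ⊥-elim (¬px px)
    ... | no _   = refl
    length-yes : f x ≡ β → length (filter has (x ∷ xs)) ≡ suc (length (filter has xs))
    length-yes px = cong length (filter-accept has px)
    length-no : f x ≢ β → length (filter has (x ∷ xs)) ≡ length (filter has xs)
    length-no ¬px = cong length (filter-reject has ¬px)
    go : Dec (f x ≡ β) → rank< (x ∷ xs) (suc q) < length (filter has (x ∷ xs)) × position (x ∷ xs) (rank< (x ∷ xs) (suc q)) ≡ suc q
    go (yes px) = subst₂ _<_ (sym (rank-yes xs q px)) (sym (length-yes px)) (s≤s r<) ,
      trans (cong (position (x ∷ xs)) (rank-yes xs q px)) (trans (position-yes px _) (cong suc pos≡))
    go (no ¬px) = subst₂ _<_ (sym (rank-no xs q ¬px)) (sym (length-no ¬px)) r< ,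
      trans (cong (position (x ∷ xs)) (rank-no xs q ¬px)) (trans (position-no ¬px _) (cong suc pos≡))

filter-filter : ∀ {P Q R : ℕ → Set} (P? : Decidable P) (Q? : Decidable Q) (R? : Decidable R) →
  (∀ x → P x → Q x → R x) → (∀ x → R x → P x × Q x) → ∀ xs → filter R? xs ≡ filter Q? (filter P? xs)
filter-filter P? Q? R? to from [] = refl
filter-filter P? Q? R? to from (x ∷ xs) with R? x | P? x
... | yes r | no ¬p = ⊥-elim (¬p (proj₁ (from x r)))
... | no ¬r | no ¬p = filter-filter P? Q? R? to from xs
... | yes r | yes p with Q? x
...   | yes _ = cong (x ∷_) (filter-filter P? Q? R? to from xs)
...   | no ¬q = ⊥-elim (¬q (proj₂ (from x r)))
filter-filter P? Q? R? to from (x ∷ xs) | no ¬r | yes p with Q? x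
...   | yes q = ⊥-elim (¬r (to x p q))
...   | no _ = filter-filter P? Q? R? to from xs

length-halves : ∀ (f : ℕ → ℕ) → (∀ x → f x < 2) → ∀ xs →
  length (filter (λ x → f x ≟ 0) xs) + length (filter (λ x → f x ≟ 1) xs) ≡ length xs
length-halves f f<2 [] = refl
length-halves f f<2 (x ∷ xs) with n≤1⇒n≡0∨n≡1 (s≤s⁻¹ (f<2 x))
... | inj₁ fx≡ = trans (cong₂ (λ as bs → length as + length bs)
        (filter-accept (λ x → f x ≟ 0) fx≡) (filter-reject (λ x → f x ≟ 1) (λ p → case trans (sym fx≡) p of λ ())))
      (cong suc (length-halves f f<2 xs))
... | inj₂ fx≡ = trans (cong₂ (λ as bs → length as + length bs)
        (filter-reject (λ x → f x ≟ 0) (λ p → case trans (sym fx≡) p of λ ())) (filter-accept (λ x → f x ≟ 1) fx≡))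
      (trans (+-suc _ _) (cong suc (length-halves f f<2 xs)))

filter-all-≡ : ∀ {P : ℕ → Set} (P? : Decidable P) {xs} → All P xs → filter P? xs ≡ xs
filter-all-≡ P? [] = refl
filter-all-≡ P? {x ∷ xs} (p ∷ ps) with P? x
... | yes _ = cong (x ∷_) (filter-all-≡ P? ps)
... | no ¬p = ⊥-elim (¬p p)

nth-filter : ∀ {P : ℕ → Set} (P? : Decidable P) xs r → r < length (filter P? xs) → P (nth (filter P? xs) r)
nth-filter P? (x ∷ xs) r r< with P? x
nth-filter P? (x ∷ xs) zero    r<       | yes p = p
nth-filter P? (x ∷ xs) (suc r) (s≤s r<) | yes p = nth-filter P? xs r r<
nth-filter P? (x ∷ xs) r       r<       | no _  = nth-filter P? xs r r<

-- Depths in a heap-ordered binary tree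

depth : ℕ → ℕ
depth = ⌊log₂_⌋

depth-2* : ∀ p → 1 ≤ p → depth (2 * p) ≡ suc (depth p)
depth-2* (suc p) _ = ⌊log₂[2*b]⌋≡1+⌊log₂b⌋ (suc p)

⌊1+2n/2⌋ : ∀ n → ⌊ suc (2 * n) /2⌋ ≡ n
⌊1+2n/2⌋ zero    = refl
⌊1+2n/2⌋ (suc n) = trans (cong (λ k → ⌊ suc k /2⌋) (cong suc (+-suc n (n + 0)))) (cong suc (⌊1+2n/2⌋ n))

depth-1+2* : ∀ p → 1 ≤ p → depth (suc (2 * p)) ≡ suc (depth p)
depth-1+2* p 1≤p = trans (sym (m+[n∸m]≡n 1≤depth)) (cong suc
    (trans (sym (⌊log₂⌊n/2⌋⌋≡⌊log₂n⌋∸1 (suc (2 * p)))) (cong ⌊log₂_⌋ (⌊1+2n/2⌋ p))))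
  where
  1≤depth : 1 ≤ depth (suc (2 * p))
  1≤depth = ≤-trans (s≤s z≤n) (≤-trans (≤-reflexive (sym (depth-2* p 1≤p))) (⌊log₂⌋-mono-≤ (n≤1+n (2 * p))))

depth-child : ∀ p β → 1 ≤ p → β ≤ 1 → depth (2 * p + β) ≡ suc (depth p)
depth-child p 0 1≤p _ = trans (cong depth (+-identityʳ (2 * p))) (depth-2* p 1≤p)
depth-child p 1 1≤p _ = trans (cong depth (+-comm (2 * p) 1)) (depth-1+2* p 1≤p)
depth-child p (suc (suc _)) _ (s≤s ())

2^depth≤ : ∀ c → 1 ≤ c → 2 ^ depth c ≤ c
2^depth≤ = <-rec _ go
  where
  go : ∀ c → (∀ {k} → k < c → 1 ≤ k → 2 ^ depth k ≤ k) → 1 ≤ c → 2 ^ depth c ≤ c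
  go 1 _ _ = ≤-refl
  go c@(suc (suc c′)) rec _ = ≤-trans (≤-reflexive (cong (2 ^_) (sym step)))
      (≤-trans (*-monoʳ-≤ 2 (rec half<c 1≤half)) 2half≤)
    where
    half = ⌊ c /2⌋
    half<c : half < c
    half<c = ⌊n/2⌋<n (suc c′)
    1≤half : 1 ≤ half
    1≤half = s≤s z≤n
    step : suc (depth half) ≡ depth c
    step = trans (cong suc (⌊log₂⌊n/2⌋⌋≡⌊log₂n⌋∸1 c)) (m+[n∸m]≡n (≤-trans (≤-reflexive (sym (⌊log₂[2^n]⌋≡n 1))) (⌊log₂⌋-mono-≤ (s≤s (s≤s (z≤n {c′}))))))
    2half≤ : 2 * half ≤ c
    2half≤ = ≤-trans (+-monoʳ-≤ half (≤-trans (≤-reflexive (+-identityʳ half)) (⌊n/2⌋≤⌈n/2⌉ c))) (≤-reflexive (⌊n/2⌋+⌈n/2⌉≡n c))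

depth-< : ∀ {c d} → 1 ≤ c → c < 2 ^ d → depth c < d
depth-< {c} {d} 1≤c c< = ≰⇒> λ d≤ → <⇒≱ c< (≤-trans (2^-mono d≤) (2^depth≤ c 1≤c))

≤depth : ∀ {c d} → 2 ^ d ≤ c → d ≤ depth c
≤depth {c} {d} 2^d≤ = ≤-trans (≤-reflexive (sym (⌊log₂[2^n]⌋≡n d))) (⌊log₂⌋-mono-≤ 2^d≤)

-- The nodes of the tree over a list T of leaf codes: node c holds the codes
-- whose ancestor at the depth of c is c.

module Nodes (Λ : ℕ) (T : List ℕ) (codes : All (λ v → v div 2 ^ Λ ≡ 1) T) where

  n : ℕ
  n = length T

  ancestor : ℕ → ℕ → ℕ
  ancestor d v = v div 2 ^ (Λ ∸ d)

  branchBit : ℕ → ℕ → ℕ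
  branchBit d v = v div 2 ^ (Λ ∸ 1 ∸ d) mod 2

  seq : ℕ → List ℕ
  seq c = filter (λ v → ancestor (depth c) v ≟ c) T

  len′ : ℕ → ℕ
  len′ c = length (seq c)

  -- The segments of nodes 1, 2, 3, … are consecutive.
  off : ℕ → ℕ
  off c = Σ< (c ∸ 1) (λ k → len′ (suc k))

  bf : ℕ → ℕ → ℕ
  bf p q = branchBit (depth p) (nth (seq p) q)

  branchBit<2 : ∀ d v → branchBit d v < 2
  branchBit<2 d v = mod< (v div 2 ^ (Λ ∸ 1 ∸ d)) z<s

  seq-root : seq 1 ≡ T
  seq-root = filter-all-≡ (λ v → ancestor 0 v ≟ 1) codes

  ancestor-suc : ∀ d v → d < Λ → ancestor (suc d) v ≡ 2 * ancestor d v + branchBit d v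
  ancestor-suc d v d<Λ = begin
    v div 2 ^ (Λ ∸ suc d)                                            ≡⟨ cong (λ k → v div 2 ^ k) e₁ ⟩
    v′                                                               ≡⟨ divmod v′ 2 ⟩
    v′ mod 2 + v′ div 2 * 2                                          ≡⟨ cong (λ t → v′ mod 2 + t * 2) (trans (div-div v (0<2^ (Λ ∸ 1 ∸ d)) z<s) (cong (λ k → v div 2 ^ k) e₂)) ⟩
    v′ mod 2 + ancestor d v * 2                                      ≡⟨ trans (+-comm (v′ mod 2) _) (cong (_+ v′ mod 2) (*-comm (ancestor d v) 2)) ⟩
    2 * ancestor d v + branchBit d v                                 ∎
    where
    open ≡-Reasoning
    v′ = v div 2 ^ (Λ ∸ 1 ∸ d)
    e₁ : Λ ∸ suc d ≡ Λ ∸ 1 ∸ d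
    e₁ = sym (∸-+-assoc Λ 1 d)
    e₂ : suc (Λ ∸ 1 ∸ d) ≡ Λ ∸ d
    e₂ = trans (cong suc (sym e₁)) (sym (n∸r≡suc d<Λ))

  2p+β-injective : ∀ {p p′ β β′} → β < 2 → β′ < 2 → 2 * p + β ≡ 2 * p′ + β′ → p ≡ p′ × β ≡ β′
  2p+β-injective {p} {p′} {β} {β′} β< β′< q =
      trans (sym (div-unique p β< (lemma p β))) (trans (cong (_div 2) q) (div-unique p′ β′< (lemma p′ β′)))
    , trans (sym (mod-unique p β< (lemma p β))) (trans (cong (_mod 2) q) (mod-unique p′ β′< (lemma p′ β′)))
    where
    lemma : ∀ p β → 2 * p + β ≡ β + p * 2
    lemma = solve-∀

  -- The ancestor at the next depth is twice the present ancestor plus the branch bit, and a number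
  -- has only one such representation; so filtering by the child is filtering by the parent and then
  -- by the bit.
  seq-child : ∀ p β → 1 ≤ p → depth p < Λ → β ≤ 1 → seq (2 * p + β) ≡ filter (λ v → branchBit (depth p) v ≟ β) (seq p)
  seq-child p β 1≤p d<Λ β≤1 = filter-filter _ _ (λ v → ancestor (depth (2 * p + β)) v ≟ 2 * p + β)
      (λ v p≡ β≡ → trans (step v) (cong₂ (λ a b → 2 * a + b) p≡ β≡))
      (λ v c≡ → 2p+β-injective (branchBit<2 (depth p) v) (s≤s β≤1) (trans (sym (step v)) c≡))
      T
    where
    step : ∀ v → ancestor (depth (2 * p + β)) v ≡ 2 * ancestor (depth p) v + branchBit (depth p) v
    step v = trans (cong (λ d → ancestor d v) (depth-child p β 1≤p β≤1)) (ancestor-suc (depth p) v d<Λ)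

  len-children : ∀ p → 1 ≤ p → depth p < Λ → len′ (2 * p) + len′ (suc (2 * p)) ≡ len′ p
  len-children p 1≤p d<Λ = trans (cong₂ (λ a b → length a + length b)
      (trans (cong seq (sym (+-identityʳ (2 * p)))) (seq-child p 0 1≤p d<Λ z≤n))
      (trans (cong seq (+-comm 1 (2 * p))) (seq-child p 1 1≤p d<Λ ≤-refl)))
    (length-halves (branchBit (depth p)) (branchBit<2 (depth p)) (seq p))

  seq-ancestor : ∀ c r → r < len′ c → ancestor (depth c) (nth (seq c) r) ≡ c
  seq-ancestor c = nth-filter (λ v → ancestor (depth c) v ≟ c) T

  off-suc : ∀ c → 1 ≤ c → off (suc c) ≡ off c + len′ c
  off-suc (suc c) _ = refl

  off-mono : ∀ {c c′} → c ≤ c′ → off c ≤ off c′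
  off-mono c≤ = Σ-mono (λ k → len′ (suc k)) (∸-monoˡ-≤ 1 c≤)

  -- The nodes `p`, ..., `2 p - 1` cut every path from the root to a leaf, so each of the `n` codes
  -- lies in exactly one of them. The induction replaces `p` by its two children. As a consequence
  -- the segment of a left child starts `n` slots after that of its parent.
  off-2* : ∀ p → 1 ≤ p → p ≤ 2 ^ Λ → off (2 * p) ≡ off p + n
  off-2* 1 _ _ = cong length seq-root
  off-2* (suc p@(suc _)) _ p< = begin
    off (2 * suc p)                                     ≡⟨ cong off (cong suc (+-suc p (p + 0))) ⟩
    off (suc (suc (2 * p)))                             ≡⟨ off-suc (suc (2 * p)) z<s ⟩
    off (suc (2 * p)) + len′ (suc (2 * p))              ≡⟨ cong (_+ len′ (suc (2 * p))) (off-suc (2 * p) z<s) ⟩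
    off (2 * p) + len′ (2 * p) + len′ (suc (2 * p))     ≡⟨ +-assoc (off (2 * p)) _ _ ⟩
    off (2 * p) + (len′ (2 * p) + len′ (suc (2 * p)))   ≡⟨ cong₂ _+_ (off-2* p z<s (<⇒≤ p<)) (len-children p z<s (depth-< z<s p<)) ⟩
    off p + n + len′ p                                  ≡⟨ lemma (off p) n (len′ p) ⟩
    off p + len′ p + n                                  ≡⟨ cong (_+ n) (off-suc p z<s) ⟨
    off (suc p) + n                                     ∎
    where
    open ≡-Reasoning
    lemma : ∀ a b c → a + b + c ≡ a + c + b
    lemma = solve-∀

  off-level : ∀ d → d ≤ suc Λ → off (2 ^ d) ≡ d * n
  off-level zero    _ = refl
  off-level (suc d) (s≤s d≤Λ) = trans (off-2* (2 ^ d) (0<2^ d) (2^-mono d≤Λ))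
    (trans (cong (_+ n) (off-level d (m≤n⇒m≤1+n d≤Λ))) (+-comm (d * n) n))

  segment-end : ∀ {c C r} → 1 ≤ c → c < C → r < len′ c → off c + r < off C
  segment-end {c} {C} {r} 1≤c c<C r< = <-≤-trans (+-monoʳ-< (off c) r<) (≤-trans (≤-reflexive (sym (off-suc c 1≤c))) (off-mono c<C))

  segment-unique : ∀ {c c′ r r′} → 1 ≤ c → 1 ≤ c′ → r < len′ c → r′ < len′ c′ → off c + r ≡ off c′ + r′ → c ≡ c′ × r ≡ r′
  segment-unique {c} {c′} {r} {r′} 1≤c 1≤c′ r< r′< q with <-cmp c c′
  ... | tri≈ _ refl _ = refl , +-cancelˡ-≡ (off c) r r′ q
  ... | tri< c< _ _ = ⊥-elim (<⇒≢ (<-≤-trans (segment-end 1≤c c< r<) (m≤m+n (off c′) r′)) q)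
  ... | tri> _ _ c> = ⊥-elim (<⇒≢ (<-≤-trans (segment-end 1≤c′ c> r′<) (m≤m+n (off c) r)) (sym q))

  -- With `segment-unique` this identifies the slots with the pairs of a node and an index in it, so
  -- that a processor number stands for one element.
  locate : ∀ C z → z < off C → ∃[ c ] ∃[ r ] 1 ≤ c × c < C × r < len′ c × z ≡ off c + r
  locate (suc C) z = below C
    where
    below : ∀ C → z < off (suc C) → ∃[ c ] ∃[ r ] 1 ≤ c × c < suc C × r < len′ c × z ≡ off c + r
    below (suc C) z< with z <? off (suc C)
    ... | yes z<′ = case below C z<′ of λ { (c , r , 1≤c , c< , r< , z≡) → c , r , 1≤c , m<n⇒m<1+n c< , r< , z≡ }
    ... | no z≮ = suc C , z ∸ off (suc C) , z<s , ≤-refl ,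
            +-cancelˡ-< (off (suc C)) _ _ (subst (_< off (suc C) + len′ (suc C)) (sym (m+[n∸m]≡n (≮⇒≥ z≮))) z<) ,
            sym (m+[n∸m]≡n (≮⇒≥ z≮))

  -- The depth of a slot: level d occupies the slots from d n on.
  slot-depth : ∀ {c r} → 1 ≤ n → 1 ≤ c → c < 2 ^ suc Λ → r < len′ c → (off c + r) div n ≡ depth c
  slot-depth {c} {r} 1≤n 1≤c c< r< = ≤-antisym (s≤s⁻¹ (div< {q = suc d} upper)) (≤div 1≤n lower)
    where
    d = depth c
    d≤Λ : d ≤ Λ
    d≤Λ = s≤s⁻¹ (depth-< 1≤c c<)
    upper : off c + r < suc d * n
    upper = <-≤-trans (segment-end 1≤c (≰⇒> λ p → <⇒≱ (n<1+n d) (≤depth p)) r<) (≤-reflexive (off-level (suc d) (s≤s d≤Λ)))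
    lower : d * n ≤ off c + r
    lower = ≤-trans (≤-reflexive (sym (off-level d (m≤n⇒m≤1+n d≤Λ)))) (≤-trans (off-mono (≮⇒≥ λ p → <-irrefl refl (depth-< 1≤c p))) (m≤m+n (off c) r))

-- Which cells a step may touch.  The cells of aux are told apart by their
-- position in a row of 16 fields.

key : Array → ℕ → ℕ
key A j = if A ≡ᵇ aux then j mod 16 + 100 else A

Frame : List ℕ → Mem → Mem → Set
Frame L M M′ = ∀ A j → T (fresh L (key A j)) → M′ A j ≡ M A j

fresh-++ˡ : ∀ L L′ {k} → T (fresh (L ++ L′) k) → T (fresh L k)
fresh-++ˡ []      L′ f = tt
fresh-++ˡ (A ∷ L) L′ {k} f with k ≡ᵇ A
... | false = fresh-++ˡ L L′ f

fresh-++ʳ : ∀ L L′ {k} → T (fresh (L ++ L′) k) → T (fresh L′ k)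
fresh-++ʳ []      L′ f = f
fresh-++ʳ (A ∷ L) L′ {k} f with k ≡ᵇ A
... | false = fresh-++ʳ L L′ f

disjoint : List ℕ → List ℕ → Bool
disjoint []      L = true
disjoint (A ∷ K) L = if fresh L A then disjoint K L else false

disjoint-fresh : ∀ K L {k} → T (disjoint K L) → ¬ T (fresh K k) → T (fresh L k)
disjoint-fresh []      L _ ¬f = ⊥-elim (¬f tt)
disjoint-fresh (A ∷ K) L {k} d ¬f with k ≡ᵇ A in k≡ | fresh L A in fA
... | true  | true = subst (λ x → T (fresh L x)) (sym (≡ᵇ⇒≡ k A (subst T (sym k≡) tt))) (subst T (sym fA) tt)
... | false | true = disjoint-fresh K L d ¬f

frame-trans : ∀ L {M M′ M″} → Frame L M M′ → Frame L M′ M″ → Frame L M M″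
frame-trans L f f′ A j k = trans (f′ A j k) (f A j k)

frame-++ʳ : ∀ L L′ {M M′} → Frame L′ M M′ → Frame (L ++ L′) M M′
frame-++ʳ L L′ f A j k = f A j (fresh-++ʳ L L′ k)

keeps-frame : ∀ L {M M′} → T (fresh L aux) → Keeps L M M′ → Frame L M M′
keeps-frame L fa k A j f with A ≡ᵇ aux in A≡
... | true  = k A (subst (λ B → T (fresh L B)) (sym (≡ᵇ⇒≡ A aux (subst T (sym A≡) tt))) fa) j
... | false = k A f j

lam hdr cur pos : Array
lam = 13
hdr = 14
cur = 20
pos = 21

open SizeExp (cell hdr) public

temps inputs : List ℕ
temps  = ctr ∷ slen ∷ tot ∷ src ∷ dst ∷ []
inputs = params ∷ start ∷ len ∷ lam ∷ hdr ∷ cur ∷ pos ∷ []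

nE lamE depthE nodE bitE idxE lnE : Exp
nE     = load params (lit 0)
lamE   = cell lam
depthE = pid ⊘ nE
nodE   = bin shr (load cur pid) (lamE ⊖ depthE)
bitE   = bin shr (load cur pid) (lamE ⊖ lit 1 ⊖ depthE) ⊛ lit 2
idxE   = pid ⊖ load start nodE
lnE    = load len nodE

minE : Exp → Exp → Exp
minE x y = ifE (ltE x y) x y

-- `2 ^ w - 1`, put together from two halves because `2 ^ w` is not a word.
maxE : Exp
maxE = 2^E (wE ⊖ lit 1) ⊖ lit 1 ⊕ 2^E (wE ⊖ lit 1)

-- Subtraction modulo 2 ^ w.
diffE : Exp → Exp → Exp
diffE x y = x ⊕ (maxE ⊖ y ⊕ lit 1)

-- Each node owns `4 n` rows of 16 fields, far more than it fills. The gaps cost nothing, and the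
-- address of a structure needs no prefix sum over the sizes of the others.
cellE : Exp → Exp → Exp → Exp
cellE p row f = lit 16 ⊗ (lit 4 ⊗ nE ⊗ p ⊕ row) ⊕ f

-- Writes the sums of s over the intervals [l, h).
packP : (K s g : Exp) (A : Array) (a h l : Exp) → Program
packP K s g A a h l = (pardo K (lit 1) src pid s ∷ []) ++ (assign slen K ∷ []) ++ scan
  ++ (pardo K g A a (diffE (load dst h) (load dst l)) ∷ [])

-- Prefix sums of packed fields overflow many times over. Their difference is still right modulo
-- `W`, and it is exact because the word assembled from one segment fits.
mod-difference : ∀ W {x y} D → 0 < W → x ≡ (y + D) mod W → y < W → D < W → (x + (W ∸ y)) mod W ≡ D
mod-difference W {x} {y} D 0<W refl y< D< = begin
  ((y + D) mod W + (W ∸ y)) mod W   ≡⟨ mod-+ˡ (y + D) (W ∸ y) W ⟩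
  (y + D + (W ∸ y)) mod W           ≡⟨ cong (_mod W) (trans (lemma y D (W ∸ y)) (cong (D +_) (trans (m+[n∸m]≡n (<⇒≤ y<)) (sym (*-identityˡ W))))) ⟩
  (D + 1 * W) mod W                 ≡⟨ mod-+* D 1 W ⟩
  D mod W                           ≡⟨ mod-small D< ⟩
  D                                 ∎
  where
  open ≡-Reasoning
  lemma : ∀ a b c → a + b + c ≡ b + (a + c)
  lemma = solve-∀

-- The setting of the construction, and parallel steps as composable units

record Setting : Set where
  field
    w e Λ θ : ℕ
    sz      : Geometry.Sizes w e θ
    L       : List ℕ
    codes   : All (λ v → v div 2 ^ Λ ≡ 1) L
    1≤Λ     : 1 ≤ Λ
    1≤n     : 1 ≤ length L
    n<      : length L < 2 ^ (1 * θ)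
    Λ<      : suc Λ < 2 ^ (1 * θ)
    -- This is what `σ ≤ n` provides: the tree has O(n) nodes, so one processor per node can be
    -- charged to the input length.
    nodes≤  : 2 ^ suc Λ ≤ 4 * length L
    -- The units of work and depth. They are instantiated by `Λ * n` and `Λ * lg n`, and `γ` by the
    -- factor of `lg n` in the word length.
    X Y γ   : ℕ
    1≤X     : 1 ≤ X
    1≤Y     : 1 ≤ Y
    slots≤  : suc Λ * length L ≤ 2 * X
    w≤X     : w ≤ γ * X
    w≤Y     : w ≤ γ * Y

module Build (𝒮 : Setting) where

  open Setting 𝒮 public
  open Geometry w e public
  open Sizes sz public
  open Scan w θ 64θ≤w 10≤θ w<2^θ public
  open Nodes Λ L codes public
  open QueryProof w e θ sz using (0<ℓ; 0<b; 0<B; ℓ<w; ℓF<w; b<w; B<ℓ) public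

  Q : ℕ → ℕ → ℕ → ℕ
  Q p β r = Occurrences.position (branchBit (depth p)) β (λ v → branchBit (depth p) v ≟ β) (seq p) r

  nodes : ℕ
  nodes = 2 ^ suc Λ

  -- The interface between the two phases: what the levels leave behind, and what the table passes
  -- read and never overwrite.
  record Inp (M : Mem) : Set where
    field
      n-stored   : M params 0 ≡ n
      w-stored   : M params 2 ≡ w
      lam-stored : M lam 0 ≡ Λ
      hdr-stored : M hdr 0 ≡ e
      off-stored : ∀ c → 1 ≤ c → c < nodes → M start c ≡ off c
      len-stored : ∀ c → 1 ≤ c → c < nodes → M len c ≡ len′ c
      cur-stored : ∀ c r → 1 ≤ c → c < nodes → r < len′ c → M cur (off c + r) ≡ nth (seq c) r
      pos-stored : ∀ p β r → 1 ≤ p → p < 2 ^ Λ → β ≤ 1 → r < len′ (2 * p + β) → M pos (off (2 * p + β) + r) ≡ Q p β r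

  inp-frame : ∀ K {M M′} → {_ : T (disjoint inputs K)} → Frame K M M′ → Inp M → Inp M′
  inp-frame K {M} {M′} {d} f i = record
    { n-stored   = trans (f params 0 (ok params λ ())) n-stored
    ; w-stored   = trans (f params 2 (ok params λ ())) w-stored
    ; lam-stored = trans (f lam 0 (ok lam λ ())) lam-stored
    ; hdr-stored = trans (f hdr 0 (ok hdr λ ())) hdr-stored
    ; off-stored = λ c 1≤c c< → trans (f start c (ok start λ ())) (off-stored c 1≤c c<)
    ; len-stored = λ c 1≤c c< → trans (f len c (ok len λ ())) (len-stored c 1≤c c<)
    ; cur-stored = λ c r 1≤c c< r< → trans (f cur _ (ok cur λ ())) (cur-stored c r 1≤c c< r<)
    ; pos-stored = λ p β r 1≤p p< β≤ r< → trans (f pos _ (ok pos λ ())) (pos-stored p β r 1≤p p< β≤ r<)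
    }
    where
    open Inp i
    ok : ∀ A → ¬ T (fresh inputs A) → T (fresh K A)
    ok A = disjoint-fresh inputs K d

  -- Which processor z writes which cell c in a parallel step.
  record Plan (k : ℕ) (g : Exp) (A : Array) (a : Exp) (K : List ℕ) : Set₁ where
    field
      Dom       : ℕ → ℕ → Set
      sound     : ∀ {M} (Wd : Words w M) → Inp M → ∀ z → z < k → eval w M z g ≢ 0 → Dom z (eval w M z a)
      complete  : ∀ {M} (Wd : Words w M) → Inp M → ∀ z c → Dom z c → z < k × eval w M z g ≢ 0 × eval w M z a ≡ c
      injective : ∀ {z z′ c} → Dom z c → Dom z′ c → z ≡ z′
      touches   : ∀ {z c} → Dom z c → ¬ T (fresh K (key A c))

    module _ {v M M′} (Wd : Words w M) (inp : Inp M) (out : Wrote k g A a v M M′) where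

      plan-written : ∀ z c → Dom z c → M′ A c ≡ eval w M z v
      plan-written z c d with complete Wd inp z c d
      ... | z< , g≢0 , a≡ = written out z z< g≢0 a≡ λ z′ z′< g′ a′ →
              cong (λ t → eval w M t v) (injective (subst (Dom z′) a′ (sound Wd inp z′ z′< g′)) d)

      plan-frame : Frame K M M′
      plan-frame B j f with B ≟ A
      ... | no B≢A = untouched out B≢A j
      ... | yes refl = unwritten out λ z z< g≢0 a≡ → touches (sound Wd inp z z< g≢0) (subst (λ c → T (fresh K (key A c))) (sym a≡) f)

  -- The constant 151 is the cost of a prefix sum in its own units, and `3 * γ + 5` bounds those
  -- units in terms of `X` and `Y`. The remaining 5000 exceeds the literal cost of the other
  -- statements of any step, which is checked by computation.
  C₀ : ℕ
  C₀ = 151 * (3 * γ + 5) + 5000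

  -- A step relies on `Inp` alone, never on the facts of earlier steps, and its own fact speaks only
  -- of cells under its own keys. Disjoint keys therefore let facts accumulate, whatever the order
  -- of the steps.
  record Step : Set₁ where
    field
      prog   : Program
      keys   : List ℕ
      Fact   : Mem → Set
      stable : ∀ {M M′} → (∀ A j → ¬ T (fresh keys (key A j)) → M′ A j ≡ M A j) → Fact M → Fact M′
      run    : ∀ {M} → Words w M → Inp M → Triple X Y prog M C₀ C₀ (λ M′ → Fact M′ × Frame (temps ++ keys) M M′)

  cheaper : ∀ {P M Q} a b → a ≤ C₀ → b ≤ C₀ → Triple X Y P M a b Q → Triple X Y P M C₀ C₀ Q
  cheaper a b a≤ b≤ f = triple λ R K t d k → Triple.run f R K t d λ M′ t′ d′ Wd q t≤ d≤ →
    k M′ t′ d′ Wd q (≤-trans t≤ (+-monoʳ-≤ t (*-monoˡ-≤ X a≤))) (≤-trans d≤ (+-monoʳ-≤ d (*-monoˡ-≤ Y b≤)))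

  progs : List Step → Program
  progs []       = []
  progs (s ∷ ss) = Step.prog s ++ progs ss

  keysOf : List Step → List ℕ
  keysOf []       = []
  keysOf (s ∷ ss) = Step.keys s ++ keysOf ss

  Facts : List Step → Mem → Set
  Facts []       M = ⊤
  Facts (s ∷ ss) M = Step.Fact s M × Facts ss M

  Compatible : List Step → Set
  Compatible []       = ⊤
  Compatible (s ∷ ss) = T (disjoint inputs (temps ++ Step.keys s)) × T (disjoint (Step.keys s) (temps ++ keysOf ss)) × Compatible ss

  run-all : ∀ ss → Compatible ss → ∀ {M} → Words w M → Inp M →
    Triple X Y (progs ss) M (length ss * C₀) (length ss * C₀) (λ M′ → Facts ss M′ × Inp M′ × Frame (temps ++ keysOf ss) M M′)
  run-all [] _ Wd inp = skip Wd (tt , inp , λ _ _ _ → refl)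
  run-all (s ∷ ss) (d , d′ , ds) {M} Wd inp = Step.run s Wd inp ⨾ λ M₁ Wd₁ (fact , f) →
    consequence (λ M₂ Wd₂ (facts , inp₂ , f′) →
        (Step.stable s (λ A j ¬fr → f′ A j (disjoint-fresh (Step.keys s) _ d′ ¬fr)) fact , facts) , inp₂ ,
        λ A j fr → trans (f′ A j (rest A j fr)) (f A j (front A j fr)))
      (run-all ss ds Wd₁ (inp-frame (temps ++ Step.keys s) {_} {_} {d} f inp))
    where
    ks = Step.keys s
    join : ∀ L L′ {k} → T (fresh L k) → T (fresh L′ k) → T (fresh (L ++ L′) k)
    join [] L′ _ f = f
    join (A ∷ L) L′ {k} f f′ with k ≡ᵇ A
    ... | false = join L L′ f f′
    front : ∀ A j → T (fresh (temps ++ (ks ++ keysOf ss)) (key A j)) → T (fresh (temps ++ ks) (key A j))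
    front A j fr = join temps ks {key A j} (fresh-++ˡ temps (ks ++ keysOf ss) {key A j} fr)
      (fresh-++ˡ ks (keysOf ss) {key A j} (fresh-++ʳ temps (ks ++ keysOf ss) {key A j} fr))
    rest : ∀ A j → T (fresh (temps ++ (ks ++ keysOf ss)) (key A j)) → T (fresh (temps ++ keysOf ss) (key A j))
    rest A j fr = join temps (keysOf ss) {key A j} (fresh-++ˡ temps (ks ++ keysOf ss) {key A j} fr)
      (fresh-++ʳ ks (keysOf ss) {key A j} (fresh-++ʳ temps (ks ++ keysOf ss) {key A j} fr))

  module _ {k g A a K} (plan : Plan k g A a K) (KE : Exp)
    (KE-value : ∀ {M} (Wd : Words w M) → Inp M → eval w M 0 KE ≡ k) (k≤ : k ≤ 2 * X) where

    open Plan plan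

    scatter : ∀ v (value : ∀ {z c} → Dom z c → ℕ) {_ : T (ops KE + 2 * (ops g + ops a + ops v + 1) ≤ᵇ 5000)} →
      (∀ {M} (Wd : Words w M) → Inp M → ∀ z c (d : Dom z c) → eval w M z v ≡ value d) → Step
    scatter v value {small} value≡ = record
      { prog   = pardo KE g A a v ∷ []
      ; keys   = K
      ; Fact   = λ M′ → ∀ z c (d : Dom z c) → M′ A c ≡ value d
      ; stable = λ f fact z c d → trans (f A c (touches d)) (fact z c d)
      ; run    = λ Wd inp → cheaper _ _ cost≤ (≤-trans (+-monoʳ-≤ (ops KE) (m≤n*m (ops g + ops a + ops v + 1) 2)) cost≤)
          (pardo-rule 2 Wd (KE-value Wd inp) k≤ 1≤X 1≤Y λ M′ Wd′ out →
            (λ z c d → trans (plan-written Wd inp out z c d) (value≡ Wd inp z c d)) , frame-++ʳ temps K (plan-frame Wd inp out))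
      }
      where
      cost≤ : ops KE + 2 * (ops g + ops a + ops v + 1) ≤ C₀
      cost≤ = ≤-trans (≤ᵇ⇒≤ _ 5000 small) (m≤n+m 5000 (151 * (3 * γ + 5)))

    packed : ∀ s h l (hi lo value : ∀ {z c} → Dom z c → ℕ) → k < 2 ^ (2 * θ) →
      {_ : T ((ops KE + 2 * (1 + 1 + ops s + 1)) + ((ops KE + 4) + (ops KE + 2 * (ops g + ops a + ops (diffE (load dst h) (load dst l)) + 1))) ≤ᵇ 5000)} →
      (∀ {M} (Wd : Words w M) → Inp M → ∀ z c (d : Dom z c) →
        eval w M z h ≡ hi d × eval w M z l ≡ lo d × lo d ≤ hi d × hi d ≤ k) →
      (∀ {M} (Wd : Words w M) → Inp M → ∀ z c (d : Dom z c) → Σ< (hi d ∸ lo d) (λ i → eval w M (lo d + i) s) mod W ≡ value d) → Step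
    packed s h l hi lo value k< {small} bounds value≡ = record
      { prog   = packP KE s g A a h l
      ; keys   = K
      ; Fact   = λ M′ → ∀ z c (d : Dom z c) → M′ A c ≡ value d
      ; stable = λ f fact z c d → trans (f A c (touches d)) (fact z c d)
      ; run    = λ Wd inp → cheaper _ _ cost≤ cost≤′ (pack-run Wd inp)
      }
      where
      δ = diffE (load dst h) (load dst l)
      lit₁ = ops KE + 2 * (1 + 1 + ops s + 1)
      lit₃ = ops KE + 2 * (ops g + ops a + ops δ + 1)
      α = 3 * γ + 5
      rearrange : ∀ a b c d → a + (b + (c + d)) ≡ c + (a + (b + d))
      rearrange = solve-∀
      cost≤ : lit₁ + ((ops KE + 4) + (151 * α + lit₃)) ≤ C₀
      cost≤ = ≤-trans (≤-reflexive (rearrange lit₁ (ops KE + 4) (151 * α) lit₃)) (+-monoʳ-≤ (151 * α) (≤ᵇ⇒≤ (lit₁ + ((ops KE + 4) + lit₃)) 5000 small))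
      cost≤′ : (ops KE + (1 + 1 + ops s + 1)) + ((ops KE + 4) + (151 * α + (ops KE + (ops g + ops a + ops δ + 1)))) ≤ C₀
      cost≤′ = ≤-trans (+-mono-≤ (+-monoʳ-≤ (ops KE) (m≤n*m (1 + 1 + ops s + 1) 2)) (+-monoʳ-≤ (ops KE + 4)
        (+-monoʳ-≤ (151 * α) (+-monoʳ-≤ (ops KE) (m≤n*m (ops g + ops a + ops δ + 1) 2))))) cost≤
      chunks≤ : w * (k div w + 1) ≤ α * X
      chunks≤ = ≤-trans (≤-reflexive (trans (*-distribˡ-+ w (k div w) 1) (cong₂ _+_ (*-comm w (k div w)) (*-identityʳ w))))
        (≤-trans (+-mono-≤ (≤-trans (div*≤ k w) k≤) w≤X) (≤-trans (≤-reflexive (sym (*-distribʳ-+ X 2 γ)))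
          (*-monoˡ-≤ X (≤-trans (+-mono-≤ (s≤s (s≤s (z≤n {3}))) (m≤n*m γ 3)) (≤-reflexive (+-comm 5 (3 * γ)))))))
      w1≤ : w * 1 ≤ α * Y
      w1≤ = ≤-trans (≤-reflexive (*-identityʳ w)) (≤-trans w≤Y (*-monoˡ-≤ Y (≤-trans (m≤n*m γ 3) (m≤m+n (3 * γ) 5))))
      pack-run : ∀ {M} → Words w M → Inp M → Triple X Y (packP KE s g A a h l) M _ _
        (λ M′ → (∀ z c (d : Dom z c) → M′ A c ≡ value d) × Frame (temps ++ K) M M′)
      pack-run {M} Wd inp =
        pardo-rule {Q = λ M₁ → Frame temps M M₁ × (∀ z → z < k → M₁ src z ≡ eval w M z s)} 2 Wd (KE-value Wd inp) k≤ 1≤X 1≤Y (λ M₁ Wd₁ out →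
            keeps-frame temps _ (λ B f j → untouched out (fresh-≢ {temps} f λ ()) j) ,
            λ z z< → written out z z< (one≢0 Wd z) (pid≡ Wd z<) λ z′ z′< _ p → cong (λ t → eval w M t s) (trans (sym (pid≡ Wd z′<)) p))
        ⨾ λ M₁ Wd₁ (f₁ , src₁) →
        assign-rule {Q = λ M₂ → Frame temps M M₂ × (∀ z → z < k → M₂ src z ≡ eval w M z s) × M₂ slen 0 ≡ k} Wd₁ 1≤X 1≤Y (KE-value Wd₁ (inp-frame temps f₁ inp)) (λ M₂ Wd₂ o n≡ →
            frame-trans temps f₁ (keeps-frame temps _ (λ B f j → o B j (fresh-≢ {temps} f λ ()))) ,
            (λ z z< → trans (o src z λ ()) (src₁ z z<)) , n≡)
        ⨾ λ M₂ Wd₂ (f₂ , src₂ , slen₂) →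
        rescale α α chunks≤ w1≤ (scan-rule (Inp.w-stored (inp-frame temps f₂ inp)) slen₂ k< Wd₂)
        ⨾ λ M₃ Wd₃ (k₃ , dst₃) →
        let f₃ : Frame temps M M₃
            f₃ = frame-trans temps f₂ (keeps-frame temps _ λ B f j → k₃ B (sub-temps B f) j)
            inp₃ = inp-frame temps f₃ inp
        in pardo-rule 2 Wd₃ (KE-value Wd₃ inp₃) k≤ 1≤X 1≤Y λ M₄ Wd₄ out →
          (λ z c d → trans (plan-written Wd₃ inp₃ out z c d) (difference M₃ Wd₃ inp₃
            (λ y y≤ → trans (dst₃ y y≤) (cong (_mod W) (Σ-cong y λ i i<y → src₂ i (<-≤-trans i<y y≤)))) z c d)) ,
          λ B j f → trans (plan-frame Wd₃ inp₃ out B j (fresh-++ʳ temps K {key B j} f)) (f₃ B j (fresh-++ˡ temps K {key B j} f))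
        where
        pid≡ : ∀ {M} (Wd : Words w M) {z} → z < k → eval w M z pid ≡ z
        pid≡ {M} Wd {z} z< = valˢ (At.pidˢ M Wd z 2 (<-trans z< k<))
        sub-temps : ∀ B → T (fresh temps B) → T (fresh scanTemps B)
        sub-temps B f = disjoint-all B (fresh-≢ {temps} f λ ()) (fresh-≢ {temps} f λ ()) (fresh-≢ {temps} f λ ())
          where
          disjoint-all : ∀ B → B ≢ ctr → B ≢ tot → B ≢ dst → T (fresh scanTemps B)
          disjoint-all B p q r with B ≡ᵇ ctr | ≡ᵇ⇒≡ B ctr | B ≡ᵇ tot | ≡ᵇ⇒≡ B tot | B ≡ᵇ dst | ≡ᵇ⇒≡ B dst
          ... | true  | b≡ | _ | _ | _ | _ = p (b≡ tt)
          ... | false | _ | true | b≡ | _ | _ = q (b≡ tt)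
          ... | false | _ | false | _ | true | b≡ = r (b≡ tt)
          ... | false | _ | false | _ | false | _ = tt
        difference : ∀ M₃ (Wd₃ : Words w M₃) → Inp M₃ → (∀ y → y ≤ k → M₃ dst y ≡ Σ< y (λ i → eval w M i s) mod W) →
          ∀ z c (d : Dom z c) → eval w M₃ z δ ≡ value d
        difference M₃ Wd₃ inp₃ dst₃ z c d with bounds Wd₃ inp₃ z c d
        ... | h≡ , l≡ , lo≤hi , hi≤k = trans (val (addʷ hV (addʷ (sub⇓ maxV lV) one⇓))) (trans fold
              (trans (mod-difference W D (0<2^ w) x≡ (mod< (S (lo d)) (0<2^ w)) (mod< seg (0<2^ w))) (value≡ Wd inp z c d)))
          where
          open At M₃ Wd₃ z
          S : ℕ → ℕ
          S y = Σ< y (λ i → eval w M i s)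
          seg = Σ< (hi d ∸ lo d) (λ i → eval w M (lo d + i) s)
          D = seg mod W
          hV : load dst h ⇓ S (hi d) mod W
          hV = load⇓ {e = h} (by h≡) (dst₃ (hi d) hi≤k)
          lV : load dst l ⇓ S (lo d) mod W
          lV = load⇓ {e = l} (by l≡) (dst₃ (lo d) (≤-trans lo≤hi hi≤k))
          w-1V : wE ⊖ lit 1 ⇓ w ∸ 1
          w-1V = sub⇓ (load⇓ (↓ litˢ 2) (Inp.w-stored inp₃)) one⇓
          w-1< : w ∸ 1 < w
          w-1< = ≤-reflexive (m+[n∸m]≡n 1≤w)
          half+half : 2 ^ (w ∸ 1) ∸ 1 + 2 ^ (w ∸ 1) ≡ W ∸ 1
          half+half = trans (sym (+-∸-comm (2 ^ (w ∸ 1)) (0<2^ (w ∸ 1)))) (cong (_∸ 1)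
            (trans (cong (2 ^ (w ∸ 1) +_) (sym (+-identityʳ _))) (cong (2 ^_) (m+[n∸m]≡n 1≤w))))
          W-1< : W ∸ 1 < W
          W-1< = ≤-reflexive (m+[n∸m]≡n (0<2^ w))
          maxV : maxE ⇓ W ∸ 1
          maxV = cast half+half (add⇓ (2^-1⇓ w-1V w-1<) (2^⇓ w-1V w-1<) (subst (_< W) (sym half+half) W-1<))
          y = S (lo d) mod W
          y< = mod< (S (lo d)) {W} (0<2^ w)
          fold : (S (hi d) mod W + (W ∸ 1 ∸ y + 1) mod W) mod W ≡ (S (hi d) mod W + (W ∸ y)) mod W
          fold = trans (mod-+ʳ (S (hi d) mod W) (W ∸ 1 ∸ y + 1) W) (cong (λ t → (S (hi d) mod W + t) mod W)
            (trans (cong (_+ 1) (trans (∸-+-assoc W 1 y) (trans (cong (W ∸_) (+-comm 1 y)) (sym (∸-+-assoc W y 1)))))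
              (m∸n+n≡m (m<n⇒0<n∸m y<))))
          x≡ : S (hi d) mod W ≡ (y + D) mod W
          x≡ = sym (trans (mod-+ˡ (S (lo d)) D W) (trans (mod-+ʳ (S (lo d)) seg W) (cong (_mod W)
            (trans (sym (Σ-split (lo d) (hi d ∸ lo d) (λ i → eval w M i s))) (cong S (m+[n∸m]≡n lo≤hi))))))

Σ-length : ∀ {m n f} → m ≡ n → Σ< m f ≡ Σ< n f
Σ-length refl = refl

n+2<4n : ∀ {n} → 1 ≤ n → n + 2 < 4 * n
n+2<4n {n} 1≤n = ≤-trans (≤-reflexive (cong suc (+-comm n 2))) (≤-trans (+-monoˡ-≤ n (*-monoʳ-≤ 3 1≤n)) (≤-reflexive (lemma n)))
  where
  lemma : ∀ n → 3 * n + n ≡ 4 * n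
  lemma = solve-∀

-- Steps with one processor per slot, and the rank directory

slots₁E slots₂E superStartE superRowE spanE : Exp
slots₁E     = nE ⊗ lamE
slots₂E     = nE ⊗ (lamE ⊕ lit 1)
superStartE = eqE (idxE ⊛ BE) (lit 0)
superRowE   = idxE ⊘ BE ⊕ lit 1
spanE       = pid ⊕ minE BE (lnE ⊖ idxE)

indicatorE countSrcE : ℕ → Exp
indicatorE β = eqE bitE (lit β)
countSrcE β  = indicatorE β ⊗ 2^E (ℓE ⊗ (idxE ⊛ BE ⊘ bE))

rankCellE : ℕ → ℕ → Exp
rankCellE β f = cellE nodE superRowE (lit (f + 8 * β))

rankP countP : ℕ → Program
rankP β  = packP slots₁E (indicatorE β) superStartE aux (rankCellE β 0) pid (load start nodE)
countP β = packP slots₁E (countSrcE β) superStartE aux (rankCellE β 1) spanE pid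

module Steps (𝒮 : Setting) where

  open Build 𝒮 public

  slots : ℕ
  slots = suc Λ * n

  slots< : slots < 2 ^ (2 * θ)
  slots< = subst (slots <_) (trans (cong₂ (λ a b → 2 ^ a * 2 ^ b) (*-identityˡ θ) (*-identityˡ θ))
    (trans (sym (2^-+ θ θ)) (cong (λ t → 2 ^ (θ + t)) (sym (*-identityˡ θ))))) (*-mono-< Λ< n<)

  slot< : ∀ {c r} → 1 ≤ c → c < nodes → r < len′ c → off c + r < slots
  slot< 1≤c c< r< = <-≤-trans (segment-end 1≤c c< r<) (≤-reflexive (off-level (suc Λ) ≤-refl))

  2^1≤ : 2 ^ 1 ≤ 2 ^ θ
  2^1≤ = 2^-mono {1} (≤-trans (s≤s z≤n) 10≤θ)

  node-bound : ∀ {c} → c < nodes → c < 2 ^ (2 * θ)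
  node-bound {c} c< = <-≤-trans (<-≤-trans c< nodes≤) (<⇒≤ (<-≤-trans (*-monoʳ-< 4 n<)
    (≤-trans (*-monoˡ-≤ (2 ^ (1 * θ)) (2^-mono {2} (≤-trans (s≤s (s≤s z≤n)) 10≤θ))) (≤-reflexive (sym (2^-+ θ (1 * θ)))))))

  len≤n : ∀ c → len′ c ≤ n
  len≤n c = length-filter (λ v → ancestor (depth c) v ≟ c) L

  len< : ∀ c → len′ c < 2 ^ (1 * θ)
  len< c = ≤-<-trans (len≤n c) n<

  e<2^1θ : e < 2 ^ (1 * θ)
  e<2^1θ = subst (λ t → e < 2 ^ t) (sym (*-identityˡ θ)) e<2^θ

  module Common {M} (Wd : Words w M) (inp : Inp M) (z : ℕ) where

    open Inp inp public
    open At M Wd z public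

    nV : nE ⇓⟨ 1 ⟩ n
    nV = loadˢ 1 (litˢ 0) n-stored n<

    lamV : lamE ⇓⟨ 1 ⟩ Λ
    lamV = loadˢ 1 (litˢ 0) lam-stored (<-trans (n<1+n Λ) Λ<)

    wV : wE ⇓⟨ 1 ⟩ w
    wV = loadˢ 1 (litˢ 2) w-stored w<2^1θ

    eV : cell hdr ⇓⟨ 1 ⟩ e
    eV = loadˢ 1 (litˢ 0) hdr-stored e<2^1θ

    ℓV : ℓE ⇓⟨ 2 ⟩ ℓ
    ℓV = litˢ 8 *ˢ eV

    bV : bE ⇓⟨ 3 ⟩ b
    bV = ℓV *ˢ eV

    FV : FE ⇓⟨ 1 ⟩ F
    FV = wV /ˢ (litˢ 2 *ˢ ℓV)

    BV : BE ⇓⟨ 4 ⟩ B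
    BV = bV *ˢ FV

    minV : ∀ {xE yE s t x y} → xE ⇓⟨ s ⟩ x → yE ⇓⟨ t ⟩ y → minE xE yE ⇓⟨ s ⊔ t ⟩ x ⊓ y
    minV {s = s} {t} {x} {y} xV yV with x <? y
    ... | yes x<y = weaken (s ⊔ t) (m≤m⊔n s t) (castˢ (sym (m≤n⇒m⊓n≡m (<⇒≤ x<y))) (if-trueˢ (cast (𝟙<-true x<y) (lt⇓ (↓ xV) (↓ yV))) xV))
    ... | no x≮y = weaken (s ⊔ t) (m≤n⊔m s t) (castˢ (sym (m≥n⇒m⊓n≡n (≮⇒≥ x≮y))) (if-falseˢ (cast (𝟙<-false (≮⇒≥ x≮y)) (lt⇓ (↓ xV) (↓ yV))) yV))

    cellV : ∀ {pE rowE fE s t p row f} → pE ⇓⟨ s ⟩ p → rowE ⇓⟨ t ⟩ row → fE ⇓⟨ 4 ⟩ f → {_ : T (s ≤ᵇ 10)} → {_ : T (t ≤ᵇ 10)} →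
      cellE pE rowE fE ⇓⟨ 17 ⟩ 16 * (4 * n * p + row) + f
    cellV {s = s} {t} pV rowV fV {s≤} {t≤} = weaken 17 (≤ᵇ⇒≤ 15 17 _)
      (litˢ 16 *ˢ (litˢ 4 *ˢ nV *ˢ weaken 10 (≤ᵇ⇒≤ s 10 s≤) pV +ˢ weaken 10 (≤ᵇ⇒≤ t 10 t≤) rowV) +ˢ fV)

  module Slot {M} (Wd : Words w M) (inp : Inp M) {c r : ℕ} (1≤c : 1 ≤ c) (c< : c < nodes) (r< : r < len′ c) where

    open Common Wd inp (off c + r) public

    pidV : pid ⇓⟨ 2 ⟩ off c + r
    pidV = pidˢ 2 (<-trans (slot< 1≤c c< r<) slots<)

    depthV : depthE ⇓⟨ 2 ⟩ depth c
    depthV = castˢ (slot-depth 1≤n 1≤c c< r<) (pidV /ˢ nV)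

    nodV : nodE ⇓⟨ 2 ⟩ c
    nodV = cast (seq-ancestor c r r<) (shr⇓ (load⇓ (↓ pidV) (cur-stored c r 1≤c c< r<)) (sub⇓ (↓ lamV) (↓ depthV)))
      within node-bound c<

    bitV : bitE ⇓⟨ 1 ⟩ bf c r
    bitV = rem⇓ (shr⇓ (load⇓ (↓ pidV) (cur-stored c r 1≤c c< r<)) (sub⇓ (sub⇓ (↓ lamV) one⇓) (↓ depthV))) (↓ litˢ 2)
      within <-≤-trans (branchBit<2 (depth c) (nth (seq c) r)) (≤-trans 2^1≤ (≤-reflexive (cong (2 ^_) (sym (*-identityˡ θ)))))

    offV : load start nodE ⇓⟨ 2 ⟩ off c
    offV = loadˢ 2 nodV (off-stored c 1≤c c<) (≤-<-trans (m≤m+n (off c) r) (<-trans (slot< 1≤c c< r<) slots<))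

    lenV : lnE ⇓⟨ 1 ⟩ len′ c
    lenV = loadˢ 1 nodV (len-stored c 1≤c c<) (len< c)

    idxV : idxE ⇓⟨ 2 ⟩ r
    idxV = castˢ (m+n∸m≡n (off c) r) (pidV -ˢ offV)

    lenIdxV : lnE ⊖ idxE ⇓⟨ 1 ⟩ len′ c ∸ r
    lenIdxV = lenV -ˢ idxV

  row-unique : ∀ {p p′ row row′ f f′} → row < 4 * n → row′ < 4 * n → f < 16 → f′ < 16 →
    16 * (4 * n * p + row) + f ≡ 16 * (4 * n * p′ + row′) + f′ → p ≡ p′ × row ≡ row′ × f ≡ f′
  row-unique {p} {p′} {row} {row′} {f} {f′} row< row′< f< f′< q = proj₁ low , proj₂ low , proj₂ high
    where
    lemma : ∀ k a f → k * a + f ≡ f + a * k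
    lemma = solve-∀
    pair : ∀ {k a a′ x x′} → x < k → x′ < k → k * a + x ≡ k * a′ + x′ → a ≡ a′ × x ≡ x′
    pair {k} {a} {a′} {x} {x′} x< x′< q =
        trans (sym (div-unique a x< (lemma k a x))) (trans (cong (_div k) q) (div-unique a′ x′< (lemma k a′ x′)))
      , trans (sym (mod-unique a x< (lemma k a x))) (trans (cong (_mod k) q) (mod-unique a′ x′< (lemma k a′ x′)))
    high = pair {16} f< f′< q
    low = pair {4 * n} {p} {p′} row< row′< (proj₁ high)

  cell-field : ∀ p row {f} → f < 16 → (16 * (4 * n * p + row) + f) mod 16 ≡ f
  cell-field p row {f} f< = mod-unique (4 * n * p + row) f< (lemma (4 * n * p + row) f)
    where
    lemma : ∀ a f → 16 * a + f ≡ f + a * 16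
    lemma = solve-∀

  -- Parallel steps over the slots of the nodes below C: processor off c + r acts
  -- for element r of node c.
  module OverSlots (C : ℕ) (1≤C : 1 ≤ C) (C≤ : C ≤ nodes) (g : Exp) (A : Array) (a : Exp) (K : List ℕ)
    (G : ℕ → ℕ → ℕ) (ad : ℕ → ℕ → ℕ)
    (g-value : ∀ {M} (Wd : Words w M) (inp : Inp M) {c r} → 1 ≤ c → c < C → r < len′ c → eval w M (off c + r) g ≡ G c r)
    (a-value : ∀ {M} (Wd : Words w M) (inp : Inp M) {c r} → 1 ≤ c → c < C → r < len′ c → G c r ≢ 0 → eval w M (off c + r) a ≡ ad c r)
    (ad-injective : ∀ {c r c′ r′} → 1 ≤ c → c < C → r < len′ c → G c r ≢ 0 → 1 ≤ c′ → c′ < C → r′ < len′ c′ → G c′ r′ ≢ 0 →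
      ad c r ≡ ad c′ r′ → c ≡ c′ × r ≡ r′)
    (ad-key : ∀ {c r} → 1 ≤ c → c < C → r < len′ c → G c r ≢ 0 → ¬ T (fresh K (key A (ad c r)))) where

    record Acts (z x : ℕ) : Set where
      constructor acts
      field
        {c r} : ℕ
        1≤c : 1 ≤ c
        c<  : c < C
        r<  : r < len′ c
        on  : G c r ≢ 0
        z≡  : z ≡ off c + r
        x≡  : x ≡ ad c r

    plan : Plan (off C) g A a K
    plan = record
      { Dom       = Acts
      ; sound     = λ Wd inp z z< g≢0 → sound′ Wd inp z z< g≢0
      ; complete  = λ { Wd inp z x (acts 1≤c c< r< on refl refl) →
          segment-end 1≤c c< r< , (λ p → on (trans (sym (g-value Wd inp 1≤c c< r<)) p)) , a-value Wd inp 1≤c c< r< on }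
      ; injective = λ { (acts {c} {r} 1≤c c< r< on refl refl) (acts 1≤c′ c′< r′< on′ refl p) →
          cong₂ (λ c r → off c + r) (proj₁ (ad-injective 1≤c c< r< on 1≤c′ c′< r′< on′ p)) (proj₂ (ad-injective 1≤c c< r< on 1≤c′ c′< r′< on′ p)) }
      ; touches   = λ { (acts 1≤c c< r< on refl refl) → ad-key 1≤c c< r< on }
      }
      where
      sound′ : ∀ {M} (Wd : Words w M) → Inp M → ∀ z → z < off C → eval w M z g ≢ 0 → Acts z (eval w M z a)
      sound′ Wd inp z z< g≢0 with locate C z z<
      ... | c , r , 1≤c , c< , r< , refl = acts 1≤c c< r< on refl (a-value Wd inp 1≤c c< r< on)
        where on = λ p → g≢0 (trans (g-value Wd inp 1≤c c< r<) p)

    module _ (KE : Exp) (KE-value : ∀ {M} (Wd : Words w M) → Inp M → eval w M 0 KE ≡ off C) where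

      slot-scatter : ∀ v (vl : ℕ → ℕ → ℕ) {_ : T (ops KE + 2 * (ops g + ops a + ops v + 1) ≤ᵇ 5000)} →
        (∀ {M} (Wd : Words w M) (inp : Inp M) {c r} → 1 ≤ c → c < C → r < len′ c → G c r ≢ 0 → eval w M (off c + r) v ≡ vl c r) → Step
      slot-scatter v vl {small} vl≡ = scatter plan KE KE-value (≤-trans (off-mono C≤) (≤-trans (≤-reflexive (off-level (suc Λ) ≤-refl)) slots≤))
        v (λ d → vl (Acts.c d) (Acts.r d)) {small}
        (λ { Wd inp z x (acts 1≤c c< r< on refl refl) → vl≡ Wd inp 1≤c c< r< on })

      slot-packed : ∀ s h l (hi lo vl : ℕ → ℕ → ℕ)
        {_ : T ((ops KE + 2 * (1 + 1 + ops s + 1)) + ((ops KE + 4) + (ops KE + 2 * (ops g + ops a + ops (diffE (load dst h) (load dst l)) + 1))) ≤ᵇ 5000)} →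
        (∀ {M} (Wd : Words w M) (inp : Inp M) {c r} → 1 ≤ c → c < C → r < len′ c → G c r ≢ 0 →
          eval w M (off c + r) h ≡ hi c r × eval w M (off c + r) l ≡ lo c r × lo c r ≤ hi c r × hi c r ≤ off C) →
        (∀ {M} (Wd : Words w M) (inp : Inp M) {c r} → 1 ≤ c → c < C → r < len′ c → G c r ≢ 0 →
          Σ< (hi c r ∸ lo c r) (λ i → eval w M (lo c r + i) s) mod W ≡ vl c r) → Step
      slot-packed s h l hi lo vl {small} bounds vl≡ = packed plan KE KE-value (≤-trans off≤ slots≤) s h l
        (λ d → hi (Acts.c d) (Acts.r d)) (λ d → lo (Acts.c d) (Acts.r d)) (λ d → vl (Acts.c d) (Acts.r d))
        (≤-<-trans off≤ slots<) {small}
        (λ { Wd inp z x (acts 1≤c c< r< on refl refl) → bounds Wd inp 1≤c c< r< on })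
        (λ { Wd inp z x (acts 1≤c c< r< on refl refl) → vl≡ Wd inp 1≤c c< r< on })
        where
        off≤ : off C ≤ slots
        off≤ = ≤-trans (off-mono C≤) (≤-reflexive (off-level (suc Λ) ≤-refl))

    act : ∀ {c r} → 1 ≤ c → c < C → r < len′ c → G c r ≢ 0 → Acts (off c + r) (ad c r)
    act 1≤c c< r< on = acts 1≤c c< r< on refl refl

  slots₁ : ∀ {M} (Wd : Words w M) → Inp M → eval w M 0 slots₁E ≡ off (2 ^ Λ)
  slots₁ Wd inp = trans (valˢ (nV *ˢ lamV)) (trans (*-comm n Λ) (sym (off-level Λ (n≤1+n Λ))))
    where open Common Wd inp 0

  slots₂ : ∀ {M} (Wd : Words w M) → Inp M → eval w M 0 slots₂E ≡ off nodes
  slots₂ Wd inp = trans (valˢ (nV *ˢ (lamV +ˢ litˢ 1))) (trans (trans (*-comm n (Λ + 1)) (cong (_* n) (+-comm Λ 1))) (sym (off-level (suc Λ) ≤-refl)))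
    where open Common Wd inp 0

  2^Λ≤nodes : 2 ^ Λ ≤ nodes
  2^Λ≤nodes = 2^-mono (n≤1+n Λ)

  rank′ : ℕ → ℕ → ℕ → ℕ
  rank′ p β q = rk (len′ p) (bf p) β q

  multiple : ∀ {r k} → r mod k ≡ 0 → r ≡ r div k * k
  multiple {r} {k} r≡ = trans (divmod r k) (cong (_+ r div k * k) r≡)

  𝟙≡-true⁻¹ : ∀ {x y} → 𝟙≡ x y ≢ 0 → x ≡ y
  𝟙≡-true⁻¹ {x} {y} p with x ≟ y
  ... | yes q = q
  ... | no q = ⊥-elim (p (𝟙≡-false q))

  n<W : n < W
  n<W = <-≤-trans n< (2^-mono (≤-trans (*-monoˡ-≤ θ (s≤s (z≤n {63}))) 64θ≤w))

  small-row : ∀ {row} → row ≤ n + 2 → row < 4 * n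
  small-row row≤ = ≤-<-trans row≤ (n+2<4n 1≤n)

  𝟙*-≢0 : ∀ {x y} → x * y ≢ 0 → x ≢ 0 × y ≢ 0
  𝟙*-≢0 {x} {y} p = (λ q → p (cong (_* y) q)) , (λ q → p (trans (cong (x *_) q) (*-zeroʳ x)))

  field-key : ∀ K {p row f} → f < 16 → ¬ T (fresh K (f + 100)) → ¬ T (fresh K (key aux (16 * (4 * n * p + row) + f)))
  field-key K {p} {row} f< ¬fr = subst (λ t → ¬ T (fresh K (t + 100))) (sym (cell-field p row f<)) ¬fr

  own-key : ∀ k → ¬ T (fresh (k ∷ []) k)
  own-key k with k ≡ᵇ k | ≡⇒≡ᵇ k k refl
  ... | true | _ = λ x → x

  -- A segment cut off at the end of a node, padded with zeros.
  Σ-padded : ∀ k m r {f g} → (∀ i → i < k → r + i < m → f i ≡ g i) → (∀ i → m ≤ r + i → g i ≡ 0) → Σ< (k ⊓ (m ∸ r)) f ≡ Σ< k g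
  Σ-padded k m r {f} {g} f≡g g≡0 = trans (Σ-cong (k ⊓ (m ∸ r)) λ i i< → f≡g i (<-≤-trans i< (m⊓n≤m k (m ∸ r))) (inside i i<))
    (sym (Σ-extend g (m⊓n≤m k (m ∸ r)) λ i ≤i i<k → g≡0 i (beyond i ≤i i<k)))
    where
    inside : ∀ i → i < k ⊓ (m ∸ r) → r + i < m
    inside i i< = ≰⇒> λ m≤ → <⇒≱ (<-≤-trans i< (m⊓n≤n k (m ∸ r))) (m≤n+o⇒m∸n≤o m r m≤)
    beyond : ∀ i → k ⊓ (m ∸ r) ≤ i → i < k → m ≤ r + i
    beyond i ≤i i<k with ≤-total k (m ∸ r)
    ... | inj₁ k≤ = ⊥-elim (<⇒≱ i<k (subst (_≤ i) (m≤n⇒m⊓n≡m k≤) ≤i))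
    ... | inj₂ ≤k = ≤-trans (m≤n+m∸n m r) (+-monoʳ-≤ r (subst (_≤ i) (m≥n⇒m⊓n≡n ≤k) ≤i))

  -- When every element carries the place value of its block, one sum over the superblock is already
  -- the word of block counts. So the same prefix sum both counts and packs.
  pack-blocks : ∀ (v : ℕ → ℕ) → Σ< B (λ i → v i * 2 ^ (ℓ * (i div b))) ≡ pack ℓ F (λ u → Σ< b (λ i → v (u * b + i)))
  pack-blocks v = trans (cong (λ k → Σ< k (λ i → v i * 2 ^ (ℓ * (i div b)))) (*-comm b F))
    (trans (Σ-blocks F b (λ i → v i * 2 ^ (ℓ * (i div b)))) (Σ-cong F λ u _ → trans (Σ-cong b {g = λ i → v (u * b + i) * 2 ^ (ℓ * u)} λ i i<b →
        cong (λ t → v (u * b + i) * 2 ^ (ℓ * t)) (div-unique u i<b (+-comm (u * b) i)))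
      (Σ-*ʳ b (λ i → v (u * b + i)) (2 ^ (ℓ * u)))))

  pack-fits : ∀ {N v} → N ≤ F → (∀ u → u < N → v u < 2 ^ ℓ) → pack ℓ N v < W
  pack-fits {N} N≤ v< = <-≤-trans (pack< ℓ N v<) (2^-mono (≤-trans (*-monoʳ-≤ ℓ N≤) (<⇒≤ ℓF<w)))

  shifted : ∀ {M} (Wd : Words w M) z {xE yE x y} → At._⇓_ M Wd z xE x → At._⇓_ M Wd z yE y → x < 2 ^ ℓ → y < F →
    At._⇓_ M Wd z yE y → At._⇓_ M Wd z ℓE ℓ → At._⇓_ M Wd z (xE ⊗ 2^E (ℓE ⊗ yE)) (x * 2 ^ (ℓ * y))
  shifted {M} Wd z {x = x} {y} xV yV x< y< _ ℓV = mul⇓ xV (2^⇓ (mul⇓ ℓV yV (mul<ʷ (<⇒≤ ℓy<w))) ℓy<w)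
      (<-≤-trans (*-monoˡ-< (2 ^ (ℓ * y)) {{m^n≢0 2 (ℓ * y)}} x<) (≤-trans (≤-reflexive (sym (2^-+ ℓ (ℓ * y))))
        (2^-mono (≤-trans (≤-reflexive (sym (*-suc ℓ y))) (≤-trans (*-monoʳ-≤ ℓ y<) (<⇒≤ ℓF<w))))))
    where
    open At M Wd z
    ℓy<w : ℓ * y < w
    ℓy<w = ≤-<-trans (*-monoʳ-≤ ℓ (<⇒≤ y<)) ℓF<w

  1<2^ℓ : 1 < 2 ^ ℓ
  1<2^ℓ = ≤-trans (≤-reflexive (sym (*-identityʳ 2))) (2^-mono {1} 0<ℓ)

  b≤B : b ≤ B
  b≤B = m≤m*n b F {{>-nonZero 0<F}}

  B<2^ℓ : B < 2 ^ ℓ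
  B<2^ℓ = <-≤-trans B<ℓ (m∸n≤m (2 ^ ℓ) 1)

  -- The rank directory: field 8 β of row s + 1 of a node counts the bits β before
  -- its superblock s, field 8 β + 1 packs the counts of the blocks of s.
  module RankSteps (β : ℕ) (β≤1 : β ≤ 1) where

    f<16 : ∀ f {_ : T (f <ᵇ 8)} → f + 8 * β < 16
    f<16 f {ok} = +-mono-<-≤ (<ᵇ⇒< f 8 ok) (*-monoʳ-≤ 8 β≤1)

    ok : ∀ {x} → x ≤ 15 → T (x <ᵇ 1024)
    ok x≤ = <⇒<ᵇ (≤-<-trans x≤ (<ᵇ⇒< 15 1024 tt))

    module _ (f : ℕ) {f<8 : T (f <ᵇ 8)} where

      ad : ℕ → ℕ → ℕ
      ad c r = 16 * (4 * n * c + (r div B + 1)) + (f + 8 * β)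

      row< : ∀ {c r} → r < len′ c → r div B + 1 < 4 * n
      row< {c} {r} r< = small-row (+-mono-≤ (≤-trans (div≤ r B) (≤-trans (<⇒≤ r<) (len≤n c))) (s≤s z≤n))

      private
        g-value : ∀ {M} (Wd : Words w M) (inp : Inp M) {c r} → 1 ≤ c → c < 2 ^ Λ → r < len′ c → eval w M (off c + r) superStartE ≡ 𝟙≡ (r mod B) 0
        g-value Wd inp 1≤c c< r< = valˢ (eqˢ (idxV %ˢ BV) (litˢ 0))
          where open Slot Wd inp 1≤c (<-≤-trans c< 2^Λ≤nodes) r<

        a-value : ∀ {M} (Wd : Words w M) (inp : Inp M) {c r} → 1 ≤ c → c < 2 ^ Λ → r < len′ c → 𝟙≡ (r mod B) 0 ≢ 0 → eval w M (off c + r) (rankCellE β f) ≡ ad c r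
        a-value Wd inp 1≤c c< r< _ = valˢ (cellV nodV (idxV /ˢ BV +ˢ litˢ 1) (weaken 4 (≤ᵇ⇒≤ 1 4 _) (litˢ (f + 8 * β) {ok (s≤s⁻¹ (f<16 f {f<8}))})))
          where open Slot Wd inp 1≤c (<-≤-trans c< 2^Λ≤nodes) r<

        ad-injective : ∀ {c r c′ r′} → 1 ≤ c → c < 2 ^ Λ → r < len′ c → 𝟙≡ (r mod B) 0 ≢ 0 → 1 ≤ c′ → c′ < 2 ^ Λ → r′ < len′ c′ → 𝟙≡ (r′ mod B) 0 ≢ 0 →
          ad c r ≡ ad c′ r′ → c ≡ c′ × r ≡ r′
        ad-injective _ _ r< on _ _ r′< on′ p = case row-unique (row< r<) (row< r′<) (f<16 f {f<8}) (f<16 f {f<8}) p of λ { (refl , rows , _) →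
          refl , trans (multiple {k = B} (𝟙≡-true⁻¹ on)) (trans (cong (_* B) (+-cancelʳ-≡ 1 _ _ rows)) (sym (multiple {k = B} (𝟙≡-true⁻¹ on′)))) }

        keys : List ℕ
        keys = (f + 8 * β + 100) ∷ []

        ad-key : ∀ {c r} → 1 ≤ c → c < 2 ^ Λ → r < len′ c → 𝟙≡ (r mod B) 0 ≢ 0 → ¬ T (fresh keys (key aux (ad c r)))
        ad-key {c} {r} _ _ _ _ = field-key keys {c} {r div B + 1} (f<16 f {f<8}) (own-key (f + 8 * β + 100))

      open OverSlots (2 ^ Λ) (0<2^ Λ) 2^Λ≤nodes superStartE aux (rankCellE β f) keys (λ c r → 𝟙≡ (r mod B) 0) ad g-value a-value ad-injective ad-key public

    indV : ∀ {M} (Wd : Words w M) (inp : Inp M) {c r} → 1 ≤ c → c < 2 ^ Λ → r < len′ c →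
      At._⇓_ M Wd (off c + r) (indicatorE β) (ind (len′ c) (bf c) β r)
    indV Wd inp {c} {r} 1≤c c< r< = cast (sym (trans (cong (_* 𝟙≡ (bf c r) β) (𝟙<-true r<)) (*-identityˡ _)))
        (↓ eqˢ bitV (litˢ β {ok (≤-trans β≤1 (s≤s z≤n))}))
      where open Slot Wd inp 1≤c (<-≤-trans c< 2^Λ≤nodes) r<

    rank≤ : ∀ c q → rank′ c β q ≤ q
    rank≤ c q = ≤-trans (Σ-≤ q (λ i _ → *-mono-≤ (𝟙≤1 (i <ᵇ len′ c)) (𝟙≤1 (bf c i ≡ᵇ β)))) (≤-reflexive (trans (Σ-const q 1) (*-identityʳ q)))

    R-step : Step
    R-step = slot-packed 0 slots₁E slots₁ (indicatorE β) pid (load start nodE) (λ c r → off c + r) (λ c _ → off c) (λ c r → rank′ c β r)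
      (λ Wd inp {c} {r} 1≤c c< r< _ → let open Slot Wd inp 1≤c (<-≤-trans c< 2^Λ≤nodes) r< in
        valˢ pidV , valˢ offV , m≤m+n (off c) r , <⇒≤ (segment-end 1≤c c< r<))
      (λ Wd inp {c} {r} 1≤c c< r< _ → trans (cong (_mod W) (trans (Σ-length (m+n∸m≡n (off c) r))
          (Σ-cong r λ i i<r → val (indV Wd inp 1≤c c< (<-trans i<r r<)))))
        (mod-small (≤-<-trans (rank≤ c r) (<-≤-trans (<-≤-trans r< (len≤n c)) (<⇒≤ n<W)))))

    D-step : Step
    D-step = slot-packed 1 slots₁E slots₁ (countSrcE β) spanE pid
      (λ c r → off c + r + (B ⊓ (len′ c ∸ r))) (λ c r → off c + r) (λ c r → pack ℓ F (counts (len′ c) (bf c) β (r div B)))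
      (λ Wd inp {c} {r} 1≤c c< r< _ → let open Slot Wd inp 1≤c (<-≤-trans c< 2^Λ≤nodes) r< in
        valˢ (pidV +ˢ minV BV lenIdxV) , valˢ pidV , m≤m+n (off c + r) _ , end≤ 1≤c c< r<)
      (λ Wd inp {c} {r} 1≤c c< r< on → trans (cong (_mod W) (total Wd inp 1≤c c< r< (multiple {k = B} (𝟙≡-true⁻¹ on))))
        (mod-small (pack-fits ≤-refl (λ u _ → ≤-<-trans (counts≤ c (r div B) u) (≤-<-trans b≤B B<2^ℓ)))))
      where
      end≤ : ∀ {c r} → 1 ≤ c → c < 2 ^ Λ → r < len′ c → off c + r + (B ⊓ (len′ c ∸ r)) ≤ off (2 ^ Λ)
      end≤ {c} {r} 1≤c c< r< = ≤-trans (≤-reflexive (+-assoc (off c) r _)) (≤-trans (+-monoʳ-≤ (off c) (≤-trans (+-monoʳ-≤ r (m⊓n≤n B (len′ c ∸ r))) (≤-reflexive (m+[n∸m]≡n (<⇒≤ r<)))))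
        (≤-trans (≤-reflexive (sym (off-suc c 1≤c))) (off-mono c<)))
      counts≤ : ∀ c s u → counts (len′ c) (bf c) β s u ≤ b
      counts≤ c s u = ≤-trans (Σ-≤ b (λ i _ → *-mono-≤ (𝟙≤1 (s * B + (u * b + i) <ᵇ len′ c)) (𝟙≤1 (bf c (s * B + (u * b + i)) ≡ᵇ β)))) (≤-reflexive (trans (Σ-const b 1) (*-identityʳ b)))
      total : ∀ {M} (Wd : Words w M) (inp : Inp M) {c r} → 1 ≤ c → c < 2 ^ Λ → r < len′ c → r ≡ r div B * B →
        Σ< (off c + r + (B ⊓ (len′ c ∸ r)) ∸ (off c + r)) (λ i → eval w M (off c + r + i) (countSrcE β)) ≡ pack ℓ F (counts (len′ c) (bf c) β (r div B))
      total {M} Wd inp {c} {r} 1≤c c< r< r≡ = trans (Σ-length (m+n∸m≡n (off c + r) _))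
        (trans (Σ-padded B (len′ c) r {g = λ i → ind (len′ c) (bf c) β (s * B + i) * 2 ^ (ℓ * (i div b))} term
            (λ i m≤ → cong (_* 2 ^ (ℓ * (i div b))) (cong (_* 𝟙≡ (bf c (s * B + i)) β) (𝟙<-false (subst (λ t → len′ c ≤ t + i) r≡ m≤)))))
          (pack-blocks (λ i → ind (len′ c) (bf c) β (s * B + i))))
        where
        s = r div B
        term : ∀ i → i < B → r + i < len′ c → eval w M (off c + r + i) (countSrcE β) ≡ ind (len′ c) (bf c) β (s * B + i) * 2 ^ (ℓ * (i div b))
        term i i<B r+i< = trans (cong (λ z → eval w M z (countSrcE β)) (+-assoc (off c) r i))
          (trans (val (shifted Wd (off c + (r + i)) (indV Wd inp 1≤c c< r+i<) blkV (≤-<-trans (*-mono-≤ (𝟙≤1 (r + i <ᵇ len′ c)) (𝟙≤1 (bf c (r + i) ≡ᵇ β))) 1<2^ℓ) blk< blkV (↓ ℓV)))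
            (cong₂ (λ x y → ind (len′ c) (bf c) β x * 2 ^ (ℓ * (y div b))) (cong (_+ i) r≡) y≡))
          where
          open Slot Wd inp 1≤c (<-≤-trans c< 2^Λ≤nodes) r+i<
          blkV : idxE ⊛ BE ⊘ bE ⇓ (r + i) mod B div b
          blkV = ↓ (idxV %ˢ BV /ˢ bV)
          blk< : (r + i) mod B div b < F
          blk< = div< (subst ((r + i) mod B <_) (*-comm b F) (mod< (r + i) 0<B))
          y≡ : (r + i) mod B ≡ i
          y≡ = mod-unique s i<B (trans (cong (_+ i) r≡) (+-comm (s * B) i))

-- Packing the bitmaps into words

≥2E : Exp
≥2E   = ltE nE (pid ⊕ lit 1)

sbE : Exp → Exp
sbE x = load pos x ⊘ BE

bitWordE : Exp
bitWordE = bitE ⊗ 2^E (pid ⊛ wE)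

bitsP : Program
bitsP = packP slots₁E bitWordE (eqE (pid ⊛ wE) (lit 0)) bits (pid ⊘ wE) (pid ⊕ minE wE (slots₁E ⊖ pid)) pid

module MoreSteps (𝒮 : Setting) where

  open Steps 𝒮 public

  -- The bits of all slots, in the order of the nodes.
  bslot : ℕ → ℕ
  bslot z with z <? off (2 ^ Λ)
  ... | no _  = 0
  ... | yes z< with locate (2 ^ Λ) z z<
  ...   | c , r , _ = bf c r

  bslot≡ : ∀ {c r} → 1 ≤ c → c < 2 ^ Λ → r < len′ c → bslot (off c + r) ≡ bf c r
  bslot≡ {c} {r} 1≤c c< r< with off c + r <? off (2 ^ Λ)
  ... | no z≮ = ⊥-elim (z≮ (segment-end 1≤c c< r<))
  ... | yes z< with locate (2 ^ Λ) (off c + r) z<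
  ...   | c′ , r′ , 1≤c′ , c′< , r′< , z≡ = case segment-unique 1≤c 1≤c′ r< r′< z≡ of λ { (refl , refl) → refl }

  bslot<2 : ∀ z → bslot z < 2
  bslot<2 z with z <? off (2 ^ Λ)
  ... | no _  = s≤s z≤n
  ... | yes z< with locate (2 ^ Λ) z z<
  ...   | c , r , _ = branchBit<2 (depth c) (nth (seq c) r)

  N₁ : ℕ
  N₁ = off (2 ^ Λ)

  -- Words are aligned with the slots of the whole structure and not with the nodes, so a word may
  -- contain bits of several nodes; hence the sums are taken over `bslot`.
  module BitSteps where

    private
      G ad : ℕ → ℕ → ℕ
      G c r = 𝟙≡ ((off c + r) mod w) 0
      ad c r = (off c + r) div w

      g-value : ∀ {M} (Wd : Words w M) (inp : Inp M) {c r} → 1 ≤ c → c < 2 ^ Λ → r < len′ c → eval w M (off c + r) (eqE (pid ⊛ wE) (lit 0)) ≡ G c r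
      g-value Wd inp 1≤c c< r< = valˢ (eqˢ (pidV %ˢ wV) (litˢ 0))
        where open Slot Wd inp 1≤c (<-≤-trans c< 2^Λ≤nodes) r<

      a-value : ∀ {M} (Wd : Words w M) (inp : Inp M) {c r} → 1 ≤ c → c < 2 ^ Λ → r < len′ c → G c r ≢ 0 → eval w M (off c + r) (pid ⊘ wE) ≡ ad c r
      a-value Wd inp 1≤c c< r< _ = valˢ (pidV /ˢ wV)
        where open Slot Wd inp 1≤c (<-≤-trans c< 2^Λ≤nodes) r<

      ad-injective : ∀ {c r c′ r′} → 1 ≤ c → c < 2 ^ Λ → r < len′ c → G c r ≢ 0 → 1 ≤ c′ → c′ < 2 ^ Λ → r′ < len′ c′ → G c′ r′ ≢ 0 →
        ad c r ≡ ad c′ r′ → c ≡ c′ × r ≡ r′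
      ad-injective 1≤c _ r< on 1≤c′ _ r′< on′ p = segment-unique 1≤c 1≤c′ r< r′<
        (trans (multiple {k = w} (𝟙≡-true⁻¹ on)) (trans (cong (_* w) p) (sym (multiple {k = w} (𝟙≡-true⁻¹ on′)))))

      ad-key : ∀ {c r} → 1 ≤ c → c < 2 ^ Λ → r < len′ c → G c r ≢ 0 → ¬ T (fresh (bits ∷ []) (key bits (ad c r)))
      ad-key _ _ _ _ ()

    open OverSlots (2 ^ Λ) (0<2^ Λ) 2^Λ≤nodes (eqE (pid ⊛ wE) (lit 0)) bits (pid ⊘ wE) (bits ∷ []) G ad g-value a-value ad-injective ad-key public

    bits-step : Step
    bits-step = slot-packed slots₁E slots₁ bitWordE (pid ⊕ minE wE (slots₁E ⊖ pid)) pid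
      (λ c r → off c + r + (w ⊓ (N₁ ∸ (off c + r)))) (λ c r → off c + r) (λ c r → pack 1 (w ⊓ (N₁ ∸ (off c + r))) (λ i → bslot (off c + r + i)))
      (λ Wd inp {c} {r} 1≤c c< r< _ → let open Slot Wd inp 1≤c (<-≤-trans c< 2^Λ≤nodes) r< in
        valˢ (pidV +ˢ minV wV (castˢ (trans (*-comm n Λ) (sym (off-level Λ (n≤1+n Λ)))) (nV *ˢ lamV) -ˢ pidV)) , valˢ pidV , m≤m+n (off c + r) _ ,
        ≤-trans (+-monoʳ-≤ (off c + r) (m⊓n≤n w _)) (≤-reflexive (m+[n∸m]≡n (<⇒≤ (segment-end 1≤c c< r<)))))
      (λ Wd inp {c} {r} 1≤c c< r< on → trans (cong (_mod W) (trans (Σ-length (m+n∸m≡n (off c + r) _))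
          (Σ-cong (w ⊓ (N₁ ∸ (off c + r))) (λ i i< → term Wd inp (multiple {k = w} (𝟙≡-true⁻¹ on)) i (<-≤-trans i< (m⊓n≤m w _))
            (subst (off c + r + i <_) (m+[n∸m]≡n (<⇒≤ (segment-end 1≤c c< r<))) (+-monoʳ-< (off c + r) (<-≤-trans i< (m⊓n≤n w _))))))))
        (mod-small (<-≤-trans (pack< 1 (w ⊓ (N₁ ∸ (off c + r))) (λ i _ → bslot<2 (off c + r + i))) (2^-mono (≤-trans (≤-reflexive (*-identityˡ _)) (m⊓n≤m w _))))))
      where
      term : ∀ {M} (Wd : Words w M) (inp : Inp M) {z} → z ≡ z div w * w → ∀ i → i < w → z + i < N₁ →
        eval w M (z + i) bitWordE ≡ bslot (z + i) * 2 ^ (1 * i)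
      term {M} Wd inp {z} z≡ i i<w z+i< with locate (2 ^ Λ) (z + i) z+i<
      ... | c′ , r′ , 1≤c′ , c′< , r′< , at = trans (cong (λ t → eval w M t bitWordE) at)
            (trans (val (mul⇓ (↓ bitV) (2^⇓ rem≡ i<w) fits)) (cong₂ _*_ (trans (sym (bslot≡ 1≤c′ c′< r′<)) (cong bslot (sym at))) (cong (2 ^_) (sym (*-identityˡ i)))))
        where
        open Slot Wd inp 1≤c′ (<-≤-trans c′< 2^Λ≤nodes) r′<
        rem≡ : pid ⊛ wE ⇓ i
        rem≡ = cast (trans (cong (_mod w) (sym at)) (mod-unique (z div w) i<w (trans (cong (_+ i) z≡) (+-comm (z div w * w) i)))) (↓ (pidV %ˢ wV))
        fits : bf c′ r′ * 2 ^ i < W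
        fits = <-≤-trans (*-monoˡ-< (2 ^ i) {{m^n≢0 2 i}} (branchBit<2 (depth c′) (nth (seq c′) r′))) (2^-mono i<w)

    bits-stored : ∀ {M} → Step.Fact bits-step M → ∀ {p q} → 1 ≤ p → p < 2 ^ Λ → q < len′ p → bitAt w M bits (off p + q) ≡ bf p q
    bits-stored {M} fact {p} {q} 1≤p p< q< = go (locate (2 ^ Λ) ((off p + q) div w * w) (≤-<-trans (div*≤ (off p + q) w) (segment-end 1≤p p< q<)))
     where
     go : (∃[ c ] ∃[ r ] 1 ≤ c × c < 2 ^ Λ × r < len′ c × (off p + q) div w * w ≡ off c + r) → bitAt w M bits (off p + q) ≡ bf p q
     go (c , r , 1≤c , c< , r< , at) = trans (cong (λ t → bit i t) word) (trans (cong (λ k → pack 1 N v div 2 ^ k mod 2) (sym (*-identityˡ i)))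
          (trans (pack-digit 1 N (λ j _ → bslot<2 (z₀ + j)) i<N) (trans (cong bslot z₀+i) (bslot≡ 1≤p p< q<))))
      where
      z = off p + q
      i = z mod w
      z₀ = off c + r
      N = w ⊓ (N₁ ∸ z₀)
      v = λ j → bslot (z₀ + j)
      z₀+i : z₀ + i ≡ z
      z₀+i = trans (cong (_+ i) (sym at)) (trans (+-comm (z div w * w) i) (sym (divmod z w)))
      z₀-div : z₀ div w ≡ z div w
      z₀-div = trans (cong (_div w) (sym at)) (*-cancel-div (z div w) 1≤w)
      on : 𝟙≡ (z₀ mod w) 0 ≢ 0
      on p = case trans (sym (cong (λ t → 𝟙≡ t 0) (trans (cong (_mod w) (sym at)) (trans (mod-+* 0 (z div w) w) 0mod)))) p of λ ()
        where
        0mod : 0 mod w ≡ 0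
        0mod = mod-small 1≤w
      word : M bits (z div w) ≡ pack 1 N v
      word = trans (cong (M bits) (sym z₀-div)) (fact z₀ (z₀ div w) (act 1≤c c< r< on))
      i<N : i < N
      i<N = ⊓-pres-m< (mod< z 1≤w) (m+n≤o⇒m≤o∸n (suc i) (subst (_≤ N₁) (trans (cong suc (sym z₀+i)) (trans (cong suc (+-comm z₀ i)) refl)) (segment-end 1≤p p< q<)))

-- Select directory: the occurrences of a bit are the elements of a child

gfE glE slE longE childE betaOfE : Exp
gfE     = pid ⊖ idxE ⊛ BE
glE     = gfE ⊕ minE (BE) (lnE ⊖ (idxE ⊖ idxE ⊛ BE)) ⊖ lit 1
slE     = pid ⊕ minE (bE) (lnE ⊖ idxE) ⊖ lit 1
longE   = ltE (sbE gfE ⊕ BE) (sbE glE)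
childE  = nodE ⊘ lit 2
betaOfE = nodE ⊛ lit 2

childGuardE : Exp → Exp
childGuardE h = ≥2E ⊗ h

childCellE : ℕ → Exp → Exp
childCellE f row = cellE childE row (lit f ⊕ lit 8 ⊗ betaOfE)

module ChildSteps (𝒮 : Setting) where

  open MoreSteps 𝒮 public

  -- Element r of a node c ≥ 2 is occurrence r of the bit c mod 2 in its parent.
  Qc sb : ℕ → ℕ → ℕ
  Qc c r = Q (c div 2) (c mod 2) r
  sb c r = Qc c r div B

  -- The first and last elements of the group of r, and the last of its subgroup.
  gf : ℕ → ℕ
  gf r = r ∸ r mod B

  gl sl long : ℕ → ℕ → ℕ
  gl c r = gf r + (B ⊓ (len′ c ∸ gf r)) ∸ 1
  sl c r = r + (b ⊓ (len′ c ∸ r)) ∸ 1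
  -- The threshold `B` is the number of positions that a group has to store: a group spread over
  -- more than `B` superblocks finds that many rows among its own.
  long c r = 𝟙< (sb c (gf r) + B) (sb c (gl c r))

  c≡ : ∀ c → c ≡ 2 * (c div 2) + c mod 2
  c≡ c = trans (divmod c 2) (trans (+-comm (c mod 2) _) (cong (_+ c mod 2) (*-comm (c div 2) 2)))

  module Parent {c : ℕ} (2≤c : 2 ≤ c) (c< : c < nodes) where

    p β : ℕ
    p = c div 2
    β = c mod 2

    1≤c : 1 ≤ c
    1≤c = ≤-trans (s≤s z≤n) 2≤c

    1≤p : 1 ≤ p
    1≤p = ≤div {q = 1} (s≤s z≤n) 2≤c

    p< : p < 2 ^ Λ
    p< = div< (subst (c <_) (*-comm 2 (2 ^ Λ)) c<)

    β≤1 : β ≤ 1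
    β≤1 = s≤s⁻¹ (mod< c (s≤s (z≤n {1})))

    seq≡ : seq c ≡ filter (λ v → branchBit (depth p) v ≟ β) (seq p)
    seq≡ = trans (cong seq (c≡ c)) (seq-child p β 1≤p (depth-< 1≤p p<) β≤1)

    Q-spec : ∀ {r} → r < len′ c → Qc c r < len′ p × ind (len′ p) (bf p) β (Qc c r) ≡ 1 × rank′ p β (Qc c r) ≡ r
    Q-spec {r} r< = proj₁ spec , proj₁ (proj₂ spec) , proj₁ (proj₂ (proj₂ spec))
      where spec = Occurrences.position-spec (branchBit (depth p)) β (λ v → branchBit (depth p) v ≟ β) (seq p) r (subst (r <_) (cong length seq≡) r<)

    Q-mono : ∀ {r r′} → r < r′ → r′ < len′ c → Qc c r < Qc c r′
    Q-mono {r} {r′} r<r′ r′< = ≰⇒> λ Q≥ → <⇒≱ r<r′ (subst₂ _≤_ (proj₂ (proj₂ (Q-spec r′<))) (proj₂ (proj₂ (Q-spec (<-trans r<r′ r′<)))) (Σ-mono (ind (len′ p) (bf p) β) Q≥))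

    sb-mono : ∀ {r r′} → r ≤ r′ → r′ < len′ c → sb c r ≤ sb c r′
    sb-mono {r} {r′} r≤ r′< with m≤n⇒m<n∨m≡n r≤
    ... | inj₁ r<r′ = div-mono B (<⇒≤ (Q-mono r<r′ r′<))
    ... | inj₂ refl = ≤-refl

    Q<n : ∀ {r} → r < len′ c → Qc c r < n
    Q<n r< = <-≤-trans (proj₁ (Q-spec r<)) (len≤n p)

    sb<n : ∀ {r} → r < len′ c → sb c r < n
    sb<n r< = ≤-<-trans (div≤ _ B) (Q<n r<)

  gf≤ : ∀ r → gf r ≤ r
  gf≤ r = m∸n≤m r (r mod B)

  gf≡ : ∀ r → gf r ≡ r div B * B
  gf≡ r = trans (cong (_∸ r mod B) (divmod r B)) (m+n∸m≡n (r mod B) (r div B * B))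

  gf+ : ∀ r → gf r + r mod B ≡ r
  gf+ r = m∸n+n≡m (mod≤ r B)

  last< : ∀ {k r m} → 0 < k → r < m → r + (k ⊓ (m ∸ r)) ∸ 1 < m
  last< {k} {r} {m} 0<k r<m = ≤-trans (≤-reflexive (m+[n∸m]≡n (≤-trans (⊓-pres-m< 0<k (m<n⇒0<n∸m r<m)) (m≤n+m _ r))))
    (≤-trans (+-monoʳ-≤ r (m⊓n≤n k (m ∸ r))) (≤-reflexive (m+[n∸m]≡n (<⇒≤ r<m))))

  ≤last : ∀ {k r m x} → r + x < m → x < k → r + x ≤ r + (k ⊓ (m ∸ r)) ∸ 1
  ≤last {k} {r} {m} {x} r+x< x<k = ≤-trans (≤-reflexive (sym (m+n∸n≡m (r + x) 1))) (∸-monoˡ-≤ 1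
    (≤-trans (≤-reflexive (+-assoc r x 1)) (+-monoʳ-≤ r (subst (_≤ k ⊓ (m ∸ r)) (+-comm 1 x) (⊓-pres-m< x<k (m+n≤o⇒m≤o∸n (suc x) (subst (_≤ m) (cong suc (+-comm r x)) r+x<)))))))

  gl< : ∀ {c r} → r < len′ c → gl c r < len′ c
  gl< {c} {r} r< = last< 0<B (≤-<-trans (gf≤ r) r<)

  ≤gl : ∀ {c r x} → gf r + x < len′ c → x < B → gf r + x ≤ gl c r
  ≤gl = ≤last

  gl<gf : ∀ {c r r′} → gf r < gf r′ → gl c r < gf r′
  gl<gf {c} {r} {r′} lts = pred< (≤-trans (+-monoʳ-≤ (gf r) (m⊓n≤m B (len′ c ∸ gf r))) next) (≤-<-trans z≤n lts)
    where
    pred< : ∀ {x y} → x ≤ y → 0 < y → x ∸ 1 < y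
    pred< {zero}  _  0<y = 0<y
    pred< {suc x} x≤ _   = x≤
    next : gf r + B ≤ gf r′
    next = subst₂ (λ x y → x + B ≤ y) (sym (gf≡ r)) (sym (gf≡ r′))
      (≤-trans (≤-reflexive (+-comm (r div B * B) B)) (*-monoˡ-≤ B (*-cancelʳ-< B (r div B) (r′ div B) (subst₂ _<_ (gf≡ r) (gf≡ r′) lts))))

  module ChildSlot {M} (Wd : Words w M) (inp : Inp M) {c r : ℕ} (2≤c : 2 ≤ c) (c< : c < nodes) (r< : r < len′ c) where

    open Parent 2≤c c< public
    open Slot Wd inp 1≤c c< r< public

    posV : ∀ {xE s r′} → xE ⇓⟨ s ⟩ off c + r′ → r′ < len′ c → load pos xE ⇓⟨ 1 ⟩ Qc c r′
    posV {r′ = r′} xV r′< = loadˢ 1 xV (trans (cong (λ t → M pos (off t + r′)) (c≡ c)) (pos-stored p β r′ 1≤p p< β≤1 (subst (λ t → r′ < len′ t) (c≡ c) r′<)))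
      (<-trans (Q<n r′<) n<)

    sbV : ∀ {xE s r′} → xE ⇓⟨ s ⟩ off c + r′ → r′ < len′ c → sbE xE ⇓⟨ 1 ⟩ sb c r′
    sbV xV r′< = posV xV r′< /ˢ BV

    gf< : gf r < len′ c
    gf< = ≤-<-trans (gf≤ r) r<

    gfV : gfE ⇓⟨ 2 ⟩ off c + gf r
    gfV = castˢ (+-∸-assoc (off c) (mod≤ r B)) (pidV -ˢ idxV %ˢ BV)

    glV : glE ⇓⟨ 5 ⟩ off c + gl c r
    glV = castˢ (shape (off c) (gf r) _ (⊓-pres-m< 0<B (m<n⇒0<n∸m gf<))) (gfV +ˢ minV BV (lenV -ˢ (idxV -ˢ idxV %ˢ BV)) -ˢ litˢ 1)
      where
      shape : ∀ a x k → 0 < k → a + x + k ∸ 1 ≡ a + (x + k ∸ 1)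
      shape a x k 0<k = trans (cong (_∸ 1) (+-assoc a x k)) (+-∸-assoc a (≤-trans 0<k (m≤n+m k x)))

    slV : slE ⇓⟨ 4 ⟩ off c + sl c r
    slV = castˢ (shape (off c) r _ (⊓-pres-m< 0<b (m<n⇒0<n∸m r<))) (pidV +ˢ minV bV lenIdxV -ˢ litˢ 1)
      where
      shape : ∀ a x k → 0 < k → a + x + k ∸ 1 ≡ a + (x + k ∸ 1)
      shape a x k 0<k = trans (cong (_∸ 1) (+-assoc a x k)) (+-∸-assoc a (≤-trans 0<k (m≤n+m k x)))

    longV : longE ⇓⟨ 1 ⟩ long c r
    longV = ltˢ (sbV gfV gf< +ˢ BV) (sbV glV (gl< r<))

  -- The root fills exactly the slots below `n`, so comparing the slot with `n` excludes the one
  -- node that is no child.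
  ≥2 : ℕ → ℕ → ℕ
  ≥2 c r = 𝟙< n (off c + r + 1)

  ≥2-true : ∀ {c r} → 2 ≤ c → ≥2 c r ≡ 1
  ≥2-true {c} {r} 2≤c = 𝟙<-true (≤-<-trans (≤-trans (≤-reflexive (sym (off-2* 1 ≤-refl (0<2^ Λ)))) (≤-trans (off-mono 2≤c) (m≤m+n (off c) r))) (m<m+n (off c + r) z<s))

  ≥2-false : ∀ {r} → r < len′ 1 → ≥2 1 r ≡ 0
  ≥2-false {r} r< = 𝟙<-false (≤-trans (≤-reflexive (+-comm r 1)) (≤-trans r< (len≤n 1)))

  ≥2⁻¹ : ∀ {c r} → 1 ≤ c → r < len′ c → ≥2 c r ≢ 0 → 2 ≤ c
  ≥2⁻¹ {1} _ r< p = ⊥-elim (p (≥2-false r<))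
  ≥2⁻¹ {suc (suc c)} _ _ _ = s≤s (s≤s z≤n)

  -- The elements of a child fill the table of its parent. Rows need be distinct only within one
  -- child: its sibling uses the field 8 places away, and other parents own other rows.
  module ChildStep (f : ℕ) (f<8 : T (f <ᵇ 8)) (hE rE : Exp) (H row : ℕ → ℕ → ℕ)
    (h-value : ∀ {M} (Wd : Words w M) (inp : Inp M) {c r} (2≤c : 2 ≤ c) (c< : c < nodes) (r< : r < len′ c) → At._⇓_ M Wd (off c + r) hE (H c r))
    (r-value : ∀ {M} (Wd : Words w M) (inp : Inp M) {c r} (2≤c : 2 ≤ c) (c< : c < nodes) (r< : r < len′ c) → At._⇓⟨_⟩_ M Wd (off c + r) rE 10 (row c r))
    (row≤ : ∀ {c r} (2≤c : 2 ≤ c) (c< : c < nodes) (r< : r < len′ c) → H c r ≢ 0 → row c r ≤ n + 2)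
    (row-inj : ∀ {c r r′} (2≤c : 2 ≤ c) (c< : c < nodes) → r < len′ c → r′ < len′ c → H c r ≢ 0 → H c r′ ≢ 0 → row c r ≡ row c r′ → r ≡ r′) where

    private
      f< : f < 8
      f< = <ᵇ⇒< f 8 f<8

      1024-ok : T (f <ᵇ 1024)
      1024-ok = <⇒<ᵇ (<-≤-trans f< (≤ᵇ⇒≤ 8 1024 tt))

      field< : ∀ c → f + 8 * (c mod 2) < 16
      field< c = +-mono-<-≤ f< (*-monoʳ-≤ 8 (s≤s⁻¹ (mod< c (s≤s (z≤n {1})))))

    G ad : ℕ → ℕ → ℕ
    G c r = ≥2 c r * H c r
    ad c r = 16 * (4 * n * (c div 2) + row c r) + (f + 8 * (c mod 2))

    private
      split : ∀ {c r} → 1 ≤ c → r < len′ c → G c r ≢ 0 → 2 ≤ c × H c r ≢ 0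
      split {c} {r} 1≤c r< on = ≥2⁻¹ {c} {r} 1≤c r< (proj₁ (𝟙*-≢0 {≥2 c r} on)) , proj₂ (𝟙*-≢0 {≥2 c r} on)

      g-value : ∀ {M} (Wd : Words w M) (inp : Inp M) {c r} → 1 ≤ c → c < nodes → r < len′ c → eval w M (off c + r) (childGuardE hE) ≡ G c r
      g-value Wd inp {c} {r} 1≤c c< r< with m≤n⇒m<n∨m≡n 1≤c
      ... | inj₁ 2≤c = val (mul⇓ (↓ ltˢ nV (pidV +ˢ litˢ 1)) hV (subst (_< W) (sym (trans (cong (_* H c r) (≥2-true {c} {r} 2≤c)) (*-identityˡ _))) (word hV)))
        where
        open Slot Wd inp 1≤c c< r<
        hV = h-value Wd inp 2≤c c< r<
      ... | inj₂ refl = trans (val (mul⇓ (cast (≥2-false r<) (↓ ltˢ nV (pidV +ˢ litˢ 1))) (self hE) (0<2^ w))) (sym (cong (_* H 1 r) (≥2-false r<)))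
        where open Slot Wd inp 1≤c c< r<

    private
      same : ∀ {c r c′ r′} → 2 ≤ c → c < nodes → r < len′ c → H c r ≢ 0 → 2 ≤ c′ → c′ < nodes → r′ < len′ c′ → H c′ r′ ≢ 0 →
        c div 2 ≡ c′ div 2 × row c r ≡ row c′ r′ × f + 8 * (c mod 2) ≡ f + 8 * (c′ mod 2) → c ≡ c′ × r ≡ r′
      same {c} {r} {c′} {r′} 2≤c c< r< on 2≤c′ c′< r′< on′ (p≡ , row≡ , f≡) = go c≡c′ r′< on′ row≡
        where
        c≡c′ : c ≡ c′
        c≡c′ = trans (c≡ c) (trans (cong₂ (λ p β → 2 * p + β) p≡ (*-cancelˡ-≡ (c mod 2) (c′ mod 2) 8 (+-cancelˡ-≡ f _ _ f≡))) (sym (c≡ c′)))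
        go : c ≡ c′ → r′ < len′ c′ → H c′ r′ ≢ 0 → row c r ≡ row c′ r′ → c ≡ c′ × r ≡ r′
        go refl r′< on′ row≡ = refl , row-inj 2≤c c< r< r′< on on′ row≡
      touch : ∀ β → β ≤ 1 → ¬ T (fresh ((f + 100) ∷ (f + 8 + 100) ∷ []) (f + 8 * β + 100))
      touch 0 _ fr with f + 8 * 0 + 100 ≡ᵇ f + 100 | ≡⇒≡ᵇ (f + 8 * 0 + 100) (f + 100) (cong (_+ 100) (+-identityʳ f))
      ... | true | _ = fr
      touch 1 _ fr with f + 8 * 1 + 100 ≡ᵇ f + 100
      ... | true = fr
      ... | false with f + 8 * 1 + 100 ≡ᵇ f + 8 + 100 | ≡⇒≡ᵇ (f + 8 * 1 + 100) (f + 8 + 100) refl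
      ...   | true | _ = fr
      touch (suc (suc _)) (s≤s ())

    private
      a-value : ∀ {M} (Wd : Words w M) (inp : Inp M) {c r} → 1 ≤ c → c < nodes → r < len′ c → G c r ≢ 0 → eval w M (off c + r) (childCellE f rE) ≡ ad c r
      a-value Wd inp {c} {r} 1≤c c< r< on =
        valˢ (cellV (nodV /ˢ litˢ 2) (r-value Wd inp (proj₁ (split {c} {r} 1≤c r< on)) c< r<) (litˢ f {1024-ok} +ˢ litˢ 8 *ˢ (nodV %ˢ litˢ 2)))
        where open Slot Wd inp 1≤c c< r<

      ad-injective : ∀ {c r c′ r′} → 1 ≤ c → c < nodes → r < len′ c → G c r ≢ 0 → 1 ≤ c′ → c′ < nodes → r′ < len′ c′ → G c′ r′ ≢ 0 →
        ad c r ≡ ad c′ r′ → c ≡ c′ × r ≡ r′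
      ad-injective {c} {r} {c′} {r′} 1≤c c< r< on 1≤c′ c′< r′< on′ p =
        same (proj₁ s) c< r< (proj₂ s) (proj₁ s′) c′< r′< (proj₂ s′)
          (row-unique (small-row (row≤ (proj₁ s) c< r< (proj₂ s))) (small-row (row≤ (proj₁ s′) c′< r′< (proj₂ s′))) (field< c) (field< c′) p)
        where
        s  = split {c} {r} 1≤c r< on
        s′ = split {c′} {r′} 1≤c′ r′< on′

      keys : List ℕ
      keys = (f + 100) ∷ (f + 8 + 100) ∷ []

      ad-key : ∀ {c r} → 1 ≤ c → c < nodes → r < len′ c → G c r ≢ 0 → ¬ T (fresh keys (key aux (ad c r)))
      ad-key {c} {r} _ _ _ _ = field-key keys {c div 2} {row c r} (field< c) (touch (c mod 2) (s≤s⁻¹ (mod< c (s≤s (z≤n {1})))))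

    open OverSlots nodes (0<2^ (suc Λ)) ≤-refl (childGuardE hE) aux (childCellE f rE) keys G ad g-value a-value ad-injective ad-key public

    child-act : ∀ {c r} → 2 ≤ c → c < nodes → r < len′ c → H c r ≢ 0 → Acts (off c + r) (ad c r)
    child-act {c} {r} 2≤c c< r< on = act (≤-trans (s≤s z≤n) 2≤c) c< r< (λ p → on (trans (sym (trans (cong (_* H c r) (≥2-true {c} {r} 2≤c)) (*-identityˡ _))) p))

    parent : ∀ {c r} → 1 ≤ c → r < len′ c → G c r ≢ 0 → 2 ≤ c × H c r ≢ 0
    parent {c} {r} = split {c} {r}

-- Select directory: groups

shortE P-guardE P-srcE E-rowE : Exp
shortE   = lit 1 ⊖ longE
P-guardE = superStartE ⊗ shortE
P-srcE   = (eqE (idxE ⊛ bE) (lit 0) ⊗ (sbE pid ⊖ sbE gfE)) ⊗ 2^E (ℓE ⊗ (idxE ⊛ BE ⊘ bE))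
E-rowE   = sbE gfE ⊕ idxE ⊛ BE ⊕ lit 2

groupP : Program
groupP = (pardo slots₂E (childGuardE superStartE) aux (childCellE 2 superRowE) (sbE gfE) ∷ [])
  ++ (pardo slots₂E (childGuardE superStartE) aux (childCellE 3 superRowE) longE ∷ [])
  ++ packP slots₂E P-srcE (childGuardE P-guardE) aux (childCellE 4 superRowE) spanE pid
  ++ (pardo slots₂E (childGuardE longE) aux (childCellE 5 E-rowE) (load pos pid) ∷ [])

module GroupSteps (𝒮 : Setting) where

  open ChildSteps 𝒮 public

  groupStart groupRow : ℕ → ℕ → ℕ
  groupStart c r = 𝟙≡ (r mod B) 0
  groupRow c r = r div B + 1

  private
    start-value : ∀ {M} (Wd : Words w M) (inp : Inp M) {c r} (2≤c : 2 ≤ c) (c< : c < nodes) (r< : r < len′ c) → At._⇓_ M Wd (off c + r) superStartE (groupStart c r)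
    start-value Wd inp 2≤c c< r< = ↓ eqˢ (idxV %ˢ BV) (litˢ 0)
      where open ChildSlot Wd inp 2≤c c< r<

    groupRow-value : ∀ {M} (Wd : Words w M) (inp : Inp M) {c r} (2≤c : 2 ≤ c) (c< : c < nodes) (r< : r < len′ c) → At._⇓⟨_⟩_ M Wd (off c + r) superRowE 10 (groupRow c r)
    groupRow-value Wd inp 2≤c c< r< = weaken 10 (≤ᵇ⇒≤ 3 10 _) (idxV /ˢ BV +ˢ litˢ 1)
      where open ChildSlot Wd inp 2≤c c< r<

    groupRow≤ : ∀ {c r} → r < len′ c → groupRow c r ≤ n + 2
    groupRow≤ {c} {r} r< = +-mono-≤ (≤-trans (div≤ r B) (≤-trans (<⇒≤ r<) (len≤n c))) (s≤s z≤n)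

    groupRow-inj : ∀ {r r′} → r mod B ≡ 0 → r′ mod B ≡ 0 → r div B + 1 ≡ r′ div B + 1 → r ≡ r′
    groupRow-inj r≡ r′≡ rows = trans (multiple {k = B} r≡) (trans (cong (_* B) (+-cancelʳ-≡ 1 _ _ rows)) (sym (multiple {k = B} r′≡)))

    start-row≤ : ∀ {c r} (2≤c : 2 ≤ c) (c< : c < nodes) (r< : r < len′ c) → groupStart c r ≢ 0 → groupRow c r ≤ n + 2
    start-row≤ {c} {r} _ _ r< _ = groupRow≤ {c} {r} r<

    start-row-inj : ∀ {c r r′} (2≤c : 2 ≤ c) (c< : c < nodes) → r < len′ c → r′ < len′ c → groupStart c r ≢ 0 → groupStart c r′ ≢ 0 → groupRow c r ≡ groupRow c r′ → r ≡ r′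
    start-row-inj _ _ _ _ on on′ = groupRow-inj (𝟙≡-true⁻¹ on) (𝟙≡-true⁻¹ on′)

  module GStep = ChildStep 2 tt superStartE superRowE groupStart groupRow start-value groupRow-value start-row≤ start-row-inj
  module FStep = ChildStep 3 tt superStartE superRowE groupStart groupRow start-value groupRow-value start-row≤ start-row-inj

  G-step F-step : Step
  G-step = GStep.slot-scatter slots₂E slots₂ (sbE gfE) (λ c r → sb c (gf r))
    λ Wd inp {c} {r} 1≤c c< r< on → let open ChildSlot Wd inp (proj₁ (GStep.parent {c} {r} 1≤c r< on)) c< r< in valˢ (sbV gfV gf<)
  F-step = FStep.slot-scatter slots₂E slots₂ longE long
    λ Wd inp {c} {r} 1≤c c< r< on → let open ChildSlot Wd inp (proj₁ (FStep.parent {c} {r} 1≤c r< on)) c< r< in valˢ longV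

  -- Short groups: the superblocks of the first elements of their subgroups,
  -- relative to that of the group.

  short-bound : ∀ {c r} → 1 ∸ long c r ≢ 0 → sb c (gl c r) ≤ sb c (gf r) + B
  short-bound {c} {r} on with sb c (gl c r) ≤? sb c (gf r) + B
  ... | yes p = p
  ... | no ¬p = ⊥-elim (on (cong (1 ∸_) (𝟙<-true (≰⇒> ¬p))))

  private
    P-guard : ℕ → ℕ → ℕ
    P-guard c r = groupStart c r * (1 ∸ long c r)

    P-value : ∀ {M} (Wd : Words w M) (inp : Inp M) {c r} (2≤c : 2 ≤ c) (c< : c < nodes) (r< : r < len′ c) → At._⇓_ M Wd (off c + r) P-guardE (P-guard c r)
    P-value Wd inp 2≤c c< r< = ↓ (eqˢ (idxV %ˢ BV) (litˢ 0) *ˢ (litˢ 1 -ˢ longV))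
      where open ChildSlot Wd inp 2≤c c< r<

    P-row≤ : ∀ {c r} (2≤c : 2 ≤ c) (c< : c < nodes) (r< : r < len′ c) → P-guard c r ≢ 0 → groupRow c r ≤ n + 2
    P-row≤ {c} {r} _ _ r< _ = groupRow≤ {c} {r} r<

    P-row-inj : ∀ {c r r′} (2≤c : 2 ≤ c) (c< : c < nodes) → r < len′ c → r′ < len′ c → P-guard c r ≢ 0 → P-guard c r′ ≢ 0 → groupRow c r ≡ groupRow c r′ → r ≡ r′
    P-row-inj {c} {r} {r′} _ _ _ _ on on′ = groupRow-inj (𝟙≡-true⁻¹ (proj₁ (𝟙*-≢0 {groupStart c r} on))) (𝟙≡-true⁻¹ (proj₁ (𝟙*-≢0 {groupStart c r′} on′)))

  module PStep = ChildStep 4 tt P-guardE superRowE P-guard groupRow P-value groupRow-value P-row≤ P-row-inj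

  -- The factor in front makes the fields after the last occurrence 0, so that the packed word is
  -- determined in full.
  relative : ℕ → ℕ → ℕ → ℕ
  relative c r u = 𝟙< (r + u * b) (len′ c) * (sb c (r + u * b) ∸ sb c r)

  span-end : ∀ {c r} k → 1 ≤ c → c < nodes → r < len′ c → off c + r + (k ⊓ (len′ c ∸ r)) ≤ off nodes
  span-end {c} {r} k 1≤c c< r< = ≤-trans (≤-reflexive (+-assoc (off c) r _)) (≤-trans (+-monoʳ-≤ (off c) (≤-trans (+-monoʳ-≤ r (m⊓n≤n k (len′ c ∸ r))) (≤-reflexive (m+[n∸m]≡n (<⇒≤ r<)))))
    (≤-trans (≤-reflexive (sym (off-suc c 1≤c))) (off-mono c<)))

  module _ {c r : ℕ} (2≤c : 2 ≤ c) (c< : c < nodes) (r< : r < len′ c) (r≡ : r ≡ r div B * B) where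

    open Parent 2≤c c<

    gf-in : ∀ {i} → i < B → gf (r + i) ≡ r
    gf-in {i} i<B = trans (gf≡ (r + i)) (trans (cong (_* B) (div-unique (r div B) i<B (trans (cong (_+ i) r≡) (+-comm (r div B * B) i)))) (sym r≡))

    mod-in : ∀ {i} → i < B → (r + i) mod B ≡ i
    mod-in {i} i<B = mod-unique (r div B) i<B (trans (cong (_+ i) r≡) (+-comm (r div B * B) i))

    gf-self : gf r ≡ r
    gf-self = trans (gf≡ r) (sym r≡)

    short-in : 1 ∸ long c r ≢ 0 → ∀ {i} → i < B → r + i < len′ c → sb c (r + i) ∸ sb c r ≤ B
    short-in sh {i} i<B r+i< = m≤n+o⇒m∸n≤o (sb c (r + i)) (sb c r) (subst (λ t → sb c (r + i) ≤ sb c t + B) gf-self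
      (≤-trans (sb-mono (subst (λ t → t + i ≤ gl c r) gf-self (≤gl {c} {r} (subst (λ t → t + i < len′ c) (sym gf-self) r+i<) i<B)) (gl< r<)) (short-bound sh)))

  mod-b : ∀ x → x mod B mod b ≡ x mod b
  mod-b x = trans (cong (λ k → x mod k mod b) (*-comm b F)) (mod-*-mod x b F)

  relative< : ∀ {c r} → 2 ≤ c → c < nodes → r < len′ c → r ≡ r div B * B → 1 ∸ long c r ≢ 0 → ∀ u → u < F → relative c r u ≤ B
  relative< {c} {r} 2≤c c< r< r≡ sh u u<F with r + u * b <? len′ c
  ... | yes p = ≤-trans (≤-reflexive (trans (cong (_* (sb c (r + u * b) ∸ sb c r)) (𝟙<-true p)) (*-identityˡ _)))
        (short-in 2≤c c< r< r≡ sh (<-≤-trans (*-monoˡ-< b {{>-nonZero 0<b}} u<F) (≤-reflexive (*-comm F b))) p)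
  ... | no p = ≤-trans (≤-reflexive (cong (_* (sb c (r + u * b) ∸ sb c r)) (𝟙<-false (≮⇒≥ p)))) z≤n

  P-total : ∀ {M} (Wd : Words w M) (inp : Inp M) {c r} → 2 ≤ c → c < nodes → r < len′ c → r ≡ r div B * B → 1 ∸ long c r ≢ 0 →
    Σ< (off c + r + (B ⊓ (len′ c ∸ r)) ∸ (off c + r)) (λ i → eval w M (off c + r + i) P-srcE) ≡ pack ℓ F (relative c r)
  P-total {M} Wd inp {c} {r} 2≤c c< r< r≡ sh = trans (Σ-length (m+n∸m≡n (off c + r) _))
      (trans (Σ-padded B (len′ c) r {g = λ i → v i * 2 ^ (ℓ * (i div b))} term
          (λ i m≤ → cong (λ t → t * (𝟙≡ (i mod b) 0 * (sb c (r + i) ∸ sb c r)) * 2 ^ (ℓ * (i div b))) (𝟙<-false m≤)))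
        (trans (pack-blocks v) (pack-cong ℓ F blocks)))
    where
    v : ℕ → ℕ
    v i = 𝟙< (r + i) (len′ c) * (𝟙≡ (i mod b) 0 * (sb c (r + i) ∸ sb c r))
    term : ∀ i → i < B → r + i < len′ c → eval w M (off c + r + i) P-srcE ≡ v i * 2 ^ (ℓ * (i div b))
    term i i<B r+i< = trans (cong (λ z → eval w M z P-srcE) (+-assoc (off c) r i))
        (trans (val (shifted Wd (off c + (r + i)) (↓ diffV) blkV small blk< blkV (↓ ℓV)))
          (cong₂ (λ x y → x * 2 ^ (ℓ * y)) value≡ (cong (_div b) (mod-in 2≤c c< r< r≡ i<B))))
      where
      open ChildSlot Wd inp 2≤c c< r+i<
      diffV : eqE (idxE ⊛ bE) (lit 0) ⊗ (sbE pid ⊖ sbE gfE) ⇓⟨ 2 ⟩ 𝟙≡ ((r + i) mod b) 0 * (sb c (r + i) ∸ sb c (gf (r + i)))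
      diffV = eqˢ (idxV %ˢ bV) (litˢ 0) *ˢ (sbV pidV r+i< -ˢ sbV gfV gf<)
      blkV : idxE ⊛ BE ⊘ bE ⇓ (r + i) mod B div b
      blkV = ↓ (idxV %ˢ BV /ˢ bV)
      blk< : (r + i) mod B div b < F
      blk< = div< (subst ((r + i) mod B <_) (*-comm b F) (mod< (r + i) 0<B))
      small : 𝟙≡ ((r + i) mod b) 0 * (sb c (r + i) ∸ sb c (gf (r + i))) < 2 ^ ℓ
      small = ≤-<-trans (≤-trans (*-monoˡ-≤ _ (𝟙≤1 ((r + i) mod b ≡ᵇ 0))) (≤-trans (≤-reflexive (*-identityˡ _))
        (≤-trans (≤-reflexive (cong (λ t → sb c (r + i) ∸ sb c t) (gf-in 2≤c c< r< r≡ i<B))) (short-in 2≤c c< r< r≡ sh i<B r+i<)))) B<2^ℓ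
      value≡ : 𝟙≡ ((r + i) mod b) 0 * (sb c (r + i) ∸ sb c (gf (r + i))) ≡ v i
      value≡ = trans (cong₂ (λ x y → 𝟙≡ x 0 * (sb c (r + i) ∸ sb c y)) (trans (sym (mod-b (r + i))) (cong (_mod b) (mod-in 2≤c c< r< r≡ i<B))) (gf-in 2≤c c< r< r≡ i<B))
        (sym (trans (cong (_* (𝟙≡ (i mod b) 0 * (sb c (r + i) ∸ sb c r))) (𝟙<-true r+i<)) (*-identityˡ _)))
    -- Only the first element of a subgroup contributes to its digit.
    blocks : ∀ u → u < F → Σ< b (λ i → v (u * b + i)) ≡ relative c r u
    blocks u u<F = trans (Σ-extend (λ i → v (u * b + i)) 0<b rest)
        (cong₂ (λ x y → 𝟙< (r + x) (len′ c) * y) (+-identityʳ (u * b))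
          (trans (cong₂ (λ x y → 𝟙≡ x 0 * (sb c (r + y) ∸ sb c r)) (mod-unique u 0<b (+-identityʳ (u * b))) (+-identityʳ (u * b))) (*-identityˡ _)))
      where
      rest : ∀ i → 1 ≤ i → i < b → v (u * b + i) ≡ 0
      rest i 1≤i i<b = trans (cong (λ t → 𝟙< (r + (u * b + i)) (len′ c) * (t * (sb c (r + (u * b + i)) ∸ sb c r)))
          (trans (cong (λ t → 𝟙≡ t 0) (mod-unique u i<b (+-comm (u * b) i))) (𝟙≡-false (>⇒≢ 1≤i)))) (*-zeroʳ (𝟙< (r + (u * b + i)) (len′ c)))

  P-step : Step
  P-step = PStep.slot-packed slots₂E slots₂ P-srcE spanE pid
    (λ c r → off c + r + (B ⊓ (len′ c ∸ r))) (λ c r → off c + r) (λ c r → pack ℓ F (relative c r))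
    (λ Wd inp {c} {r} 1≤c c< r< _ → let open Slot Wd inp 1≤c c< r< in
      valˢ (pidV +ˢ minV BV lenIdxV) , valˢ pidV , m≤m+n (off c + r) _ , span-end {c} {r} B 1≤c c< r<)
    (λ Wd inp {c} {r} 1≤c c< r< on → let q = PStep.parent {c} {r} 1≤c r< on ; r≡ = multiple {k = B} (𝟙≡-true⁻¹ (proj₁ (𝟙*-≢0 {groupStart c r} (proj₂ q)))) ; sh = proj₂ (𝟙*-≢0 {groupStart c r} (proj₂ q)) in
      trans (cong (_mod W) (P-total Wd inp (proj₁ q) c< r< r≡ sh))
        (mod-small (pack-fits ≤-refl (λ u u<F → ≤-<-trans (relative< (proj₁ q) c< r< r≡ sh u u<F) B<2^ℓ))))

  -- Long groups: the positions of all their elements.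

  private
    E-row : ℕ → ℕ → ℕ
    E-row c r = sb c (gf r) + r mod B + 2

    long⁻¹ : ∀ {c r} → long c r ≢ 0 → sb c (gf r) + B < sb c (gl c r)
    long⁻¹ {c} {r} on with sb c (gf r) + B <? sb c (gl c r)
    ... | yes p = p
    ... | no ¬p = ⊥-elim (on (𝟙<-false (≮⇒≥ ¬p)))

    E-value : ∀ {M} (Wd : Words w M) (inp : Inp M) {c r} (2≤c : 2 ≤ c) (c< : c < nodes) (r< : r < len′ c) → At._⇓_ M Wd (off c + r) longE (long c r)
    E-value Wd inp 2≤c c< r< = ↓ longV
      where open ChildSlot Wd inp 2≤c c< r<

    E-row-value : ∀ {M} (Wd : Words w M) (inp : Inp M) {c r} (2≤c : 2 ≤ c) (c< : c < nodes) (r< : r < len′ c) → At._⇓⟨_⟩_ M Wd (off c + r) E-rowE 10 (E-row c r)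
    E-row-value Wd inp 2≤c c< r< = weaken 10 (≤ᵇ⇒≤ 4 10 _) (sbV gfV gf< +ˢ idxV %ˢ BV +ˢ litˢ 2)
      where open ChildSlot Wd inp 2≤c c< r<

    E-row≤ : ∀ {c r} (2≤c : 2 ≤ c) (c< : c < nodes) (r< : r < len′ c) → long c r ≢ 0 → E-row c r ≤ n + 2
    E-row≤ {c} {r} 2≤c c< r< on = +-monoˡ-≤ 2 (≤-trans (+-monoʳ-≤ (sb c (gf r)) (<⇒≤ (mod< r 0<B))) (≤-trans (<⇒≤ (long⁻¹ {c} {r} on)) (<⇒≤ (Parent.sb<n 2≤c c< (gl< {c} {r} r<)))))

    -- A long group takes the `B` rows that begin with its first superblock, and its last element
    -- lies more than `B` superblocks further on. The next group starts no earlier than that, so the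
    -- rows of different groups do not meet.
    E-row-< : ∀ {c r r′} (2≤c : 2 ≤ c) (c< : c < nodes) → r′ < len′ c → long c r ≢ 0 → gf r < gf r′ → sb c (gf r) + r mod B < sb c (gf r′)
    E-row-< {c} {r} {r′} 2≤c c< r′< on lts = <-trans (+-monoʳ-< (sb c (gf r)) (mod< r 0<B)) (<-≤-trans (long⁻¹ {c} {r} on)
      (Parent.sb-mono 2≤c c< (<⇒≤ (gl<gf {c} {r} {r′} lts)) (≤-<-trans (gf≤ r′) r′<)))

    E-row-inj : ∀ {c r r′} (2≤c : 2 ≤ c) (c< : c < nodes) → r < len′ c → r′ < len′ c → long c r ≢ 0 → long c r′ ≢ 0 → E-row c r ≡ E-row c r′ → r ≡ r′
    E-row-inj {c} {r} {r′} 2≤c c< r< r′< on on′ rows with <-cmp (gf r) (gf r′)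
    ... | tri< lts _ _ = ⊥-elim (<⇒≢ (<-≤-trans (E-row-< {c} {r} {r′} 2≤c c< r′< on lts) (m≤m+n _ _)) (+-cancelʳ-≡ 2 _ _ rows))
    ... | tri> _ _ gts = ⊥-elim (<⇒≢ (<-≤-trans (E-row-< {c} {r′} {r} 2≤c c< r< on′ gts) (m≤m+n _ _)) (sym (+-cancelʳ-≡ 2 _ _ rows)))
    ... | tri≈ _ gf≡gf _ = trans (sym (gf+ r)) (trans (cong₂ _+_ gf≡gf
            (+-cancelˡ-≡ (sb c (gf r)) _ _ (trans (+-cancelʳ-≡ 2 _ _ rows) (cong (λ t → sb c t + r′ mod B) (sym gf≡gf))))) (gf+ r′))

  module EStep = ChildStep 5 tt longE E-rowE long E-row E-value E-row-value E-row≤ E-row-inj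

  E-step : Step
  E-step = EStep.slot-scatter slots₂E slots₂ (load pos pid) Qc
    λ Wd inp {c} {r} 1≤c c< r< on → let open ChildSlot Wd inp (proj₁ (EStep.parent {c} {r} 1≤c r< on)) c< r< in valˢ (posV pidV r<)

-- Select directory: spread subgroups; the records of the nodes

sfE S-guardE S-rowE S-srcE : Exp
sfE      = pid ⊖ idxE ⊛ bE
S-guardE = eqE (idxE ⊛ bE) (lit 0) ⊗ (shortE ⊗ ltE (sbE pid ⊕ lit 1) (sbE slE))
S-rowE   = sbE pid ⊕ lit 2
S-srcE   = (load pos pid ⊖ sbE sfE ⊗ BE) ⊗ 2^E (ℓE ⊗ (idxE ⊛ bE))

spreadP recordP : Program
spreadP = packP slots₂E S-srcE (childGuardE S-guardE) aux (childCellE 6 S-rowE) (pid ⊕ minE bE (lnE ⊖ idxE)) pid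
recordP = (pardo (2^E lamE) (ltE (lit 0) pid) left pid (lit 2 ⊗ pid) ∷ [])
  ++ (pardo (2^E lamE) (ltE (lit 0) pid) right pid (lit 2 ⊗ pid ⊕ lit 1) ∷ [])
  ++ (pardo (2^E lamE) (ltE (lit 0) pid) auxStart pid (lit 64 ⊗ nE ⊗ pid) ∷ [])
  ++ (pardo (2^E lamE) (ltE (lit 0) pid) auxLen pid (lit 16 ⊗ (load len pid ⊘ BE ⊕ lit 3)) ∷ [])
  ++ (pardo (2^E lamE) (ltE (lit 0) pid) aux (cellE pid (lit 0) (lit 7)) (cell hdr) ∷ [])

tablesP : Program
tablesP = rankP 0 ++ rankP 1 ++ countP 0 ++ countP 1 ++ bitsP ++ groupP ++ spreadP ++ recordP

module TableSteps (𝒮 : Setting) where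

  open GroupSteps 𝒮 public

  -- Subgroups reaching beyond the superblock after that of their first element:
  -- the positions of their elements relative to that superblock.

  private
    H row : ℕ → ℕ → ℕ
    H c r = 𝟙≡ (r mod b) 0 * ((1 ∸ long c r) * 𝟙< (sb c r + 1) (sb c (sl c r)))
    row c r = sb c r + 2

    sl< : ∀ {c r} → r < len′ c → sl c r < len′ c
    sl< r< = last< 0<b r<

    H-value : ∀ {M} (Wd : Words w M) (inp : Inp M) {c r} (2≤c : 2 ≤ c) (c< : c < nodes) (r< : r < len′ c) → At._⇓_ M Wd (off c + r) S-guardE (H c r)
    H-value Wd inp {c} {r} 2≤c c< r< = ↓ (eqˢ (idxV %ˢ bV) (litˢ 0) *ˢ ((litˢ 1 -ˢ longV) *ˢ ltˢ (sbV pidV r< +ˢ litˢ 1) (sbV slV (sl< {c} {r} r<))))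
      where open ChildSlot Wd inp 2≤c c< r<

    row-value : ∀ {M} (Wd : Words w M) (inp : Inp M) {c r} (2≤c : 2 ≤ c) (c< : c < nodes) (r< : r < len′ c) → At._⇓⟨_⟩_ M Wd (off c + r) S-rowE 10 (row c r)
    row-value Wd inp 2≤c c< r< = weaken 10 (≤ᵇ⇒≤ 2 10 _) (sbV pidV r< +ˢ litˢ 2)
      where open ChildSlot Wd inp 2≤c c< r<

    row≤ : ∀ {c r} (2≤c : 2 ≤ c) (c< : c < nodes) (r< : r < len′ c) → H c r ≢ 0 → row c r ≤ n + 2
    row≤ 2≤c c< r< _ = +-monoˡ-≤ 2 (<⇒≤ (Parent.sb<n 2≤c c< r<))

    H⁻¹ : ∀ {c r} → H c r ≢ 0 → r mod b ≡ 0 × 1 ∸ long c r ≢ 0 × sb c r + 1 < sb c (sl c r)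
    H⁻¹ {c} {r} on = 𝟙≡-true⁻¹ (proj₁ split) , proj₁ split′ , far
      where
      split = 𝟙*-≢0 {𝟙≡ (r mod b) 0} on
      split′ = 𝟙*-≢0 {1 ∸ long c r} (proj₂ split)
      far : sb c r + 1 < sb c (sl c r)
      far = ≰⇒> λ p → proj₂ split′ (𝟙<-false p)

    -- A stored subgroup ends in a later superblock than the one where it begins, and the next
    -- subgroup starts no earlier than that end. So one row per superblock suffices.
    apart : ∀ {c r r′} (2≤c : 2 ≤ c) (c< : c < nodes) → r′ < len′ c → H c r ≢ 0 → H c r′ ≢ 0 → r < r′ → sb c r < sb c r′
    apart {c} {r} {r′} 2≤c c< r′< on on′ r<r′ = <-trans (m<m+n (sb c r) z<s) (<-≤-trans (proj₂ (proj₂ (H⁻¹ {c} {r} on))) (Parent.sb-mono 2≤c c< sl≤ r′<))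
      where
      r≡ = multiple {k = b} (proj₁ (H⁻¹ {c} {r} on))
      r′≡ = multiple {k = b} (proj₁ (H⁻¹ {c} {r′} on′))
      r+b≤ : r + b ≤ r′
      r+b≤ = subst₂ (λ x y → x + b ≤ y) (sym r≡) (sym r′≡)
        (≤-trans (≤-reflexive (+-comm (r div b * b) b)) (*-monoˡ-≤ b (*-cancelʳ-< b (r div b) (r′ div b) (subst₂ _<_ r≡ r′≡ r<r′))))
      sl≤ : sl c r ≤ r′
      sl≤ = ≤-trans (m∸n≤m _ 1) (≤-trans (+-monoʳ-≤ r (m⊓n≤m b (len′ c ∸ r))) r+b≤)

    row-inj : ∀ {c r r′} (2≤c : 2 ≤ c) (c< : c < nodes) → r < len′ c → r′ < len′ c → H c r ≢ 0 → H c r′ ≢ 0 → row c r ≡ row c r′ → r ≡ r′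
    row-inj {c} {r} {r′} 2≤c c< r< r′< on on′ rows with <-cmp r r′
    ... | tri≈ _ r≡ _ = r≡
    ... | tri< lts _ _ = ⊥-elim (<⇒≢ (apart {c} {r} {r′} 2≤c c< r′< on on′ lts) (+-cancelʳ-≡ 2 _ _ rows))
    ... | tri> _ _ gts = ⊥-elim (<⇒≢ (apart {c} {r′} {r} 2≤c c< r< on′ on gts) (sym (+-cancelʳ-≡ 2 _ _ rows)))

  module SStep = ChildStep 6 tt S-guardE S-rowE H row H-value row-value row≤ row-inj

  spread-on : ℕ → ℕ → ℕ
  spread-on = H

  -- `B` is a multiple of `b`, so a subgroup does not cross the boundary of its group.
  within-group : ∀ {r i} → r mod b ≡ 0 → i < b → r mod B + i < B
  within-group {r} {i} r≡ i<b = subst (λ t → t + i < B) (sym k≡) (<-≤-trans (+-monoʳ-< (k * b) i<b)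
      (≤-trans (≤-reflexive (+-comm (k * b) b)) (≤-trans (*-monoˡ-≤ b k<F) (≤-reflexive (*-comm F b)))))
    where
    k = r mod B div b
    k<F : k < F
    k<F = div< (subst (r mod B <_) (*-comm b F) (mod< r 0<B))
    k≡ : r mod B ≡ k * b
    k≡ = multiple {k = b} (trans (mod-b r) r≡)

  -- The subgroup belongs to a short group, whose last element lies at most `B` superblocks after
  -- its first. An offset is thus at most `(B + 2) * B`, which `BB<` fits into a counter.
  subgroup-bound : ∀ {c r i} (2≤c : 2 ≤ c) (c< : c < nodes) → r < len′ c → r mod b ≡ 0 → 1 ∸ long c r ≢ 0 → i < b → r + i < len′ c →
    Qc c (r + i) ∸ sb c r * B < 2 ^ ℓ
  subgroup-bound {c} {r} {i} 2≤c c< r< r≡ sh i<b r+i< = ≤-<-trans (m≤n+o⇒m∸n≤o (Qc c (r + i)) (sb c r * B)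
      (≤-trans (<⇒≤ (div-upper (Qc c (r + i)) 0<B)) (≤-trans (*-monoˡ-≤ B (≤-trans (s≤s sb≤) (s≤s (m≤n⇒m≤1+n ≤-refl)))) (≤-reflexive (lemma (sb c r) B))))) BB<
    where
    open Parent 2≤c c<
    lemma : ∀ s B → suc (suc (s + B)) * B ≡ s * B + (B + 2) * B
    lemma = solve-∀
    r+i≡ : gf r + (r mod B + i) ≡ r + i
    r+i≡ = trans (sym (+-assoc (gf r) _ i)) (cong (_+ i) (gf+ r))
    sb≤ : sb c (r + i) ≤ sb c r + B
    sb≤ = ≤-trans (sb-mono (subst (_≤ gl c r) r+i≡ (≤gl {c} {r} (subst (_< len′ c) (sym r+i≡) r+i<) (within-group r≡ i<b))) (gl< {c} {r} r<))
      (≤-trans (short-bound {c} {r} sh) (+-monoˡ-≤ B (sb-mono (gf≤ r) r<)))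

  offsets : ℕ → ℕ → ℕ → ℕ
  offsets c r i = Qc c (r + i) ∸ sb c r * B

  S-total : ∀ {M} (Wd : Words w M) (inp : Inp M) {c r} → 2 ≤ c → c < nodes → r < len′ c → r mod b ≡ 0 → 1 ∸ long c r ≢ 0 →
    Σ< (off c + r + (b ⊓ (len′ c ∸ r)) ∸ (off c + r)) (λ i → eval w M (off c + r + i) S-srcE) ≡ pack ℓ (b ⊓ (len′ c ∸ r)) (offsets c r)
  S-total {M} Wd inp {c} {r} 2≤c c< r< r≡ sh = trans (Σ-length (m+n∸m≡n (off c + r) _)) (Σ-cong (b ⊓ (len′ c ∸ r)) λ i i< →
      term i (<-≤-trans i< (m⊓n≤m b _)) (subst (r + i <_) (m+[n∸m]≡n (<⇒≤ r<)) (+-monoʳ-< r (<-≤-trans i< (m⊓n≤n b _)))))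
    where
    term : ∀ i → i < b → r + i < len′ c → eval w M (off c + r + i) S-srcE ≡ offsets c r i * 2 ^ (ℓ * i)
    term i i<b r+i< = trans (cong (λ z → eval w M z S-srcE) (+-assoc (off c) r i))
        (trans (val (shifted Wd (off c + (r + i)) (↓ diffV) idxbV small (<-≤-trans (mod< (r + i) 0<b) b≤F) idxbV (↓ ℓV)))
          (cong₂ (λ x y → (Qc c (r + i) ∸ sb c x * B) * 2 ^ (ℓ * y)) first≡ mod≡))
      where
      open ChildSlot Wd inp 2≤c c< r+i<
      mod≡ : (r + i) mod b ≡ i
      mod≡ = mod-unique (r div b) i<b (trans (cong (_+ i) (multiple {k = b} r≡)) (+-comm (r div b * b) i))
      first≡ : r + i ∸ (r + i) mod b ≡ r
      first≡ = trans (cong (r + i ∸_) mod≡) (m+n∸n≡m r i)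
      sfV : sfE ⇓⟨ 2 ⟩ off c + (r + i ∸ (r + i) mod b)
      sfV = castˢ (+-∸-assoc (off c) (mod≤ (r + i) b)) (pidV -ˢ idxV %ˢ bV)
      diffV : load pos pid ⊖ sbE sfE ⊗ BE ⇓⟨ 1 ⟩ Qc c (r + i) ∸ sb c (r + i ∸ (r + i) mod b) * B
      diffV = posV pidV r+i< -ˢ sbV sfV (≤-<-trans (m∸n≤m (r + i) ((r + i) mod b)) r+i<) *ˢ BV
      idxbV : idxE ⊛ bE ⇓ (r + i) mod b
      idxbV = ↓ (idxV %ˢ bV)
      small : Qc c (r + i) ∸ sb c (r + i ∸ (r + i) mod b) * B < 2 ^ ℓ
      small = subst (λ x → Qc c (r + i) ∸ sb c x * B < 2 ^ ℓ) (sym first≡) (subgroup-bound {c} {r} {i} 2≤c c< r< r≡ sh i<b r+i<)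

  S-step : Step
  S-step = SStep.slot-packed slots₂E slots₂ S-srcE (pid ⊕ minE bE (lnE ⊖ idxE)) pid
    (λ c r → off c + r + (b ⊓ (len′ c ∸ r))) (λ c r → off c + r) (λ c r → pack ℓ (b ⊓ (len′ c ∸ r)) (offsets c r))
    (λ Wd inp {c} {r} 1≤c c< r< _ → let open Slot Wd inp 1≤c c< r< in
      valˢ (pidV +ˢ minV bV lenIdxV) , valˢ pidV , m≤m+n (off c + r) _ , span-end {c} {r} b 1≤c c< r<)
    (λ Wd inp {c} {r} 1≤c c< r< on → let q = SStep.parent {c} {r} 1≤c r< on ; h = H⁻¹ {c} {r} (proj₂ q) in
      trans (cong (_mod W) (S-total Wd inp (proj₁ q) c< r< (proj₁ h) (proj₁ (proj₂ h))))
        (mod-small (pack-fits (≤-trans (m⊓n≤m b _) b≤F) (λ i i< → subgroup-bound {c} {r} {i} (proj₁ q) c< r< (proj₁ h) (proj₁ (proj₂ h))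
          (<-≤-trans i< (m⊓n≤m b _)) (subst (r + i <_) (m+[n∸m]≡n (<⇒≤ r<)) (+-monoʳ-< r (<-≤-trans i< (m⊓n≤n b _))))))))

  -- One step per node: processor p acts for node p.
  module OverNodes (A : Array) (a : Exp) (K : List ℕ) (ad : ℕ → ℕ)
    (a-value : ∀ {M} (Wd : Words w M) (inp : Inp M) p → p < 2 ^ Λ → eval w M p a ≡ ad p)
    (ad-injective : ∀ {p p′} → ad p ≡ ad p′ → p ≡ p′)
    (ad-key : ∀ p → ¬ T (fresh K (key A (ad p)))) where

    node< : ∀ {p} → p < 2 ^ Λ → p < 2 ^ (2 * θ)
    node< p< = node-bound (<-≤-trans p< 2^Λ≤nodes)

    pidN : ∀ {M} (Wd : Words w M) (inp : Inp M) p → p < 2 ^ Λ → At._⇓⟨_⟩_ M Wd p pid 2 p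
    pidN Wd inp p p< = pidˢ 2 (node< p<)
      where open Common Wd inp p

    plan : Plan (2 ^ Λ) (ltE (lit 0) pid) A a K
    plan = record
      { Dom       = λ z x → 1 ≤ z × z < 2 ^ Λ × x ≡ ad z
      ; sound     = λ Wd inp z z< g≢0 → positive Wd inp z z< g≢0 , z< , a-value Wd inp z z<
      ; complete  = λ { Wd inp z x (1≤z , z< , refl) → z< , (λ q → case trans (sym (trans (guard Wd inp z z<) (𝟙<-true 1≤z))) q of λ ()) , a-value Wd inp z z< }
      ; injective = λ { (_ , _ , refl) (_ , _ , q) → ad-injective q }
      ; touches   = λ { {z} (_ , _ , refl) → ad-key z }
      }
      where
      guard : ∀ {M} (Wd : Words w M) (inp : Inp M) z → z < 2 ^ Λ → eval w M z (ltE (lit 0) pid) ≡ 𝟙< 0 z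
      guard Wd inp z z< = valˢ (ltˢ (litˢ 0) (pidN Wd inp z z<))
        where open Common Wd inp z
      positive : ∀ {M} (Wd : Words w M) (inp : Inp M) z → z < 2 ^ Λ → eval w M z (ltE (lit 0) pid) ≢ 0 → 1 ≤ z
      positive Wd inp zero    z< g≢0 = ⊥-elim (g≢0 (guard Wd inp 0 z<))
      positive Wd inp (suc z) z< g≢0 = s≤s z≤n

    nodes-value : ∀ {M} (Wd : Words w M) → Inp M → eval w M 0 (2^E lamE) ≡ 2 ^ Λ
    nodes-value Wd inp = val (2^⇓ (↓ lamV) Λ<w)
      where
      open Common Wd inp 0
      Λ<w : Λ < w
      Λ<w = <-≤-trans (2^-cancel-< (node-bound (^-monoʳ-< 2 (s≤s (s≤s z≤n)) (n<1+n Λ)))) (≤-trans (*-monoˡ-≤ θ (s≤s (s≤s (z≤n {62})))) 64θ≤w)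

    nodes≤2X : 2 ^ Λ ≤ 2 * X
    nodes≤2X = ≤-trans (*-cancelˡ-≤ 2 (≤-trans nodes≤ (≤-reflexive (*-assoc 2 2 n)))) (≤-trans (*-monoˡ-≤ n (s≤s 1≤Λ)) slots≤)

    node-scatter : ∀ v (vl : ℕ → ℕ) {_ : T (ops (2^E lamE) + 2 * (ops (ltE (lit 0) pid) + ops a + ops v + 1) ≤ᵇ 5000)} →
      (∀ {M} (Wd : Words w M) (inp : Inp M) p → 1 ≤ p → p < 2 ^ Λ → eval w M p v ≡ vl p) → Step
    node-scatter v vl {small} vl≡ = scatter plan (2^E lamE) nodes-value nodes≤2X v (λ {z} _ → vl z) {small}
      (λ { Wd inp z x (1≤z , z< , _) → vl≡ Wd inp z 1≤z z< })

  own-pid : ∀ {M} (Wd : Words w M) (inp : Inp M) p → p < 2 ^ Λ → eval w M p pid ≡ p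
  own-pid Wd inp p p< = valˢ (pidˢ 2 (node-bound (<-≤-trans p< 2^Λ≤nodes)))
    where open Common Wd inp p

  header-cell : ℕ → ℕ
  header-cell p = 16 * (4 * n * p + 0) + 7

  private
    same : ∀ {p p′ : ℕ} → p ≡ p′ → p ≡ p′
    same q = q

    left-key : ∀ p → ¬ T (fresh (left ∷ []) (key left p))
    left-key p ()

    right-key : ∀ p → ¬ T (fresh (right ∷ []) (key right p))
    right-key p ()

    auxStart-key : ∀ p → ¬ T (fresh (auxStart ∷ []) (key auxStart p))
    auxStart-key p ()

    auxLen-key : ∀ p → ¬ T (fresh (auxLen ∷ []) (key auxLen p))
    auxLen-key p ()

    header-value : ∀ {M} (Wd : Words w M) (inp : Inp M) p → p < 2 ^ Λ → eval w M p (cellE pid (lit 0) (lit 7)) ≡ header-cell p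
    header-value Wd inp p p< = valˢ (cellV (pidˢ 2 (node-bound (<-≤-trans p< 2^Λ≤nodes))) (litˢ 0) (weaken 4 (≤ᵇ⇒≤ 1 4 _) (litˢ 7)))
      where open Common Wd inp p

    header-injective : ∀ {p p′} → header-cell p ≡ header-cell p′ → p ≡ p′
    header-injective q = proj₁ (row-unique (small-row z≤n) (small-row z≤n) (≤ᵇ⇒≤ 8 16 _) (≤ᵇ⇒≤ 8 16 _) q)

    header-key : ∀ p → ¬ T (fresh (107 ∷ []) (key aux (header-cell p)))
    header-key p = field-key (107 ∷ []) {p} {0} (≤ᵇ⇒≤ 8 16 _) (λ x → x)

  module LeftStep     = OverNodes left pid (left ∷ []) (λ p → p) own-pid same left-key
  module RightStep    = OverNodes right pid (right ∷ []) (λ p → p) own-pid same right-key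
  module AuxStartStep = OverNodes auxStart pid (auxStart ∷ []) (λ p → p) own-pid same auxStart-key
  module AuxLenStep   = OverNodes auxLen pid (auxLen ∷ []) (λ p → p) own-pid same auxLen-key
  module HeaderStep   = OverNodes aux (cellE pid (lit 0) (lit 7)) (107 ∷ []) header-cell header-value header-injective header-key

  left-step right-step auxStart-step auxLen-step header-step : Step
  left-step = LeftStep.node-scatter (lit 2 ⊗ pid) (λ p → 2 * p)
    λ Wd inp p _ p< → let open Common Wd inp p in valˢ (litˢ 2 *ˢ LeftStep.pidN Wd inp p p<)
  right-step = RightStep.node-scatter (lit 2 ⊗ pid ⊕ lit 1) (λ p → 2 * p + 1)
    λ Wd inp p _ p< → let open Common Wd inp p in valˢ (litˢ 2 *ˢ RightStep.pidN Wd inp p p< +ˢ litˢ 1)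
  auxStart-step = AuxStartStep.node-scatter (lit 64 ⊗ nE ⊗ pid) (λ p → 64 * n * p)
    λ Wd inp p _ p< → let open Common Wd inp p in valˢ (litˢ 64 *ˢ nV *ˢ AuxStartStep.pidN Wd inp p p<)
  auxLen-step = AuxLenStep.node-scatter (lit 16 ⊗ (load len pid ⊘ BE ⊕ lit 3)) (λ p → 16 * (len′ p div B + 3))
    λ Wd inp p 1≤p p< → let open Common Wd inp p in valˢ (litˢ 16 *ˢ (loadˢ 1 (AuxLenStep.pidN Wd inp p p<) (len-stored p 1≤p (<-≤-trans p< 2^Λ≤nodes)) (len< p) /ˢ BV +ˢ litˢ 3))
  header-step = HeaderStep.node-scatter (cell hdr) (λ _ → e)
    λ Wd inp p _ p< → let open Common Wd inp p in valˢ eV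

  module R₀ = RankSteps 0 z≤n
  module R₁ = RankSteps 1 (s≤s z≤n)

  steps : List Step
  steps = R₀.R-step ∷ R₁.R-step ∷ R₀.D-step ∷ R₁.D-step ∷ BitSteps.bits-step ∷ G-step ∷ F-step ∷ P-step ∷ E-step ∷ S-step
    ∷ left-step ∷ right-step ∷ auxStart-step ∷ auxLen-step ∷ header-step ∷ []

  compatible : Compatible steps
  compatible = tt , tt , tt , tt , tt , tt , tt , tt , tt , tt , tt , tt , tt , tt , tt , tt , tt , tt , tt , tt , tt , tt , tt , tt , tt , tt , tt , tt , tt , tt , tt

  -- The steps live over a `Setting`, hence over a particular input, whereas the theorem asks for
  -- one program for all inputs. That this holds by computation shows that their text is always the
  -- same.
  program : progs steps ≡ tablesP
  program = refl

-- The tables of one node, as the queries require them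

*-≢0 : ∀ x y → x ≢ 0 → y ≢ 0 → x * y ≢ 0
*-≢0 x y x≢0 y≢0 q with m*n≡0⇒m≡0∨n≡0 x q
... | inj₁ x≡0 = x≢0 x≡0
... | inj₂ y≡0 = y≢0 y≡0

module Tables (𝒮 : Setting) where

  open TableSteps 𝒮 public

  Q-first : ∀ {p β} → β < 2 → (2 * p + β) div 2 ≡ p × (2 * p + β) mod 2 ≡ β
  Q-first {p} {β} β<2 = div-unique p β<2 (lemma p β) , mod-unique p β<2 (lemma p β)
    where
    lemma : ∀ p β → 2 * p + β ≡ β + p * 2
    lemma = solve-∀

  module _ {M : Mem} {p : ℕ} (1≤p : 1 ≤ p) (p< : p < 2 ^ Λ) where

    private
      m = len′ p

      cell≡ : ∀ row x → 64 * n * p + 16 * row + x ≡ 16 * (4 * n * p + row) + x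
      cell≡ row x = lemma n p row x
        where
        lemma : ∀ n p row x → 64 * n * p + 16 * row + x ≡ 16 * (4 * n * p + row) + x
        lemma = solve-∀

      multiple-on : ∀ {x k} → 0 < k → 𝟙≡ (x * k mod k) 0 ≢ 0
      multiple-on {x} {k} 0<k q = case trans (sym (cong (λ t → 𝟙≡ t 0) (mod-unique {r = 0} x 0<k refl))) q of λ ()

      count≡ : ∀ β → β ≤ 1 → rk m (bf p) β m ≡ len′ (2 * p + β)
      count≡ β β≤1 = trans (Occurrences.rank-length (branchBit (depth p)) β (λ v → branchBit (depth p) v ≟ β) (seq p))
        (sym (cong length (seq-child p β 1≤p (depth-< 1≤p p<) β≤1)))

    R-table : ∀ β (β≤1 : β ≤ 1) → Step.Fact (RankSteps.R-step β β≤1) M → ∀ s → s * B < m → M aux (64 * n * p + 16 * (s + 1) + (0 + 8 * β)) ≡ rk m (bf p) β (s * B)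
    R-table β β≤1 fact s sB< = trans (cong (M aux) (trans (cell≡ (s + 1) _) (cong (λ t → 16 * (4 * n * p + (t + 1)) + (0 + 8 * β)) (sym (*-cancel-div s 0<B)))))
      (fact _ _ (RankSteps.act β β≤1 0 1≤p p< sB< (multiple-on {s} 0<B)))

    D-table : ∀ β (β≤1 : β ≤ 1) → Step.Fact (RankSteps.D-step β β≤1) M → ∀ s → s * B < m → M aux (64 * n * p + 16 * (s + 1) + (1 + 8 * β)) ≡ pack ℓ F (counts m (bf p) β s)
    D-table β β≤1 fact s sB< = trans (cong (M aux) (trans (cell≡ (s + 1) _) (cong (λ t → 16 * (4 * n * p + (t + 1)) + (1 + 8 * β)) (sym (*-cancel-div s 0<B)))))
      (trans (fact _ _ (RankSteps.act β β≤1 1 1≤p p< sB< (multiple-on {s} 0<B))) (cong (λ t → pack ℓ F (counts m (bf p) β t)) (*-cancel-div s 0<B)))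

    module Select (β : ℕ) (β≤1 : β ≤ 1) where

      c : ℕ
      c = 2 * p + β

      2≤c : 2 ≤ c
      2≤c = ≤-trans (*-monoʳ-≤ 2 1≤p) (m≤m+n (2 * p) β)

      c< : c < nodes
      c< = ≤-trans (s≤s (+-monoʳ-≤ (2 * p) β≤1)) (≤-trans (≤-reflexive (lemma p)) (*-monoʳ-≤ 2 p<))
        where
        lemma : ∀ p → suc (2 * p + 1) ≡ 2 * suc p
        lemma = solve-∀

      open Parent 2≤c c< using (sb-mono)

      p≡ : c div 2 ≡ p
      p≡ = proj₁ (Q-first (s≤s β≤1))

      β≡ : c mod 2 ≡ β
      β≡ = proj₂ (Q-first {p} (s≤s β≤1))

      Q≡ : ∀ r → Qc c r ≡ Q p β r
      Q≡ r = cong₂ (λ p β → Q p β r) p≡ β≡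

      sb≡ : ∀ r → sb c r ≡ Q p β r div B
      sb≡ r = cong (_div B) (Q≡ r)

      -- The facts are stated in the coordinates of the child `c`, the table in those of its parent
      -- and the bit.
      from-cell : ∀ {row row′ v} f → row ≡ row′ → M aux (16 * (4 * n * (c div 2) + row) + (f + 8 * (c mod 2))) ≡ v → M aux (64 * n * p + 16 * row′ + (f + 8 * β)) ≡ v
      from-cell {row} f refl q = trans (cong (M aux) (trans (cell≡ row _) (cong₂ (λ p β → 16 * (4 * n * p + row) + (f + 8 * β)) (sym p≡) (sym β≡)))) q

      Q-table : ∀ r → r < rk m (bf p) β m → Q p β r < m × ind m (bf p) β (Q p β r) ≡ 1 × rk m (bf p) β (Q p β r) ≡ r
      Q-table r r< = proj₁ spec , proj₁ (proj₂ spec) , proj₁ (proj₂ (proj₂ spec))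
        where
        spec = Occurrences.position-spec (branchBit (depth p)) β (λ v → branchBit (depth p) v ≟ β) (seq p) r
          (subst (r <_) (Occurrences.rank-length (branchBit (depth p)) β (λ v → branchBit (depth p) v ≟ β) (seq p)) r<)

      module _ (k : ℕ) (kB< : k * B < len′ c) where

        r≡ : k * B ≡ k * B div B * B
        r≡ = cong (_* B) (sym (*-cancel-div k 0<B))

        gf≡k : gf (k * B) ≡ k * B
        gf≡k = gf-self 2≤c c< kB< r≡

        row≡ : k * B div B + 1 ≡ k + 1
        row≡ = cong (_+ 1) (*-cancel-div k 0<B)

        long-in : ∀ {i} → i < B → long c (k * B + i) ≡ long c (k * B)
        long-in {i} i<B = cong (λ x → 𝟙< (sb c x + B) (sb c (x + (B ⊓ (len′ c ∸ x)) ∸ 1))) (trans (gf-in 2≤c c< kB< r≡ i<B) (sym gf≡k))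

        G-table : Step.Fact G-step M → M aux (64 * n * p + 16 * (k + 1) + (2 + 8 * β)) ≡ Q p β (k * B) div B
        G-table fact = trans (from-cell 2 row≡ (fact _ _ (GStep.child-act 2≤c c< kB< (multiple-on {k} 0<B)))) (trans (cong (sb c) gf≡k) (sb≡ (k * B)))

        F-table : Step.Fact F-step M → M aux (64 * n * p + 16 * (k + 1) + (3 + 8 * β)) ≡ long c (k * B)
        F-table fact = from-cell 3 row≡ (fact _ _ (FStep.child-act 2≤c c< kB< (multiple-on {k} 0<B)))

        E-table : Step.Fact E-step M → long c (k * B) ≢ 0 → ∀ i → i < B → k * B + i < len′ c →
          M aux (64 * n * p + 16 * (Q p β (k * B) div B + i + 2) + (5 + 8 * β)) ≡ Q p β (k * B + i)
        E-table fact on i i<B i< = trans (from-cell 5 (cong (_+ 2) (cong₂ _+_ (trans (cong (sb c) (gf-in 2≤c c< kB< r≡ i<B)) (sb≡ (k * B))) (mod-in 2≤c c< kB< r≡ i<B)))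
          (fact _ _ (EStep.child-act 2≤c c< i< (subst (_≢ 0) (sym (long-in i<B)) on)))) (Q≡ (k * B + i))

        module _ (short : 1 ∸ long c (k * B) ≢ 0) where

          P-table : Step.Fact P-step M → M aux (64 * n * p + 16 * (k + 1) + (4 + 8 * β)) ≡ pack ℓ F (relative c (k * B))
          P-table fact = from-cell 4 row≡ stored
            where
            on : groupStart c (k * B) * (1 ∸ long c (k * B)) ≢ 0
            on = *-≢0 (groupStart c (k * B)) (1 ∸ long c (k * B)) (multiple-on {k} 0<B) short
            stored : M aux (PStep.ad c (k * B)) ≡ pack ℓ F (relative c (k * B))
            stored = fact (off c + k * B) (PStep.ad c (k * B)) (PStep.child-act 2≤c c< kB< on)

          relative-small : ∀ u → u < F → relative c (k * B) u < 2 ^ ℓ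
          relative-small u u<F = ≤-<-trans (relative< 2≤c c< kB< r≡ short u u<F) B<2^ℓ

          relative≡ : ∀ u → u < F → k * B + u * b < len′ c → Q p β (k * B) div B + relative c (k * B) u ≡ Q p β (k * B + u * b) div B
          relative≡ u _ u< = trans (cong₂ _+_ (sym (sb≡ (k * B))) (trans (cong (_* (sb c (k * B + u * b) ∸ sb c (k * B))) (𝟙<-true u<)) (*-identityˡ _)))
            (trans (m+[n∸m]≡n (sb-mono (m≤m+n (k * B) (u * b)) u<)) (sb≡ (k * B + u * b)))

          S-table : Step.Fact S-step M → ∀ u i → u < F → i < b → k * B + u * b + i < len′ c →
            let s = Q p β (k * B + u * b) div B in (s + 2) * B ≤ Q p β (k * B + u * b + i) →
            ∃[ N ] ∃[ v ] N ≤ b × i < N × (∀ i → i < N → v i < 2 ^ ℓ) × M aux (64 * n * p + 16 * (s + 2) + (6 + 8 * β)) ≡ pack ℓ N v ×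
              s * B + v i ≡ Q p β (k * B + u * b + i)
          S-table fact u i u<F i<b i< far = N , offsets c r , m⊓n≤m b _ , i<N ,
              (λ i′ i′< → subgroup-bound {c} {r} {i′} 2≤c c< r< mod≡ short-r (<-≤-trans i′< (m⊓n≤m b _)) (subst (r + i′ <_) (m+[n∸m]≡n (<⇒≤ r<)) (+-monoʳ-< r (<-≤-trans i′< (m⊓n≤n b _))))) ,
              from-cell 6 (cong (_+ 2) (sb≡ r)) stored ,
              trans (cong (λ t → Q p β r div B * B + (Qc c (r + i) ∸ t * B)) (sb≡ r)) (trans (cong (λ t → Q p β r div B * B + (t ∸ Q p β r div B * B)) (Q≡ (r + i)))
                (m+[n∸m]≡n (≤-trans (*-monoˡ-≤ B (m≤m+n (Q p β r div B) 2)) far)))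
            where
            r = k * B + u * b
            N = b ⊓ (len′ c ∸ r)
            r< : r < len′ c
            r< = ≤-<-trans (m≤m+n r i) i<
            ub<B : u * b < B
            ub<B = <-≤-trans (*-monoˡ-< b {{>-nonZero 0<b}} u<F) (≤-reflexive (*-comm F b))
            i<N : i < N
            i<N = ⊓-pres-m< i<b (m+n≤o⇒m≤o∸n (suc i) (subst (_≤ len′ c) (cong suc (+-comm r i)) i<))
            mod≡ : r mod b ≡ 0
            mod≡ = mod-unique (k * F + u) 0<b (trans (cong (λ t → k * t + u * b) (*-comm b F)) (lemma k F b u))
              where
              lemma : ∀ k F b u → k * (F * b) + u * b ≡ (k * F + u) * b
              lemma = solve-∀
            -- `long` depends only on the group, and `r` lies in the group that starts at `k * B`.
            short-r : 1 ∸ long c r ≢ 0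
            short-r = subst (λ t → 1 ∸ t ≢ 0) (sym (long-in ub<B)) short
            far′ : sb c r + 1 < sb c (sl c r)
            far′ = <-≤-trans (≤-trans (≤-reflexive (trans (lemma (sb c r)) (cong (_+ 2) (sb≡ r)))) (≤-trans (≤div 0<B far) (≤-reflexive (sym (sb≡ (r + i))))))
                (sb-mono (≤last {b} {r} i< i<b) (last< {b} 0<b r<))
              where
              lemma : ∀ x → suc (x + 1) ≡ x + 2
              lemma = solve-∀
            on : spread-on c r ≢ 0
            on = *-≢0 (𝟙≡ (r mod b) 0) ((1 ∸ long c r) * 𝟙< (sb c r + 1) (sb c (sl c r)))
              (λ q → case trans (sym (cong (λ t → 𝟙≡ t 0) mod≡)) q of λ ())
              (*-≢0 (1 ∸ long c r) (𝟙< (sb c r + 1) (sb c (sl c r))) short-r (λ q → case trans (sym (𝟙<-true far′)) q of λ ()))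
            stored : M aux (SStep.ad c r) ≡ pack ℓ N (offsets c r)
            stored = fact (off c + r) (SStep.ad c r) (SStep.child-act 2≤c c< r< on)

    by-bit : ∀ {P : ℕ → Set} → P 0 → P 1 → ∀ β → β ≤ 1 → P β
    by-bit p₀ p₁ 0 _ = p₀
    by-bit p₀ p₁ 1 _ = p₁
    by-bit p₀ p₁ (suc (suc _)) (s≤s ())

    table : Facts steps M → Table m (bf p) (λ β r → Q p β r) M (64 * n * p) (off p)
    table (fR₀ , fR₁ , fD₀ , fD₁ , fB , fG , fF , fP , fE , fS , _ , _ , _ , _ , fH , _) = record
      { e-stored    = trans (cong (M aux) (lemma n p)) (fH p (header-cell p) (1≤p , p< , refl))
      ; bits-stored = λ q q< → BitSteps.bits-stored {M} fB 1≤p p< q<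
      ; R-stored    = λ β s β≤1 → by-bit {λ β → s * B < m → M aux (64 * n * p + 16 * (s + 1) + (0 + 8 * β)) ≡ rk m (bf p) β (s * B)} (R-table 0 z≤n fR₀ s) (R-table 1 (s≤s z≤n) fR₁ s) β β≤1
      ; D-stored    = λ β s β≤1 → by-bit {λ β → s * B < m → M aux (64 * n * p + 16 * (s + 1) + (1 + 8 * β)) ≡ pack ℓ F (counts m (bf p) β s)} (D-table 0 z≤n fD₀ s) (D-table 1 (s≤s z≤n) fD₁ s) β β≤1
      ; Q-spec      = λ β r β≤1 → Select.Q-table β β≤1 r
      ; G-stored    = λ β k β≤1 k< → Select.G-table β β≤1 k (subst (k * B <_) (count≡ β β≤1) k<) fG
      ; group       = λ β k β≤1 k< → group-table β β≤1 k (subst (k * B <_) (count≡ β β≤1) k<)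
      }
      where
      lemma : ∀ n p → 64 * n * p + 7 ≡ 16 * (4 * n * p + 0) + 7
      lemma = solve-∀
      group-table : ∀ β (β≤1 : β ≤ 1) k → k * B < len′ (2 * p + β) →
        GroupStored m (bf p) (λ β r → Q p β r) (λ row f → M aux (64 * n * p + 16 * row + (f + 8 * β))) β k
      group-table β β≤1 k k< = decide (sb c (gf (k * B)) + B <? sb c (gl c (k * B)))
        where
        open Select β β≤1
        resize : ∀ {x} → x < rk m (bf p) β m → x < len′ c
        resize {x} = subst (x <_) (count≡ β β≤1)
        last<m : Qc c (gl c (k * B)) < m
        last<m = subst (λ x → Qc c (gl c (k * B)) < len′ x) p≡ (proj₁ (Parent.Q-spec 2≤c c< (gl< {c} {k * B} k<)))
        decide : Dec (sb c (gf (k * B)) + B < sb c (gl c (k * B))) →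
          GroupStored m (bf p) (λ β r → Q p β r) (λ row f → M aux (64 * n * p + 16 * row + (f + 8 * β))) β k
        decide (yes q) = inj₁ (trans (F-table k k< fF) (𝟙<-true q) ,
            subst (λ x → x + B ≤ m div B) (sb≡ (k * B)) (subst (λ x → sb c x + B ≤ m div B) (gf≡k k k<) (≤-trans (<⇒≤ q) (div-mono B (<⇒≤ last<m)))) ,
            λ i i<B i< → E-table k k< fE (λ q′ → case trans (sym (𝟙<-true q)) q′ of λ ()) i i<B (resize i<))
        decide (no q) = inj₂ (trans (F-table k k< fF) (𝟙<-false (≮⇒≥ q)) ,
            (relative c (k * B) , relative-small k k< short , P-table k k< short fP , λ u u< lts → relative≡ k k< short u u< (resize lts)) ,
            λ u i u< i< lts far → S-table k k< short fS u i u< i< (resize lts) far)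
          where
          short : 1 ∸ long c (k * B) ≢ 0
          short q′ = case trans (sym (cong (1 ∸_) (𝟙<-false (≮⇒≥ q)))) q′ of λ ()

-- The specified ranks and occurrences as sums of indicators

rankSum : (ℕ → ℕ) → ℕ → List ℕ → ℕ → ℕ
rankSum g β X i = Σ< i (λ j → 𝟙< j (length X) * 𝟙≡ (g (nth X j)) β)

rankSum-∷ : ∀ g β x X i → rankSum g β (x ∷ X) (suc i) ≡ 𝟙≡ (g x) β + rankSum g β X i
rankSum-∷ g β x X i = trans (Σ-suc i (λ j → 𝟙< j (suc (length X)) * 𝟙≡ (g (nth (x ∷ X) j)) β)) (cong (_+ rankSum g β X i) (*-identityˡ (𝟙≡ (g x) β)))

occurrences-∷ : ∀ β y Y → occurrences β (y ∷ Y) ≡ 𝟙≡ y β + occurrences β Y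
occurrences-∷ β y Y with y ≟ β
... | yes refl = trans (cong length (filter-accept (_≟ β) {xs = Y} refl)) (cong (_+ occurrences β Y) (sym (𝟙≡-true β)))
... | no y≢ = trans (cong length (filter-reject (_≟ β) {xs = Y} y≢)) (cong (_+ occurrences β Y) (sym (𝟙≡-false y≢)))

rank-map : ∀ (g : ℕ → ℕ) β X i → rank β i (map g X) ≡ rankSum g β X i
rank-map g β []      zero    = refl
rank-map g β []      (suc i) = sym (trans (Σ-cong (suc i) {g = λ _ → 0} (λ j _ → refl)) (trans (Σ-const (suc i) 0) (*-zeroʳ (suc i))))
rank-map g β (x ∷ X) zero    = refl
rank-map g β (x ∷ X) (suc i) = trans (occurrences-∷ β (g x) (take i (map g X)))
  (trans (cong (𝟙≡ (g x) β +_) (rank-map g β X i)) (sym (rankSum-∷ g β x X i)))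

occurrences-map : ∀ (g : ℕ → ℕ) β X → occurrences β (map g X) ≡ rankSum g β X (length X)
occurrences-map g β []      = refl
occurrences-map g β (x ∷ X) = trans (occurrences-∷ β (g x) (map g X))
  (trans (cong (𝟙≡ (g x) β +_) (occurrences-map g β X)) (sym (rankSum-∷ g β x X (length X))))

lookup-map : ∀ (g : ℕ → ℕ) X (i : Fin (length (map g X))) → lookup (map g X) i ≡ g (nth X (toℕ i))
lookup-map g (x ∷ X) fzero    = refl
lookup-map g (x ∷ X) (fsuc i) = lookup-map g X i

-- The structure takes O(m / log log m) bits for a bitmap of length m.

loglog : ℕ → ℕ
loglog m = ⌊log₂ lg m ⌋

structureSize : ℕ → ℕ
structureSize m = 16 * ((8 * m) div suc (loglog m))

structureSize-sublinear : Sublinear structureSize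
-- From this length on, log log m is at least 128 k; here 128 = 16 * 8 collects the two factors of
-- `structureSize`.
structureSize-sublinear k = 2 ^ 2 ^ (128 * k) , λ m large → *-cancelˡ-≤ 8 (≤-trans (≤-reflexive (lemma k ((8 * m) div suc (loglog m))))
    (≤-trans (*-monoʳ-≤ ((8 * m) div suc (loglog m)) (≤-trans (big m large) (n≤1+n (loglog m)))) (div*≤ (8 * m) (suc (loglog m)))))
  where
  lemma : ∀ k x → 8 * (k * (16 * x)) ≡ x * (128 * k)
  lemma = solve-∀
  big : ∀ m → 2 ^ 2 ^ (128 * k) ≤ m → 128 * k ≤ loglog m
  big m large = ≤-trans (≤-reflexive (sym (⌊log₂[2^n]⌋≡n (128 * k)))) (⌊log₂⌋-mono-≤
    (≤-trans (≤-reflexive (sym (⌈log₂2^n⌉≡n (2 ^ (128 * k))))) (≤-trans (⌈log₂⌉-mono-≤ large) (m≤n⊔m 1 ⌈log₂ m ⌉))))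

-- The slack of 48 words is three rows of 16: the header row, and the two rows by which the rows in
-- use can exceed the number of full superblocks.
structure : RankSelect
structure = record
  { rankQuery   = assign result rankE ∷ []
  ; selectQuery = assign result selectE ∷ []
  ; queryWork   = ops rankE + ops selectE + 4
  ; size        = structureSize
  ; sublinear   = structureSize-sublinear
  ; slack       = 48
  }

-- Every node carries a correct structure

module NodeProof (𝒮 : Setting) (dense : Setting.w 𝒮 * Setting.e 𝒮 ≤ 4 * Geometry.B (Setting.w 𝒮) (Setting.e 𝒮))
  (loglog≤ : ∀ m → m ≤ length (Setting.L 𝒮) → suc (loglog m) ≤ 2 * Setting.e 𝒮) where

  open Tables 𝒮 public

  module _ {n₀ σ : ℕ} (S : Vec (Fin σ) n₀) {M : Mem} (inp : Inp M) (facts : Facts steps M) {p : ℕ} (1≤p : 1 ≤ p) (p< : p < 2 ^ Λ) where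

    private
      p<nodes : p < nodes
      p<nodes = <-≤-trans p< 2^Λ≤nodes

      g : ℕ → ℕ
      g = branchBit (depth p)

      Bp : List ℕ
      Bp = map g (seq p)

      m : ℕ
      m = len′ p

      length≡ : length Bp ≡ m
      length≡ = length-map g (seq p)

      start≡ : M start p ≡ off p
      start≡ = Inp.off-stored inp p 1≤p p<nodes

      auxStart≡ : M auxStart p ≡ 64 * n * p
      auxStart≡ = proj₁ (proj₂ (proj₂ (proj₂ (proj₂ (proj₂ (proj₂ (proj₂ (proj₂ (proj₂ (proj₂ (proj₂ (proj₂ facts)))))))))))) p p (1≤p , p< , refl)

      auxLen≡ : M auxLen p ≡ 16 * (m div B + 3)
      auxLen≡ = proj₁ (proj₂ (proj₂ (proj₂ (proj₂ (proj₂ (proj₂ (proj₂ (proj₂ (proj₂ (proj₂ (proj₂ (proj₂ (proj₂ facts))))))))))))) p p (1≤p , p< , refl)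

      tbl : Table m (bf p) (λ β r → Q p β r) M (64 * n * p) (off p)
      tbl = table 1≤p p< facts

      -- A row of 16 words per superblock makes `16 * w * (m / B)` bits. By `dense` this is at most
      -- 64 m / e, and by `loglog≤` the divisor `e` is at least half of `suc (loglog m)`.
      succinct-size : 16 * (m div B + 3) * w ≤ structureSize m + 48 * w
      succinct-size = ≤-trans (≤-reflexive (lemma (m div B) w)) (+-monoˡ-≤ (48 * w) (*-monoʳ-≤ 16 (≤div {8 * m} {suc (loglog m)} {m div B * w} z<s fits)))
        where
        lemma : ∀ x w → 16 * (x + 3) * w ≡ 16 * (x * w) + 48 * w
        lemma = solve-∀
        shape : ∀ x w e → x * w * (2 * e) ≡ 2 * (x * (w * e))
        shape = solve-∀
        shape′ : ∀ x B → 2 * (x * (4 * B)) ≡ 8 * (x * B)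
        shape′ = solve-∀
        x = m div B * w
        grow : x * suc (loglog m) ≤ x * (2 * e)
        grow = *-monoʳ-≤ x {suc (loglog m)} {2 * e} (loglog≤ m (len≤n p))
        fits : x * suc (loglog m) ≤ 8 * m
        fits = ≤-trans grow (≤-trans (≤-reflexive (shape (m div B) w e)) (≤-trans (*-monoʳ-≤ 2 (*-monoʳ-≤ (m div B) dense))
            (≤-trans (≤-reflexive (shape′ (m div B) B)) (*-monoʳ-≤ 8 (div*≤ m B)))))

      bf<2 : ∀ q → q < m → bf p q < 2
      bf<2 q _ = branchBit<2 (depth p) (nth (seq p) q)

      A₀< : 64 * n * p < 2 ^ (8 * θ)
      A₀< = <-≤-trans (*-mono-< (*-mono-< 64< n<) (node-bound p<nodes)) (≤-trans (≤-reflexive (trans (cong (_* 2 ^ (2 * θ)) (sym (2^-+ (1 * θ) (1 * θ)))) (sym (2^-+ (1 * θ + 1 * θ) (2 * θ)))))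
          (2^-mono (≤-trans (≤-reflexive (lemma θ)) (*-monoˡ-≤ θ (≤ᵇ⇒≤ 4 8 _)))))
        where
        lemma : ∀ θ → 1 * θ + 1 * θ + 2 * θ ≡ 4 * θ
        lemma = solve-∀
        64< : 64 < 2 ^ (1 * θ)
        64< = <-≤-trans (<ᵇ⇒< 64 1024 _) (2^-mono {10} (≤-trans 10≤θ (≤-reflexive (sym (*-identityˡ θ)))))

      st< : off p < 2 ^ (2 * θ)
      st< = ≤-<-trans (≤-trans (off-mono (<⇒≤ p<nodes)) (≤-reflexive (off-level (suc Λ) ≤-refl))) slots<

      module Asked {m₀ β i M′} (m₀≡ : m₀ ≡ m) (β≤1 : β ≤ 1) (query : Query w structure S M m₀ p β i M′) where

        open Query query

        table′ : Table m (bf p) (λ β r → Q p β r) M′ (64 * n * p) (off p)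
        table′ = table-transfer 0<B
          (λ q q< → subst (λ s → M′ bits ((s + q) div w) ≡ M bits ((s + q) div w)) start≡ (≡-bits q (subst (q <_) (sym m₀≡) q<)))
          (λ x x< → subst (λ a → M′ aux (a + x) ≡ M aux (a + x)) auxStart≡ (≡-aux x (subst (x <_) (sym auxLen≡) x<)))
          tbl

        ranks : ∀ {i} → M′ arg 2 ≡ i → i ≤ m → eval w M′ 0 rankE ≡ rk m (bf p) β i
        ranks = QueryProof.rank-correct w e θ sz bf<2 table′ words (proj₂ (proj₂ parameters)) (node-bound p<nodes) arg-node β≤1 arg-bit
          A₀< (trans ≡-auxStart auxStart≡) st< (trans ≡-start start≡) (len< p)

        selects : ∀ {j} → M′ arg 2 ≡ suc j → j < rk m (bf p) β m → ∃[ q ] eval w M′ 0 selectE ≡ q × q < m × rk m (bf p) β q ≤ j × j < rk m (bf p) β (suc q)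
        selects = QueryProof.select-correct w e θ sz bf<2 table′ words (proj₂ (proj₂ parameters)) (node-bound p<nodes) arg-node β≤1 arg-bit
          A₀< (trans ≡-auxStart auxStart≡) st< (trans ≡-start start≡) (len< p)

      answer : ∀ {M′ v y} {P : Mem → Set} → Words w M′ → eval w M′ 0 v ≡ y → (∀ M″ → M″ result 0 ≡ y → P M″) → ∀ {c} → ops v + 4 ≤ c →
        Halts w (λ M″ t _ → P M″ × t ≤ c) (assign result v ∷ []) M′ 0 0
      answer {M′} {v} {y} Wd v≡ post cost = Triple.run (assign-rule {1} {1} {Q = λ M″ → M″ result 0 ≡ y} Wd ≤-refl ≤-refl v≡ (λ _ _ _ q → q)) _ [] 0 0
        λ M″ t d _ q t≤ _ → done (post M″ q , ≤-trans t≤ (≤-trans (≤-reflexive (*-identityʳ _)) cost))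

      rank-cost : ops rankE + 4 ≤ RankSelect.queryWork structure
      rank-cost = +-monoˡ-≤ 4 {ops rankE} {ops rankE + ops selectE} (m≤m+n (ops rankE) (ops selectE))

      select-cost : ops selectE + 4 ≤ RankSelect.queryWork structure
      select-cost = +-monoˡ-≤ 4 {ops selectE} {ops rankE + ops selectE} (m≤n+m (ops selectE) (ops rankE))

      -- The rank rises across position `q`. As one position adds at most 1, its bit is `β` and the
      -- rank after it is exactly `j + 1`.
      is-select : ∀ β j q → q < m → rk m (bf p) β q ≤ j → j < rk m (bf p) β (suc q) → IsSelect β (suc j) Bp q
      is-select β j q q<m lo hi = fromℕ< q<len , toℕ-fromℕ< q<len ,
          trans (lookup-map g (seq p) (fromℕ< q<len)) (trans (cong (λ t → g (nth (seq p) t)) (toℕ-fromℕ< q<len)) bit≡) ,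
          trans (cong (λ t → rank β (suc t) Bp) (toℕ-fromℕ< q<len)) (trans (rank-map g β (seq p) (suc q)) rank≡)
        where
        q<len : q < length Bp
        q<len = subst (q <_) (sym length≡) q<m
        here : rk m (bf p) β (suc q) ≡ rk m (bf p) β q + 𝟙≡ (bf p q) β
        here = cong (rk m (bf p) β q +_) (trans (cong (_* 𝟙≡ (bf p q) β) (𝟙<-true q<m)) (*-identityˡ _))
        bit≡ : bf p q ≡ β
        bit≡ = 𝟙≡-true⁻¹ λ z → <⇒≱ hi (≤-trans (≤-reflexive (trans here (trans (cong (rk m (bf p) β q +_) z) (+-identityʳ _)))) lo)
        rank≡ : rk m (bf p) β (suc q) ≡ suc j
        rank≡ = ≤-antisym (≤-trans (≤-reflexive here) (≤-trans (+-mono-≤ lo (𝟙≤1 (bf p q ≡ᵇ β))) (≤-reflexive (+-comm j 1)))) hi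

    node-at : NodeAt w structure S M (map (branchBit (depth p)) (seq p)) p
    node-at = record
      { length-stored = trans (Inp.len-stored inp p 1≤p p<nodes) (sym length≡)
      ; bitmap-stored = λ i → trans (cong (λ s → bitAt w M bits (s + toℕ i)) start≡)
          (trans (Table.bits-stored tbl (toℕ i) (subst (toℕ i <_) length≡ (toℕ<n i))) (sym (lookup-map g (seq p) i)))
      ; succinct      = subst₂ (λ a s → a * w ≤ structureSize s + 48 * w) (sym auxLen≡) (sym length≡) succinct-size
      ; rank-ok       = λ β i M′ β≤1 i≤ query → answer {P = λ M″ → M″ result 0 ≡ rank β i Bp} (Query.words query)
          (trans (Asked.ranks length≡ β≤1 query (Query.arg-index query) (subst (i ≤_) length≡ i≤)) (sym (rank-map g β (seq p) i)))
          (λ _ q → q) rank-cost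
      ; select-ok     = λ β j M′ β≤1 1≤j j≤ query → select-ok′ β j M′ β≤1 1≤j j≤ query
      }
      where
      select-ok′ : ∀ β j M′ → β ≤ 1 → 1 ≤ j → j ≤ occurrences β Bp → Query w structure S M (length Bp) p β j M′ →
        Halts w (λ M″ t _ → IsSelect β j Bp (M″ result 0) × t ≤ RankSelect.queryWork structure) (assign result selectE ∷ []) M′ 0 0
      select-ok′ β (suc j) M′ β≤1 _ j≤ query = finish (Asked.selects length≡ β≤1 query (Query.arg-index query) (subst (j <_) (occurrences-map g β (seq p)) j≤))
        where
        finish : (∃[ q ] eval w M′ 0 selectE ≡ q × q < m × rk m (bf p) β q ≤ j × j < rk m (bf p) β (suc q)) →
          Halts w (λ M″ t _ → IsSelect β (suc j) Bp (M″ result 0) × t ≤ RankSelect.queryWork structure) (assign result selectE ∷ []) M′ 0 0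
        finish (q , q≡ , q<m , lo , hi) = answer {P = λ M″ → IsSelect β (suc j) Bp (M″ result 0)} (Query.words query) q≡
          (λ M″ r≡ → subst (IsSelect β (suc j) Bp) (sym r≡) (is-select β j q q<m lo hi)) select-cost

-- The next level from the present one

lvl dest : Array
lvl  = 22
dest = 23

levelE slotE codeE parentE branchE : Exp
levelE  = cell lvl
slotE   = levelE ⊗ nE ⊕ pid
codeE   = load cur slotE
parentE = bin shr codeE (lamE ⊖ levelE)
branchE = bin shr codeE (lamE ⊖ lit 1 ⊖ levelE) ⊛ lit 2

-- Reads the prefix sums of the bits of the level from dst.
onesBeforeE : Exp → Exp → Exp
onesBeforeE p q = load dst (load start p ⊖ levelE ⊗ nE ⊕ q) ⊖ load dst (load start p ⊖ levelE ⊗ nE)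

newE newParentE newBitE newOnesE newLenE newStartE destE : Exp
newE       = 2^E (levelE ⊕ lit 1) ⊕ pid
newParentE = newE ⊘ lit 2
newBitE    = newE ⊛ lit 2
newOnesE   = onesBeforeE newParentE (load len newParentE)
newLenE    = ifE newBitE newOnesE (load len newParentE ⊖ newOnesE)
-- By `off-2*` a left child starts `n` slots after its parent; a right child follows the zeros that
-- form its left sibling.
newStartE  = load start newParentE ⊕ nE ⊕ newBitE ⊗ (load len newParentE ⊖ newOnesE)
destE      = load start (lit 2 ⊗ parentE ⊕ branchE)
  ⊕ ifE branchE (onesBeforeE parentE q) (q ⊖ onesBeforeE parentE q)
  where q = slotE ⊖ load start parentE

levelP : Program
levelP = (pardo nE (lit 1) src pid branchE ∷ []) ++ scan
  ++ (pardo (2^E (levelE ⊕ lit 1)) (lit 1) len newE newLenE ∷ [])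
  ++ (pardo (2^E (levelE ⊕ lit 1)) (lit 1) start newE newStartE ∷ [])
  ++ (pardo nE (lit 1) dest pid destE ∷ [])
  ++ (pardo nE (lit 1) cur (load dest pid) codeE ∷ [])
  ++ (pardo nE (lit 1) pos (load dest pid) (slotE ⊖ load start parentE) ∷ [])

-- `Y₁` is the depth unit of a single level, and the work unit of a level is `n`; the loop over `Λ`
-- levels multiplies both up to `X` and `Y`.
module Levels (𝒮 : Setting) (Y₁ : ℕ) (1≤Y₁ : 1 ≤ Y₁) (w≤n : Setting.w 𝒮 ≤ Setting.γ 𝒮 * length (Setting.L 𝒮)) (w≤Y₁ : Setting.w 𝒮 ≤ Setting.γ 𝒮 * Y₁) where

  open Steps 𝒮 public

  record Base (M : Mem) : Set where
    field
      n-stored    : M params 0 ≡ n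
      w-stored    : M params 2 ≡ w
      lam-stored  : M lam 0 ≡ Λ
      hdr-stored  : M hdr 0 ≡ e
      root-stored : M root 0 ≡ 1
      slen-stored : M slen 0 ≡ n

  baseArrays : List ℕ
  baseArrays = params ∷ lam ∷ hdr ∷ root ∷ slen ∷ []

  base-keep : ∀ K {M M′} → {_ : T (disjoint baseArrays K)} → Keeps K M M′ → Base M → Base M′
  base-keep K {_} {_} {d} k i = record
    { n-stored    = trans (k params (ok params λ ()) 0) n-stored
    ; w-stored    = trans (k params (ok params λ ()) 2) w-stored
    ; lam-stored  = trans (k lam (ok lam λ ()) 0) lam-stored
    ; hdr-stored  = trans (k hdr (ok hdr λ ()) 0) hdr-stored
    ; root-stored = trans (k root (ok root λ ()) 0) root-stored
    ; slen-stored = trans (k slen (ok slen λ ()) 0) slen-stored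
    }
    where
    open Base i
    ok : ∀ A → ¬ T (fresh baseArrays A) → T (fresh K A)
    ok A = disjoint-fresh baseArrays K d

  Starts Lens Codes Positions : ℕ → Mem → Set
  Starts D M    = ∀ c → 1 ≤ c → c < 2 ^ D → M start c ≡ off c
  Lens D M      = ∀ c → 1 ≤ c → c < 2 ^ D → M len c ≡ len′ c
  Codes D M     = ∀ c r → 1 ≤ c → c < 2 ^ D → r < len′ c → M cur (off c + r) ≡ nth (seq c) r
  Positions D M = ∀ p β r → 1 ≤ p → p < 2 ^ D → β ≤ 1 → r < len′ (2 * p + β) → M pos (off (2 * p + β) + r) ≡ Q p β r

  Same : Array → Mem → Mem → Set
  Same A M M′ = ∀ j → M′ A j ≡ M A j

  wrote-keeps : ∀ {x g A a v M M′} → Wrote x g A a v M M′ → Keeps (A ∷ []) M M′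
  wrote-keeps {A = A} out B f = untouched out (fresh-≢ {A ∷ []} f (own-key A))

  starts-keep : ∀ D M M′ → Same start M M′ → Starts D M → Starts D M′
  starts-keep D M M′ k s c 1≤c c< = trans (k c) (s c 1≤c c<)

  lens-keep : ∀ D M M′ → Same len M M′ → Lens D M → Lens D M′
  lens-keep D M M′ k s c 1≤c c< = trans (k c) (s c 1≤c c<)

  codes-keep : ∀ D M M′ → Same cur M M′ → Codes D M → Codes D M′
  codes-keep D M M′ k s c r 1≤c c< r< = trans (k _) (s c r 1≤c c< r<)

  positions-keep : ∀ D M M′ → Same pos M M′ → Positions D M → Positions D M′
  positions-keep D M M′ k s p β r 1≤p p< β≤ r< = trans (k _) (s p β r 1≤p p< β≤ r<)

  -- All four tables cover the nodes of depth at most `d`. `Positions` is indexed by the parent,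
  -- hence `d` and not `suc d`.
  Level : ℕ → Mem → Set
  Level d M = Base M × Starts (suc d) M × Lens (suc d) M × Codes (suc d) M × Positions d M

  level-stable : ∀ {d M M′} → only lvl M M′ → Level d M → Level d M′
  level-stable {d} {M} {M′} o (b , s , l , c , p) = base-keep (lvl ∷ []) (λ B f j → o B j (fresh-≢ {lvl ∷ []} f λ ())) b ,
    starts-keep (suc d) M M′ (λ j → o start j λ ()) s , lens-keep (suc d) M M′ (λ j → o len j λ ()) l ,
    codes-keep (suc d) M M′ (λ j → o cur j λ ()) c , positions-keep d M M′ (λ j → o pos j λ ()) p

  count₁ : ℕ → ℕ → ℕ
  count₁ p q = Σ< q (bf p)

  rank₁ : ∀ p q → q ≤ len′ p → rank′ p 1 q ≡ count₁ p q
  rank₁ p q q≤ = Σ-cong q λ i i<q → trans (cong (_* 𝟙≡ (bf p i) 1) (𝟙<-true (<-≤-trans i<q q≤))) (trans (*-identityˡ _) (sym (same-indicator (branchBit<2 (depth p) _))))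

  rank₀ : ∀ p q → q ≤ len′ p → rank′ p 0 q ≡ q ∸ count₁ p q
  rank₀ p q q≤ = sym (∸-swap (sym (trans (cong (count₁ p q +_) (Σ-cong q λ i i<q → trans (cong (_* 𝟙≡ (bf p i) 0) (𝟙<-true (<-≤-trans i<q q≤)))
      (trans (*-identityˡ _) (sym (flip-indicator (branchBit<2 (depth p) _))))))
    (trans (sym (Σ-+ q (bf p) (λ i → 1 ∸ bf p i))) (trans (Σ-cong q (λ i _ → m+[n∸m]≡n (s≤s⁻¹ (branchBit<2 (depth p) (nth (seq p) i))))) (trans (Σ-const q 1) (*-identityʳ q)))))))

  module Occ (p β : ℕ) = Occurrences (branchBit (depth p)) β (λ v → branchBit (depth p) v ≟ β)

  rank-total : ∀ p β → 1 ≤ p → p < 2 ^ Λ → β ≤ 1 → rank′ p β (len′ p) ≡ len′ (2 * p + β)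
  rank-total p β 1≤p p< β≤1 = trans (Occ.rank-length p β (seq p)) (sym (cong length (seq-child p β 1≤p (depth-< 1≤p p<) β≤1)))

  off-odd : ∀ p → 1 ≤ p → p < 2 ^ Λ → off (2 * p + 1) ≡ off p + n + rank′ p 0 (len′ p)
  off-odd p 1≤p p< = trans (cong off (+-comm (2 * p) 1)) (trans (off-suc (2 * p) (≤-trans 1≤p (m≤n*m p 2))) (cong₂ _+_ (off-2* p 1≤p (<⇒≤ p<))
    (trans (cong len′ (sym (+-identityʳ (2 * p)))) (sym (rank-total p 0 1≤p p< z≤n)))))

  module AtLevel {d : ℕ} (d<Λ : d < Λ) where

    base : ℕ
    base = d * n

    base≡ : off (2 ^ d) ≡ base
    base≡ = off-level d (<⇒≤ (<-trans d<Λ (n<1+n Λ)))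

    next≡ : off (2 ^ suc d) ≡ n + base
    next≡ = off-level (suc d) (<⇒≤ (s≤s d<Λ))

    2^d≤ : 2 ^ suc d ≤ 2 ^ Λ
    2^d≤ = 2^-mono d<Λ

    record OnLevel (x : ℕ) : Set where
      constructor on-level
      field
        {p q} : ℕ
        2^d≤p : 2 ^ d ≤ p
        p<2^  : p < 2 ^ suc d
        q<    : q < len′ p
        x≡    : base + x ≡ off p + q
      1≤p : 1 ≤ p
      1≤p = ≤-trans (0<2^ d) 2^d≤p
      p<Λ : p < 2 ^ Λ
      p<Λ = <-≤-trans p<2^ 2^d≤
      p<nodes : p < nodes
      p<nodes = <-≤-trans p<Λ 2^Λ≤nodes
      depth≡ : depth p ≡ d
      depth≡ = ≤-antisym (s≤s⁻¹ (depth-< 1≤p p<2^)) (≤depth 2^d≤p)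

    on : ∀ x → x < n → OnLevel x
    on x x< with locate (2 ^ suc d) (base + x) (≤-trans (≤-reflexive (sym (+-suc base x))) (≤-trans (+-monoʳ-≤ base x<) (≤-reflexive (trans (+-comm base n) (sym next≡)))))
    ... | p , q , 1≤p , p< , q< , z≡ = on-level (≮⇒≥ λ p<2^d → <⇒≱ (segment-end 1≤p p<2^d q<) (≤-trans (≤-reflexive base≡) (≤-trans (m≤m+n base x) (≤-reflexive z≡)))) p< q< z≡

    base≤ : ∀ {p} → 2 ^ d ≤ p → base ≤ off p
    base≤ 2^d≤p = ≤-trans (≤-reflexive (sym base≡)) (off-mono 2^d≤p)

    index : ∀ {p q} → 2 ^ d ≤ p → p < 2 ^ suc d → q < len′ p → base + (off p ∸ base + q) ≡ off p + q × off p ∸ base + q < n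
    index {p} {q} 2^d≤p p< q< = z≡ , +-cancelˡ-< base _ n (subst (_< base + n) (sym z≡) (<-≤-trans (segment-end (≤-trans (0<2^ d) 2^d≤p) p< q<) (≤-reflexive (trans next≡ (+-comm n base)))))
      where
      z≡ : base + (off p ∸ base + q) ≡ off p + q
      z≡ = trans (sym (+-assoc base (off p ∸ base) q)) (cong (_+ q) (m+[n∸m]≡n (base≤ 2^d≤p)))

    end≤ : ∀ {p} → 2 ^ d ≤ p → p < 2 ^ suc d → off p ∸ base + len′ p ≤ n
    end≤ {p} 2^d≤p p< = +-cancelˡ-≤ base _ n (≤-trans (≤-reflexive (trans (sym (+-assoc base (off p ∸ base) (len′ p))) (cong (_+ len′ p) (m+[n∸m]≡n (base≤ 2^d≤p)))))
      (≤-trans (≤-reflexive (sym (off-suc p (≤-trans (0<2^ d) 2^d≤p)))) (≤-trans (off-mono p<) (≤-reflexive (trans next≡ (+-comm n base))))))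

    Sums : Mem → Set
    Sums M = ∀ p q → 2 ^ d ≤ p → p < 2 ^ suc d → q ≤ len′ p → M dst (off p ∸ base + q) ∸ M dst (off p ∸ base) ≡ count₁ p q

    count₁≤ : ∀ p q → q ≤ len′ p → count₁ p q ≤ n
    count₁≤ p q q≤ = ≤-trans (Σ-≤ q (λ i _ → s≤s⁻¹ (branchBit<2 (depth p) (nth (seq p) i)))) (≤-trans (≤-reflexive (trans (Σ-const q 1) (*-identityʳ q))) (≤-trans q≤ (len≤n p)))

    module Cells {M} (Wd : Words w M) (b : Base M) (d≡ : M lvl 0 ≡ d) (z : ℕ) where

      open Base b public
      open At M Wd z public

      d<2^ : d < 2 ^ (1 * θ)
      d<2^ = <-trans d<Λ (<-trans (n<1+n Λ) Λ<)

      nV : nE ⇓⟨ 1 ⟩ n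
      nV = loadˢ 1 (litˢ 0) n-stored n<

      lamV : lamE ⇓⟨ 1 ⟩ Λ
      lamV = loadˢ 1 (litˢ 0) lam-stored (<-trans (n<1+n Λ) Λ<)

      levelV : levelE ⇓⟨ 1 ⟩ d
      levelV = loadˢ 1 (litˢ 0) d≡ d<2^

      Λ<w : Λ < w
      Λ<w = <-≤-trans (2^-cancel-< (node-bound (^-monoʳ-< 2 (s≤s (s≤s z≤n)) (n<1+n Λ)))) (≤-trans (*-monoˡ-≤ θ (s≤s (s≤s (z≤n {62})))) 64θ≤w)

      doubleV : 2^E (levelE ⊕ lit 1) ⇓ 2 ^ suc d
      doubleV = cast (cong (2 ^_) (+-comm d 1)) (2^⇓ (↓ (levelV +ˢ litˢ 1)) (≤-<-trans (≤-trans (≤-reflexive (+-comm d 1)) d<Λ) Λ<w))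

      onesV : ∀ {pE qE p q s} → Starts (suc d) M → Sums M → 2 ^ d ≤ p → p < 2 ^ suc d → q ≤ len′ p → pE ⇓⟨ 3 ⟩ p → qE ⇓⟨ s ⟩ q → {_ : T (s ≤ᵇ 3)} →
        onesBeforeE pE qE ⇓⟨ 1 ⟩ count₁ p q
      onesV {s = s} st sums 2^d≤p p< q≤ pV qV {s≤} = cast (sums _ _ 2^d≤p p< q≤)
          (sub⇓ (load⇓ (↓ (loV +ˢ weaken 3 (≤ᵇ⇒≤ s 3 s≤) qV)) refl) (load⇓ (↓ loV) refl)) within ≤-<-trans (count₁≤ _ _ q≤) n<
        where
        loV = loadˢ 2 pV (st _ (≤-trans (0<2^ d) 2^d≤p) p<) (≤-<-trans (off≤slots p<) slots<) -ˢ levelV *ˢ nV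
          where
          off≤slots : ∀ {p} → p < 2 ^ suc d → off p ≤ slots
          off≤slots p< = ≤-trans (off-mono (≤-trans (<⇒≤ p<) (≤-trans 2^d≤ 2^Λ≤nodes))) (≤-reflexive (off-level (suc Λ) ≤-refl))

    module Element {M} (Wd : Words w M) (b : Base M) (d≡ : M lvl 0 ≡ d) (codes : Codes (suc d) M) {x : ℕ} (x< : x < n) (o : OnLevel x) where

      open OnLevel o public
      open Cells Wd b d≡ x public

      pidV : pid ⇓⟨ 1 ⟩ x
      pidV = pid⇓ (small-word {1} (s≤s z≤n) x<2^) within x<2^
        where x<2^ = <-trans x< n<

      slotV : slotE ⇓⟨ 3 ⟩ off p + q
      slotV = castˢ x≡ (levelV *ˢ nV +ˢ pidV)

      code : codeE ⇓ nth (seq p) q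
      code = load⇓ (↓ slotV) (codes p q 1≤p p<2^ q<)

      parentV : parentE ⇓⟨ 3 ⟩ p
      parentV = cast (trans (cong (λ t → ancestor t (nth (seq p) q)) (sym depth≡)) (seq-ancestor p q q<)) (shr⇓ code (sub⇓ (↓ lamV) (↓ levelV)))
        within <-≤-trans (node-bound p<nodes) (2^-mono (*-monoˡ-≤ θ (s≤s (s≤s (z≤n {1})))))

      branchV : branchE ⇓⟨ 1 ⟩ bf p q
      branchV = cast (cong (λ t → branchBit t (nth (seq p) q)) (sym depth≡)) (rem⇓ (shr⇓ code (sub⇓ (sub⇓ (↓ lamV) one⇓) (↓ levelV))) (↓ litˢ 2))
        within <-≤-trans (branchBit<2 (depth p) (nth (seq p) q)) (≤-trans 2^1≤ (≤-reflexive (cong (2 ^_) (sym (*-identityˡ θ)))))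

      offsetV : Starts (suc d) M → slotE ⊖ load start parentE ⇓⟨ 3 ⟩ q
      offsetV st = castˢ (m+n∸m≡n (off p) q) (slotV -ˢ loadˢ 2 parentV (st p 1≤p p<2^) (≤-<-trans (m≤m+n (off p) q) (<-trans (slot< 1≤p p<nodes q<) slots<)))

      c : ℕ
      c = 2 * p + bf p q

      β≤1 : bf p q ≤ 1
      β≤1 = s≤s⁻¹ (branchBit<2 (depth p) (nth (seq p) q))

      rank-spec : rank′ p (bf p q) q < len′ c × Q p (bf p q) (rank′ p (bf p q) q) ≡ q
      rank-spec = subst (rank′ p (bf p q) q <_) (sym (cong length (seq-child p (bf p q) 1≤p (depth-< 1≤p p<Λ) β≤1))) (proj₁ pr) , proj₂ pr
        where pr = Occ.position-rank p (bf p q) (seq p) q q< refl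

      destV : Starts (suc (suc d)) M → Sums M → destE ⇓ off c + rank′ p (bf p q) q
      destV st sums = add⇓ (↓ startV) rankV (small-word {2} (s≤s (s≤s z≤n)) (<-trans (slot< 1≤c c<nodes (proj₁ rank-spec)) slots<))
        where
        st′ : Starts (suc d) M
        st′ c 1≤c c< = st c 1≤c (<-≤-trans c< (2^-mono (n≤1+n (suc d))))
        1≤c : 1 ≤ c
        1≤c = ≤-trans 1≤p (≤-trans (m≤n*m p 2) (m≤m+n (2 * p) (bf p q)))
        c<2^ : c < 2 ^ suc (suc d)
        c<2^ = ≤-trans (s≤s (+-monoʳ-≤ (2 * p) β≤1)) (≤-trans (≤-reflexive (lemma p)) (*-monoʳ-≤ 2 p<2^))
          where
          lemma : ∀ p → suc (2 * p + 1) ≡ 2 * suc p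
          lemma = solve-∀
        c<nodes : c < nodes
        c<nodes = <-≤-trans c<2^ (2^-mono (s≤s d<Λ))
        startV : load start (lit 2 ⊗ parentE ⊕ branchE) ⇓⟨ 2 ⟩ off c
        startV = loadˢ 2 (litˢ 2 *ˢ parentV +ˢ branchV) (st c 1≤c c<2^) (≤-<-trans (m≤m+n (off c) _) (<-trans (slot< 1≤c c<nodes (proj₁ rank-spec)) slots<))
        onesQ = onesV st′ sums 2^d≤p p<2^ (<⇒≤ q<) parentV (offsetV st′)
        rankV : ifE branchE (onesBeforeE parentE (slotE ⊖ load start parentE)) (slotE ⊖ load start parentE ⊖ onesBeforeE parentE (slotE ⊖ load start parentE)) ⇓ rank′ p (bf p q) q
        rankV with n≤1⇒n≡0∨n≡1 β≤1
        ... | inj₁ β≡0 = if-false (cast β≡0 (↓ branchV)) (cast (trans (sym (rank₀ p q (<⇒≤ q<))) (cong (λ β → rank′ p β q) (sym β≡0))) (sub⇓ (↓ offsetV st′) (↓ onesQ)))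
        ... | inj₂ β≡1 = if-true (cast β≡1 (↓ branchV)) (cast (trans (sym (rank₁ p q (<⇒≤ q<))) (cong (λ β → rank′ p β q) (sym β≡1))) (↓ onesQ))

module LevelStep (𝒮 : Setting) (Y₁ : ℕ) (1≤Y₁ : 1 ≤ Y₁) (w≤n : Setting.w 𝒮 ≤ Setting.γ 𝒮 * length (Setting.L 𝒮)) (w≤Y₁ : Setting.w 𝒮 ≤ Setting.γ 𝒮 * Y₁) where

  open Levels 𝒮 Y₁ 1≤Y₁ w≤n w≤Y₁ public

  module _ {d : ℕ} (d<Λ : d < Λ) where

    open AtLevel d<Λ

    private
      n<² : n < 2 ^ (2 * θ)
      n<² = <-≤-trans n< (2^-mono (*-monoˡ-≤ θ (s≤s (z≤n {1}))))

      pid≡ : ∀ {M} (Wd : Words w M) {z} → z < n → eval w M z pid ≡ z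
      pid≡ {M} Wd {z} z< = valˢ (At.pidˢ M Wd z 2 (<-trans z< n<²))

      bf≤1 : ∀ p q → bf p q ≤ 1
      bf≤1 p q = s≤s⁻¹ (branchBit<2 (depth p) (nth (seq p) q))

    BitsStored : Mem → Set
    BitsStored M = ∀ x → x < n → (o : OnLevel x) → M src x ≡ bf (OnLevel.p o) (OnLevel.q o)

    bits-written : ∀ {M M′} (Wd : Words w M) → Base M → M lvl 0 ≡ d → Codes (suc d) M → Wrote n (lit 1) src pid branchE M M′ → BitsStored M′
    bits-written {M} Wd b d≡ codes out x x< o = written out x x< (one≢0 Wd x) (pid≡ Wd x<) λ x′ x′< _ p →
      trans (cong (λ t → eval w M t branchE) (trans (sym (pid≡ Wd x′<)) p)) (valˢ (Element.branchV Wd b d≡ codes x< o))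

    -- A level has `n` bits and `n < W`, so here the prefix sums never wrap and plain subtraction
    -- gives the counts.
    sums-stored : ∀ {M M′} → BitsStored M → (∀ z → z ≤ n → M′ dst z ≡ Σ< z (M src) mod W) → Sums M′
    sums-stored {M} {M′} bits dsts p q 2^d≤p p< q≤ = trans (cong₂ _∸_ (exact (lo + q) (≤-trans (+-monoʳ-≤ lo q≤) (end≤ 2^d≤p p<))) (exact lo (≤-trans (m≤m+n lo (len′ p)) (end≤ 2^d≤p p<))))
        (∸-swap (trans (Σ-split lo q (M src)) (cong (Σ< lo (M src) +_) (Σ-cong q λ i i<q → let ix = index 2^d≤p p< (<-≤-trans i<q q≤) in
          bits (lo + i) (proj₂ ix) (on-level 2^d≤p p< (<-≤-trans i<q q≤) (proj₁ ix))))))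
      where
      lo = off p ∸ base
      exact : ∀ y → y ≤ n → M′ dst y ≡ Σ< y (M src)
      exact y y≤ = trans (dsts y y≤) (mod-small (≤-<-trans (≤-trans (Σ-≤ y λ i i<y → let i< = <-≤-trans i<y y≤ in
          ≤-trans (≤-reflexive (bits i i< (on i i<))) (bf≤1 (OnLevel.p (on i i<)) (OnLevel.q (on i i<))))
        (≤-reflexive (trans (Σ-const y 1) (*-identityʳ y)))) (≤-<-trans y≤ n<W)))

    module NewNode {M} (Wd : Words w M) (b : Base M) (d≡ : M lvl 0 ≡ d) (st : Starts (suc d) M) (ln : Lens (suc d) M) (sums : Sums M) (z : ℕ) (z< : z < 2 ^ suc d) where

      open Cells Wd b d≡ z public

      c p β : ℕ
      c = 2 ^ suc d + z
      p = c div 2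
      β = c mod 2

      2^d≤p : 2 ^ d ≤ p
      2^d≤p = ≤div z<s (≤-trans (≤-reflexive (*-comm (2 ^ d) 2)) (m≤m+n (2 ^ suc d) z))

      c<2^ : c < 2 ^ suc (suc d)
      c<2^ = <-≤-trans (+-monoʳ-< (2 ^ suc d) z<) (≤-reflexive (cong (2 ^ suc d +_) (sym (+-identityʳ _))))

      p<2^ : p < 2 ^ suc d
      p<2^ = div< (<-≤-trans c<2^ (≤-reflexive (*-comm 2 (2 ^ suc d))))

      1≤p : 1 ≤ p
      1≤p = ≤-trans (0<2^ d) 2^d≤p

      p<Λ : p < 2 ^ Λ
      p<Λ = <-≤-trans p<2^ 2^d≤

      β≤1 : β ≤ 1
      β≤1 = s≤s⁻¹ (mod< c (s≤s (z≤n {1})))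

      c≡ : c ≡ 2 * p + β
      c≡ = trans (divmod c 2) (trans (+-comm β _) (cong (_+ β) (*-comm p 2)))

      c-small : c < 2 ^ (2 * θ)
      c-small = node-bound (<-≤-trans c<2^ (2^-mono (s≤s d<Λ)))

      newV : newE ⇓⟨ 2 ⟩ c
      newV = add⇓ doubleV (pid⇓ (small-word {2} (s≤s (s≤s z≤n)) (≤-<-trans (m≤n+m z (2 ^ suc d)) c-small))) (small-word {2} (s≤s (s≤s z≤n)) c-small) within c-small

      pV : newParentE ⇓⟨ 2 ⟩ p
      pV = newV /ˢ litˢ 2

      bitV : newBitE ⇓⟨ 2 ⟩ β
      bitV = newV %ˢ litˢ 2

      lenV : load len newParentE ⇓⟨ 1 ⟩ len′ p
      lenV = loadˢ 1 pV (ln p 1≤p p<2^) (len< p)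

      onesNewV : newOnesE ⇓⟨ 1 ⟩ count₁ p (len′ p)
      onesNewV = onesV st sums 2^d≤p p<2^ ≤-refl (weaken 3 (s≤s (s≤s z≤n)) pV) lenV

      zeros≡ : len′ p ∸ count₁ p (len′ p) ≡ rank′ p 0 (len′ p)
      zeros≡ = sym (rank₀ p (len′ p) ≤-refl)

      newLen : eval w M z newLenE ≡ len′ c
      newLen with n≤1⇒n≡0∨n≡1 β≤1
      ... | inj₁ β≡0 = trans (val (if-false {x = newOnesE} (cast β≡0 (↓ bitV)) (↓ (lenV -ˢ onesNewV)))) (trans zeros≡ (trans (rank-total p 0 1≤p p<Λ z≤n) (cong len′ (trans (cong (2 * p +_) (sym β≡0)) (sym c≡)))))
      ... | inj₂ β≡1 = trans (val (if-true {y = load len newParentE ⊖ newOnesE} (cast β≡1 (↓ bitV)) (↓ onesNewV))) (trans (sym (rank₁ p (len′ p) ≤-refl)) (trans (rank-total p 1 1≤p p<Λ ≤-refl) (cong len′ (trans (cong (2 * p +_) (sym β≡1)) (sym c≡)))))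

      newStart : eval w M z newStartE ≡ off c
      newStart = trans (valˢ (loadˢ 2 pV (st p 1≤p p<2^) (≤-<-trans off-p slots<) +ˢ nV +ˢ bitV *ˢ (lenV -ˢ onesNewV))) (trans (cong (λ t → off p + n + β * t) zeros≡) (value≡ (n≤1⇒n≡0∨n≡1 β≤1)))
        where
        off-p : off p ≤ slots
        off-p = ≤-trans (off-mono (<⇒≤ (<-≤-trans p<Λ 2^Λ≤nodes))) (≤-reflexive (off-level (suc Λ) ≤-refl))
        value≡ : β ≡ 0 ⊎ β ≡ 1 → off p + n + β * rank′ p 0 (len′ p) ≡ off c
        value≡ (inj₁ β≡0) = trans (cong (λ t → off p + n + t * rank′ p 0 (len′ p)) β≡0) (trans (+-identityʳ _) (trans (sym (off-2* p 1≤p (<⇒≤ p<Λ)))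
          (cong off (trans (sym (+-identityʳ (2 * p))) (trans (cong (2 * p +_) (sym β≡0)) (sym c≡))))))
        value≡ (inj₂ β≡1) = trans (cong (λ t → off p + n + t * rank′ p 0 (len′ p)) β≡1) (trans (cong (off p + n +_) (*-identityˡ _)) (trans (sym (off-odd p 1≤p p<Λ))
          (cong off (trans (cong (2 * p +_) (sym β≡1)) (sym c≡)))))

    -- A step writing f c for each new node c extends the table of f by a level.
    extend : ∀ {A v M M′} (f : ℕ → ℕ) (Wd : Words w M) (b : Base M) (d≡ : M lvl 0 ≡ d) (st : Starts (suc d) M) (ln : Lens (suc d) M) (sums : Sums M) →
      (∀ z (z< : z < 2 ^ suc d) → eval w M z v ≡ f (2 ^ suc d + z)) → (∀ c → 1 ≤ c → c < 2 ^ suc d → M A c ≡ f c) →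
      Wrote (2 ^ suc d) (lit 1) A newE v M M′ → ∀ c → 1 ≤ c → c < 2 ^ suc (suc d) → M′ A c ≡ f c
    extend {A} {v} {M} {M′} f Wd b d≡ st ln sums new old out c 1≤c c< = decide (c <? 2 ^ suc d)
      where
      at : ∀ z → z < 2 ^ suc d → eval w M z newE ≡ 2 ^ suc d + z
      at z z< = valˢ (NewNode.newV Wd b d≡ st ln sums z z<)
      decide : Dec (c < 2 ^ suc d) → M′ A c ≡ f c
      decide (yes c<′) = trans (unwritten out λ z z< _ p → <⇒≢ (<-≤-trans c<′ (m≤m+n (2 ^ suc d) z)) (sym (trans (sym (at z z<)) p))) (old c 1≤c c<′)
      decide (no c≮) = written out z₀ z₀< (one≢0 Wd z₀) (trans (at z₀ z₀<) z₀≡) λ z z< _ p → trans (new z z<) (cong f (trans (sym (at z z<)) p))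
        where
        z₀ = c ∸ 2 ^ suc d
        z₀≡ : 2 ^ suc d + z₀ ≡ c
        z₀≡ = m+[n∸m]≡n (≮⇒≥ c≮)
        z₀< : z₀ < 2 ^ suc d
        z₀< = +-cancelˡ-< (2 ^ suc d) _ _ (subst₂ _<_ (sym z₀≡) (cong (2 ^ suc d +_) (+-identityʳ _)) c<)

    target : ∀ {x} → OnLevel x → ℕ
    target o = off (2 * p + bf p q) + rank′ p (bf p q) q
      where open OnLevel o

    Dests : Mem → Set
    Dests M = ∀ x → x < n → (o : OnLevel x) → M dest x ≡ target o

    dests-written : ∀ {M M′} (Wd : Words w M) → Base M → M lvl 0 ≡ d → Codes (suc d) M → Starts (suc (suc d)) M → Sums M →
      Wrote n (lit 1) dest pid destE M M′ → Dests M′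
    dests-written {M} Wd b d≡ codes st sums out x x< o = written out x x< (one≢0 Wd x) (pid≡ Wd x<) λ x′ x′< _ p →
      trans (cong (λ t → eval w M t destE) (trans (sym (pid≡ Wd x′<)) p)) (val (Element.destV Wd b d≡ codes x< o st sums))

    -- Every slot of the next level is the target of exactly one element.
    module Source {p β r : ℕ} (2^d≤p : 2 ^ d ≤ p) (p<2^ : p < 2 ^ suc d) (β≤1 : β ≤ 1) (r< : r < len′ (2 * p + β)) where

      1≤p : 1 ≤ p
      1≤p = ≤-trans (0<2^ d) 2^d≤p

      spec = Occ.position-spec p β (seq p) r (subst (r <_) (cong length (seq-child p β 1≤p (depth-< 1≤p (<-≤-trans p<2^ 2^d≤)) β≤1)) r<)

      q x : ℕ
      q = Q p β r
      x = off p ∸ base + q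

      q< : q < len′ p
      q< = proj₁ spec

      x< : x < n
      x< = proj₂ (index 2^d≤p p<2^ q<)

      o : OnLevel x
      o = on-level 2^d≤p p<2^ q< (proj₁ (index 2^d≤p p<2^ q<))

      bit≡ : bf p q ≡ β
      bit≡ = 𝟙≡-true⁻¹ λ z → case trans (sym (trans (trans (cong (_* 𝟙≡ (bf p q) β) (𝟙<-true q<)) (*-identityˡ _)) z)) (proj₁ (proj₂ spec)) of λ ()

      target≡ : target o ≡ off (2 * p + β) + r
      target≡ = trans (cong (λ β → off (2 * p + β) + rank′ p β q) bit≡) (cong (off (2 * p + β) +_) (proj₁ (proj₂ (proj₂ spec))))

      nth≡ : nth (seq (2 * p + β)) r ≡ nth (seq p) q
      nth≡ = trans (cong (λ X → nth X r) (seq-child p β 1≤p (depth-< 1≤p (<-≤-trans p<2^ 2^d≤)) β≤1)) (proj₂ (proj₂ (proj₂ spec)))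

    -- Segments are disjoint, so a slot determines the child and the rank in it. The child
    -- determines parent and bit, and `position-rank` recovers the position from the rank.
    target-unique : ∀ {x p β r} (o : OnLevel x) (2^d≤p : 2 ^ d ≤ p) (p<2^ : p < 2 ^ suc d) (β≤1 : β ≤ 1) (r< : r < len′ (2 * p + β)) →
      target o ≡ off (2 * p + β) + r → OnLevel.p o ≡ p × OnLevel.q o ≡ Q p β r
    target-unique {x} {p} {β} {r} o 2^d≤p p<2^ β≤1 r< t≡ = proj₁ same-p , trans (sym (proj₂ rank-spec)) (trans (cong₂ (λ β r → Q p′ β r) (proj₂ same-p) (proj₂ same)) (cong (λ p → Q p β r) (proj₁ same-p)))
      where
      open OnLevel o renaming (p to p′; q to q′; q< to q′<; 1≤p to 1≤p′; p<Λ to p′<Λ; p<2^ to p′<; 2^d≤p to 2^d≤p′)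
      β′≤1 : bf p′ q′ ≤ 1
      β′≤1 = s≤s⁻¹ (branchBit<2 (depth p′) (nth (seq p′) q′))
      rank-spec : rank′ p′ (bf p′ q′) q′ < len′ (2 * p′ + bf p′ q′) × Q p′ (bf p′ q′) (rank′ p′ (bf p′ q′) q′) ≡ q′
      rank-spec = subst (rank′ p′ (bf p′ q′) q′ <_) (sym (cong length (seq-child p′ (bf p′ q′) 1≤p′ (depth-< 1≤p′ p′<Λ) β′≤1))) (proj₁ pr) , proj₂ pr
        where pr = Occ.position-rank p′ (bf p′ q′) (seq p′) q′ q′< refl
      1≤2p : ∀ {p β} → 1 ≤ p → 1 ≤ 2 * p + β
      1≤2p {p} {β} 1≤p = ≤-trans 1≤p (≤-trans (m≤n*m p 2) (m≤m+n (2 * p) β))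
      same : 2 * p′ + bf p′ q′ ≡ 2 * p + β × rank′ p′ (bf p′ q′) q′ ≡ r
      same = segment-unique (1≤2p 1≤p′) (1≤2p (≤-trans (0<2^ d) 2^d≤p)) (proj₁ rank-spec) r< t≡
      same-p : p′ ≡ p × bf p′ q′ ≡ β
      same-p = 2p+β-injective (s≤s β′≤1) (s≤s β≤1) (proj₁ same)

    module Scattered {A v M M′} (Wd : Words w M) (dests : Dests M) (f : ℕ → ℕ → ℕ)
      (f-value : ∀ x → x < n → (o : OnLevel x) → eval w M x v ≡ f (OnLevel.p o) (OnLevel.q o)) (out : Wrote n (lit 1) A (load dest pid) v M M′) where

      dest≡ : ∀ x → x < n → (o : OnLevel x) → eval w M x (load dest pid) ≡ target o
      dest≡ x x< o = trans (cong (M dest) (pid≡ Wd x<)) (dests x x< o)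

      new : ∀ {p β r} → 2 ^ d ≤ p → p < 2 ^ suc d → β ≤ 1 → r < len′ (2 * p + β) → M′ A (off (2 * p + β) + r) ≡ f p (Q p β r)
      new {p} {β} {r} 2^d≤p p< β≤1 r< = written out S.x S.x< (one≢0 Wd S.x) (trans (dest≡ S.x S.x< S.o) S.target≡) λ x x< _ q →
          trans (f-value x x< (on x x<)) (let u = target-unique (on x x<) 2^d≤p p< β≤1 r< (trans (sym (dest≡ x x< (on x x<))) q) in cong₂ f (proj₁ u) (proj₂ u))
        where module S = Source 2^d≤p p< β≤1 r<

      -- All targets lie on the next level, hence beyond the slots filled so far.
      old : ∀ {j} → j < off (2 ^ suc d) → M′ A j ≡ M A j
      old {j} j< = unwritten out λ x x< _ q → let o = on x x< in
        <⇒≢ (<-≤-trans j< (≤-trans (off-mono (≤-trans (*-monoʳ-≤ 2 (OnLevel.2^d≤p o)) (m≤m+n _ _))) (m≤m+n _ _))) (trans (sym q) (dest≡ x x< o))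

    private
      α : ℕ
      α = 3 * γ + 5

      chunks≤ : w * (n div w + 1) ≤ α * n
      chunks≤ = ≤-trans (≤-reflexive (trans (*-distribˡ-+ w (n div w) 1) (cong₂ _+_ (*-comm w (n div w)) (*-identityʳ w))))
        (≤-trans (+-mono-≤ (div*≤ n w) w≤n) (≤-trans (≤-reflexive (lemma n γ)) (*-monoˡ-≤ n (≤-trans (+-mono-≤ (s≤s (z≤n {4})) (m≤n*m γ 3)) (≤-reflexive (+-comm 5 (3 * γ)))))))
        where
        lemma : ∀ n γ → n + γ * n ≡ (1 + γ) * n
        lemma = solve-∀

      w1≤ : w * 1 ≤ α * Y₁
      w1≤ = ≤-trans (≤-reflexive (*-identityʳ w)) (≤-trans w≤Y₁ (*-monoˡ-≤ Y₁ (≤-trans (m≤n*m γ 3) (m≤m+n (3 * γ) 5))))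

      new≤ : 2 ^ suc d ≤ 2 * n
      new≤ = ≤-trans 2^d≤ (*-cancelˡ-≤ 2 (≤-trans nodes≤ (≤-reflexive (*-assoc 2 2 n))))

      work depth′ : (k a v : Exp) → ℕ
      work   k a v = ops k + 2 * (1 + ops a + ops v + 1)
      depth′ k a v = ops k + (1 + ops a + ops v + 1)

      total : ((k a v : Exp) → ℕ) → ℕ
      total f = f nE pid branchE + (151 * α + (f (2^E (levelE ⊕ lit 1)) newE newLenE + (f (2^E (levelE ⊕ lit 1)) newE newStartE
        + (f nE pid destE + (f nE (load dest pid) codeE + f nE (load dest pid) (slotE ⊖ load start parentE))))))

      rearrange : ∀ c s r → c + (s + r) ≡ s + (c + r)
      rearrange = solve-∀

      work≤ : total work ≤ C₀
      work≤ = ≤-trans (≤-reflexive (rearrange (work nE pid branchE) (151 * α) _)) (+-monoʳ-≤ (151 * α) (≤ᵇ⇒≤ (work nE pid branchE + _) 5000 tt))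

      depth≤ : total depth′ ≤ C₀
      depth≤ = ≤-trans (≤-reflexive (rearrange (depth′ nE pid branchE) (151 * α) _)) (+-monoʳ-≤ (151 * α) (≤ᵇ⇒≤ (depth′ nE pid branchE + _) 5000 tt))

      within-budget : ∀ {P M R} → Triple n Y₁ P M (total work) (total depth′) R → Triple n Y₁ P M C₀ C₀ R
      within-budget f = triple λ R K t d k → Triple.run f R K t d λ M′ t′ d′ Wd q t≤ d≤ →
          k M′ t′ d′ Wd q (≤-trans t≤ (+-monoʳ-≤ t (*-monoˡ-≤ n work≤))) (≤-trans d≤ (+-monoʳ-≤ d (*-monoˡ-≤ Y₁ depth≤)))

      -- Within a round the tables are extended one after the other, so each has an index of its
      -- own.
      Rest : ℕ → ℕ → ℕ → ℕ → Mem → Set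
      Rest i j k l M = Base M × M lvl 0 ≡ d × Starts i M × Lens j M × Codes k M × Positions l M

      carry : ∀ K i j k l M M′ → {_ : T (disjoint (lvl ∷ start ∷ len ∷ cur ∷ pos ∷ baseArrays) K)} → Keeps K M M′ → Rest i j k l M → Rest i j k l M′
      carry K i j k l M M′ {ok} kp (b , d≡ , st , ln , co , po) = base-keep K {M} {M′} {base-ok} kp b , trans (kp lvl (f lvl λ ()) 0) d≡ ,
          starts-keep i M M′ (kp start (f start λ ())) st , lens-keep j M M′ (kp len (f len λ ())) ln ,
          codes-keep k M M′ (kp cur (f cur λ ())) co , positions-keep l M M′ (kp pos (f pos λ ())) po
        where
        all = lvl ∷ start ∷ len ∷ cur ∷ pos ∷ baseArrays
        f : ∀ A → ¬ T (fresh all A) → T (fresh K A)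
        f A = disjoint-fresh all K ok
        drop : ∀ A L → T (disjoint (A ∷ L) K) → T (disjoint L K)
        drop A L t with fresh K A
        ... | true = t
        base-ok : T (disjoint baseArrays K)
        base-ok = drop pos baseArrays (drop cur (pos ∷ baseArrays) (drop len (cur ∷ pos ∷ baseArrays) (drop start (len ∷ cur ∷ pos ∷ baseArrays) (drop lvl (start ∷ len ∷ cur ∷ pos ∷ baseArrays) ok))))

    private
      sd ssd : ℕ
      sd  = suc d
      ssd = suc (suc d)

      starts-down : ∀ {M} → Starts ssd M → Starts sd M
      starts-down st c 1≤c c< = st c 1≤c (<-≤-trans c< (2^-mono (n≤1+n sd)))

      merge-codes : ∀ {M M′} → Codes sd M → (∀ {j} → j < off (2 ^ sd) → M′ cur j ≡ M cur j) →
        (∀ {p β r} → 2 ^ d ≤ p → p < 2 ^ sd → β ≤ 1 → r < len′ (2 * p + β) → M′ cur (off (2 * p + β) + r) ≡ nth (seq p) (Q p β r)) → Codes ssd M′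
      merge-codes {M} {M′} co old new c r 1≤c c< r< = decide (c <? 2 ^ sd)
        where
        decide : Dec (c < 2 ^ sd) → M′ cur (off c + r) ≡ nth (seq c) r
        decide (yes c<′) = trans (old (segment-end 1≤c c<′ r<)) (co c r 1≤c c<′ r<)
        decide (no c≮) = subst (λ c → M′ cur (off c + r) ≡ nth (seq c) r) (sym c≡) (trans (new 2^d≤p p< β≤1 r<′) (sym (Source.nth≡ 2^d≤p p< β≤1 r<′)))
          where
          c≡ : c ≡ 2 * (c div 2) + c mod 2
          c≡ = trans (divmod c 2) (trans (+-comm (c mod 2) _) (cong (_+ c mod 2) (*-comm (c div 2) 2)))
          2^d≤p : 2 ^ d ≤ c div 2
          2^d≤p = ≤div z<s (≤-trans (≤-reflexive (*-comm (2 ^ d) 2)) (≮⇒≥ c≮))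
          p< : c div 2 < 2 ^ sd
          p< = div< (<-≤-trans c< (≤-reflexive (*-comm 2 (2 ^ sd))))
          β≤1 : c mod 2 ≤ 1
          β≤1 = s≤s⁻¹ (mod< c (s≤s (z≤n {1})))
          r<′ : r < len′ (2 * (c div 2) + c mod 2)
          r<′ = subst (λ c → r < len′ c) c≡ r<

      merge-positions : ∀ {M M′} → Positions d M → (∀ {j} → j < off (2 ^ sd) → M′ pos j ≡ M pos j) →
        (∀ {p β r} → 2 ^ d ≤ p → p < 2 ^ sd → β ≤ 1 → r < len′ (2 * p + β) → M′ pos (off (2 * p + β) + r) ≡ Q p β r) → Positions sd M′
      merge-positions {M} {M′} po old new p β r 1≤p p< β≤1 r< = decide (p <? 2 ^ d)
        where
        decide : Dec (p < 2 ^ d) → M′ pos (off (2 * p + β) + r) ≡ Q p β r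
        decide (yes p<′) = trans (old (segment-end (≤-trans 1≤p (≤-trans (m≤n*m p 2) (m≤m+n (2 * p) β)))
            (≤-trans (s≤s (+-monoʳ-≤ (2 * p) β≤1)) (≤-trans (≤-reflexive (lemma p)) (*-monoʳ-≤ 2 p<′))) r<)) (po p β r 1≤p p<′ β≤1 r<)
          where
          lemma : ∀ p → suc (2 * p + 1) ≡ 2 * suc p
          lemma = solve-∀
        decide (no p≮) = new (≮⇒≥ p≮) p< β≤1 r<

    level-rule : ∀ {M} → Words w M → Level d M → M lvl 0 ≡ d → Triple n Y₁ levelP M C₀ C₀ (λ M′ → Level (suc d) M′ × M′ lvl 0 ≡ d)
    level-rule {M} Wd (b , st , ln , co , po) d≡ = within-budget
      ( pardo-rule {Q = λ M₁ → Rest sd sd sd d M₁ × BitsStored M₁} 2 Wd (n-value Wd b d≡) (m≤m*2 n) 1≤n 1≤Y₁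
          (λ M₁ Wd₁ out → carry (src ∷ []) sd sd sd d M M₁ (wrote-keeps out) (b , d≡ , st , ln , co , po) , bits-written Wd b d≡ co out)
      ⨾ λ M₁ Wd₁ (s₁@(b₁ , _) , bits₁) → rescale α α chunks≤ w1≤ (scan-rule (Base.w-stored b₁) (Base.slen-stored b₁) n<² Wd₁)
      ⨾ λ M₂ Wd₂ (k₂ , dsts) → let s₂ = carry scanTemps sd sd sd d M₁ M₂ k₂ s₁ ; sums₂ = sums-stored {M₁} {M₂} bits₁ dsts in
        new-len Wd₂ s₂ sums₂
      ⨾ λ M₃ Wd₃ (s₃ , sums₃) → new-start Wd₃ s₃ sums₃
      ⨾ λ M₄ Wd₄ (s₄ , sums₄) → new-dest Wd₄ s₄ sums₄
      ⨾ λ M₅ Wd₅ (s₅ , dests₅) → new-codes Wd₅ s₅ dests₅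
      ⨾ λ M₆ Wd₆ (s₆ , dests₆) → new-positions Wd₆ s₆ dests₆)
      where
      m≤m*2 : ∀ m → m ≤ 2 * m
      m≤m*2 m = m≤n*m m 2

      n-value : ∀ {M} (Wd : Words w M) → Base M → M lvl 0 ≡ d → eval w M 0 nE ≡ n
      n-value Wd b d≡ = valˢ (Cells.nV Wd b d≡ 0)

      double-value : ∀ {M} (Wd : Words w M) → Base M → M lvl 0 ≡ d → eval w M 0 (2^E (levelE ⊕ lit 1)) ≡ 2 ^ suc d
      double-value Wd b d≡ = val (Cells.doubleV Wd b d≡ 0)

      new-len : ∀ {M} → Words w M → Rest sd sd sd d M → Sums M →
        Triple n Y₁ (pardo (2^E (levelE ⊕ lit 1)) (lit 1) len newE newLenE ∷ []) M (work (2^E (levelE ⊕ lit 1)) (newE) (newLenE)) (depth′ (2^E (levelE ⊕ lit 1)) (newE) (newLenE)) (λ M′ → Rest sd ssd sd d M′ × Sums M′)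
      new-len {M} Wd (b , d≡ , st , ln , co , po) sums = pardo-rule 2 Wd (double-value Wd b d≡) new≤ 1≤n 1≤Y₁ λ M′ _ out → let kp = wrote-keeps out in
        (base-keep (len ∷ []) kp b , trans (kp lvl tt 0) d≡ , starts-keep sd M M′ (kp start tt) st ,
          extend len′ Wd b d≡ st ln sums (NewNode.newLen Wd b d≡ st ln sums) ln out , codes-keep sd M M′ (kp cur tt) co , positions-keep d M M′ (kp pos tt) po) ,
        λ p q a b c → trans (cong₂ _∸_ (kp dst tt _) (kp dst tt _)) (sums p q a b c)

      new-start : ∀ {M} → Words w M → Rest sd ssd sd d M → Sums M →
        Triple n Y₁ (pardo (2^E (levelE ⊕ lit 1)) (lit 1) start newE newStartE ∷ []) M (work (2^E (levelE ⊕ lit 1)) (newE) (newStartE)) (depth′ (2^E (levelE ⊕ lit 1)) (newE) (newStartE)) (λ M′ → Rest ssd ssd sd d M′ × Sums M′)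
      new-start {M} Wd (b , d≡ , st , ln , co , po) sums = pardo-rule 2 Wd (double-value Wd b d≡) new≤ 1≤n 1≤Y₁ λ M′ _ out → let kp = wrote-keeps out in
        (base-keep (start ∷ []) kp b , trans (kp lvl tt 0) d≡ , extend off Wd b d≡ st ln′ sums (NewNode.newStart Wd b d≡ st ln′ sums) st out ,
          lens-keep ssd M M′ (kp len tt) ln , codes-keep sd M M′ (kp cur tt) co , positions-keep d M M′ (kp pos tt) po) ,
        λ p q a b c → trans (cong₂ _∸_ (kp dst tt _) (kp dst tt _)) (sums p q a b c)
        where
        ln′ : Lens sd M
        ln′ c 1≤c c< = ln c 1≤c (<-≤-trans c< (2^-mono (n≤1+n sd)))

      new-dest : ∀ {M} → Words w M → Rest ssd ssd sd d M → Sums M →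
        Triple n Y₁ (pardo nE (lit 1) dest pid destE ∷ []) M (work (nE) (pid) (destE)) (depth′ (nE) (pid) (destE)) (λ M′ → Rest ssd ssd sd d M′ × Dests M′)
      new-dest {M} Wd s@(b , d≡ , st , _ , co , _) sums = pardo-rule 2 Wd (n-value Wd b d≡) (m≤m*2 n) 1≤n 1≤Y₁ λ M′ _ out →
        carry (dest ∷ []) ssd ssd sd d M M′ (wrote-keeps out) s , dests-written Wd b d≡ co st sums out

      new-codes : ∀ {M} → Words w M → Rest ssd ssd sd d M → Dests M →
        Triple n Y₁ (pardo nE (lit 1) cur (load dest pid) codeE ∷ []) M (work (nE) (load dest pid) (codeE)) (depth′ (nE) (load dest pid) (codeE)) (λ M′ → Rest ssd ssd ssd d M′ × Dests M′)
      new-codes {M} Wd (b , d≡ , st , ln , co , po) dests = pardo-rule 2 Wd (n-value Wd b d≡) (m≤m*2 n) 1≤n 1≤Y₁ λ M′ _ out → let kp = wrote-keeps out in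
        (base-keep (cur ∷ []) kp b , trans (kp lvl tt 0) d≡ , starts-keep ssd M M′ (kp start tt) st , lens-keep ssd M M′ (kp len tt) ln ,
          merge-codes {M} {M′} co (Scattered.old Wd dests (λ p q → nth (seq p) q) f-value out) (Scattered.new Wd dests (λ p q → nth (seq p) q) f-value out) ,
          positions-keep d M M′ (kp pos tt) po) , λ x x< o → trans (kp dest tt x) (dests x x< o)
        where
        f-value : ∀ x → x < n → (o : OnLevel x) → eval w M x codeE ≡ nth (seq (OnLevel.p o)) (OnLevel.q o)
        f-value x x< o = val (Element.code Wd b d≡ co x< o)

      new-positions : ∀ {M} → Words w M → Rest ssd ssd ssd d M → Dests M →
        Triple n Y₁ (pardo nE (lit 1) pos (load dest pid) (slotE ⊖ load start parentE) ∷ []) M (work (nE) (load dest pid) (slotE ⊖ load start parentE)) (depth′ (nE) (load dest pid) (slotE ⊖ load start parentE)) (λ M′ → Level (suc d) M′ × M′ lvl 0 ≡ d)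
      new-positions {M} Wd (b , d≡ , st , ln , co , po) dests = pardo-rule 2 Wd (n-value Wd b d≡) (m≤m*2 n) 1≤n 1≤Y₁ λ M′ _ out → let kp = wrote-keeps out in
        (base-keep (pos ∷ []) kp b , starts-keep ssd M M′ (kp start tt) st , lens-keep ssd M M′ (kp len tt) ln , codes-keep ssd M M′ (kp cur tt) co ,
          merge-positions {M} {M′} po (Scattered.old Wd dests (λ _ q → q) f-value out) (Scattered.new Wd dests (λ _ q → q) f-value out)) , trans (kp lvl tt 0) d≡
        where
        co′ : Codes sd M
        co′ c r 1≤c c< r< = co c r 1≤c (<-≤-trans c< (2^-mono (n≤1+n sd))) r<
        f-value : ∀ x → x < n → (o : OnLevel x) → eval w M x (slotE ⊖ load start parentE) ≡ OnLevel.q o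
        f-value x x< o = valˢ (Element.offsetV Wd b d≡ co′ x< o (starts-down {M} st))

-- Numerical estimates

≤2^⌈log₂⌉ : ∀ n → n ≤ 2 ^ ⌈log₂ n ⌉
≤2^⌈log₂⌉ = <-rec _ go
  where
  go : ∀ n → (∀ {k} → k < n → k ≤ 2 ^ ⌈log₂ k ⌉) → n ≤ 2 ^ ⌈log₂ n ⌉
  go 0 _ = z≤n
  go 1 _ = ≤-refl
  go n@(suc (suc n′)) rec = ≤-trans n≤ (≤-trans (*-monoʳ-≤ 2 (rec (⌈n/2⌉<n n′))) (≤-reflexive (cong (2 ^_) step)))
    where
    half = ⌈ n /2⌉
    n≤ : n ≤ 2 * half
    n≤ = ≤-trans (≤-reflexive (sym (⌊n/2⌋+⌈n/2⌉≡n n))) (≤-trans (+-monoˡ-≤ half (⌊n/2⌋≤⌈n/2⌉ n)) (≤-reflexive (cong (half +_) (sym (+-identityʳ half)))))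
    step : suc ⌈log₂ half ⌉ ≡ ⌈log₂ n ⌉
    step = trans (cong suc (⌈log₂⌈n/2⌉⌉≡⌈log₂n⌉∸1 n)) (m+[n∸m]≡n (≤-trans (≤-reflexive (sym (⌈log₂2^n⌉≡n 1))) (⌈log₂⌉-mono-≤ (s≤s (s≤s (z≤n {n′}))))))

1≤lg : ∀ n → 1 ≤ lg n
1≤lg n = m≤m⊔n 1 ⌈log₂ n ⌉

≤2^lg : ∀ n → n ≤ 2 ^ lg n
≤2^lg n = ≤-trans (≤2^⌈log₂⌉ n) (2^-mono (m≤n⊔m 1 ⌈log₂ n ⌉))

lg-mono : ∀ {m n} → m ≤ n → lg m ≤ lg n
lg-mono m≤n = ⊔-mono-≤ (≤-refl {1}) (⌈log₂⌉-mono-≤ m≤n)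

lg-least : ∀ {n k} → 1 ≤ k → n ≤ 2 ^ k → lg n ≤ k
lg-least {n} {k} 1≤k n≤ = ⊔-lub 1≤k (≤-trans (⌈log₂⌉-mono-≤ n≤) (≤-reflexive (⌈log₂2^n⌉≡n k)))

lg≤ : ∀ {n} → 1 ≤ n → lg n ≤ n
lg≤ {n} 1≤n = lg-least 1≤n (<⇒≤ (n<2^n n))

lg-minimal : ∀ n → lg n ≡ 1 ⊎ 2 ^ (lg n ∸ 1) < n
lg-minimal n with lg n ≟ 1
... | yes p = inj₁ p
... | no p = inj₂ (≰⇒> λ n≤ → <⇒≱ (≤-reflexive (m+[n∸m]≡n (1≤lg n))) (lg-least (m<n⇒0<n∸m (≤∧≢⇒< (1≤lg n) (λ q → p (sym q)))) n≤))

2^lg≤ : ∀ {n} → 1 ≤ n → 2 ^ lg n ≤ 2 * n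
2^lg≤ {n} 1≤n with lg-minimal n
... | inj₁ p = ≤-trans (≤-reflexive (cong (2 ^_) p)) (*-monoʳ-≤ 2 1≤n)
... | inj₂ p = ≤-trans (≤-reflexive (cong (2 ^_) (sym (m+[n∸m]≡n (1≤lg n))))) (*-monoʳ-≤ 2 (<⇒≤ p))

-- For e = k + 25 and blocks of b = 8 e² bits, this is (b + 1)² < 2 ^ e.
quartic<2^ : ∀ k → suc (8 * (k + 25) * (k + 25)) * suc (8 * (k + 25) * (k + 25)) < 2 ^ (k + 25)
quartic<2^ zero = <ᵇ⇒< (5001 * 5001) 33554432 tt
quartic<2^ (suc k) = ≤-<-trans bound (<-≤-trans (*-monoʳ-< 2 (quartic<2^ k)) ≤-refl)
  where
  e = k + 25
  y = suc (8 * e * e)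
  δ = 16 * e + 8
  expand : ∀ k → suc (8 * suc (k + 25) * suc (k + 25)) ≡ suc (8 * (k + 25) * (k + 25)) + (16 * (k + 25) + 8)
  expand = solve-∀
  square : ∀ y δ → (y + δ) * (y + δ) ≡ y * y + δ * (2 * y + δ)
  square = solve-∀
  3δ≤y : 3 * δ ≤ y
  3δ≤y = ≤-trans (≤-trans (m≤m+n (3 * δ) _) (≤-reflexive (split k))) (n≤1+n _)
    where
    split : ∀ k → 3 * (16 * (k + 25) + 8) + (8 * (k * k) + 352 * k + 3776) ≡ 8 * (k + 25) * (k + 25)
    split = solve-∀
  -- Passing from `e` to `suc e` adds `δ * (2 * y + δ)` to the square. With `3 * δ ≤ y` this is at
  -- most the square itself, so the left-hand side at most doubles, while the right-hand side does
  -- double.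
  fits : δ * (2 * y + δ) ≤ y * y
  fits = ≤-trans (*-monoʳ-≤ δ (≤-trans (+-monoʳ-≤ (2 * y) (≤-trans (m≤n*m δ 3) 3δ≤y)) (≤-reflexive (lemma y))))
      (≤-trans (≤-reflexive (lemma′ δ y)) (*-monoˡ-≤ y 3δ≤y))
    where
    lemma : ∀ y → 2 * y + y ≡ 3 * y
    lemma = solve-∀
    lemma′ : ∀ δ y → δ * (3 * y) ≡ 3 * δ * y
    lemma′ = solve-∀
  bound : suc (8 * suc e * suc e) * suc (8 * suc e * suc e) ≤ 2 * (y * y)
  bound = ≤-trans (≤-reflexive (trans (cong (λ t → t * t) (expand k)) (square y δ))) (≤-trans (+-monoʳ-≤ (y * y) fits) (≤-reflexive (cong (y * y +_) (sym (+-identityʳ (y * y))))))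

-- `θ` is chosen so that a word has 64 units. Since `κ` is at least `2 ^ 25`, a unit is at least
-- twice `lg n` and exceeds `e`, so that `n`, `w` and `e` each fit in one unit, for every `n`.
module Numbers {κ n : ℕ} (κ≥ : 2 ^ 25 ≤ κ) (1≤n : 1 ≤ n) where

  u w e θ : ℕ
  u = lg n
  w = κ * u
  e = depth w
  θ = (κ div 64) * u

  open Geometry w e public

  1≤u : 1 ≤ u
  1≤u = 1≤lg n

  κ≤w : κ ≤ w
  κ≤w = m≤m*n κ u {{>-nonZero 1≤u}}

  1≤w : 1 ≤ w
  1≤w = ≤-trans (0<2^ 25) (≤-trans κ≥ κ≤w)

  2^e≤w : 2 ^ e ≤ w
  2^e≤w = 2^depth≤ w 1≤w

  w<2^e : w < 2 ^ suc e
  w<2^e = ≰⇒> λ p → <⇒≱ (n<1+n e) (≤depth p)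

  25≤e : 25 ≤ e
  25≤e = ≤depth (≤-trans κ≥ κ≤w)

  1≤e : 1 ≤ e
  1≤e = ≤-trans (s≤s z≤n) 25≤e

  block< : suc b * suc b < 2 ^ e
  block< = subst (λ x → suc (8 * x * x) * suc (8 * x * x) < 2 ^ x) (m∸n+n≡m 25≤e) (quartic<2^ (e ∸ 25))

  1≤2ℓ : 1 ≤ 2 * ℓ
  1≤2ℓ = ≤-trans 1≤e (≤-trans (m≤n*m e 8) (m≤n*m ℓ 2))

  2ℓ≤b : 2 * ℓ ≤ b
  2ℓ≤b = ≤-trans (≤-reflexive (*-comm 2 ℓ)) (*-monoʳ-≤ ℓ (≤-trans (s≤s (s≤s z≤n)) 25≤e))

  bb<w : b * b < w
  bb<w = ≤-<-trans (*-mono-≤ (n≤1+n b) (n≤1+n b)) (<-≤-trans block< 2^e≤w)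

  b≤F : b ≤ F
  b≤F = ≤div 1≤2ℓ (≤-trans (*-monoʳ-≤ b 2ℓ≤b) (<⇒≤ bb<w))

  1≤b : 1 ≤ b
  1≤b = ≤-trans 1≤2ℓ 2ℓ≤b

  1≤F : 1 ≤ F
  1≤F = ≤-trans 1≤b b≤F

  b<2^e : b < 2 ^ e
  b<2^e = <-trans (n<1+n b) (≤-<-trans (m≤m*n (suc b) (suc b)) block<)

  F<2^ : F < 2 ^ suc e
  F<2^ = ≤-<-trans (div≤ w (2 * ℓ)) w<2^e

  B<2^ : B < 2 ^ (e + suc e)
  B<2^ = <-≤-trans (*-mono-< b<2^e F<2^) (≤-reflexive (sym (2^-+ e (suc e))))

  -- The largest stored quantity, an offset of at most `(B + 2) * B`, takes fewer than 4 e + 4 bits;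
  -- the choice ℓ = 8 e absorbs the additive constant.
  e+≤ℓ : ∀ {k} j → k ≤ 4 * e + j → j ≤ 4 → k ≤ ℓ
  e+≤ℓ j k≤ j≤ = ≤-trans k≤ (≤-trans (+-monoʳ-≤ (4 * e) (≤-trans j≤ (*-monoʳ-≤ 4 1≤e))) (≤-reflexive (lemma e)))
    where
    lemma : ∀ e → 4 * e + 4 * e ≡ 8 * e
    lemma = solve-∀

  64≤κ : 64 * (κ div 64) ≤ κ
  64≤κ = ≤-trans (≤-reflexive (*-comm 64 (κ div 64))) (div*≤ κ 64)

  64θ≤w : 64 * θ ≤ w
  64θ≤w = ≤-trans (≤-reflexive (sym (*-assoc 64 (κ div 64) u))) (*-monoˡ-≤ u 64≤κ)

  10≤κ : 10 ≤ κ div 64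
  10≤κ = ≤div z<s (≤-trans (≤ᵇ⇒≤ 640 33554432 tt) κ≥)

  κ≤θ : κ div 64 ≤ θ
  κ≤θ = m≤m*n (κ div 64) u {{>-nonZero 1≤u}}

  w≤128θ : w ≤ 128 * θ
  w≤128θ = ≤-trans (*-monoˡ-≤ u κ≤) (≤-reflexive (*-assoc 128 (κ div 64) u))
    where
    lemma : ∀ x → 64 * x + x * 64 ≡ 128 * x
    lemma = solve-∀
    κ≤ : κ ≤ 128 * (κ div 64)
    κ≤ = ≤-trans (<⇒≤ (div-upper κ (z<s {63}))) (≤-trans (+-monoˡ-≤ (κ div 64 * 64) (*-monoʳ-≤ 64 (≤-trans (s≤s z≤n) 10≤κ))) (≤-reflexive (lemma (κ div 64))))

  -- The chain is `128 * suc e ≤ suc b * suc b < 2 ^ e ≤ w ≤ 128 * θ`.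
  suc-e≤θ : suc e ≤ θ
  suc-e≤θ = *-cancelˡ-≤ 128 (≤-trans (*-mono-≤ 128≤ e≤b) (≤-trans (<⇒≤ (<-≤-trans block< 2^e≤w)) w≤128θ))
    where
    e≤b : suc e ≤ suc b
    e≤b = s≤s (≤-trans (≤-trans (m≤n*m e 8) (m≤n*m ℓ 2)) 2ℓ≤b)
    128≤ : 128 ≤ suc b
    128≤ = ≤-trans (≤ᵇ⇒≤ 128 5000 tt) (≤-trans (*-mono-≤ (*-monoʳ-≤ 8 25≤e) 25≤e) (n≤1+n b))

  2u≤θ : u + u ≤ θ
  2u≤θ = ≤-trans (≤-reflexive (cong (u +_) (sym (+-identityʳ u)))) (*-monoˡ-≤ u (≤-trans (s≤s (s≤s z≤n)) 10≤κ))

  -- Rounding down in `F` loses at most a factor 2, because `F` is at least 1; without rounding,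
  -- `2 * B` would be `w * e`.
  dense : w * e ≤ 4 * B
  dense = ≤-trans (*-monoˡ-≤ e (≤-trans (<⇒≤ (div-upper w 1≤2ℓ)) (*-monoˡ-≤ (2 * ℓ) {suc F} {2 * F} (≤-trans (+-monoˡ-≤ F 1≤F) (≤-reflexive (cong (F +_) (sym (+-identityʳ F))))))))
      (≤-reflexive (lemma F e))
    where
    lemma : ∀ F e → 2 * F * (2 * (8 * e)) * e ≡ 4 * (8 * e * e * F)
    lemma = solve-∀

  loglog≤ : ∀ m → m ≤ n → suc (loglog m) ≤ 2 * e
  loglog≤ m m≤ = ≤-trans (s≤s (⌊log₂⌋-mono-≤ (≤-trans (lg-mono m≤) (m≤n*m u κ {{>-nonZero (≤-trans (0<2^ 25) κ≥)}})))) (≤-trans (+-monoˡ-≤ e 1≤e) (≤-reflexive (cong (e +_) (sym (+-identityʳ e)))))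

  sizes : Sizes θ
  sizes = record
    { 64θ≤w    = 64θ≤w
    ; 10≤θ     = ≤-trans 10≤κ κ≤θ
    ; w<2^θ    = <-≤-trans w<2^e (2^-mono suc-e≤θ)
    ; e<2^θ    = <-≤-trans (n<2^n e) (2^-mono (≤-trans (n≤1+n e) suc-e≤θ))
    ; 0<e      = 1≤e
    ; 0<F      = 1≤F
    ; block    = <-≤-trans block< 2^e≤w
    ; counters = counters
    ; b≤F      = b≤F
    ; B<       = <-≤-trans B<2^ (2^-mono (∸-monoˡ-≤ {suc (e + suc e)} {ℓ} 1 (≤-trans (≤-reflexive (shape e)) (≤-trans (+-mono-≤ (*-monoʳ-≤ 2 (≤-refl {e})) (*-monoʳ-≤ 2 1≤e)) (≤-trans (≤-reflexive (shape₄ e)) (*-monoˡ-≤ e (≤ᵇ⇒≤ 4 8 tt)))))))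
    ; BB<      = <-≤-trans (*-mono-< (<-≤-trans (+-mono-<-≤ B<2^ two≤) (≤-reflexive (cong (2 ^ (e + suc e) +_) (sym (+-identityʳ _))))) B<2^)
        (≤-trans (≤-reflexive (sym (2^-+ (suc (e + suc e)) (e + suc e)))) (2^-mono (e+≤ℓ 3 (≤-reflexive (shape₃ e)) (n≤1+n 3))))
    ; F<       = m+n≤o⇒m≤o∸n (suc F) (≤-trans (≤-reflexive (+-comm (suc F) 1)) (≤-trans (s≤s F<2^) (≤-trans (+-monoˡ-≤ (2 ^ suc e) (0<2^ (suc e)))
        (≤-trans (≤-reflexive (cong (2 ^ suc e +_) (sym (+-identityʳ _)))) (2^-mono (e+≤ℓ 2 (≤-trans (≤-reflexive (+-comm 2 e)) (+-monoˡ-≤ 2 (m≤n*m e 4))) (s≤s (s≤s z≤n))))))))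
    }
    where
    shape : ∀ e → suc (e + suc e) ≡ 2 * e + 2 * 1
    shape = solve-∀
    shape₄ : ∀ e → 2 * e + 2 * e ≡ 4 * e
    shape₄ = solve-∀
    shape₃ : ∀ e → suc (e + suc e) + (e + suc e) ≡ 4 * e + 3
    shape₃ = solve-∀
    two≤ : 2 ≤ 2 ^ (e + suc e)
    two≤ = 2^-mono {1} (≤-trans 1≤e (m≤m+n e (suc e)))
    counters : ℓ + ℓ * F < w
    counters = *-cancelˡ-< 2 (ℓ + ℓ * F) w (≤-<-trans (≤-reflexive (lemma ℓ F)) (<-≤-trans (+-mono-<-≤ 2ℓ<w (div*≤ w (2 * ℓ))) (≤-reflexive (cong (w +_) (sym (+-identityʳ w))))))
      where
      lemma : ∀ ℓ F → 2 * (ℓ + ℓ * F) ≡ 2 * ℓ + F * (2 * ℓ)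
      lemma = solve-∀
      2ℓ<w : 2 * ℓ < w
      2ℓ<w = ≤-<-trans (≤-trans 2ℓ≤b (m≤m*n b b {{>-nonZero 1≤b}})) bb<w

-- Logarithms computed by the program

record CeilLog (t k : ℕ) : Set where
  constructor ceil-log
  field
    positive : 1 ≤ k
    enough   : t ≤ 2 ^ k
    least    : k ≡ 1 ⊎ 2 ^ (k ∸ 1) < t

-- This identifies what the loop finds with the numbers `Λ` and `suc e`, which are defined by other
-- means.
ceil-log-unique : ∀ {t k k′} → CeilLog t k → CeilLog t k′ → k ≡ k′
ceil-log-unique c c′ = ≤-antisym (below c c′) (below c′ c)
  where
  below : ∀ {t k k′} → CeilLog t k → CeilLog t k′ → k ≤ k′
  below (ceil-log _ _ (inj₁ refl)) (ceil-log 1≤k′ _ _) = 1≤k′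
  below {k = k} (ceil-log 1≤k _ (inj₂ 2^<t)) (ceil-log _ t≤ _) = ≤-trans (≤-reflexive (sym (m+[n∸m]≡n 1≤k))) (2^-cancel-< (<-≤-trans 2^<t t≤))

lg-ceil-log : ∀ n → CeilLog n (lg n)
lg-ceil-log n = ceil-log (1≤lg n) (≤2^lg n) (lg-minimal n)

Except : Array → Mem → Mem → Set
Except A M M′ = ∀ B j → B ≢ ctr → B ≢ A → M′ B j ≡ M B j

-- For increasing `k`, each test `2 ^ k < t` that succeeds overwrites the result by `k + 1`, so the
-- last success decides. The initial 1 realises the convention that a logarithm is at least 1.
ceilLog : Array → Exp → Program
ceilLog A t = assign A (lit 1) ∷ for ctr wE (pardo (lit 1) (ltE (2^E (cell ctr)) t) A (lit 0) (cell ctr ⊕ lit 1) ∷ [])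

module Log (w θ : ℕ) (64θ≤w : 64 * θ ≤ w) (10≤θ : 10 ≤ θ) (w<2^θ : w < 2 ^ θ) where

  open Scan w θ 64θ≤w 10≤θ w<2^θ public

  module _ (A : Array) (A≢ctr : A ≢ ctr) (A≢params : A ≢ params) (tE : Exp) {M₀ : Mem} {t : ℕ} (t< : t < 2 ^ w) (w-stored : M₀ params 2 ≡ w) where

    private
      guard = ltE (2^E (cell ctr)) tE

      record Found (k : ℕ) (M : Mem) : Set where
        field
          kept     : Except A M₀ M
          positive : 1 ≤ M A 0
          least    : M A 0 ≡ 1 ⊎ 2 ^ (M A 0 ∸ 1) < t
          passed   : ∀ j → j < k → 2 ^ j < t → suc j ≤ M A 0

      found-cast : ∀ {k M M′} → Except A M M′ → M′ A 0 ≡ M A 0 → Found k M → Found k M′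
      found-cast {k} {M} {M′} ex A≡ f = record
        { kept     = λ B j p q → trans (ex B j p q) (Found.kept f B j p q)
        ; positive = subst (1 ≤_) (sym A≡) (Found.positive f)
        ; least    = subst (λ x → x ≡ 1 ⊎ 2 ^ (x ∸ 1) < t) (sym A≡) (Found.least f)
        ; passed   = λ j j< 2^< → subst (suc j ≤_) (sym A≡) (Found.passed f j j< 2^<)
        }

    module _ (value : ∀ {M} → Words w M → Except A M₀ M → eval w M 0 tE ≡ t) where

      private
        w-value : ∀ {k M} → Words w M → Found k M → eval w M 0 wE ≡ w
        w-value {M = M} Wd f = val (At.load⇓ M Wd 0 (At.↓ At.litˢ M Wd 0 2) (trans (Found.kept f params 2 (λ ()) (λ p → A≢params (sym p))) w-stored))

        initial : ∀ {M} → Except A M₀ M → M A 0 ≡ 1 → Found 0 M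
        initial ex A≡ = record { kept = ex ; positive = ≤-reflexive (sym A≡) ; least = inj₁ A≡ ; passed = λ _ () }

        advance : ∀ {k M M′} → k < w → Words w M → Found k M → M ctr 0 ≡ k → Wrote 1 guard A (lit 0) (cell ctr ⊕ lit 1) M M′ → Found (suc k) M′
        advance {k} {M} {M′} k<w Wd f c≡ out = go (2 ^ k <? t)
          where
          open At M Wd 0 using (by; load⇓; zero⇓; one⇓; add⇓; lt⇓; 2^⇓; mul<ʷ)
          ctrV = load⇓ {ctr} zero⇓ c≡
          guard≡ : eval w M 0 guard ≡ 𝟙< (2 ^ k) t
          guard≡ = val (lt⇓ (2^⇓ ctrV k<w) (by {tE} (value Wd (Found.kept f))))
          next≡ : eval w M 0 (cell ctr ⊕ lit 1) ≡ suc k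
          next≡ = trans (val (add⇓ ctrV one⇓ (mul<ʷ (≤-trans (≤-reflexive (+-comm k 1)) k<w)))) (+-comm k 1)
          ex : Except A M M′
          ex B j _ B≢A = untouched out B≢A j
          go : Dec (2 ^ k < t) → Found (suc k) M′
          go (yes 2^k<t) = record
            { kept     = λ B j p q → trans (ex B j p q) (Found.kept f B j p q)
            ; positive = subst (1 ≤_) (sym new) (s≤s z≤n)
            ; least    = inj₂ (subst (λ x → 2 ^ (x ∸ 1) < t) (sym new) 2^k<t)
            ; passed   = λ j j< _ → subst (suc j ≤_) (sym new) j<
            }
            where
            new : M′ A 0 ≡ suc k
            new = written out 0 z<s (λ p → case trans (sym (trans guard≡ (𝟙<-true 2^k<t))) p of λ ()) (val zero⇓) λ { zero _ _ _ → next≡ ; (suc _) (s≤s ()) }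
          go (no 2^k≮t) = record
            { kept     = Found.kept same
            ; positive = Found.positive same
            ; least    = Found.least same
            ; passed   = λ j j< 2^< → Found.passed same j (≤∧≢⇒< (s≤s⁻¹ j<) (λ { refl → 2^k≮t 2^< })) 2^<
            }
            where
            same : Found k M′
            same = found-cast ex (unwritten out λ { zero _ g≢0 _ → g≢0 (trans guard≡ (𝟙<-false (≮⇒≥ 2^k≮t))) ; (suc _) (s≤s ()) }) f

        finished : ∀ {M} → Found w M → CeilLog t (M A 0)
        finished {M} f = ceil-log (Found.positive f)
          (≮⇒≥ λ 2^< → <⇒≱ (n<1+n (M A 0)) (Found.passed f (M A 0) (2^-cancel-< (<-trans 2^< t<)) 2^<)) (Found.least f)

      ceilLog-rule : Words w M₀ → Triple (w * 1) (w * 1) (ceilLog A tE) M₀ _ _ (λ M → Except A M₀ M × CeilLog t (M A 0))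
      ceilLog-rule Wd₀ =
        assign-rule {Q = Found 0} Wd₀ 1≤w1 1≤w1 (val (At.one⇓ M₀ Wd₀ 0)) (λ M₁ _ o A≡ → initial (λ B j _ B≢A → o B j B≢A) A≡)
        ⨾ λ M₁ Wd₁ f₁ → consequence {Q = Found w} (λ M _ f → Found.kept f , finished f)
          (for-rule ≤-refl ≤-refl w 1≤w (n<2^n w) Found (λ {k} o f → found-cast (λ B j p _ → o B j p) (o A 0 A≢ctr) f) w-value
            (λ {k} {M} k<w Wd f c≡ → pardo-rule {1} {1} 1 Wd (val (At.one⇓ M Wd 0)) ≤-refl ≤-refl ≤-refl λ M′ _ out →
              advance k<w Wd f c≡ out , trans (untouched out (λ p → A≢ctr (sym p)) 0) c≡)
            Wd₁ (λ M′ o → found-cast (λ B j p _ → o B j p) (o A 0 A≢ctr) f₁))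
        where
        1≤w1 : 1 ≤ w * 1
        1≤w1 = ≤-trans 1≤w (≤-reflexive (sym (*-identityʳ w)))

-- The whole program

Cells : Set
Cells = List (Array × ℕ × ℕ)

Holds : Cells → Mem → Set
Holds []                 M = ⊤
Holds ((A , j , x) ∷ cs) M = M A j ≡ x × Holds cs M

avoids : Cells → List ℕ → Bool
avoids []             K = true
avoids ((A , _) ∷ cs) K = if fresh K A then avoids cs K else false

holds-keep : ∀ cs K {M M′} → T (avoids cs K) → Keeps K M M′ → Holds cs M → Holds cs M′
holds-keep []                 K _ _ _ = tt
holds-keep ((A , j , x) ∷ cs) K d k (p , ps) with fresh K A in f
... | true = trans (k A (subst T (sym f) tt) j) p , holds-keep cs K d k ps

σE symbolE : Exp
σE      = load params (lit 1)
-- Symbols get a leading 1, so that the code of a leaf is its heap index; over a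
-- one-letter alphabet the tree has height 1 and the only symbol is a right leaf.
symbolE = 2^E lamE ⊕ load input pid ⊕ eqE σE (lit 1)

initialCells : ℕ → ℕ → ℕ → Cells
initialCells n σ w = (params , 0 , n) ∷ (params , 1 , σ) ∷ (params , 2 , w) ∷ []

levelWT : Program
-- ⌊log₂ w⌋ + 1 equals ⌈log₂ (w + 1)⌉, so the same loop serves for `e`, after which 1 is subtracted.
levelWT = ceilLog lam σE ++ ceilLog hdr (wE ⊕ lit 1) ++ (assign hdr (cell hdr ⊖ lit 1) ∷ []) ++ (assign root (lit 1) ∷ [])
  ++ (pardo (lit 1) (lit 1) start (lit 1) (lit 0) ∷ []) ++ (pardo (lit 1) (lit 1) len (lit 1) nE ∷ []) ++ (assign slen nE ∷ [])
  ++ (pardo nE (lit 1) cur pid symbolE ∷ []) ++ for lvl lamE levelP ++ tablesP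

module Construction (𝒮 : Setting) (Y₁ : ℕ) (1≤Y₁ : 1 ≤ Y₁) (w≤n : Setting.w 𝒮 ≤ Setting.γ 𝒮 * length (Setting.L 𝒮)) (w≤Y₁ : Setting.w 𝒮 ≤ Setting.γ 𝒮 * Y₁)
  (X≡ : Setting.Λ 𝒮 * length (Setting.L 𝒮) ≡ Setting.X 𝒮) (Y≡ : Setting.Λ 𝒮 * Y₁ ≡ Setting.Y 𝒮)
  (σ : ℕ) (σ< : σ < 2 ^ (1 * Setting.θ 𝒮)) (log-σ : CeilLog σ (Setting.Λ 𝒮)) (log-w : CeilLog (Setting.w 𝒮 + 1) (suc (Setting.e 𝒮))) where

  open LevelStep 𝒮 Y₁ 1≤Y₁ w≤n w≤Y₁ public
  open TableSteps 𝒮 using (steps; compatible; program) public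
  open Log w θ 64θ≤w 10≤θ w<2^θ using (ceilLog-rule)

  Symbols : Mem → Set
  Symbols M = ∀ i → i < n → M input i < σ × nth L i ≡ 2 ^ Λ + M input i + 𝟙≡ σ 1

  Ready : Cells → Mem → Set
  Ready cs M = Symbols M × Holds cs M

  ready-keep : ∀ cs K {M M′} → T (fresh K input) → T (avoids cs K) → Keeps K M M′ → Ready cs M → Ready cs M′
  ready-keep cs K f d k (sy , hs) = (λ i i< → subst (λ s → s < σ × nth L i ≡ 2 ^ Λ + s + 𝟙≡ σ 1) (sym (k input f i)) (sy i i<)) , holds-keep cs K d k hs

  cs₀ cs₁ cs₂ cs₃ : Cells
  cs₀ = initialCells n σ w
  cs₁ = (lam , 0 , Λ) ∷ cs₀
  cs₂ = (hdr , 0 , e) ∷ cs₁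
  cs₃ = (slen , 0 , n) ∷ (len , 1 , n) ∷ (start , 1 , 0) ∷ (root , 0 , 1) ∷ cs₂

  private
    store : ∀ cs A a v {j x M} {_ : T (avoids cs (A ∷ []))} {_ : T (fresh (A ∷ []) input)} {_ : T (4 + ops a + ops v ≤ᵇ 100)} →
      Words w M → eval w M 0 a ≡ j → eval w M 0 v ≡ x → Ready cs M →
      Triple X Y (pardo (lit 1) (lit 1) A a v ∷ []) M C₀ C₀ (Ready ((A , j , x) ∷ cs))
    store cs A a v {j} {x} {M} {d} {f} {small} Wd a≡ v≡ r = cheaper _ _ cost≤ (≤-trans (≤-reflexive (cong suc (sym (*-identityˡ _)))) cost≤)
      (pardo-rule 1 Wd (val (At.one⇓ M Wd 0)) (≤-trans 1≤X (≤-reflexive (sym (*-identityˡ X)))) 1≤X 1≤Y λ M′ _ out →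
        let r′ = ready-keep cs (A ∷ []) f d (wrote-keeps out) r in
        proj₁ r′ , written out 0 z<s (one≢0 Wd 0) a≡ (λ { zero _ _ _ → v≡ ; (suc _) (s≤s ()) }) , proj₂ r′)
      where
      shape : ∀ a v → 1 + 1 * (1 + a + v + 1) ≡ 3 + a + v
      shape = solve-∀
      cost≤ : 1 + 1 * (1 + ops a + ops v + 1) ≤ C₀
      cost≤ = ≤-trans (≤-reflexive (shape (ops a) (ops v))) (≤-trans (n≤1+n _) (≤-trans (≤ᵇ⇒≤ (4 + ops a + ops v) 100 small) (≤-trans (≤ᵇ⇒≤ 100 5000 tt) (m≤n+m 5000 (151 * (3 * γ + 5))))))

    slow : ∀ {P M a b Q} {_ : T (a ≤ᵇ 453)} {_ : T (b ≤ᵇ 453)} → Triple (w * 1) (w * 1) P M a b Q → Triple X Y P M C₀ C₀ Q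
    slow {a = a} {b} {_} {a≤} {b≤} f = cheaper (a * γ) (b * γ) (scaled a a≤) (scaled b b≤)
      (rescale γ γ (≤-trans (≤-reflexive (*-identityʳ w)) w≤X) (≤-trans (≤-reflexive (*-identityʳ w)) w≤Y) f)
      where
      scaled : ∀ a → T (a ≤ᵇ 453) → a * γ ≤ C₀
      scaled a a≤ = ≤-trans (*-monoˡ-≤ γ (≤ᵇ⇒≤ a 453 a≤)) (≤-trans (≤-reflexive (*-assoc 151 3 γ)) (≤-trans (*-monoʳ-≤ 151 (m≤m+n (3 * γ) 5)) (m≤m+n _ 5000)))

    n-value : ∀ {M} (Wd : Words w M) → M params 0 ≡ n → ∀ z → eval w M z nE ≡ n
    n-value {M} Wd p z = val (At.load⇓ M Wd z (At.zero⇓ M Wd z) p)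

    setup : ∀ {M} → Words w M → Ready cs₀ M → Triple X Y (ceilLog lam σE ++ ceilLog hdr (wE ⊕ lit 1)) M (C₀ + C₀) (C₀ + C₀) (Ready ((hdr , 0 , suc e) ∷ cs₁))
    setup {M} Wd r@(_ , _ , σ≡ , w≡ , _) =
      slow (consequence {Q = λ M′ → Except lam M M′ × CeilLog σ (M′ lam 0)}
        (λ M₁ _ (ex , c) → let r₁ = ready-keep cs₀ (ctr ∷ lam ∷ []) tt tt (λ B f j → ex B j (fresh-≢ {ctr ∷ lam ∷ []} f λ ()) (fresh-≢ {ctr ∷ lam ∷ []} f λ ())) r in
          proj₁ r₁ , ceil-log-unique c log-σ , proj₂ r₁)
        (ceilLog-rule lam (λ ()) (λ ()) σE {M} σ<2^w w≡ (λ {M′} Wd′ ex → val (At.load⇓ M′ Wd′ 0 (At.one⇓ M′ Wd′ 0) (trans (ex params 1 (λ ()) (λ ())) σ≡))) Wd))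
      ⨾ λ M₁ Wd₁ r₁ → second M₁ Wd₁ r₁
      where
      σ<2^w : σ < 2 ^ w
      σ<2^w = At.small-word M Wd 0 {1} (s≤s z≤n) σ<
      w+1V : ∀ {M} (Wd : Words w M) → M params 2 ≡ w → eval w M 0 (wE ⊕ lit 1) ≡ w + 1
      w+1V {M} Wd w≡ = valˢ (At._+ˢ_ M Wd 0 (At.loadˢ M Wd 0 1 (At.litˢ M Wd 0 2) w≡ w<2^1θ) (At.litˢ M Wd 0 1))
      w+1< : w + 1 < 2 ^ w
      w+1< = subst (_< 2 ^ w) (w+1V Wd w≡) (eval< {w} {M} Wd 0 (wE ⊕ lit 1))
      second : ∀ M₁ (Wd₁ : Words w M₁) → Ready cs₁ M₁ → Triple X Y (ceilLog hdr (wE ⊕ lit 1)) M₁ C₀ C₀ (Ready ((hdr , 0 , suc e) ∷ cs₁))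
      second M₁ Wd₁ r₁@(_ , _ , _ , _ , w≡₁ , _) = slow (consequence {Q = λ M′ → Except hdr M₁ M′ × CeilLog (w + 1) (M′ hdr 0)}
        (λ M₂ _ (ex , c) → let r₂ = ready-keep cs₁ (ctr ∷ hdr ∷ []) tt tt (λ B f j → ex B j (fresh-≢ {ctr ∷ hdr ∷ []} f λ ()) (fresh-≢ {ctr ∷ hdr ∷ []} f λ ())) r₁ in
          proj₁ r₂ , ceil-log-unique c log-w , proj₂ r₂)
        (ceilLog-rule hdr (λ ()) (λ ()) (wE ⊕ lit 1) {M₁} w+1< w≡₁ (λ {M′} Wd′ ex → w+1V Wd′ (trans (ex params 2 (λ ()) (λ ())) w≡₁)) Wd₁))

    roots : ∀ {M} → Words w M → Ready ((hdr , 0 , suc e) ∷ cs₁) M →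
      Triple X Y ((assign hdr (cell hdr ⊖ lit 1) ∷ []) ++ (assign root (lit 1) ∷ [])
        ++ (pardo (lit 1) (lit 1) start (lit 1) (lit 0) ∷ []) ++ (pardo (lit 1) (lit 1) len (lit 1) nE ∷ []) ++ (assign slen nE ∷ [])) M
        (C₀ + (C₀ + (C₀ + (C₀ + C₀)))) (C₀ + (C₀ + (C₀ + (C₀ + C₀)))) (Ready cs₃)
    roots {M} Wd (sy , h≡ , hs) =
      store cs₁ hdr (lit 0) (cell hdr ⊖ lit 1) Wd (val (At.zero⇓ M Wd 0)) (val (At.sub⇓ M Wd 0 (At.load⇓ M Wd 0 (At.zero⇓ M Wd 0) h≡) (At.one⇓ M Wd 0))) (sy , hs)
      ⨾ λ M₁ Wd₁ r₁ → store cs₂ root (lit 0) (lit 1) Wd₁ (val (At.zero⇓ M₁ Wd₁ 0)) (val (At.one⇓ M₁ Wd₁ 0)) r₁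
      ⨾ λ M₂ Wd₂ r₂ → store ((root , 0 , 1) ∷ cs₂) start (lit 1) (lit 0) Wd₂ (val (At.one⇓ M₂ Wd₂ 0)) (val (At.zero⇓ M₂ Wd₂ 0)) r₂
      ⨾ λ M₃ Wd₃ r₃ → store ((start , 1 , 0) ∷ (root , 0 , 1) ∷ cs₂) len (lit 1) nE Wd₃ (val (At.one⇓ M₃ Wd₃ 0)) (n-value Wd₃ (proj₁ (proj₂ (proj₂ (proj₂ (proj₂ (proj₂ r₃)))))) 0) r₃
      ⨾ λ M₄ Wd₄ r₄ → store ((len , 1 , n) ∷ (start , 1 , 0) ∷ (root , 0 , 1) ∷ cs₂) slen (lit 0) nE Wd₄ (val (At.zero⇓ M₄ Wd₄ 0)) (n-value Wd₄ (proj₁ (proj₂ (proj₂ (proj₂ (proj₂ (proj₂ (proj₂ r₄))))))) 0) r₄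

    n≤2X : n ≤ 2 * X
    n≤2X = ≤-trans (m≤m+n n (Λ * n)) slots≤

    codes-written : ∀ {M} → Words w M → Ready cs₃ M → Triple X Y (pardo nE (lit 1) cur pid symbolE ∷ []) M C₀ C₀ (Level 0)
    codes-written {M} Wd r@(sy , s≡ , l≡ , st≡ , r≡ , h≡ , lam≡ , n≡ , σ≡ , w≡ , _) = cheaper _ _ (small 32) (small 17)
      (pardo-rule 2 Wd (n-value Wd n≡ 0) n≤2X 1≤X 1≤Y λ M′ _ out → level M′ (ready-keep cs₃ (cur ∷ []) tt tt (wrote-keeps out) r) (stored out))
      where
      small : ∀ x {_ : T (x ≤ᵇ 5000)} → x ≤ C₀
      small x {p} = ≤-trans (≤ᵇ⇒≤ x 5000 p) (m≤n+m 5000 (151 * (3 * γ + 5)))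
      pid≡ : ∀ {z} → z < n → eval w M z pid ≡ z
      pid≡ {z} z< = valˢ (At.pidˢ M Wd z 1 (<-≤-trans z< (<⇒≤ n<)))
      symbol≡ : ∀ z → z < n → eval w M z symbolE ≡ nth L z
      symbol≡ z z< = trans (valˢ (powV +ˢ loadˢ 1 (pidˢ 1 (<-≤-trans z< (<⇒≤ n<))) refl (<-trans (proj₁ (sy z z<)) σ<) +ˢ eqˢ (loadˢ 1 (litˢ 1) σ≡ σ<) (litˢ 1)))
          (sym (proj₂ (sy z z<)))
        where
        open At M Wd z
        Λ<w : Λ < w
        Λ<w = <-≤-trans (2^-cancel-< (node-bound (^-monoʳ-< 2 (s≤s (s≤s z≤n)) (n<1+n Λ)))) (≤-trans (*-monoˡ-≤ θ (s≤s (s≤s (z≤n {62})))) 64θ≤w)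
        powV : 2^E lamE ⇓⟨ 2 ⟩ 2 ^ Λ
        powV = 2^⇓ (load⇓ zero⇓ lam≡) Λ<w within node-bound (^-monoʳ-< 2 (s≤s (s≤s z≤n)) (n<1+n Λ))
      stored : ∀ {M′} → Wrote n (lit 1) cur pid symbolE M M′ → ∀ i → i < n → M′ cur i ≡ nth L i
      stored out i i< = written out i i< (one≢0 Wd i) (pid≡ i<) λ z z< _ p → trans (symbol≡ z z<) (cong (nth L) (trans (sym (pid≡ z<)) p))
      level : ∀ M′ → Ready cs₃ M′ → (∀ i → i < n → M′ cur i ≡ nth L i) → Level 0 M′
      level M′ (_ , s≡ , l≡ , st≡ , r≡ , h≡ , lam≡ , n≡ , σ≡ , w≡ , _) cur≡ =
          record { n-stored = n≡ ; w-stored = w≡ ; lam-stored = lam≡ ; hdr-stored = h≡ ; root-stored = r≡ ; slen-stored = s≡ } ,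
          starts , lens , codes′ , λ _ _ _ 1≤p p<1 _ _ → ⊥-elim (<⇒≱ p<1 1≤p)
        where
        starts : Starts 1 M′
        starts 1 _ _ = st≡
        starts (suc (suc _)) _ (s≤s (s≤s ()))
        lens : Lens 1 M′
        lens 1 _ _ = trans l≡ (sym (cong length seq-root))
        lens (suc (suc _)) _ (s≤s (s≤s ()))
        codes′ : Codes 1 M′
        codes′ 1 r _ _ r< = trans (cur≡ r (subst (λ xs → r < length xs) seq-root r<)) (cong (λ xs → nth xs r) (sym seq-root))
        codes′ (suc (suc _)) _ _ (s≤s (s≤s ()))

    levels : ∀ {M} → Words w M → Level 0 M → Triple X Y (for lvl lamE levelP) M (C₀ + 13 + 10) (C₀ + 13 + 10) (Level Λ)
    levels Wd level₀ = subst₂ (λ X Y → Triple X Y (for lvl lamE levelP) _ (C₀ + 13 + 10) (C₀ + 13 + 10) (Level Λ)) X≡ Y≡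
      (for-rule 1≤n 1≤Y₁ Λ 1≤Λ (<-trans (n<1+n Λ) (At.small-word _ Wd 0 {1} (s≤s z≤n) Λ<)) Level (λ {k} {M} {M′} → level-stable {k} {M} {M′})
        (λ {k} {M} Wd lv → val (At.load⇓ M Wd 0 (At.zero⇓ M Wd 0) (Base.lam-stored (proj₁ lv))))
        (λ k< Wd lv c≡ → level-rule k< Wd lv c≡) Wd (λ M′ o → level-stable {0} o level₀))

    inp : ∀ {M} → Level Λ M → Inp M
    inp (b , st , ln , co , po) = record
      { n-stored = n-stored ; w-stored = w-stored ; lam-stored = lam-stored ; hdr-stored = hdr-stored
      ; off-stored = st ; len-stored = ln ; cur-stored = co ; pos-stored = po }
      where open Base b

  Built : Mem → Set
  Built M = Facts steps M × Inp M × M root 0 ≡ 1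

  -- The 24 units are 15 table steps, 8 for the initialisation and one for the levels; 13 + 10 is
  -- the overhead of the loop.
  total : ∀ c → c + c + (c + (c + (c + (c + c))) + (c + (c + 13 + 10 + 15 * c))) ≡ 24 * c + 23
  total = solve-∀

  built : ∀ {M} → Words w M → Ready cs₀ M → Triple X Y levelWT M (24 * C₀ + 23) (24 * C₀ + 23) Built
  built {M} Wd r = subst (λ c → Triple X Y levelWT M c c Built) (total C₀)
    (setup Wd r ⨾ λ M₁ Wd₁ r₁ → roots Wd₁ r₁ ⨾ λ M₂ Wd₂ r₂ → codes-written Wd₂ r₂ ⨾ λ M₃ Wd₃ l₃ → levels Wd₃ l₃ ⨾ λ M₄ Wd₄ l₄ →
      subst (λ P → Triple X Y P M₄ (15 * C₀) (15 * C₀) Built) program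
        (consequence (λ M₅ _ (facts , inp₅ , f) → facts , inp₅ , trans (f root 0 tt) (Base.root-stored (proj₁ l₄)))
          (run-all steps compatible Wd₄ (inp l₄))))

-- From codes and heap indices back to ranges of symbols

map-filter-map : ∀ {P R : ℕ → Set} (P? : Decidable P) (R? : Decidable R) (f g h : ℕ → ℕ) {X} →
  All (λ s → (P s → R (h s)) × (R (h s) → P s) × (P s → f s ≡ g (h s))) X → map f (filter P? X) ≡ map g (filter R? (map h X))
map-filter-map P? R? f g h [] = refl
map-filter-map P? R? f g h {s ∷ X} ((to , from , agree) ∷ ps) with P? s
... | yes p = trans (cong₂ _∷_ (agree p) (map-filter-map P? R? f g h ps)) (cong (map g) (sym (filter-accept R? (to p))))
... | no ¬p = trans (map-filter-map P? R? f g h ps) (cong (map g) (sym (filter-reject R? (¬p ∘ from))))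

lookup-nth : ∀ X (i : Fin (length X)) → lookup X i ≡ nth X (toℕ i)
lookup-nth (x ∷ X) fzero    = refl
lookup-nth (x ∷ X) (fsuc i) = lookup-nth X i

nth-map : ∀ (f : ℕ → ℕ) X i → i < length X → nth (map f X) i ≡ f (nth X i)
nth-map f (x ∷ X) zero    _        = refl
nth-map f (x ∷ X) (suc i) (s≤s i<) = nth-map f X i i<

nth-all : ∀ {P : ℕ → Set} {X} → All P X → ∀ i → i < length X → P (nth X i)
nth-all (p ∷ ps) zero    _        = p
nth-all (p ∷ ps) (suc i) (s≤s i<) = nth-all ps i i<

symbols< : ∀ {n σ} (S : Vec (Fin σ) n) → All (_< σ) (symbols S)
symbols< []      = []
symbols< (s ∷ S) = toℕ<n s ∷ symbols< S

length-symbols : ∀ {n σ} (S : Vec (Fin σ) n) → length (symbols S) ≡ n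
length-symbols []      = refl
length-symbols (s ∷ S) = cong suc (length-symbols S)

choose-< : ∀ {s m} → s < m → (if s <ᵇ m then 0 else 1) ≡ 0
choose-< {s} {m} s<m with s <ᵇ m | <⇒<ᵇ s<m
... | true | _ = refl

choose-≥ : ∀ {s m} → m ≤ s → (if s <ᵇ m then 0 else 1) ≡ 1
choose-≥ {s} {m} m≤s with s <ᵇ m | <ᵇ⇒< s m
... | true  | below = ⊥-elim (<⇒≱ (below tt) m≤s)
... | false | _  = refl

code : ℕ → ℕ → ℕ
code σ s = 2 ^ lg σ + s + 𝟙≡ σ 1

code-many : ∀ {σ} s → 2 ≤ σ → code σ s ≡ s + 2 ^ lg σ
code-many {σ} s 2≤σ = trans (cong (2 ^ lg σ + s +_) (𝟙≡-false {σ} {1} λ { refl → <⇒≱ 2≤σ ≤-refl })) (trans (+-identityʳ _) (+-comm (2 ^ lg σ) s))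

code-leading : ∀ {σ s} → s < σ → code σ s div 2 ^ lg σ ≡ 1
code-leading {1} {zero} _ = refl
code-leading {1} {suc _} (s≤s ())
code-leading {σ@(suc (suc σ′))} {s} s< = trans (cong (_div 2 ^ lg σ) (code-many {σ} s (s≤s (s≤s z≤n))))
  (div-unique {r = s} 1 (<-≤-trans s< (≤2^lg σ)) (cong (s +_) (sym (*-identityˡ _))))

-- A node at height suc h above the leaves covers the block of 2 ^ suc h symbols
-- starting at k * 2 ^ suc h.
module Block (k h : ℕ) where

  first last : ℕ
  first = k * 2 ^ suc h
  last  = first + 2 ^ suc h ∸ 1

  suc-last : suc last ≡ first + 2 ^ suc h
  suc-last = m+[n∸m]≡n (≤-trans (0<2^ (suc h)) (m≤n+m (2 ^ suc h) first))

  first≡ : first ≡ 2 * k * 2 ^ h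
  first≡ = lemma k (2 ^ h)
    where
    lemma : ∀ k x → k * (2 * x) ≡ 2 * k * x
    lemma = solve-∀

  middle : mid first last ≡ first + 2 ^ h
  middle = div-unique {y = 2} {r = 0} (first + 2 ^ h) z<s (trans (+-assoc first last 1)
      (trans (cong (first +_) (trans (+-comm last 1) suc-last)) (lemma first (2 ^ h))))
    where
    lemma : ∀ a x → a + (a + 2 * x) ≡ (a + x) * 2
    lemma = solve-∀

  size : suc last ∸ first ≡ 2 ^ suc h
  size = trans (cong (_∸ first) suc-last) (m+n∸m≡n first (2 ^ suc h))

  inside : ∀ s → first ≤ s → s ≤ last → s div 2 ^ suc h ≡ k
  inside s lo hi = ≤-antisym (s≤s⁻¹ (div< {q = suc k} (≤-trans (s≤s hi) (≤-reflexive (trans suc-last (+-comm first (2 ^ suc h))))))) (≤div (0<2^ (suc h)) lo)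

  inside⁻¹ : ∀ s → s div 2 ^ suc h ≡ k → first ≤ s × s ≤ last
  inside⁻¹ s refl = div*≤ s (2 ^ suc h) , s≤s⁻¹ (≤-trans (div-upper s (0<2^ (suc h))) (≤-reflexive (trans (+-comm (2 ^ suc h) first) (sym suc-last))))

  left-half : ∀ s → first ≤ s → s < first + 2 ^ h → s div 2 ^ h mod 2 ≡ 0
  left-half s lo hi = mod-unique {r = 0} k z<s (trans (≤-antisym
      (s≤s⁻¹ (div< {y = 2 ^ h} {q = suc (2 * k)} (<-≤-trans hi (≤-reflexive (trans (cong (_+ 2 ^ h) first≡) (+-comm _ (2 ^ h))))))) (≤div (0<2^ h) (≤-trans (≤-reflexive (sym first≡)) lo)))
    (*-comm 2 k))

  right-half : ∀ s → first + 2 ^ h ≤ s → s ≤ last → s div 2 ^ h mod 2 ≡ 1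
  right-half s lo hi = mod-unique {r = 1} k (s≤s (s≤s z≤n)) (trans (≤-antisym
      (s≤s⁻¹ (div< {y = 2 ^ h} {q = suc (suc (2 * k))} (≤-trans (s≤s hi) (≤-reflexive (trans suc-last (trans (cong (_+ 2 ^ suc h) first≡) (lemma (2 * k) (2 ^ h))))))))
      (≤div (0<2^ h) (≤-trans (≤-reflexive (trans (+-comm (2 ^ h) _) (cong (_+ 2 ^ h) (sym first≡)))) lo)))
    (cong suc (*-comm 2 k)))
    where
    lemma : ∀ a x → a * x + 2 * x ≡ (2 + a) * x
    lemma = solve-∀

module Tree (𝒮 : Setting) (dense : Setting.w 𝒮 * Setting.e 𝒮 ≤ 4 * Geometry.B (Setting.w 𝒮) (Setting.e 𝒮))
  (loglog≤ : ∀ m → m ≤ length (Setting.L 𝒮) → suc (loglog m) ≤ 2 * Setting.e 𝒮)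
  {n₀ σ : ℕ} (S : Vec (Fin σ) n₀) (1≤σ : 1 ≤ σ) (Λ≡ : Setting.Λ 𝒮 ≡ lg σ) (L≡ : Setting.L 𝒮 ≡ map (code σ) (symbols S)) where

  open NodeProof 𝒮 dense loglog≤ public

  module _ {M : Mem} (inp : Inp M) (facts : Facts steps M) where

    private
      left≡ : ∀ p → 1 ≤ p → p < 2 ^ Λ → M left p ≡ 2 * p
      left≡ p 1≤p p< = proj₁ (proj₂ (proj₂ (proj₂ (proj₂ (proj₂ (proj₂ (proj₂ (proj₂ (proj₂ (proj₂ facts)))))))))) p p (1≤p , p< , refl)

      right≡ : ∀ p → 1 ≤ p → p < 2 ^ Λ → M right p ≡ 2 * p + 1
      right≡ p 1≤p p< = proj₁ (proj₂ (proj₂ (proj₂ (proj₂ (proj₂ (proj₂ (proj₂ (proj₂ (proj₂ (proj₂ (proj₂ facts))))))))))) p p (1≤p , p< , refl)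

    -- Codes relabel the symbols one by one and keep their order in the text. So it suffices to
    -- compare, for each single symbol, membership in the range with the ancestor, and the half with
    -- the branch bit.
    node-of-range : ∀ {a b p} → 1 ≤ p → p < 2 ^ Λ →
      (∀ s → s < σ → (a ≤ s × s ≤ b → ancestor (depth p) (code σ s) ≡ p) × (ancestor (depth p) (code σ s) ≡ p → a ≤ s × s ≤ b) ×
        (a ≤ s × s ≤ b → (if s <ᵇ mid a b then 0 else 1) ≡ branchBit (depth p) (code σ s))) →
      NodeAt w structure S M (bitmap (symbols S) a b) p
    node-of-range {a} {b} {p} 1≤p p< match = subst (λ B → NodeAt w structure S M B p)
      (sym (trans (map-filter-map (λ s → a ≤? s ×-dec s ≤? b) (λ v → ancestor (depth p) v ≟ p) _ (branchBit (depth p)) (code σ) (All.map (λ {s} → match s) (symbols< S)))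
        (cong (λ T → map (branchBit (depth p)) (filter (λ v → ancestor (depth p) v ≟ p) T)) (sym L≡))))
      (node-at S inp facts 1≤p p<)

    tree-cast : ∀ {a a′ b b′ p p′} → a ≡ a′ → b ≡ b′ → p ≡ p′ → TreeAt w structure S M a b p → TreeAt w structure S M a′ b′ p′
    tree-cast refl refl refl t = t

    -- Block `k` at depth `d` belongs to the heap index `2 ^ d + k`, and its halves are the blocks
    -- `2 k` and `2 k + 1` one level down. The induction on `h` ends at ranges of size 2; an empty
    -- subsequence ends it earlier, although nodes are constructed there as well.
    subtree : 2 ≤ σ → ∀ h k d → d + suc h ≡ Λ → k < 2 ^ d → TreeAt w structure S M (Block.first k h) (Block.last k h) (2 ^ d + k)
    subtree 2≤σ h k d d+≡ k< = shape h d+≡ at (subsequence (symbols S) first last) refl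
      where
      open Block k h
      p = 2 ^ d + k
      1≤p : 1 ≤ p
      1≤p = ≤-trans (0<2^ d) (m≤m+n (2 ^ d) k)
      p<2^ : p < 2 ^ suc d
      p<2^ = <-≤-trans (+-monoʳ-< (2 ^ d) k<) (≤-reflexive (cong (2 ^ d +_) (sym (+-identityʳ _))))
      depth≡ : depth p ≡ d
      depth≡ = ≤-antisym (s≤s⁻¹ (depth-< 1≤p p<2^)) (≤depth (m≤m+n (2 ^ d) k))
      p< : p < 2 ^ Λ
      p< = <-≤-trans p<2^ (2^-mono (≤-trans (≤-reflexive (+-comm 1 d)) (≤-trans (+-monoʳ-≤ d (s≤s (z≤n {h}))) (≤-reflexive d+≡))))
      Λ∸d : Λ ∸ d ≡ suc h
      Λ∸d = trans (cong (_∸ d) (sym d+≡)) (m+n∸m≡n d (suc h))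
      Λ∸1∸d : Λ ∸ 1 ∸ d ≡ h
      Λ∸1∸d = trans (∸-+-assoc Λ 1 d) (trans (cong (Λ ∸_) (+-comm 1 d)) (trans (sym (∸-+-assoc Λ d 1)) (cong (_∸ 1) Λ∸d)))
      code≡ : ∀ s → code σ s ≡ s + 2 ^ d * 2 ^ suc h
      code≡ s = trans (code-many {σ} s 2≤σ) (cong (s +_) (trans (cong (2 ^_) (trans (sym Λ≡) (sym d+≡))) (2^-+ d (suc h))))
      ancestor≡ : ∀ s → ancestor (depth p) (code σ s) ≡ s div 2 ^ suc h + 2 ^ d
      ancestor≡ s = trans (cong₂ (λ x y → x div 2 ^ y) (code≡ s) (trans (cong (Λ ∸_) depth≡) Λ∸d)) (div-+* s (2 ^ d) (0<2^ (suc h)))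
      branchBit≡ : ∀ s → branchBit (depth p) (code σ s) ≡ s div 2 ^ h mod 2
      branchBit≡ s = trans (cong₂ (λ x y → x div 2 ^ y mod 2) (trans (code≡ s) (cong (s +_) (lemma (2 ^ d) (2 ^ h)))) (trans (cong (Λ ∸ 1 ∸_) depth≡) Λ∸1∸d))
          (trans (cong (_mod 2) (div-+* s (2 ^ d * 2) (0<2^ h))) (mod-+* (s div 2 ^ h) (2 ^ d) 2))
        where
        lemma : ∀ x y → x * (2 * y) ≡ x * 2 * y
        lemma = solve-∀
      bit≡ : ∀ s → first ≤ s → s ≤ last → Dec (s < first + 2 ^ h) → (if s <ᵇ mid first last then 0 else 1) ≡ s div 2 ^ h mod 2
      bit≡ s lo hi (yes s<) = trans (choose-< (<-≤-trans s< (≤-reflexive (sym middle)))) (sym (left-half s lo s<))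
      bit≡ s lo hi (no s≮) = trans (choose-≥ (≤-trans (≤-reflexive middle) (≮⇒≥ s≮))) (sym (right-half s (≮⇒≥ s≮) hi))
      at : NodeAt w structure S M (bitmap (symbols S) first last) p
      at = node-of-range 1≤p p< λ s _ →
        (λ (lo , hi) → trans (ancestor≡ s) (trans (cong (_+ 2 ^ d) (inside s lo hi)) (+-comm k (2 ^ d)))) ,
        (λ q → inside⁻¹ s (+-cancelʳ-≡ (2 ^ d) _ _ (trans (sym (ancestor≡ s)) (trans q (+-comm (2 ^ d) k))))) ,
        λ (lo , hi) → trans (bit≡ s lo hi (s <? first + 2 ^ h)) (sym (branchBit≡ s))
      shape : ∀ h → d + suc h ≡ Λ → NodeAt w structure S M (bitmap (symbols S) (Block.first k h) (Block.last k h)) p →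
        ∀ X → subsequence (symbols S) (Block.first k h) (Block.last k h) ≡ X → TreeAt w structure S M (Block.first k h) (Block.last k h) p
      shape zero    _ at _ _ = leaf (inj₁ (≤-reflexive (Block.size k 0))) at
      shape (suc h) _ at [] X≡ = leaf (inj₂ X≡) at
      shape (suc h) q at (_ ∷ _) X≡ = node (<-≤-trans (s≤s (s≤s (s≤s (z≤n {1})))) (≤-trans (2^-mono {2} (s≤s (s≤s (z≤n {h})))) (≤-reflexive (sym (Block.size k (suc h)))))) (λ X≡[] → case trans (sym X≡) X≡[] of λ ()) at
          (tree-cast (sym first≡′) (trans (cong (λ a → a + 2 ^ suc h ∸ 1) (sym first≡′)) (cong (_∸ 1) (sym middle′))) (trans (left-child (2 ^ d) k) (sym (left≡ p 1≤p p<)))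
            (subtree 2≤σ h (2 * k) (suc d) d+≡′ (*-monoʳ-< 2 k<)))
          (tree-cast start′ (trans (cong (λ a → a + 2 ^ suc h ∸ 1) start′) (cong (_∸ 1) end′)) (trans (right-child (2 ^ d) k) (sym (right≡ p 1≤p p<)))
            (subtree 2≤σ h (2 * k + 1) (suc d) d+≡′ (≤-trans (≤-reflexive (lemma k)) (*-monoʳ-≤ 2 k<))))
        where
        first≡′ = Block.first≡ k (suc h)
        middle′ = Block.middle k (suc h)
        d+≡′ : suc d + suc h ≡ Λ
        d+≡′ = trans (sym (+-suc d (suc h))) q
        lemma : ∀ k → suc (2 * k + 1) ≡ 2 * suc k
        lemma = solve-∀
        left-child : ∀ x k → 2 * x + 2 * k ≡ 2 * (x + k)
        left-child = solve-∀
        right-child : ∀ x k → 2 * x + (2 * k + 1) ≡ 2 * (x + k) + 1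
        right-child = solve-∀
        shift : ∀ k x → (2 * k + 1) * x ≡ 2 * k * x + x
        shift = solve-∀
        start′ : (2 * k + 1) * 2 ^ suc h ≡ mid (Block.first k (suc h)) (Block.last k (suc h))
        start′ = trans (shift k (2 ^ suc h)) (trans (cong (_+ 2 ^ suc h) (sym first≡′)) (sym middle′))
        double : ∀ a x → a + x + x ≡ a + 2 * x
        double = solve-∀
        end′ : mid (Block.first k (suc h)) (Block.last k (suc h)) + 2 ^ suc h ≡ Block.first k (suc h) + 2 ^ suc (suc h)
        end′ = trans (cong (_+ 2 ^ suc h) middle′) (double (Block.first k (suc h)) (2 ^ suc h))

    wavelet-tree : M root 0 ≡ 1 → WaveletTree w structure S M
    wavelet-tree root≡ = by-size σ refl
      where
      by-size : ∀ s → s ≡ σ → WaveletTree w structure S M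
      by-size 0 refl = ⊥-elim (<⇒≱ 1≤σ z≤n)
      -- ⌈log₂ 1⌉ is 0 while `Λ` is 1. The specified tree is a single leaf for [0,...,0], and
      -- `mid 0 0` is 0, so all its bits are 1; the code 3 has ancestor 1 and branch bit 1
      -- accordingly.
      by-size 1 refl = tree-cast refl refl (sym root≡) (leaf (inj₁ (s≤s z≤n)) (node-of-range ≤-refl (2^-mono {1} 1≤Λ) only-letter))
        where
        only-letter : ∀ s → s < 1 → (0 ≤ s × s ≤ 0 → ancestor 0 (code 1 s) ≡ 1) × (ancestor 0 (code 1 s) ≡ 1 → 0 ≤ s × s ≤ 0) ×
          (0 ≤ s × s ≤ 0 → (if s <ᵇ mid 0 0 then 0 else 1) ≡ branchBit 0 (code 1 s))
        only-letter zero _ = (λ _ → cong (λ x → 3 div 2 ^ x) Λ≡) , (λ _ → z≤n , z≤n) , λ _ → cong (λ x → 3 div 2 ^ (x ∸ 1 ∸ 0) mod 2) (sym Λ≡)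
        only-letter (suc _) (s≤s ())
      by-size (suc (suc s)) refl = tree-cast refl last≡ (sym root≡) (subtree (s≤s (s≤s z≤n)) (Λ ∸ 1) 0 0 (m+[n∸m]≡n 1≤Λ) z<s)
        where
        last≡ : 2 ^ suc (Λ ∸ 1) ∸ 1 ≡ 2 ^ ⌈log₂ suc (suc s) ⌉ ∸ 1
        last≡ = cong (λ x → 2 ^ x ∸ 1) (trans (m+[n∸m]≡n 1≤Λ) (trans Λ≡ (m≤n⇒m⊔n≡n (≤-trans (≤-reflexive (sym (⌈log₂2^n⌉≡n 1))) (⌈log₂⌉-mono-≤ (s≤s (s≤s (z≤n {s}))))))))

-- The constants and bounds of the theorem

module Algorithm (𝒮 : Setting) (dense : Setting.w 𝒮 * Setting.e 𝒮 ≤ 4 * Geometry.B (Setting.w 𝒮) (Setting.e 𝒮))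
  (loglog≤ : ∀ m → m ≤ length (Setting.L 𝒮) → suc (loglog m) ≤ 2 * Setting.e 𝒮)
  {n₀ σ : ℕ} (S : Vec (Fin σ) n₀) (1≤σ : 1 ≤ σ) (Λ≡ : Setting.Λ 𝒮 ≡ lg σ) (L≡ : Setting.L 𝒮 ≡ map (code σ) (symbols S))
  (Y₁ : ℕ) (1≤Y₁ : 1 ≤ Y₁) (w≤n : Setting.w 𝒮 ≤ Setting.γ 𝒮 * length (Setting.L 𝒮)) (w≤Y₁ : Setting.w 𝒮 ≤ Setting.γ 𝒮 * Y₁)
  (X≡ : Setting.Λ 𝒮 * length (Setting.L 𝒮) ≡ Setting.X 𝒮) (Y≡ : Setting.Λ 𝒮 * Y₁ ≡ Setting.Y 𝒮)
  (σ< : σ < 2 ^ (1 * Setting.θ 𝒮)) (log-w : CeilLog (Setting.w 𝒮 + 1) (suc (Setting.e 𝒮))) where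

  open Setting 𝒮 using (w; L; X; Y; γ)
  open Tree 𝒮 dense loglog≤ S 1≤σ Λ≡ L≡ using (wavelet-tree)

  log-σ : CeilLog σ (Setting.Λ 𝒮)
  log-σ = subst (CeilLog σ) (sym Λ≡) (lg-ceil-log σ)

  open Construction 𝒮 Y₁ 1≤Y₁ w≤n w≤Y₁ X≡ Y≡ σ σ< log-σ log-w using (Ready; built; Triple)

  algorithm-halts : ∀ {M} (R : Mem → ℕ → ℕ → Set) → Words w M → Ready (initialCells (length L) σ w) M →
    (∀ M′ t d → WaveletTree w structure S M′ → t ≤ (24 * (151 * (3 * γ + 5) + 5000) + 23) * X → d ≤ (24 * (151 * (3 * γ + 5) + 5000) + 23) * Y → R M′ t d) →
    Halts w R levelWT M 0 0
  algorithm-halts {M} R Wd r finish = subst (λ P → Halts w R P M 0 0) (++-identityʳ levelWT)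
    (Triple.run (built Wd r) R [] 0 0 λ M′ t d _ (facts , inp , root≡) t≤ d≤ → done (finish M′ t d (wavelet-tree inp facts root≡) t≤ d≤))

module Bounds {κ n σ : ℕ} (κ≥ : 2 ^ 25 ≤ κ) (1≤σ : 1 ≤ σ) (σ≤n : σ ≤ n) (S : Vec (Fin σ) n) where

  1≤n : 1 ≤ n
  1≤n = ≤-trans 1≤σ σ≤n

  open Numbers κ≥ 1≤n public

  L : List ℕ
  L = map (code σ) (symbols S)

  length≡ : length L ≡ n
  length≡ = trans (length-map (code σ) (symbols S)) (length-symbols S)

  n≤L : n ≤ length L
  n≤L = ≤-reflexive (sym length≡)

  Λ : ℕ
  Λ = lg σ

  Λ≤u : Λ ≤ u
  Λ≤u = lg-mono σ≤n

  u<θ : u < θ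
  u<θ = ≤-trans (+-monoˡ-≤ u 1≤u) 2u≤θ

  n<θ : n < 2 ^ (1 * θ)
  n<θ = ≤-<-trans (≤2^lg n) (^-monoʳ-< 2 (s≤s (s≤s z≤n)) (<-≤-trans u<θ (≤-reflexive (sym (*-identityˡ θ)))))

  u≤L : u ≤ length L
  u≤L = ≤-trans (lg≤ 1≤n) n≤L

  n≤ΛL : length L ≤ Λ * length L
  n≤ΛL = m≤n*m (length L) Λ {{>-nonZero (1≤lg σ)}}

  setting : Setting
  setting = record
    { w      = w
    ; e      = e
    ; Λ      = Λ
    ; θ      = θ
    ; sz     = sizes
    ; L      = L
    ; codes  = map⁺ (All.map code-leading (symbols< S))
    ; 1≤Λ    = 1≤lg σ
    ; 1≤n    = ≤-trans 1≤n n≤L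
    ; n<     = ≤-<-trans (≤-reflexive length≡) n<θ
    ; Λ<     = <-≤-trans (≤-<-trans (≤-trans (s≤s Λ≤u) u<θ) (n<2^n θ)) (≤-reflexive (cong (2 ^_) (sym (*-identityˡ θ))))
    ; nodes≤ = ≤-trans (*-monoʳ-≤ 2 (2^lg≤ 1≤σ)) (≤-trans (≤-reflexive (sym (*-assoc 2 2 σ))) (*-monoʳ-≤ 4 (≤-trans σ≤n n≤L)))
    ; X      = Λ * length L
    ; Y      = Λ * u
    ; γ      = κ
    ; 1≤X    = ≤-trans (≤-trans 1≤n n≤L) n≤ΛL
    ; 1≤Y    = *-mono-≤ (1≤lg σ) 1≤u
    ; slots≤ = +-mono-≤ n≤ΛL (≤-reflexive (sym (+-identityʳ (Λ * length L))))
    ; w≤X    = *-monoʳ-≤ κ (≤-trans u≤L n≤ΛL)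
    ; w≤Y    = *-monoʳ-≤ κ (m≤n*m u Λ {{>-nonZero (1≤lg σ)}})
    }

  log-w : CeilLog (w + 1) (suc e)
  log-w = ceil-log (s≤s z≤n) (≤-trans (≤-reflexive (+-comm w 1)) w<2^e) (inj₂ (≤-trans (s≤s 2^e≤w) (≤-reflexive (+-comm 1 w))))

  loglog-L : ∀ m → m ≤ length L → suc (loglog m) ≤ 2 * e
  loglog-L m m≤ = loglog≤ m (≤-trans m≤ (≤-reflexive length≡))

  dense-L : Setting.w setting * Setting.e setting ≤ 4 * Geometry.B (Setting.w setting) (Setting.e setting)
  dense-L = dense

  open Algorithm setting dense-L loglog-L S 1≤σ refl refl u 1≤u (*-monoʳ-≤ κ u≤L) ≤-refl refl refl (≤-<-trans σ≤n n<θ) log-w using (algorithm-halts)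

  ready : ∀ {M} → Params w n σ M → (∀ (i : Fin (length (symbols S))) → M input (toℕ i) ≡ lookup (symbols S) i) → (∀ i → i < length L → M input i < σ × nth L i ≡ 2 ^ Λ + M input i + 𝟙≡ σ 1) × Holds (initialCells (length L) σ w) M
  ready {M} (n≡ , σ≡ , w≡) stored = symbols-ready , trans n≡ (sym length≡) , σ≡ , w≡ , tt
    where
    symbols-ready : ∀ i → i < length L → M input i < σ × nth L i ≡ 2 ^ Λ + M input i + 𝟙≡ σ 1
    symbols-ready i i< = subst (_< σ) (sym input≡) (nth-all (symbols< S) i i<′) ,
        trans (nth-map (code σ) (symbols S) i i<′) (cong (code σ) (sym input≡))
      where
      i<′ : i < length (symbols S)
      i<′ = subst (i <_) (length-map (code σ) (symbols S)) i<
      input≡ : M input i ≡ nth (symbols S) i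
      input≡ = subst (λ j → M input j ≡ nth (symbols S) j) (toℕ-fromℕ< i<′) (trans (stored (fromℕ< i<′)) (lookup-nth (symbols S) (fromℕ< i<′)))

  constant : ℕ
  constant = 25 * (151 * (3 * κ + 5) + 5000)

  24c≤ : ∀ c → 24 * (c + 5000) + 23 ≤ 25 * (c + 5000)
  24c≤ c = ≤-trans (+-monoʳ-≤ (24 * (c + 5000)) (≤-trans (≤ᵇ⇒≤ 23 5000 tt) (m≤n+m 5000 c))) (≤-reflexive (+-comm (24 * (c + 5000)) (c + 5000)))

  cost : ∀ {t x} y → t ≤ (24 * (151 * (3 * κ + 5) + 5000) + 23) * (Λ * x) → x ≡ y → t ≤ constant * (y * Λ)
  cost {x = x} _ t≤ refl = ≤-trans t≤ (≤-trans (*-monoˡ-≤ (Λ * x) (24c≤ (151 * (3 * κ + 5)))) (≤-reflexive (cong (constant *_) (*-comm Λ x))))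

  halts : ∀ {M} → Input w S M → Halts w (λ M′ t d → WaveletTree w structure S M′ × t ≤ constant * (n * Λ) × d ≤ constant * (u * Λ)) levelWT M 0 0
  halts {M} (Wd , parameters , stored) = algorithm-halts _ Wd (ready {M} parameters stored) λ M′ t d tree t≤ d≤ → tree , cost n t≤ length≡ , cost u d≤ refl

theorem4p1 : ∃[ κ₀ ] ((κ : ℕ) → κ₀ ≤ κ →
    ∃[ levelWT ] ∃[ D ] ∃[ c ]
    ((n σ : ℕ) → 1 ≤ σ → σ ≤ n → (S : Vec (Fin σ) n) →
    (M : Mem) → Input (κ * lg n) S M →
    Halts (κ * lg n)
    (λ M′ work depth →
    WaveletTree (κ * lg n) D S M′
    × work ≤ c * (n * lg σ)
    × depth ≤ c * (lg n * lg σ))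
    levelWT M 0 0))
theorem4p1 = 2 ^ 25 , λ κ κ≥ → levelWT , structure , 25 * (151 * (3 * κ + 5) + 5000) ,
  λ n σ 1≤σ σ≤n S M input-stored → Bounds.halts κ≥ 1≤σ σ≤n S input-stored
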